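{- For every $\epsilon>0$ there is a constant $C_\epsilon>0$, depending only on $\epsilon$, such that the following holds. Let $p$ be a prime, let $N$ be an integer with $1\le N\le p-1$, let $r$ be a positive integer, let $a,b,b_1,\dots,b_r$ be integers, not all divisible by $p$, with $\gcd(b,p)=1$, and let $g_1,\dots,g_r$ be primitive roots modulo $p$. Then $$\left|\frac{1}{\varphi(p-1)}\sum_{g}\ \sum_{x=1}^{N} e_p\big(ax+bg^x+b_1g_1^x+\cdots+b_rg_r^x\big)\right|\le C_\epsilon\, p^{\frac{23}{24}+\epsilon},$$ where the outer sum runs over all primitive roots $g$ modulo $p$ (one representative of each residue class modulo $p$ that is a primitive root).
   Context: Notation: $e_p(\alpha):=\exp(2\pi i\alpha/p)$, and $\varphi$ is Euler's totient function, so $\varphi(p-1)$ is the number of primitive roots modulo $p$. In the exponents $x$ is an ordinary integer in $\{1,\dots,N\}$. -}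

module Defs where

open import Data.Empty using (⊥-elim)
open import Data.Integer as ℤ using (ℤ; +_; -[1+_])
import Data.Integer.Properties as ℤP
open import Data.Integer.Divisibility using () renaming (_∣_ to _∣ℤ_)
open import Algebra.Definitions.RawMonoid ℤ.+-0-rawMonoid using (sum)
open import Data.Fin using (Fin)
open import Data.List using (List; map; filter; foldr; length; upTo)
open import Data.List.Properties using (filter-accept)
open import Data.Nat as ℕ using (ℕ; zero; suc; NonZero; _!; _∸_)
import Data.Nat.Properties as ℕP
import Data.Nat.Divisibility as ℕD
open import Data.Nat.Primality using (Prime; prime⇒nonZero; prime⇒nonTrivial)
open import Data.Nat.Coprimality using (Coprime; coprime?; 1-coprimeTo)
open import Data.Product using (∃; _×_; _,_; proj₁; proj₂)
open import Data.Rational as ℚ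
  using (ℚ; mkℚ; 0ℚ; 1ℚ; ½; _+_; _*_; _-_; -_; _≤_; _<_; ∣_∣; _/_; ↥_; ↧ₙ_)
open import Data.Rational.Properties as ℚP using ()
import Data.Rational.Unnormalised as ℚᵘ
import Data.Rational.Unnormalised.Properties as ℚᵘP
open import Data.Rational.Solver using (module +-*-Solver)
open import Data.Sum using (_⊎_; inj₁; inj₂)
open import Relation.Binary.PropositionalEquality
  using (_≡_; refl; sym; trans; cong; cong₂; subst; subst₂)
open import Relation.Nullary using (¬_; Dec; yes; no)
open import Relation.Nullary.Decidable using (_×-dec_; _→-dec_; ¬?)

≤-of-0≤- : ∀ {p q} → 0ℚ ≤ q - p → p ≤ q
≤-of-0≤- {p} {q} h =
  subst₂ _≤_ (ℚP.+-identityˡ p) (lem q p) (ℚP.+-monoˡ-≤ p h)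
  where
  open +-*-Solver
  lem : ∀ q p → q - p + p ≡ q
  lem = solve 2 (λ q p → q :- p :+ p := q) refl

0≤-of-≤ : ∀ {p q} → p ≤ q → 0ℚ ≤ q - p
0≤-of-≤ {p} {q} h = subst (_≤ q - p) (ℚP.+-inverseʳ p) (ℚP.+-monoˡ-≤ (- p) h)

*-monoʳ : ∀ {r p q} → 0ℚ ≤ r → p ≤ q → r * p ≤ r * q
*-monoʳ {r} 0≤r = ℚP.*-monoˡ-≤-nonNeg r {{ℚ.nonNegative 0≤r}}

*-monoˡ : ∀ {r p q} → 0ℚ ≤ r → p ≤ q → p * r ≤ q * r
*-monoˡ {r} 0≤r = ℚP.*-monoʳ-≤-nonNeg r {{ℚ.nonNegative 0≤r}}

*-mono : ∀ {p q r s} → 0ℚ ≤ p → 0ℚ ≤ s → p ≤ q → r ≤ s → p * r ≤ q * s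
*-mono 0≤p 0≤s p≤q r≤s = ℚP.≤-trans (*-monoʳ 0≤p r≤s) (*-monoˡ 0≤s p≤q)

*-cancelˡ : ∀ {r p q} → 0ℚ < r → r * p ≤ r * q → p ≤ q
*-cancelˡ {r} 0<r = ℚP.*-cancelˡ-≤-pos r {{ℚ.positive 0<r}}

*-nonNeg : ∀ {p q} → 0ℚ ≤ p → 0ℚ ≤ q → 0ℚ ≤ p * q
*-nonNeg {p} {q} 0≤p 0≤q = subst (_≤ p * q) (ℚP.*-zeroʳ p) (*-monoʳ 0≤p 0≤q)

*-pos : ∀ {p q} → 0ℚ < p → 0ℚ < q → 0ℚ < p * q
*-pos {p} {q} 0<p 0<q =
  subst (_< p * q) (ℚP.*-zeroʳ p) (ℚP.*-monoʳ-<-pos p {{ℚ.positive 0<p}} 0<q)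

+-nonNeg : ∀ {p q} → 0ℚ ≤ p → 0ℚ ≤ q → 0ℚ ≤ p + q
+-nonNeg = ℚP.+-mono-≤

+-pos : ∀ {p q} → 0ℚ < p → 0ℚ ≤ q → 0ℚ < p + q
+-pos = ℚP.+-mono-<-≤

p≤p+q : ∀ {p q} → 0ℚ ≤ q → p ≤ p + q
p≤p+q {p} 0≤q = subst (_≤ p + _) (ℚP.+-identityʳ p) (ℚP.+-monoʳ-≤ p 0≤q)

recip-pos : ∀ {p} → 0ℚ < p → ∃ λ t → 0ℚ < t × p * t ≡ 1ℚ
recip-pos {p} 0<p = 1/p , ℚP.positive⁻¹ 1/p {{ℚP.1/pos⇒pos p}} , ℚP.*-inverseʳ p
  where
  instance
    _ = ℚ.positive 0<p
    _ = ℚP.pos⇒nonZero p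
  1/p = ℚ.1/ p

quotient : ∀ {p} δ → 0ℚ < p → 0ℚ < δ → ∃ λ t → 0ℚ < t × p * t ≡ δ
quotient {p} δ 0<p 0<δ with recip-pos 0<p
... | t , 0<t , pt = t * δ , *-pos 0<t 0<δ ,
  trans (sym (ℚP.*-assoc p t δ)) (trans (cong (_* δ) pt) (ℚP.*-identityˡ δ))

half-split : ∀ δ → δ * ½ + δ * ½ ≡ δ
half-split = solve 1 (λ δ → δ :* con ½ :+ δ :* con ½ := δ) refl
  where open +-*-Solver

0<½ : 0ℚ < ½
0<½ = ℚP.positive⁻¹ ½

0<1 : 0ℚ < 1ℚ
0<1 = ℚP.positive⁻¹ 1ℚ

∣∣-≤ : ∀ {p q} → p ≤ q → - p ≤ q → ∣ p ∣ ≤ q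
∣∣-≤ {p} {q} a b with ℚP.∣p∣≡p∨∣p∣≡-p p
... | inj₁ e = subst (_≤ q) (sym e) a
... | inj₂ e = subst (_≤ q) (sym e) b

p≤∣p∣ : ∀ p → p ≤ ∣ p ∣
p≤∣p∣ p with ℚP.≤-total 0ℚ p
... | inj₁ 0≤p = ℚP.≤-reflexive (sym (ℚP.0≤p⇒∣p∣≡p 0≤p))
... | inj₂ p≤0 = ℚP.≤-trans p≤0 (ℚP.0≤∣p∣ p)

∣p-q∣≡∣q-p∣ : ∀ p q → ∣ p - q ∣ ≡ ∣ q - p ∣
∣p-q∣≡∣q-p∣ p q = trans (cong ∣_∣ (lem p q)) (ℚP.∣-p∣≡∣p∣ (q - p))
  where
  open +-*-Solver
  lem : ∀ p q → p - q ≡ - (q - p)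
  lem = solve 2 (λ p q → p :- q := :- (q :- p)) refl

∣p∣≤∣q∣+∣p-q∣ : ∀ p q → ∣ p ∣ ≤ ∣ q ∣ + ∣ p - q ∣
∣p∣≤∣q∣+∣p-q∣ p q =
  subst (λ z → ∣ z ∣ ≤ ∣ q ∣ + ∣ p - q ∣) (lem p q) (ℚP.∣p+q∣≤∣p∣+∣q∣ q (p - q))
  where
  open +-*-Solver
  lem : ∀ p q → q + (p - q) ≡ p
  lem = solve 2 (λ p q → q :+ (p :- q) := p) refl

-- The canonical map ℕ → ℚ, by recursion; ι-/ identifies it with (+ n) / 1.
ι : ℕ → ℚ
ι zero    = 0ℚ
ι (suc n) = 1ℚ + ι n

ι-nonNeg : ∀ n → 0ℚ ≤ ι n
ι-nonNeg zero    = ℚP.≤-refl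
ι-nonNeg (suc n) = +-nonNeg (ℚP.<⇒≤ 0<1) (ι-nonNeg n)

ι-pos : ∀ n .{{_ : NonZero n}} → 0ℚ < ι n
ι-pos (suc n) = +-pos 0<1 (ι-nonNeg n)

ι-mono : ∀ {m n} → m ℕ.≤ n → ι m ≤ ι n
ι-mono {n = n} ℕ.z≤n = ι-nonNeg n
ι-mono (ℕ.s≤s h) = ℚP.+-monoʳ-≤ 1ℚ (ι-mono h)

ι-+ : ∀ m n → ι (m ℕ.+ n) ≡ ι m + ι n
ι-+ zero    n = sym (ℚP.+-identityˡ (ι n))
ι-+ (suc m) n = trans (cong (_+_ 1ℚ) (ι-+ m n)) (sym (ℚP.+-assoc 1ℚ (ι m) (ι n)))

ι-* : ∀ m n → ι (m ℕ.* n) ≡ ι m * ι n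
ι-* zero    n = sym (ℚP.*-zeroˡ (ι n))
ι-* (suc m) n = trans (ι-+ n (m ℕ.* n)) (trans (cong (_+_ (ι n)) (ι-* m n)) (lem (ι m) (ι n)))
  where
  open +-*-Solver
  lem : ∀ a b → b + a * b ≡ (1ℚ + a) * b
  lem = solve 2 (λ a b → b :+ a :* b := (con 1ℚ :+ a) :* b) refl

/-as-ℚᵘ : ∀ i d .{{_ : NonZero d}} → ℚ.toℚᵘ (i / d) ℚᵘ.≃ (i ℚᵘ./ d)
/-as-ℚᵘ i (suc d) = ℚP.toℚᵘ-fromℚᵘ (ℚᵘ.mkℚᵘ i d)

ι-/ : ∀ n → ι n ≡ + n / 1
ι-/ zero    = refl
ι-/ (suc n) = trans (cong (_+_ 1ℚ) (ι-/ n)) (ℚP.toℚᵘ-injective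
  (ℚᵘP.≃-trans (ℚP.toℚᵘ-homo-+ 1ℚ (+ n / 1))
  (ℚᵘP.≃-trans (ℚᵘP.+-congʳ (ℚ.toℚᵘ 1ℚ) (/-as-ℚᵘ (+ n) 1))
  (ℚᵘP.≃-trans (ℚᵘ.*≡* (cong (ℤ._* + 1) (cong (λ z → + 1 ℤ.+ z) (ℤP.*-identityʳ (+ n)))))
  (ℚᵘP.≃-sym (/-as-ℚᵘ (+ suc n) 1))))))

/-*ι : ∀ a d .{{_ : NonZero d}} → (+ a / d) * ι d ≡ ι a
/-*ι a d@(suc d-1) = trans (cong (_*_ (+ a / d)) (ι-/ d)) (trans (ℚP.toℚᵘ-injective
  (ℚᵘP.≃-trans (ℚP.toℚᵘ-homo-* (+ a / d) (+ d / 1))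
  (ℚᵘP.≃-trans (ℚᵘP.*-cong (/-as-ℚᵘ (+ a) d) (/-as-ℚᵘ (+ d) 1))
  (ℚᵘP.≃-trans (ℚᵘ.*≡* eq) (ℚᵘP.≃-sym (/-as-ℚᵘ (+ a) 1))))))
  (sym (ι-/ a)))
  where
  eq : + a ℤ.* + d ℤ.* + 1 ≡ + a ℤ.* + (d ℕ.* 1)
  eq = trans (ℤP.*-identityʳ _) (cong (λ z → + a ℤ.* + z) (sym (ℕP.*-identityʳ d)))

/-unique : ∀ {a d} .{{_ : NonZero d}} {q} → q * ι d ≡ ι a → q ≡ + a / d
/-unique {a} {d} {q} e = ℚP.≤-antisym
  (*-cancelʳ (ℚP.≤-reflexive eq)) (*-cancelʳ (ℚP.≤-reflexive (sym eq)))
  where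
  eq : q * ι d ≡ (+ a / d) * ι d
  eq = trans e (sym (/-*ι a d))
  *-cancelʳ : ∀ {p r} → p * ι d ≤ r * ι d → p ≤ r
  *-cancelʳ = ℚP.*-cancelʳ-≤-pos (ι d) {{ℚ.positive (ι-pos d)}}

∣↥∣-/ : ∀ q → ∣ q ∣ ≡ + ℤ.∣ ↥ q ∣ / ↧ₙ q
∣↥∣-/ q@(mkℚ n d c) = sym (ℚP.↥p/↧p≡p ∣ q ∣)

archimedean : ∀ q → ∃ λ n → q ≤ ι n
archimedean q = ℤ.∣ ↥ q ∣ , (begin
  q                                ≤⟨ p≤∣p∣ q ⟩
  ∣ q ∣                            ≡⟨ sym (ℚP.*-identityʳ _) ⟩
  ∣ q ∣ * 1ℚ                       ≤⟨ *-monoʳ (ℚP.0≤∣p∣ q) (p≤p+q (ι-nonNeg (ℚ.denominator-1 q))) ⟩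
  ∣ q ∣ * ι (↧ₙ q)                 ≡⟨ cong (_* ι (↧ₙ q)) (∣↥∣-/ q) ⟩
  (+ ℤ.∣ ↥ q ∣ / ↧ₙ q) * ι (↧ₙ q)  ≡⟨ /-*ι ℤ.∣ ↥ q ∣ (↧ₙ q) ⟩
  ι ℤ.∣ ↥ q ∣                      ∎)
  where open ℚP.≤-Reasoning

∣i/d∣ : ∀ i d .{{_ : NonZero d}} → ∣ i / d ∣ ≡ + ℤ.∣ i ∣ / d
∣i/d∣ (+ n)    d = ℚP.0≤p⇒∣p∣≡p (ℚP.nonNegative⁻¹ _ {{ℚP.normalize-nonNeg n d}})
∣i/d∣ -[1+ n ] d = trans (ℚP.∣-p∣≡∣p∣ (+ suc n / d)) (∣i/d∣ (+ suc n) d)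
mul-bound : ∀ {A B t a b c d} → 0ℚ < t → 0ℚ < B → ∣ a ∣ ≤ A → ∣ d ∣ ≤ B →
  ∣ a - c ∣ ≤ t → ∣ b - d ∣ ≤ t → ∣ a * b - c * d ∣ ≤ (A + B) * t
mul-bound {A} {B} {t} {a} {b} {c} {d} 0<t 0<B ha hd hac hbd = begin
      ∣ a * b - c * d ∣                    ≡⟨ cong ∣_∣ lem ⟩
      ∣ a * (b - d) + (a - c) * d ∣        ≤⟨ ℚP.∣p+q∣≤∣p∣+∣q∣ (a * (b - d)) ((a - c) * d) ⟩
      ∣ a * (b - d) ∣ + ∣ (a - c) * d ∣    ≡⟨ cong₂ _+_ (ℚP.∣p*q∣≡∣p∣*∣q∣ a (b - d))
                                                        (ℚP.∣p*q∣≡∣p∣*∣q∣ (a - c) d) ⟩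
      ∣ a ∣ * ∣ b - d ∣ + ∣ a - c ∣ * ∣ d ∣ ≤⟨ ℚP.+-mono-≤
        (*-mono (ℚP.0≤∣p∣ a) (ℚP.<⇒≤ 0<t) ha hbd)
        (*-mono (ℚP.0≤∣p∣ (a - c)) (ℚP.<⇒≤ 0<B) hac hd) ⟩
      A * t + t * B                        ≡⟨ lem′ ⟩
      (A + B) * t                          ∎
  where
  open ℚP.≤-Reasoning
  lem : a * b - c * d ≡ a * (b - d) + (a - c) * d
  lem = sym (trans (cong₂ _+_ (trans (ℚP.*-distribˡ-+ a b (- d)) (cong (_+_ (a * b)) (sym (ℚP.neg-distribʳ-* a d))))
     (trans (ℚP.*-distribʳ-+ d a (- c)) (cong (_+_ (a * d)) (sym (ℚP.neg-distribˡ-* c d)))))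
     (trans (ℚP.+-assoc (a * b) (- (a * d)) _) (cong (_+_ (a * b)) (trans (sym (ℚP.+-assoc (- (a * d)) (a * d) _)) (trans (cong (_+ - (c * d)) (ℚP.+-inverseˡ (a * d))) (ℚP.+-identityˡ _))))))
  lem′ : A * t + t * B ≡ (A + B) * t
  lem′ = trans (cong (_+_ (A * t)) (ℚP.*-comm t B)) (sym (ℚP.*-distribʳ-+ t A B))

IsCauchy : (ℕ → ℚ) → Set
IsCauchy u = ∀ δ → 0ℚ < δ →
  ∃ λ K → ∀ {m n} → K ℕ.≤ m → K ℕ.≤ n → ∣ u m - u n ∣ ≤ δ

record ℝ : Set where
  constructor mkℝ
  field
    seq    : ℕ → ℚ
    cauchy : IsCauchy seq

open ℝ public

-- Distinct sequences may represent the same real number; the relations below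
-- only depend on the numbers represented.
infix 4 _≤ʳ_ _<ʳ_

_≤ʳ_ : ℝ → ℝ → Set
x ≤ʳ y = ∀ δ → 0ℚ < δ → ∃ λ K → ∀ {n} → K ℕ.≤ n → seq x n ≤ seq y n + δ

_<ʳ_ : ℝ → ℝ → Set
x <ʳ y = ∃ λ δ → 0ℚ < δ × ∃ λ K → ∀ {n} → K ℕ.≤ n → seq x n + δ ≤ seq y n

cauchy-wlog : ∀ u →
  (∀ δ → 0ℚ < δ → ∃ λ K → ∀ {m n} → K ℕ.≤ n → n ℕ.≤ m → ∣ u m - u n ∣ ≤ δ) →
  IsCauchy u
cauchy-wlog u h δ 0<δ with h δ 0<δ
... | K , b = K , bound
  where
  bound : ∀ {m n} → K ℕ.≤ m → K ℕ.≤ n → ∣ u m - u n ∣ ≤ δ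
  bound {m} {n} K≤m K≤n with ℕP.≤-total n m
  ... | inj₁ n≤m = b K≤n n≤m
  ... | inj₂ m≤n = subst (_≤ δ) (∣p-q∣≡∣q-p∣ (u n) (u m)) (b K≤m m≤n)

Bound : (ℕ → ℚ) → Set
Bound u = ∃ λ B → 0ℚ < B × ∃ λ K → ∀ {n} → K ℕ.≤ n → ∣ u n ∣ ≤ B

cauchy⇒bound : ∀ u → IsCauchy u → Bound u
cauchy⇒bound u c with c 1ℚ 0<1
... | K , b = ∣ u K ∣ + 1ℚ , ℚP.+-mono-≤-< (ℚP.0≤∣p∣ (u K)) 0<1 , K , λ {n} K≤n →
  ℚP.≤-trans (∣p∣≤∣q∣+∣p-q∣ (u n) (u K))
             (ℚP.+-monoʳ-≤ ∣ u K ∣ (b K≤n ℕP.≤-refl))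

fromℚ : ℚ → ℝ
fromℚ q = mkℝ (λ _ → q) λ δ 0<δ → 0 , λ _ _ →
  subst (_≤ δ) (sym (cong ∣_∣ (ℚP.+-inverseʳ q))) (ℚP.<⇒≤ 0<δ)

0ʳ 1ʳ : ℝ
0ʳ = fromℚ 0ℚ
1ʳ = fromℚ 1ℚ

infixl 6 _+ʳ_ _-ʳ_
infixl 7 _*ʳ_
infix  8 -ʳ_

_+ʳ_ : ℝ → ℝ → ℝ
x +ʳ y = mkℝ (λ n → seq x n + seq y n) c
  where
  open +-*-Solver
  lem : ∀ a b c d → (a + b) - (c + d) ≡ (a - c) + (b - d)
  lem = solve 4 (λ a b c d → (a :+ b) :- (c :+ d) := (a :- c) :+ (b :- d)) refl
  c : IsCauchy (λ n → seq x n + seq y n)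
  c δ 0<δ with cauchy x (δ * ½) (*-pos 0<δ 0<½) | cauchy y (δ * ½) (*-pos 0<δ 0<½)
  ... | K , b | L , b′ = K ℕ.⊔ L , λ {m} {n} h h′ →
    subst₂ _≤_ (cong ∣_∣ (sym (lem (seq x m) (seq y m) (seq x n) (seq y n)))) (half-split δ)
      (ℚP.≤-trans (ℚP.∣p+q∣≤∣p∣+∣q∣ (seq x m - seq x n) (seq y m - seq y n))
        (ℚP.+-mono-≤ (b (ℕP.m⊔n≤o⇒m≤o K L h) (ℕP.m⊔n≤o⇒m≤o K L h′))
                     (b′ (ℕP.m⊔n≤o⇒n≤o K L h) (ℕP.m⊔n≤o⇒n≤o K L h′))))

-ʳ_ : ℝ → ℝ
-ʳ x = mkℝ (λ n → - seq x n) c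
  where
  open +-*-Solver
  lem : ∀ a b → - a - - b ≡ - (a - b)
  lem = solve 2 (λ a b → :- a :- :- b := :- (a :- b)) refl
  c : IsCauchy (λ n → - seq x n)
  c δ 0<δ with cauchy x δ 0<δ
  ... | K , b = K , λ {m} {n} h h′ → subst (_≤ δ)
    (sym (trans (cong ∣_∣ (lem (seq x m) (seq x n))) (ℚP.∣-p∣≡∣p∣ (seq x m - seq x n))))
    (b h h′)

_-ʳ_ : ℝ → ℝ → ℝ
x -ʳ y = x +ʳ (-ʳ y)

*-cauchy : ∀ u v → Bound u → Bound v → IsCauchy u → IsCauchy v →
  IsCauchy (λ n → u n * v n)
*-cauchy u v (A , 0<A , K₁ , bA) (B , 0<B , K₂ , bB) cu cv δ 0<δ =
  step (quotient {A + B} δ (+-pos 0<A (ℚP.<⇒≤ 0<B)) 0<δ)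
  where
  finish : ∀ t → 0ℚ < t → (A + B) * t ≡ δ → ∀ K₃ K₄ →
    (∀ {m n} → K₃ ℕ.≤ m → K₃ ℕ.≤ n → ∣ u m - u n ∣ ≤ t) →
    (∀ {m n} → K₄ ℕ.≤ m → K₄ ℕ.≤ n → ∣ v m - v n ∣ ≤ t) →
    ∃ λ K → ∀ {m n} → K ℕ.≤ m → K ℕ.≤ n → ∣ u m * v m - u n * v n ∣ ≤ δ
  finish t 0<t eq K₃ K₄ cx cy = K , λ {m} {n} h h′ →
    subst (∣ u m * v m - u n * v n ∣ ≤_) eq
      (mul-bound 0<t 0<B (bA (k₁ h)) (bB (k₂ h′)) (cx (k₃ h) (k₃ h′)) (cy (k₄ h) (k₄ h′)))
    where
    K = (K₁ ℕ.⊔ K₂) ℕ.⊔ (K₃ ℕ.⊔ K₄)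
    k₁ : ∀ {m} → K ℕ.≤ m → K₁ ℕ.≤ m
    k₁ h = ℕP.m⊔n≤o⇒m≤o K₁ K₂ (ℕP.m⊔n≤o⇒m≤o (K₁ ℕ.⊔ K₂) (K₃ ℕ.⊔ K₄) h)
    k₂ : ∀ {m} → K ℕ.≤ m → K₂ ℕ.≤ m
    k₂ h = ℕP.m⊔n≤o⇒n≤o K₁ K₂ (ℕP.m⊔n≤o⇒m≤o (K₁ ℕ.⊔ K₂) (K₃ ℕ.⊔ K₄) h)
    k₃ : ∀ {m} → K ℕ.≤ m → K₃ ℕ.≤ m
    k₃ h = ℕP.m⊔n≤o⇒m≤o K₃ K₄ (ℕP.m⊔n≤o⇒n≤o (K₁ ℕ.⊔ K₂) (K₃ ℕ.⊔ K₄) h)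
    k₄ : ∀ {m} → K ℕ.≤ m → K₄ ℕ.≤ m
    k₄ h = ℕP.m⊔n≤o⇒n≤o K₃ K₄ (ℕP.m⊔n≤o⇒n≤o (K₁ ℕ.⊔ K₂) (K₃ ℕ.⊔ K₄) h)
  step : (∃ λ t → 0ℚ < t × (A + B) * t ≡ δ) →
    ∃ λ K → ∀ {m n} → K ℕ.≤ m → K ℕ.≤ n → ∣ u m * v m - u n * v n ∣ ≤ δ
  step (t , 0<t , eq) =
    finish t 0<t eq (proj₁ (cu t 0<t)) (proj₁ (cv t 0<t)) (proj₂ (cu t 0<t)) (proj₂ (cv t 0<t))

_*ʳ_ : ℝ → ℝ → ℝ
x *ʳ y = mkℝ (λ n → seq x n * seq y n)
  (*-cauchy (seq x) (seq y) (cauchy⇒bound (seq x) (cauchy x)) (cauchy⇒bound (seq y) (cauchy y))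
    (cauchy x) (cauchy y))

psum : (ℕ → ℚ) → ℕ → ℚ
psum a zero    = 0ℚ
psum a (suc n) = psum a n + a n

infixr 8 _^ℚ_

_^ℚ_ : ℚ → ℕ → ℚ
y ^ℚ zero  = 1ℚ
y ^ℚ suc k = y * y ^ℚ k

-- If a (suc k) ≤ q * a k for k ≥ K, with q = 1 - c, then c * psum a k + a k
-- decreases for k ≥ K, and a (j + K) * (1 + j c) ≤ a K.
module RatioTest
  (a : ℕ → ℚ) (a≥0 : ∀ k → 0ℚ ≤ a k)
  (c : ℚ) (0<c : 0ℚ < c) (K : ℕ)
  (ratio : ∀ {k} → K ℕ.≤ k → a (suc k) + c * a k ≤ a k)
  where

  T : ℕ → ℚ
  T n = c * psum a n + a n

  T-step : ∀ {n} → K ℕ.≤ n → T (suc n) ≤ T n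
  T-step {n} h = subst (_≤ T n) (lem c (psum a n) (a n) (a (suc n)))
    (ℚP.+-monoʳ-≤ (c * psum a n) (ratio h))
    where
    open +-*-Solver
    lem : ∀ c s a b → c * s + (b + c * a) ≡ c * (s + a) + b
    lem = solve 4 (λ c s a b → c :* s :+ (b :+ c :* a) := c :* (s :+ a) :+ b) refl

  T-anti : ∀ j {n} → K ℕ.≤ n → T (j ℕ.+ n) ≤ T n
  T-anti zero    h = ℚP.≤-refl
  T-anti (suc j) h =
    ℚP.≤-trans (T-step (ℕP.≤-trans h (ℕP.m≤n+m _ j))) (T-anti j h)

  decay : ∀ j → a (j ℕ.+ K) * (1ℚ + ι j * c) ≤ a K
  decay zero    = ℚP.≤-reflexive (trans (cong (λ z → a K * (1ℚ + z)) (ℚP.*-zeroˡ c))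
                                        (ℚP.*-identityʳ (a K)))
  decay (suc j) = ℚP.≤-trans
    (≤-of-0≤- (subst (0ℚ ≤_) (sym (lem c (ι j) (a k) (a (suc k)))) (+-nonNeg
      (*-nonNeg 0≤w (0≤-of-≤ (ratio (ℕP.m≤n+m K j))))
      (*-nonNeg (*-nonNeg 0≤w′ (ℚP.<⇒≤ 0<c)) (*-nonNeg (ℚP.<⇒≤ 0<c) (a≥0 k))))))
    (decay j)
    where
    k = j ℕ.+ K
    0≤w′ : 0ℚ ≤ 1ℚ + ι j
    0≤w′ = ι-nonNeg (suc j)
    0≤w : 0ℚ ≤ 1ℚ + (1ℚ + ι j) * c
    0≤w = +-nonNeg (ℚP.<⇒≤ 0<1) (*-nonNeg 0≤w′ (ℚP.<⇒≤ 0<c))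
    open +-*-Solver
    lem : ∀ c i a b → a * (1ℚ + i * c) - b * (1ℚ + (1ℚ + i) * c) ≡
      (1ℚ + (1ℚ + i) * c) * (a - (b + c * a)) + (1ℚ + i) * c * (c * a)
    lem = solve 4 (λ c i a b →
      a :* (con 1ℚ :+ i :* c) :- b :* (con 1ℚ :+ (con 1ℚ :+ i) :* c) :=
      (con 1ℚ :+ (con 1ℚ :+ i) :* c) :* (a :- (b :+ c :* a))
        :+ (con 1ℚ :+ i) :* c :* (c :* a)) refl

  vanish : ∀ η → 0ℚ < η → ∃ λ J → ∀ j → J ℕ.≤ j → a (j ℕ.+ K) ≤ η
  vanish η 0<η = J , λ j J≤j → *-cancelˡ (w-pos j) (begin
    w j * a (j ℕ.+ K)    ≡⟨ ℚP.*-comm (w j) _ ⟩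
    a (j ℕ.+ K) * w j    ≤⟨ decay j ⟩
    a K                  ≡⟨ sym (ℚP.*-identityʳ (a K)) ⟩
    a K * 1ℚ             ≡⟨ cong (a K *_) (sym ηct≡1) ⟩
    a K * (η * c * t)    ≡⟨ lem (a K) (η * c) t ⟩
    (a K * t) * (η * c)  ≤⟨ *-monoˡ (ℚP.<⇒≤ 0<ηc) (ℚP.≤-trans aKt≤J (ι-mono J≤j)) ⟩
    ι j * (η * c)        ≡⟨ lem′ (ι j) η c ⟩
    (ι j * c) * η        ≤⟨ *-monoˡ (ℚP.<⇒≤ 0<η) (p≤1+p (ι j * c)) ⟩
    w j * η              ∎)
    where
    open ℚP.≤-Reasoning
    w : ℕ → ℚ
    w j = 1ℚ + ι j * c
    w-pos : ∀ j → 0ℚ < w j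
    w-pos j = +-pos 0<1 (*-nonNeg (ι-nonNeg j) (ℚP.<⇒≤ 0<c))
    p≤1+p : ∀ p → p ≤ 1ℚ + p
    p≤1+p p = subst (_≤ 1ℚ + p) (ℚP.+-identityˡ p) (ℚP.+-monoˡ-≤ p (ℚP.<⇒≤ 0<1))
    0<ηc : 0ℚ < η * c
    0<ηc = *-pos 0<η 0<c
    t = proj₁ (recip-pos 0<ηc)
    ηct≡1 : η * c * t ≡ 1ℚ
    ηct≡1 = proj₂ (proj₂ (recip-pos 0<ηc))
    J = proj₁ (archimedean (a K * t))
    aKt≤J : a K * t ≤ ι J
    aKt≤J = proj₂ (archimedean (a K * t))
    lem : ∀ x y t → x * (y * t) ≡ (x * t) * y
    lem x y t = trans (cong (x *_) (ℚP.*-comm y t)) (sym (ℚP.*-assoc x t y))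
    lem′ : ∀ i η c → i * (η * c) ≡ (i * c) * η
    lem′ i η c = lem i η c

  cauchy-psum : IsCauchy (psum a)
  cauchy-psum = cauchy-wlog (psum a) λ δ 0<δ →
    let J , small = vanish (c * δ) (*-pos 0<c 0<δ) in
    J ℕ.+ K , λ {m} {n} h n≤m → main δ J small m n h n≤m
    where
    main : ∀ δ J → (∀ j → J ℕ.≤ j → a (j ℕ.+ K) ≤ c * δ) →
      ∀ m n → J ℕ.+ K ℕ.≤ n → n ℕ.≤ m → ∣ psum a m - psum a n ∣ ≤ δ
    main δ J small m n h n≤m = ∣∣-≤ upper lower
      where
      open +-*-Solver
      K≤n : K ℕ.≤ n
      K≤n = ℕP.m+n≤o⇒n≤o J h
      mono : ∀ j n → psum a n ≤ psum a (j ℕ.+ n)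
      mono zero    n = ℚP.≤-refl
      mono (suc j) n = ℚP.≤-trans (mono j n) (p≤p+q (a≥0 (j ℕ.+ n)))
      s = psum a n
      s′ = psum a m
      s≤s′ : s ≤ s′
      s≤s′ = subst (λ k → s ≤ psum a k) (ℕP.m∸n+n≡m n≤m) (mono (m ∸ n) n)
      Tm≤Tn : T m ≤ T n
      Tm≤Tn = subst (λ k → T k ≤ T n) (ℕP.m∸n+n≡m n≤m) (T-anti (m ∸ n) K≤n)
      an≤ : a n ≤ c * δ
      an≤ = subst (λ k → a k ≤ c * δ) (ℕP.m∸n+n≡m K≤n)
        (small (n ∸ K) (ℕP.m+n≤o⇒m≤o∸n J h))
      lem : ∀ c s s′ a b d → c * d - c * (s′ - s) ≡
        ((c * s + a) - (c * s′ + b)) + (c * d - a) + b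
      lem = solve 6 (λ c s s′ a b d → c :* d :- c :* (s′ :- s) :=
        ((c :* s :+ a) :- (c :* s′ :+ b)) :+ (c :* d :- a) :+ b) refl
      upper : s′ - s ≤ δ
      upper = *-cancelˡ 0<c (≤-of-0≤- (subst (0ℚ ≤_) (sym (lem c s s′ (a n) (a m) δ))
        (+-nonNeg (+-nonNeg (0≤-of-≤ Tm≤Tn) (0≤-of-≤ an≤)) (a≥0 m))))
      0≤δ : 0ℚ ≤ δ
      0≤δ = ℚP.≤-trans (0≤-of-≤ s≤s′) upper
      lower : - (s′ - s) ≤ δ
      lower = ℚP.≤-trans (ℚP.neg-antimono-≤ (0≤-of-≤ s≤s′)) 0≤δ

comparison-step : ∀ {a b} → (∀ k → ∣ a k ∣ ≤ b k) → ∀ j n →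
  ∣ psum a (j ℕ.+ n) - psum a n ∣ ≤ psum b (j ℕ.+ n) - psum b n
comparison-step {a} {b} h zero n = ℚP.≤-reflexive
  (trans (cong ∣_∣ (ℚP.+-inverseʳ (psum a n))) (sym (ℚP.+-inverseʳ (psum b n))))
comparison-step {a} {b} h (suc j) n =
  subst₂ _≤_ (cong ∣_∣ (lem (psum a k) (a k) (psum a n))) (lem (psum b k) (b k) (psum b n))
    (ℚP.≤-trans (ℚP.∣p+q∣≤∣p∣+∣q∣ (psum a k - psum a n) (a k))
                (ℚP.+-mono-≤ (comparison-step h j n) (h k)))
  where
  k = j ℕ.+ n
  open +-*-Solver
  lem : ∀ s a s′ → (s - s′) + a ≡ s + a - s′
  lem = solve 3 (λ s a s′ → (s :- s′) :+ a := s :+ a :- s′) refl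

comparison-≤ : ∀ {a b} → (∀ k → ∣ a k ∣ ≤ b k) → ∀ {m n} → n ℕ.≤ m →
  ∣ psum a m - psum a n ∣ ≤ psum b m - psum b n
comparison-≤ {a} {b} h {m} {n} n≤m =
  subst (λ k → ∣ psum a k - psum a n ∣ ≤ psum b k - psum b n) (ℕP.m∸n+n≡m n≤m)
    (comparison-step h (m ∸ n) n)

comparison : ∀ {a b} → (∀ k → ∣ a k ∣ ≤ b k) → IsCauchy (psum b) → IsCauchy (psum a)
comparison {a} {b} h cb = cauchy-wlog (psum a) λ δ 0<δ → proj₁ (cb δ 0<δ) , λ {m} {n} K≤n n≤m →
  ℚP.≤-trans (comparison-≤ h n≤m)
    (ℚP.≤-trans (p≤∣p∣ (psum b m - psum b n))
                (proj₂ (cb δ 0<δ) (ℕP.≤-trans K≤n n≤m) K≤n))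

^ℚ-nonNeg : ∀ {y} → 0ℚ ≤ y → ∀ k → 0ℚ ≤ y ^ℚ k
^ℚ-nonNeg 0≤y zero    = ℚP.<⇒≤ 0<1
^ℚ-nonNeg 0≤y (suc k) = *-nonNeg 0≤y (^ℚ-nonNeg 0≤y k)

∣^ℚ∣-≤ : ∀ {y M} → ∣ y ∣ ≤ M → ∀ k → ∣ y ^ℚ k ∣ ≤ M ^ℚ k
∣^ℚ∣-≤ h zero = ℚP.≤-refl
∣^ℚ∣-≤ {y} {M} h (suc k) = subst (_≤ M * M ^ℚ k) (sym (ℚP.∣p*q∣≡∣p∣*∣q∣ y (y ^ℚ k)))
  (*-mono (ℚP.0≤∣p∣ y) (^ℚ-nonNeg (ℚP.≤-trans (ℚP.0≤∣p∣ y) h) k) h (∣^ℚ∣-≤ h k))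

record Signs : Set where
  constructor mkSigns
  field
    sign   : ℕ → ℤ
    ∣sign∣≤1 : ∀ k → ℤ.∣ sign k ∣ ℕ.≤ 1

open Signs

ones : Signs
ones = mkSigns (λ _ → + 1) (λ _ → ℕP.≤-refl)

cosSigns : Signs
cosSigns = mkSigns s b
  where
  s : ℕ → ℤ
  s 0 = + 1
  s 1 = + 0
  s 2 = -[1+ 0 ]
  s 3 = + 0
  s (suc (suc (suc (suc k)))) = s k
  b : ∀ k → ℤ.∣ s k ∣ ℕ.≤ 1
  b 0 = ℕP.≤-refl
  b 1 = ℕ.z≤n
  b 2 = ℕP.≤-refl
  b 3 = ℕ.z≤n
  b (suc (suc (suc (suc k)))) = b k

sinSigns : Signs
sinSigns = mkSigns s b
  where
  s : ℕ → ℤ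
  s 0 = + 0
  s 1 = + 1
  s 2 = + 0
  s 3 = -[1+ 0 ]
  s (suc (suc (suc (suc k)))) = s k
  b : ∀ k → ℤ.∣ s k ∣ ℕ.≤ 1
  b 0 = ℕ.z≤n
  b 1 = ℕP.≤-refl
  b 2 = ℕ.z≤n
  b 3 = ℕP.≤-refl
  b (suc (suc (suc (suc k)))) = b k

/-mono : ∀ {a b} d .{{_ : NonZero d}} → a ℕ.≤ b → + a / d ≤ + b / d
/-mono {a} {b} d a≤b = ℚP.*-cancelʳ-≤-pos (ι d) {{ℚ.positive (ι-pos d)}}
  (subst₂ _≤_ (sym (/-*ι a d)) (sym (/-*ι b d)) (ι-mono a≤b))

1/-nonNeg : ∀ d .{{_ : NonZero d}} → 0ℚ ≤ + 1 / d
1/-nonNeg d = ℚP.nonNegative⁻¹ (+ 1 / d) {{ℚP.normalize-nonNeg 1 d}}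

1/d≤1 : ∀ d .{{_ : NonZero d}} → + 1 / d ≤ 1ℚ
1/d≤1 d = ℚP.*-cancelʳ-≤-pos (ι d) {{ℚ.positive (ι-pos d)}}
  (subst₂ _≤_ (sym (/-*ι 1 d)) (sym (ℚP.*-identityˡ (ι d)))
    (ι-mono {1} {d} (ℕ.>-nonZero⁻¹ d)))

∣sign/d∣ : ∀ s k d .{{_ : NonZero d}} → ∣ sign s k / d ∣ ≤ + 1 / d
∣sign/d∣ s k d = subst (_≤ + 1 / d) (sym (∣i/d∣ (sign s k) d)) (/-mono d (∣sign∣≤1 s k))

geometric-cauchy : ∀ {y} → 0ℚ ≤ y → y < 1ℚ → IsCauchy (psum (y ^ℚ_))
geometric-cauchy {y} 0≤y y<1 = RatioTest.cauchy-psum (y ^ℚ_) (^ℚ-nonNeg 0≤y) (1ℚ - y)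
  (subst (_< 1ℚ - y) (ℚP.+-inverseʳ y) (ℚP.+-monoˡ-< (- y) y<1)) 0
  (λ {k} _ → ℚP.≤-reflexive (lem y (y ^ℚ k)))
  where
  open +-*-Solver
  lem : ∀ y z → y * z + (1ℚ - y) * z ≡ z
  lem = solve 2 (λ y z → y :* z :+ (con 1ℚ :- y) :* z := z) refl

log-series : Signs → (y : ℚ) → ∣ y ∣ < 1ℚ → ℝ
log-series s y ∣y∣<1 = mkℝ (psum term)
  (comparison bound (geometric-cauchy (ℚP.0≤∣p∣ y) ∣y∣<1))
  where
  term : ℕ → ℚ
  term k = (sign s (suc k) / suc k) * y ^ℚ suc k
  bound : ∀ k → ∣ term k ∣ ≤ ∣ y ∣ ^ℚ k
  bound k = begin
    ∣ c * (y * y ^ℚ k) ∣          ≡⟨ ℚP.∣p*q∣≡∣p∣*∣q∣ c (y * y ^ℚ k) ⟩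
    ∣ c ∣ * ∣ y * y ^ℚ k ∣        ≤⟨ *-mono (ℚP.0≤∣p∣ c) (^ℚ-nonNeg (ℚP.0≤∣p∣ y) k) c≤1 p≤ ⟩
    1ℚ * ∣ y ∣ ^ℚ k               ≡⟨ ℚP.*-identityˡ _ ⟩
    ∣ y ∣ ^ℚ k                    ∎
    where
    open ℚP.≤-Reasoning
    c = sign s (suc k) / suc k
    c≤1 : ∣ c ∣ ≤ 1ℚ
    c≤1 = ℚP.≤-trans (∣sign/d∣ s (suc k) (suc k)) (1/d≤1 (suc k))
    p≤ : ∣ y * y ^ℚ k ∣ ≤ ∣ y ∣ ^ℚ k
    p≤ = subst₂ _≤_ (sym (ℚP.∣p*q∣≡∣p∣*∣q∣ y (y ^ℚ k))) (ℚP.*-identityˡ _)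
      (*-mono (ℚP.0≤∣p∣ y) (^ℚ-nonNeg (ℚP.0≤∣p∣ y) k) (ℚP.<⇒≤ ∣y∣<1)
        (∣^ℚ∣-≤ {y} ℚP.≤-refl k))

exp-coeff : Signs → ℕ → ℚ
exp-coeff s k = _/_ (sign s k) (k !) {{k ℕP.!≢0}}

exp-term : Signs → ℚ → ℕ → ℚ
exp-term s y k = exp-coeff s k * y ^ℚ k

1/k! : ℕ → ℚ
1/k! k = _/_ (+ 1) (k !) {{k ℕP.!≢0}}

1/k!-nonNeg : ∀ k → 0ℚ ≤ 1/k! k
1/k!-nonNeg k = 1/-nonNeg (k !) {{k ℕP.!≢0}}

1/k!-step : ∀ k → 1/k! (suc k) * ι (suc k) ≡ 1/k! k
1/k!-step k = /-unique {1} {k !} {{k ℕP.!≢0}} (begin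
  1/k! (suc k) * ι (suc k) * ι (k !)    ≡⟨ ℚP.*-assoc (1/k! (suc k)) (ι (suc k)) (ι (k !)) ⟩
  1/k! (suc k) * (ι (suc k) * ι (k !))  ≡⟨ cong (1/k! (suc k) *_) (sym (ι-* (suc k) (k !))) ⟩
  1/k! (suc k) * ι (suc k !)            ≡⟨ /-*ι 1 (suc k !) {{suc k ℕP.!≢0}} ⟩
  ι 1                                   ∎)
  where open Relation.Binary.PropositionalEquality.≡-Reasoning

module Exponential (M : ℚ) (0<M : 0ℚ < M) where

  0≤M : 0ℚ ≤ M
  0≤M = ℚP.<⇒≤ 0<M

  e : ℕ → ℚ
  e k = 1/k! k * M ^ℚ k

  e≥0 : ∀ k → 0ℚ ≤ e k
  e≥0 k = *-nonNeg (1/k!-nonNeg k) (^ℚ-nonNeg 0≤M k)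

  e-step : ∀ k → ι (suc k) * e (suc k) ≡ M * e k
  e-step k = trans (lem (ι (suc k)) (1/k! (suc k)) M (M ^ℚ k))
    (cong (λ z → M * (z * M ^ℚ k)) (1/k!-step k))
    where
    open +-*-Solver
    lem : ∀ i f M P → i * (f * (M * P)) ≡ M * (f * i * P)
    lem = solve 4 (λ i f M P → i :* (f :* (M :* P)) := M :* (f :* i :* P)) refl

  K : ℕ
  K = proj₁ (archimedean (M + M))

  ratio : ∀ {k} → K ℕ.≤ k → e (suc k) + ½ * e k ≤ e k
  ratio {k} K≤k = subst (e (suc k) + ½ * e k ≤_) (lem (e k))
    (ℚP.+-monoˡ-≤ (½ * e k) (*-cancelˡ (ι-pos (suc k)) (begin
      ι (suc k) * e (suc k)    ≡⟨ e-step k ⟩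
      M * e k                  ≡⟨ lem₁ M (e k) ⟩
      (M + M) * (½ * e k)      ≤⟨ *-monoˡ (*-nonNeg (ℚP.<⇒≤ 0<½) (e≥0 k)) 2M≤ ⟩
      ι (suc k) * (½ * e k)    ∎)))
    where
    open ℚP.≤-Reasoning
    2M≤ : M + M ≤ ι (suc k)
    2M≤ = ℚP.≤-trans (proj₂ (archimedean (M + M))) (ι-mono (ℕP.m≤n⇒m≤1+n K≤k))
    open +-*-Solver
    lem : ∀ x → ½ * x + ½ * x ≡ x
    lem = solve 1 (λ x → con ½ :* x :+ con ½ :* x := x) refl
    lem₁ : ∀ M x → M * x ≡ (M + M) * (½ * x)
    lem₁ = solve 2 (λ M x → M :* x := (M :+ M) :* (con ½ :* x)) refl

  e-cauchy : IsCauchy (psum e)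
  e-cauchy = RatioTest.cauchy-psum e e≥0 ½ 0<½ K ratio

  d : ℕ → ℚ
  d zero    = 0ℚ
  d (suc k) = ι (suc k) * M ^ℚ k

  d-step : ∀ k → M * d k + M ^ℚ k ≡ d (suc k)
  d-step zero    = trans (cong (_+ 1ℚ) (ℚP.*-zeroʳ M)) refl
  d-step (suc k) = lem M (ι (suc k)) (M ^ℚ k)
    where
    open +-*-Solver
    lem : ∀ M i P → M * (i * P) + M * P ≡ (1ℚ + i) * (M * P)
    lem = solve 3 (λ M i P → M :* (i :* P) :+ M :* P := (con 1ℚ :+ i) :* (M :* P)) refl

  d≥0 : ∀ k → 0ℚ ≤ d k
  d≥0 zero    = ℚP.≤-refl
  d≥0 (suc k) = *-nonNeg (ι-nonNeg (suc k)) (^ℚ-nonNeg 0≤M k)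

  ^ℚ-lipschitz : ∀ {y z} → ∣ y ∣ ≤ M → ∣ z ∣ ≤ M → ∀ k →
    ∣ y ^ℚ k - z ^ℚ k ∣ ≤ ∣ y - z ∣ * d k
  ^ℚ-lipschitz {y} {z} hy hz zero = ℚP.≤-reflexive (sym (ℚP.*-zeroʳ ∣ y - z ∣))
  ^ℚ-lipschitz {y} {z} hy hz (suc k) = begin
    ∣ y * Y - z * Z ∣                     ≡⟨ cong ∣_∣ (lem y z Y Z) ⟩
    ∣ y * (Y - Z) + (y - z) * Z ∣         ≤⟨ ℚP.∣p+q∣≤∣p∣+∣q∣ (y * (Y - Z)) ((y - z) * Z) ⟩
    ∣ y * (Y - Z) ∣ + ∣ (y - z) * Z ∣     ≡⟨ cong₂ _+_ (ℚP.∣p*q∣≡∣p∣*∣q∣ y (Y - Z))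
                                                       (ℚP.∣p*q∣≡∣p∣*∣q∣ (y - z) Z) ⟩
    ∣ y ∣ * ∣ Y - Z ∣ + ∣ y - z ∣ * ∣ Z ∣ ≤⟨ ℚP.+-mono-≤
      (*-mono (ℚP.0≤∣p∣ y) (*-nonNeg (ℚP.0≤∣p∣ (y - z)) (d≥0 k)) hy (^ℚ-lipschitz hy hz k))
      (*-monoʳ (ℚP.0≤∣p∣ (y - z)) (∣^ℚ∣-≤ hz k)) ⟩
    M * (D * d k) + D * M ^ℚ k            ≡⟨ lem₁ M D (d k) (M ^ℚ k) ⟩
    D * (M * d k + M ^ℚ k)                ≡⟨ cong (D *_) (d-step k) ⟩
    D * d (suc k)                         ∎
    where
    open ℚP.≤-Reasoning
    Y = y ^ℚ k
    Z = z ^ℚ k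
    D = ∣ y - z ∣
    open +-*-Solver
    lem : ∀ y z Y Z → y * Y - z * Z ≡ y * (Y - Z) + (y - z) * Z
    lem = solve 4 (λ y z Y Z → y :* Y :- z :* Z := y :* (Y :- Z) :+ (y :- z) :* Z) refl
    lem₁ : ∀ M D d P → M * (D * d) + D * P ≡ D * (M * d + P)
    lem₁ = solve 4 (λ M D d P → M :* (D :* d) :+ D :* P := D :* (M :* d :+ P)) refl

  g : ℕ → ℚ
  g k = 1/k! k * d k

  psum-g : ∀ n → psum g (suc n) ≡ psum e n
  psum-g zero    = trans (ℚP.+-identityˡ _) (ℚP.*-zeroʳ (1/k! 0))
  psum-g (suc n) = cong₂ _+_ (psum-g n)
    (trans (sym (ℚP.*-assoc (1/k! (suc n)) (ι (suc n)) (M ^ℚ n)))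
           (cong (_* M ^ℚ n) (1/k!-step n)))

  psum-g≤ : ∀ n → psum g n ≤ psum e n
  psum-g≤ zero    = ℚP.≤-refl
  psum-g≤ (suc n) = subst (_≤ psum e (suc n)) (sym (psum-g n)) (p≤p+q (e≥0 n))

  module _ (s : Signs) where

    exp-term-≤ : ∀ {y} → ∣ y ∣ ≤ M → ∀ k → ∣ exp-term s y k ∣ ≤ e k
    exp-term-≤ {y} h k =
      subst (_≤ e k) (sym (ℚP.∣p*q∣≡∣p∣*∣q∣ (exp-coeff s k) (y ^ℚ k)))
        (*-mono (ℚP.0≤∣p∣ (exp-coeff s k)) (^ℚ-nonNeg 0≤M k)
          (∣sign/d∣ s k (k !) {{k ℕP.!≢0}}) (∣^ℚ∣-≤ h k))

    psum-lipschitz : ∀ {y z} → ∣ y ∣ ≤ M → ∣ z ∣ ≤ M → ∀ n →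
      ∣ psum (exp-term s y) n - psum (exp-term s z) n ∣ ≤ ∣ y - z ∣ * psum g n
    psum-lipschitz {y} {z} hy hz zero = ℚP.≤-reflexive (sym (ℚP.*-zeroʳ ∣ y - z ∣))
    psum-lipschitz {y} {z} hy hz (suc n) = begin
      ∣ (P + c * Y) - (Q + c * Z) ∣        ≡⟨ cong ∣_∣ (lem P Q c Y Z) ⟩
      ∣ (P - Q) + c * (Y - Z) ∣            ≤⟨ ℚP.∣p+q∣≤∣p∣+∣q∣ (P - Q) (c * (Y - Z)) ⟩
      ∣ P - Q ∣ + ∣ c * (Y - Z) ∣          ≡⟨ cong (_+_ ∣ P - Q ∣) (ℚP.∣p*q∣≡∣p∣*∣q∣ c (Y - Z)) ⟩
      ∣ P - Q ∣ + ∣ c ∣ * ∣ Y - Z ∣        ≤⟨ ℚP.+-mono-≤ (psum-lipschitz hy hz n)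
        (*-mono (ℚP.0≤∣p∣ c) (*-nonNeg (ℚP.0≤∣p∣ (y - z)) (d≥0 n))
          (∣sign/d∣ s n (n !) {{n ℕP.!≢0}}) (^ℚ-lipschitz hy hz n)) ⟩
      D * psum g n + 1/k! n * (D * d n)    ≡⟨ lem₁ D (psum g n) (1/k! n) (d n) ⟩
      D * (psum g n + 1/k! n * d n)        ∎
      where
      open ℚP.≤-Reasoning
      P = psum (exp-term s y) n
      Q = psum (exp-term s z) n
      c = exp-coeff s n
      Y = y ^ℚ n
      Z = z ^ℚ n
      D = ∣ y - z ∣
      open +-*-Solver
      lem : ∀ P Q c Y Z → (P + c * Y) - (Q + c * Z) ≡ (P - Q) + c * (Y - Z)
      lem = solve 5 (λ P Q c Y Z →
        (P :+ c :* Y) :- (Q :+ c :* Z) := (P :- Q) :+ c :* (Y :- Z)) refl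
      lem₁ : ∀ D G f d → D * G + f * (D * d) ≡ D * (G + f * d)
      lem₁ = solve 4 (λ D G f d → D :* G :+ f :* (D :* d) := D :* (G :+ f :* d)) refl

    exp-term-cauchy : ∀ u → IsCauchy u → ∀ K₁ → (∀ {n} → K₁ ℕ.≤ n → ∣ u n ∣ ≤ M) →
      Bound (psum e) → IsCauchy (λ n → psum (exp-term s (u n)) n)
    exp-term-cauchy u cu K₁ bu (B , 0<B , K₂ , be) =
      cauchy-wlog (λ n → psum (exp-term s (u n)) n) λ δ 0<δ →
        step δ 0<δ (*-pos 0<δ 0<½) (quotient {B} (δ * ½) 0<B (*-pos 0<δ 0<½))
      where
      Goal : ℚ → Set
      Goal δ = ∃ λ K → ∀ {m n} → K ℕ.≤ n → n ℕ.≤ m →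
        ∣ psum (exp-term s (u m)) m - psum (exp-term s (u n)) n ∣ ≤ δ
      finish : ∀ δ t → B * t ≡ δ * ½ → ∀ K₃ K₄ →
        (∀ {m n} → K₃ ℕ.≤ m → K₃ ℕ.≤ n → ∣ psum e m - psum e n ∣ ≤ δ * ½) →
        (∀ {m n} → K₄ ℕ.≤ m → K₄ ℕ.≤ n → ∣ u m - u n ∣ ≤ t) → Goal δ
      finish δ t eq K₃ K₄ ce cu′ = (K₁ ℕ.⊔ K₂) ℕ.⊔ (K₃ ℕ.⊔ K₄) , λ {m} {n} h n≤m →
        main m n n≤m
          (ℕP.m⊔n≤o⇒m≤o K₁ K₂ (ℕP.m⊔n≤o⇒m≤o (K₁ ℕ.⊔ K₂) (K₃ ℕ.⊔ K₄) h))
          (ℕP.m⊔n≤o⇒n≤o K₁ K₂ (ℕP.m⊔n≤o⇒m≤o (K₁ ℕ.⊔ K₂) (K₃ ℕ.⊔ K₄) h))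
          (ℕP.m⊔n≤o⇒m≤o K₃ K₄ (ℕP.m⊔n≤o⇒n≤o (K₁ ℕ.⊔ K₂) (K₃ ℕ.⊔ K₄) h))
          (ℕP.m⊔n≤o⇒n≤o K₃ K₄ (ℕP.m⊔n≤o⇒n≤o (K₁ ℕ.⊔ K₂) (K₃ ℕ.⊔ K₄) h))
        where
        main : ∀ m n → n ℕ.≤ m → K₁ ℕ.≤ n → K₂ ℕ.≤ n → K₃ ℕ.≤ n → K₄ ℕ.≤ n →
          ∣ psum (exp-term s (u m)) m - psum (exp-term s (u n)) n ∣ ≤ δ
        main m n n≤m h₁ h₂ h₃ h₄ = begin
          ∣ P - Q ∣                                  ≡⟨ cong ∣_∣ (lem P Q R) ⟩
          ∣ (P - R) + (R - Q) ∣                      ≤⟨ ℚP.∣p+q∣≤∣p∣+∣q∣ (P - R) (R - Q) ⟩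
          ∣ P - R ∣ + ∣ R - Q ∣                      ≤⟨ ℚP.+-mono-≤
            (comparison-≤ (exp-term-≤ (bu (ℕP.≤-trans h₁ n≤m))) n≤m)
            (psum-lipschitz (bu (ℕP.≤-trans h₁ n≤m)) (bu h₁) n) ⟩
          (psum e m - psum e n) + ∣ u m - u n ∣ * psum g n  ≤⟨ ℚP.+-mono-≤
            (ℚP.≤-trans (p≤∣p∣ (psum e m - psum e n)) (ce (ℕP.≤-trans h₃ n≤m) h₃))
            (ℚP.≤-trans
              (*-monoʳ (ℚP.0≤∣p∣ (u m - u n))
                (ℚP.≤-trans (psum-g≤ n) (ℚP.≤-trans (p≤∣p∣ (psum e n)) (be h₂))))
              (*-monoˡ (ℚP.<⇒≤ 0<B) (cu′ (ℕP.≤-trans h₄ n≤m) h₄))) ⟩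
          δ * ½ + t * B          ≡⟨ cong (_+_ (δ * ½)) (trans (ℚP.*-comm t B) eq) ⟩
          δ * ½ + δ * ½          ≡⟨ half-split δ ⟩
          δ                      ∎
          where
          open ℚP.≤-Reasoning
          P = psum (exp-term s (u m)) m
          Q = psum (exp-term s (u n)) n
          R = psum (exp-term s (u m)) n
          open +-*-Solver
          lem : ∀ P Q R → P - Q ≡ (P - R) + (R - Q)
          lem = solve 3 (λ P Q R → P :- Q := (P :- R) :+ (R :- Q)) refl
      step : ∀ δ → 0ℚ < δ → 0ℚ < δ * ½ → (∃ λ t → 0ℚ < t × B * t ≡ δ * ½) → Goal δ
      step δ 0<δ 0<δ/2 (t , 0<t , eq) = finish δ t eq
        (proj₁ (e-cauchy (δ * ½) 0<δ/2)) (proj₁ (cu t 0<t))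
        (proj₂ (e-cauchy (δ * ½) 0<δ/2)) (proj₂ (cu t 0<t))

exp-series-cauchy : ∀ s u → IsCauchy u → Bound u →
  IsCauchy (λ n → psum (exp-term s (u n)) n)
exp-series-cauchy s u cu (M , 0<M , K₁ , bu) =
  exp-term-cauchy s u cu K₁ bu (cauchy⇒bound (psum e) e-cauchy)
  where open Exponential M 0<M

-- The n-th rational approximation of ∑_{k ≥ 0} sₖ xᵏ / k! is the sum of the first
-- n terms of the series at the n-th rational approximation of x.
exp-series : Signs → ℝ → ℝ
exp-series s x = mkℝ (λ n → psum (exp-term s (seq x n)) n)
  (exp-series-cauchy s (seq x) (cauchy x) (cauchy⇒bound (seq x) (cauchy x)))

exp cos sin : ℝ → ℝ
exp = exp-series ones
cos = exp-series cosSigns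
sin = exp-series sinSigns

∣pred[n]/n∣<1 : ∀ n .{{_ : NonZero n}} → ∣ + (n ∸ 1) / n ∣ < 1ℚ
∣pred[n]/n∣<1 n@(suc k) = subst (_< 1ℚ) (sym (∣i/d∣ (+ k) n))
  (ℚP.*-cancelʳ-<-nonNeg (ι n) {{ℚ.nonNegative (ι-nonNeg n)}}
    (subst₂ _<_ (trans (ℚP.+-identityˡ (ι k)) (sym (/-*ι k n))) (sym (ℚP.*-identityˡ (ι n)))
      (ℚP.+-monoˡ-< (ι k) 0<1)))

-- log n = - log (1 - y) = ∑_{k ≥ 1} yᵏ / k with y = (n - 1) / n.
log : (n : ℕ) .{{_ : NonZero n}} → ℝ
log n = log-series ones (+ (n ∸ 1) / n) (∣pred[n]/n∣<1 n)

infixr 8 _^ʳ_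

_^ʳ_ : (n : ℕ) .{{_ : NonZero n}} → ℝ → ℝ
n ^ʳ s = exp (s *ʳ log n)

-- arctan y = y - y³/3 + y⁵/5 - … has the sign pattern of the sine series.
arctan : (y : ℚ) → ∣ y ∣ < 1ℚ → ℝ
arctan = log-series sinSigns

-- Euler's formula π / 4 = arctan (1/2) + arctan (1/3).
π : ℝ
π = fromℚ (+ 4 / 1) *ʳ
  (arctan ½ (ℚ.*<* (ℤ.+<+ ℕP.≤-refl)) +ʳ arctan (+ 1 / 3) (ℚ.*<* (ℤ.+<+ (ℕP.m≤n+m 2 1))))

isqrt : ℕ → ℕ
isqrt zero = 0
isqrt (suc n) with suc (isqrt n) ℕ.* suc (isqrt n) ℕP.≤? suc n
... | yes _ = suc (isqrt n)
... | no  _ = isqrt n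

isqrt-bounds : ∀ n → isqrt n ℕ.* isqrt n ℕ.≤ n × n ℕ.< suc (isqrt n) ℕ.* suc (isqrt n)
isqrt-bounds zero = ℕ.z≤n , ℕ.s≤s ℕ.z≤n
isqrt-bounds (suc n) with suc (isqrt n) ℕ.* suc (isqrt n) ℕP.≤? suc n
... | yes h = h , ℕP.<-≤-trans (ℕ.s≤s (proj₂ (isqrt-bounds n)))
  (ℕP.*-mono-< (ℕP.n<1+n (suc (isqrt n))) (ℕP.n<1+n (suc (isqrt n))))
... | no h = ℕP.m≤n⇒m≤1+n (proj₁ (isqrt-bounds n)) , ℕP.≰⇒> h

-- With ∣ q ∣ = a / b and k = n + 1: √ (a / b) = √ (a b k²) / (b k), and the
-- numerator on the right is rounded down to an integer.
√-approx : ℚ → ℕ → ℚ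
√-approx q n = + isqrt (ℤ.∣ ↥ q ∣ ℕ.* ↧ₙ q ℕ.* (suc n ℕ.* suc n)) / (↧ₙ q ℕ.* suc n)

module √-Approx (q : ℚ) (n : ℕ) where

  a b k D r : ℕ
  a = ℤ.∣ ↥ q ∣
  b = ↧ₙ q
  k = suc n
  D = b ℕ.* k
  r = isqrt (a ℕ.* b ℕ.* (k ℕ.* k))

  s t : ℚ
  s = √-approx q n
  t = + 1 / k

  0≤s : 0ℚ ≤ s
  0≤s = ℚP.nonNegative⁻¹ s {{ℚP.normalize-nonNeg r D}}

  0≤t : 0ℚ ≤ t
  0≤t = 1/-nonNeg k

  s*D : s * ι D ≡ ι r
  s*D = /-*ι r D

  q*D² : ∣ q ∣ * (ι D * ι D) ≡ ι (a ℕ.* b ℕ.* (k ℕ.* k))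
  q*D² = trans (cong (λ z → ∣ q ∣ * (z * z)) (ι-* b k))
    (trans (lem ∣ q ∣ (ι b) (ι k))
    (trans (cong (λ z → z * ι b * (ι k * ι k)) (trans (cong (_* ι b) (∣↥∣-/ q)) (/-*ι a b)))
    (sym (trans (ι-* (a ℕ.* b) (k ℕ.* k)) (cong₂ _*_ (ι-* a b) (ι-* k k))))))
    where
    open +-*-Solver
    lem : ∀ q b k → q * ((b * k) * (b * k)) ≡ q * b * b * (k * k)
    lem = solve 3 (λ q b k → q :* ((b :* k) :* (b :* k)) := q :* b :* b :* (k :* k)) refl

  sq-* : ∀ x y → (x * x) * (y * y) ≡ (x * y) * (x * y)
  sq-* = solve 2 (λ x y → (x :* x) :* (y :* y) := (x :* y) :* (x :* y)) refl
    where open +-*-Solver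

  0<D² : 0ℚ < ι D * ι D
  0<D² = *-pos (ι-pos D) (ι-pos D)

  cancel : ∀ {x y} → x * (ι D * ι D) ≤ y * (ι D * ι D) → x ≤ y
  cancel = ℚP.*-cancelʳ-≤-pos (ι D * ι D) {{ℚ.positive 0<D²}}

  lower : s * s ≤ ∣ q ∣
  lower = cancel (subst₂ _≤_
    (trans (ι-* r r) (trans (cong₂ _*_ (sym s*D) (sym s*D)) (sym (sq-* s (ι D)))))
    (sym q*D²)
    (ι-mono (proj₁ (isqrt-bounds (a ℕ.* b ℕ.* (k ℕ.* k))))))

  1≤t*D : 1ℚ ≤ t * ι D
  1≤t*D = subst (1ℚ ≤_)
    (sym (trans (cong (t *_) (trans (ι-* b k) (ℚP.*-comm (ι b) (ι k))))
         (trans (sym (ℚP.*-assoc t (ι k) (ι b))) (trans (cong (_* ι b) (/-*ι 1 k)) (ℚP.*-identityˡ (ι b))))))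
    (p≤p+q (ι-nonNeg (ℚ.denominator-1 q)))

  upper : ∣ q ∣ ≤ (s + t) * (s + t)
  upper = cancel (begin
    ∣ q ∣ * (ι D * ι D)                ≡⟨ q*D² ⟩
    ι (a ℕ.* b ℕ.* (k ℕ.* k))          ≤⟨ ι-mono (ℕP.<⇒≤ (proj₂ (isqrt-bounds (a ℕ.* b ℕ.* (k ℕ.* k))))) ⟩
    ι (suc r ℕ.* suc r)                ≡⟨ ι-* (suc r) (suc r) ⟩
    ι (suc r) * ι (suc r)              ≤⟨ *-mono (ι-nonNeg (suc r)) 0≤z r+1≤z r+1≤z ⟩
    ((s + t) * ι D) * ((s + t) * ι D)  ≡⟨ sym (sq-* (s + t) (ι D)) ⟩
    (s + t) * (s + t) * (ι D * ι D)    ∎)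
    where
    open ℚP.≤-Reasoning
    0≤z : 0ℚ ≤ (s + t) * ι D
    0≤z = *-nonNeg (+-nonNeg 0≤s 0≤t) (ι-nonNeg D)
    r+1≤z : ι (suc r) ≤ (s + t) * ι D
    r+1≤z = subst₂ _≤_ (ℚP.+-comm (ι r) 1ℚ)
      (trans (cong (_+ t * ι D) (sym s*D)) (sym (ℚP.*-distribʳ-+ (ι D) s t)))
      (ℚP.+-monoʳ-≤ (ι r) 1≤t*D)

sq-< : ∀ {x y} → 0ℚ ≤ x → x < y → x * x < y * y
sq-< {x} {y} 0≤x x<y = ℚP.≤-<-trans (*-monoʳ 0≤x (ℚP.<⇒≤ x<y))
  (ℚP.*-monoˡ-<-pos y {{ℚ.positive (ℚP.≤-<-trans 0≤x x<y)}} x<y)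

√-gap : ∀ {s s′ t η A B} → 0ℚ ≤ s → 0ℚ ≤ t → t ≤ η → s′ * s′ ≤ A → A ≤ B + η * η →
  B ≤ (s + t) * (s + t) → s′ ≤ s + (η + η)
√-gap {s} {s′} {t} {η} {A} {B} 0≤s 0≤t t≤η hA hAB hB with ℚP.≤-total s′ (s + (η + η))
... | inj₁ h = h
... | inj₂ h with s′ ℚP.≤? s + (η + η)
...   | yes h′ = h′
...   | no ¬h = ⊥-elim (ℚP.<-irrefl refl (ℚP.<-≤-trans (sq-< 0≤w (ℚP.≰⇒> ¬h)) (begin
  s′ * s′                            ≤⟨ hA ⟩
  A                                  ≤⟨ hAB ⟩
  B + η * η                          ≤⟨ ℚP.+-monoˡ-≤ (η * η) hB ⟩
  (s + t) * (s + t) + η * η          ≤⟨ ℚP.+-monoˡ-≤ (η * η)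
    (*-mono (+-nonNeg 0≤s 0≤t) (+-nonNeg 0≤s 0≤η) (ℚP.+-monoʳ-≤ s t≤η) (ℚP.+-monoʳ-≤ s t≤η)) ⟩
  (s + η) * (s + η) + η * η          ≤⟨ p≤p+q (*-nonNeg (+-nonNeg (+-nonNeg 0≤s 0≤s) (+-nonNeg 0≤η 0≤η)) 0≤η) ⟩
  (s + η) * (s + η) + η * η + (s + s + (η + η)) * η  ≡⟨ lem s η ⟩
  (s + (η + η)) * (s + (η + η))      ∎)))
  where
  open ℚP.≤-Reasoning
  0≤η : 0ℚ ≤ η
  0≤η = ℚP.≤-trans 0≤t t≤η
  0≤w : 0ℚ ≤ s + (η + η)
  0≤w = +-nonNeg 0≤s (+-nonNeg 0≤η 0≤η)
  open +-*-Solver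
  lem : ∀ s η → (s + η) * (s + η) + η * η + (s + s + (η + η)) * η ≡ (s + (η + η)) * (s + (η + η))
  lem = solve 2 (λ s η → (s :+ η) :* (s :+ η) :+ η :* η :+ (s :+ s :+ (η :+ η)) :* η :=
    (s :+ (η :+ η)) :* (s :+ (η :+ η))) refl

1/-small : ∀ η → 0ℚ < η → ∃ λ L → ∀ {n} → L ℕ.≤ n → + 1 / suc n ≤ η
1/-small η 0<η = step (recip-pos 0<η)
  where
  step : (∃ λ t → 0ℚ < t × η * t ≡ 1ℚ) → ∃ λ L → ∀ {n} → L ℕ.≤ n → + 1 / suc n ≤ η
  step (t , 0<t , ηt≡1) = proj₁ (archimedean t) , λ {n} h →
    ℚP.*-cancelʳ-≤-pos (ι (suc n)) {{ℚ.positive (ι-pos (suc n))}}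
      (subst (_≤ η * ι (suc n)) (trans ηt≡1 (sym (/-*ι 1 (suc n))))
        (*-monoʳ (ℚP.<⇒≤ 0<η)
          (ℚP.≤-trans (proj₂ (archimedean t)) (ι-mono (ℕP.m≤n⇒m≤1+n h)))))

√-cauchy : ∀ u → IsCauchy u → IsCauchy (λ n → √-approx (u n) n)
√-cauchy u cu δ 0<δ =
  step (cu (η * η) (*-pos 0<η 0<η)) (1/-small η 0<η)
  where
  η = δ * ½
  0<η : 0ℚ < η
  0<η = *-pos 0<δ 0<½
  lem : ∀ {x y} → x ≤ y + (η + η) → x - y ≤ δ
  lem {x} {y} h = subst₂ _≤_ refl (trans (lem′ y (η + η)) (half-split δ)) (ℚP.+-monoˡ-≤ (- y) h)
    where
    open +-*-Solver
    lem′ : ∀ y z → y + z - y ≡ z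
    lem′ = solve 2 (λ y z → y :+ z :- y := z) refl
  step : (∃ λ K → ∀ {m n} → K ℕ.≤ m → K ℕ.≤ n → ∣ u m - u n ∣ ≤ η * η) →
    (∃ λ L → ∀ {n} → L ℕ.≤ n → + 1 / suc n ≤ η) →
    ∃ λ K → ∀ {m n} → K ℕ.≤ m → K ℕ.≤ n →
      ∣ √-approx (u m) m - √-approx (u n) n ∣ ≤ δ
  step (K , b) (L , small) = K ℕ.⊔ L , λ {m} {n} h h′ →
    ∣∣-≤ (lem (gap m n h h′))
      (subst (_≤ δ) (swap (√-approx (u m) m) (√-approx (u n) n)) (lem (gap n m h′ h)))
    where
    open +-*-Solver
    swap : ∀ x y → y - x ≡ - (x - y)
    swap = solve 2 (λ x y → y :- x := :- (x :- y)) refl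
    gap : ∀ m n → K ℕ.⊔ L ℕ.≤ m → K ℕ.⊔ L ℕ.≤ n →
      √-approx (u m) m ≤ √-approx (u n) n + (η + η)
    gap m n h h′ = √-gap N.0≤s N.0≤t (small (ℕP.m⊔n≤o⇒n≤o K L h′)) M.lower
      (ℚP.≤-trans (∣p∣≤∣q∣+∣p-q∣ (u m) (u n))
        (ℚP.+-monoʳ-≤ ∣ u n ∣ (b (ℕP.m⊔n≤o⇒m≤o K L h) (ℕP.m⊔n≤o⇒m≤o K L h′))))
      N.upper
      where
      module M = √-Approx (u m) m
      module N = √-Approx (u n) n

-- √ ∣ x ∣, which is the square root of x when x is non-negative.
√ : ℝ → ℝ
√ x = mkℝ (λ n → √-approx (seq x n) n) (√-cauchy (seq x) (cauchy x))

infix 6 _+𝕚_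

record ℂ : Set where
  constructor _+𝕚_
  field
    re im : ℝ

open ℂ public

infixl 6 _+ᶜ_
infixr 7 _•_

0ᶜ 𝕚 : ℂ
0ᶜ = 0ʳ +𝕚 0ʳ
𝕚  = 0ʳ +𝕚 1ʳ

_+ᶜ_ : ℂ → ℂ → ℂ
z +ᶜ w = (re z +ʳ re w) +𝕚 (im z +ʳ im w)

_•_ : ℝ → ℂ → ℂ
c • z = (c *ʳ re z) +𝕚 (c *ʳ im z)

∣_∣ᶜ : ℂ → ℝ
∣ z ∣ᶜ = √ (re z *ʳ re z +ʳ im z *ʳ im z)

expᶜ : ℂ → ℂ
expᶜ z = exp (re z) • (cos (im z) +𝕚 sin (im z))

∑ : List ℕ → (ℕ → ℂ) → ℂ
∑ xs f = foldr _+ᶜ_ 0ᶜ (map f xs)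

syntax ∑ xs (λ x → z) = ∑[ x ∈ xs ] z

1⋯ : ℕ → List ℕ
1⋯ n = map suc (upTo n)

φ : ℕ → ℕ
φ n = length (filter (λ k → coprime? k n) (1⋯ n))

φ-nonZero : ∀ n .{{_ : NonZero n}} → NonZero (φ n)
φ-nonZero (suc n) = subst NonZero
  (sym (cong length (filter-accept (λ k → coprime? k (suc n)) (1-coprimeTo (suc n))))) _

-- The multiplicative order of g modulo n is φ n.
IsPrimitiveRoot : ℕ → ℤ → Set
IsPrimitiveRoot n g =
  (+ n ∣ℤ g ℤ.^ φ n ℤ.- + 1) ×
  (∀ {k} → k ℕ.< φ n → 0 ℕ.< k → ¬ (+ n ∣ℤ g ℤ.^ k ℤ.- + 1))

isPrimitiveRoot? : ∀ n g → Dec (IsPrimitiveRoot n g)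
isPrimitiveRoot? n g =
  (n ℕD.∣? ℤ.∣ g ℤ.^ φ n ℤ.- + 1 ∣) ×-dec
  ℕP.allUpTo? (λ k → (0 ℕP.<? k) →-dec ¬? (n ℕD.∣? ℤ.∣ g ℤ.^ k ℤ.- + 1 ∣)) (φ n)

-- The least non-negative representatives of the primitive roots modulo p.
primitiveRoots : ℕ → List ℕ
primitiveRoots p = filter (λ g → isPrimitiveRoot? p (+ g)) (upTo p)

e : (p : ℕ) .{{_ : NonZero p}} → ℤ → ℂ
e p α = expᶜ ((fromℚ (+ 2 / 1) *ʳ π *ʳ fromℚ (α / p)) • 𝕚)

phase : ∀ {r} (a b : ℤ) (bs gs : Fin r → ℤ) → ℕ → ℕ → ℤ
phase a b bs gs g x =
  a ℤ.* + x ℤ.+ b ℤ.* (+ g) ℤ.^ x ℤ.+ sum (λ i → bs i ℤ.* gs i ℤ.^ x)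

meanSum : ∀ {p} → Prime p → ∀ (N : ℕ) {r} (a b : ℤ) (bs gs : Fin r → ℤ) → ℂ
meanSum {p} p-prime N a b bs gs =
  fromℚ (+ 1 / φ (p ∸ 1)) •
    (∑[ g ∈ primitiveRoots p ] ∑[ x ∈ 1⋯ N ] e p (phase a b bs gs g x))
  where
  instance
    _ = prime⇒nonZero p-prime
    _ = φ-nonZero (p ∸ 1)
      {{ℕ.>-nonZero (ℕP.m<n⇒0<n∸m (ℕ.nonTrivial⇒n>1 p {{prime⇒nonTrivial p-prime}}))}}

{-# OPTIONS --safe #-}

-- The averaging over g removes the other exponentials. With w(x) the factor that does not
-- depend on g, the sum is ∑ₓ w(x) S(x), where S(x) = ∑_g e_p(b gˣ) and |w(x)| = 1, so it is
-- enough to bound each |S(x)|; this gives the exponent 1/2 + o(1), well below 23/24.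
--
-- Fix one primitive root θ (one of the gᵢ) and put n = p - 1. The primitive roots are the
-- θʸ with y < n coprime to n, and sieving out the ω prime divisors of n writes S(x) as a sum
-- of 2^ω sums T = ∑_{d ∣ y} e_p(b θ^{x y}), d ∣ n. The map c ↦ T(c) is constant on the
-- cosets of a subgroup, so averaging |T(b)|² over b θ^{x y} and completing to all residues c
-- gives |T| ≤ D(x) √p, where D(x) = #{y < n : n ∣ x y}; and ∑_{x ≤ n} D(x) ≤ n τ(n).
-- With 2^ω ≤ τ(n), n ≤ 2^ω φ(n) and τ(n)⁸ ≪ n the mean is ≪ τ(n)³ √p ≪ p^{7/8}.
--
-- That e_p is a nontrivial character of ℤ/p rests on exp(- log(1 - z)) = 1 / (1 - z) for
-- Gaussian rationals z: it yields exp(2 i arctan y) = (1 + i y) / (1 - i y), hence e^{2πi} = 1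
-- from π / 4 = arctan (1/2) + arctan (1/3), and also exp(log p) = p.
--
-- Complex numbers are handled as bounded sequences of Gaussian rationals modulo null
-- sequences.

module Submission where

-- Sequences modulo null sequences form a ring with zero divisors, so a complete character sum S
-- with S (1 - e_p(1)) = 0 need not vanish merely because e_p(1) differs from 1: a factor is
-- cancelled only when its real part eventually exceeds a positive rational. Such a gap for 1 -
-- e_p(1) needs 2π/p bounded below and at most 1, where 1 - cos c ≥ c²/6. The lower bound comes from
-- exp(iπ/2) = i, which is far from 1; the upper one holds for p ≥ `P₀`, an integer bound for the
-- approximations to 2π, and smaller primes are left to the trivial bound.
--
-- No square root is taken before the last step. A bound |u| ≤ B is kept in the form |u|² ≤ B² with
-- B a natural number, so the arithmetic stays in ℕ, and p^{23/24} is only ever reached through its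
-- 24th power exp(23 log p) = p²³. In 24th powers the arithmetic estimate p^{7/8} becomes p²¹.

-- Finite sums over commutative monoids, and counting.

module Sums where
  open import Algebra.Bundles using (CommutativeMonoid)
  open import Data.Bool using (if_then_else_)
  open import Data.Nat as ℕ using (ℕ; zero; suc; z≤n; s≤s)
  import Data.Nat.Properties as ℕP
  open import Function using (_∘_)
  open import Relation.Binary.PropositionalEquality as ≡ using (_≡_)
  open import Relation.Nullary using (¬_; Dec; yes; no; does)
  open import Relation.Nullary.Decidable using (dec-true; dec-false)

  module Summation {c ℓ} (M : CommutativeMonoid c ℓ) where
    open CommutativeMonoid M renaming (_∙_ to _+_; ε to 0#; ∙-cong to +-cong; identityˡ to +-identityˡ; identityʳ to +-identityʳ; assoc to +-assoc; comm to +-comm)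
    open import Relation.Binary.Reasoning.Setoid setoid
    open import Algebra.Properties.CommutativeSemigroup commutativeSemigroup using (interchange)

    Σ : ℕ → (ℕ → Carrier) → Carrier
    Σ zero    f = 0#
    Σ (suc n) f = f 0 + Σ n (f ∘ suc)

    -- An indicator inside a sum over a full interval replaces summation over a subset, so that the
    -- order of summation can be exchanged and indices can be shifted freely.
    when : ∀ {p} {P : Set p} → Dec P → Carrier → Carrier
    when d x = if does d then x else 0#

    when-yes : ∀ {p} {P : Set p} (d : Dec P) {x} → P → when d x ≈ x
    when-yes d h = reflexive (≡.cong (if_then _ else 0#) (dec-true d h))

    when-no : ∀ {p} {P : Set p} (d : Dec P) {x} → ¬ P → when d x ≈ 0#
    when-no d h = reflexive (≡.cong (if_then _ else 0#) (dec-false d h))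

    when-cong : ∀ {p} {P : Set p} (d : Dec P) {x y} → (P → x ≈ y) → when d x ≈ when d y
    when-cong (yes h) e = e h
    when-cong (no _)  e = refl

    when-iff : ∀ {p q} {P : Set p} {Q : Set q} (d : Dec P) (e : Dec Q) {x} → (P → Q) → (Q → P) → when d x ≈ when e x
    when-iff (yes h) e f g = sym (when-yes e (f h))
    when-iff (no h)  e f g = sym (when-no e (h ∘ g))

    Σ-cong : ∀ n {f g} → (∀ i → i ℕ.< n → f i ≈ g i) → Σ n f ≈ Σ n g
    Σ-cong zero    h = refl
    Σ-cong (suc n) h = +-cong (h 0 (s≤s z≤n)) (Σ-cong n λ i i<n → h (suc i) (s≤s i<n))

    Σ-cong′ : ∀ n {f g} → (∀ i → f i ≈ g i) → Σ n f ≈ Σ n g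
    Σ-cong′ n h = Σ-cong n λ i _ → h i

    Σ-0 : ∀ n {f} → (∀ i → i ℕ.< n → f i ≈ 0#) → Σ n f ≈ 0#
    Σ-0 zero    h = refl
    Σ-0 (suc n) h = trans (+-cong (h 0 (s≤s z≤n)) (Σ-0 n λ i i<n → h (suc i) (s≤s i<n))) (+-identityˡ 0#)

    Σ-+ : ∀ n f g → Σ n (λ i → f i + g i) ≈ Σ n f + Σ n g
    Σ-+ zero    f g = sym (+-identityˡ 0#)
    Σ-+ (suc n) f g = trans (+-cong refl (Σ-+ n (f ∘ suc) (g ∘ suc))) (interchange (f 0) (g 0) _ _)

    Σ-swap : ∀ m n (f : ℕ → ℕ → Carrier) → Σ m (λ i → Σ n (f i)) ≈ Σ n (λ j → Σ m (λ i → f i j))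
    Σ-swap zero    n f = sym (Σ-0 n λ _ _ → refl)
    Σ-swap (suc m) n f = trans (+-cong refl (Σ-swap m n (f ∘ suc))) (sym (Σ-+ n (f 0) (λ j → Σ m (λ i → f (suc i) j))))

    Σ-back : ∀ n f → Σ (suc n) f ≈ Σ n f + f n
    Σ-back zero    f = trans (+-identityʳ (f 0)) (sym (+-identityˡ (f 0)))
    Σ-back (suc n) f = trans (+-cong refl (Σ-back n (f ∘ suc))) (sym (+-assoc (f 0) _ _))

    Σ-++ : ∀ m n f → Σ (m ℕ.+ n) f ≈ Σ m f + Σ n (λ i → f (m ℕ.+ i))
    Σ-++ zero    n f = sym (+-identityˡ (Σ n f))
    Σ-++ (suc m) n f = trans (+-cong refl (Σ-++ m n (f ∘ suc))) (sym (+-assoc (f 0) _ _))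

    when-Σ : ∀ {p} {P : Set p} (d : Dec P) n f → when d (Σ n f) ≈ Σ n (λ i → when d (f i))
    when-Σ (yes _) n f = refl
    when-Σ (no _)  n f = sym (Σ-0 n λ _ _ → refl)

    Σ-rotate : ∀ n f → f n ≈ f 0 → Σ n (f ∘ suc) ≈ Σ n f
    Σ-rotate zero    f h = refl
    Σ-rotate (suc n) f h = begin
      Σ (suc n) (f ∘ suc)         ≈⟨ Σ-back n (f ∘ suc) ⟩
      Σ n (f ∘ suc) + f (suc n)   ≈⟨ +-cong refl h ⟩
      Σ n (f ∘ suc) + f 0         ≈⟨ +-comm (Σ n (f ∘ suc)) (f 0) ⟩
      f 0 + Σ n (f ∘ suc)         ∎

    Σ-shift : ∀ n f k → (∀ i → f (i ℕ.+ n) ≈ f i) → Σ n (λ i → f (k ℕ.+ i)) ≈ Σ n f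
    Σ-shift n f zero    h = refl
    Σ-shift n f (suc k) h = trans (Σ-shift n (f ∘ suc) k (h ∘ suc)) (Σ-rotate n f (h 0))

    Σ-single : ∀ n k → k ℕ.< n → ∀ (f : ℕ → Carrier) → Σ n (λ i → when (k ℕ.≟ i) (f i)) ≈ f k
    Σ-single (suc n) zero    _ f = trans (+-cong (when-yes (0 ℕ.≟ 0) {f 0} ≡.refl) (Σ-0 n λ i _ → when-no (0 ℕ.≟ suc i) {f (suc i)} λ ())) (+-identityʳ (f 0))
    Σ-single (suc n) (suc k) (s≤s h) f = trans (+-cong (when-no (suc k ℕ.≟ 0) {f 0} λ ())
      (Σ-cong′ n λ i → when-iff (suc k ℕ.≟ suc i) (k ℕ.≟ i) {f (suc i)} ℕP.suc-injective (≡.cong suc)))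
      (trans (+-identityˡ _) (Σ-single n k h (f ∘ suc)))

  module ℕΣ where
    open Summation ℕP.+-0-commutativeMonoid public

    Σ-mono : ∀ n {f g} → (∀ i → i ℕ.< n → f i ℕ.≤ g i) → Σ n f ℕ.≤ Σ n g
    Σ-mono zero    h = z≤n
    Σ-mono (suc n) h = ℕP.+-mono-≤ (h 0 (s≤s z≤n)) (Σ-mono n λ i i<n → h (suc i) (s≤s i<n))

    Σ-const : ∀ n k → Σ n (λ _ → k) ≡ n ℕ.* k
    Σ-const zero    k = ≡.refl
    Σ-const (suc n) k = ≡.cong (k ℕ.+_) (Σ-const n k)

    Σ-*ˡ : ∀ n k f → Σ n (λ i → k ℕ.* f i) ≡ k ℕ.* Σ n f
    Σ-*ˡ zero    k f = ≡.sym (ℕP.*-zeroʳ k)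
    Σ-*ˡ (suc n) k f = ≡.trans (≡.cong (k ℕ.* f 0 ℕ.+_) (Σ-*ˡ n k (f ∘ suc))) (≡.sym (ℕP.*-distribˡ-+ k (f 0) _))

    Σ-*ʳ : ∀ n k f → Σ n (λ i → f i ℕ.* k) ≡ Σ n f ℕ.* k
    Σ-*ʳ n k f = ≡.trans (Σ-cong′ n λ i → ℕP.*-comm (f i) k) (≡.trans (Σ-*ˡ n k f) (ℕP.*-comm k _))

    when-mono : ∀ {p q} {P : Set p} {Q : Set q} (d : Dec P) (e : Dec Q) {x y} → (P → Q) → x ℕ.≤ y → when d x ℕ.≤ when e y
    when-mono (yes h) e f l = ℕP.≤-trans l (ℕP.≤-reflexive (≡.sym (when-yes e (f h))))
    when-mono (no h)  e f l = z≤n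

    count : ∀ {p} {P : ℕ → Set p} → (∀ i → Dec (P i)) → ℕ → ℕ
    count P? n = Σ n (λ i → when (P? i) 1)

    count≥1 : ∀ {p} {P : ℕ → Set p} (P? : ∀ i → Dec (P i)) n → P 0 → 1 ℕ.≤ n → 1 ℕ.≤ count P? n
    count≥1 P? (suc n) h _ = ℕP.≤-trans (ℕP.≤-reflexive (≡.sym (when-yes (P? 0) {1} h))) (ℕP.m≤m+n (when (P? 0) 1) (count (P? ∘ suc) n))

    -- Subtracting the least element of P maps P injectively into Q.
    count-differences : ∀ {p q} {P : ℕ → Set p} {Q : ℕ → Set q} (P? : ∀ i → Dec (P i)) (Q? : ∀ i → Dec (Q i)) n →
      (∀ i j → P i → P (j ℕ.+ i) → Q j) → count P? n ℕ.≤ count Q? n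
    count-differences P? Q? zero    h = z≤n
    count-differences {P = P} {Q} P? Q? (suc n) h with P? 0
    ... | yes p₀ = ℕP.+-mono-≤ (ℕP.≤-reflexive (≡.sym (when-yes (Q? 0) (h 0 0 p₀ p₀))))
      (Σ-mono n λ i _ → when-mono (P? (suc i)) (Q? (suc i)) (λ pᵢ → h 0 (suc i) p₀ (≡.subst P (≡.sym (ℕP.+-identityʳ (suc i))) pᵢ)) ℕP.≤-refl)
    ... | no _ = ℕP.≤-trans (count-differences (P? ∘ suc) Q? n (λ i j a b → h (suc i) j a (≡.subst P (≡.sym (ℕP.+-suc j i)) b)))
      (ℕP.≤-trans (ℕP.m≤m+n _ _) (ℕP.≤-reflexive (≡.sym (Σ-back n (λ i → when (Q? i) 1)))))

    -- No term can fall short of 1, since the others cannot make up for it.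
    Σ-extremal : ∀ n {f : ℕ → ℕ} → (∀ i → i ℕ.< n → f i ℕ.≤ 1) → Σ n f ≡ n → ∀ i → i ℕ.< n → f i ≡ 1
    Σ-extremal (suc n) {f} h e i i<n = go i i<n
      where
      rest : Σ n (f ∘ suc) ℕ.≤ n
      rest = ℕP.≤-trans (Σ-mono n λ i i<n → h (suc i) (s≤s i<n)) (ℕP.≤-reflexive (≡.trans (Σ-const n 1) (ℕP.*-identityʳ n)))
      f0≥1 : 1 ℕ.≤ f 0
      f0≥1 = ℕP.+-cancelʳ-≤ n 1 (f 0) (ℕP.≤-trans (ℕP.≤-reflexive (≡.sym e)) (ℕP.+-monoʳ-≤ (f 0) rest))
      f0 : f 0 ≡ 1
      f0 = ℕP.≤-antisym (h 0 (s≤s z≤n)) f0≥1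
      go : ∀ i → i ℕ.< suc n → f i ≡ 1
      go zero    _       = f0
      go (suc i) (s≤s l) = Σ-extremal n (λ i i<n → h (suc i) (s≤s i<n)) (ℕP.suc-injective (≡.trans (≡.cong (ℕ._+ Σ n (f ∘ suc)) (≡.sym f0)) e)) i l

-- Prime factorizations, divisors, and the mean of gcd(x, n).

module Arithmetic where
  open import Data.Nat
  open import Data.Nat.Properties
  open import Data.Nat.Divisibility
  open import Data.Nat.Primality
  open import Data.Nat.Primality.Factorisation using (factorise; module PrimeFactorisation)
  open import Data.Nat.Coprimality using (Coprime; coprime-divisor)
  open import Data.Nat.GCD using (gcd; gcd[m,n]∣m; gcd[m,n]∣n; gcd-greatest)
  open import Data.Nat.Tactic.RingSolver using (solve-∀)
  open import Data.Empty using (⊥; ⊥-elim)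
  open import Data.List using (List; []; _∷_; length; map; _++_)
  open import Data.List.Properties using (length-++; length-map)
  open import Data.List.Relation.Unary.All as All using (All; []; _∷_)
  open import Data.List.Relation.Unary.All.Properties using () renaming (++⁺ to All-++⁺; map⁺ to All-map⁺)
  open import Data.List.Relation.Unary.Any using (here; there)
  open import Data.List.Membership.Propositional using (_∈_)
  open import Data.List.Membership.Propositional.Properties using (∈-++⁺ˡ; ∈-++⁺ʳ; ∈-map⁺)
  open import Data.Product using (∃; _×_; _,_)
  open import Data.Sum using (inj₁; inj₂; [_,_]′)
  open import Relation.Binary.PropositionalEquality
  open import Relation.Nullary using (¬_; Dec; yes; no)
  open Sums

  prime-divisor : ∀ {n} → .{{NonZero n}} → n ≢ 1 → ∃ λ q → Prime q × q ∣ n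
  prime-divisor {n} n≢1 = go (PrimeFactorisation.factors f) (PrimeFactorisation.isFactorisation f) (PrimeFactorisation.factorsPrime f)
    where
    f = factorise n
    open import Data.Nat.ListAction using (product)
    go : ∀ qs → n ≡ product qs → All Prime qs → ∃ λ q → Prime q × q ∣ n
    go [] e _ = ⊥-elim (n≢1 e)
    go (q ∷ qs) e (pq ∷ _) = q , pq , subst (q ∣_) (sym e) (m∣m*n (product qs))

  -- `k` is fuel: dividing by q ≥ 2 makes the number strictly smaller.
  strip : ∀ q → 2 ≤ q → ∀ k N → 1 ≤ N → N ≤ k → ∃ λ a → ∃ λ M → N ≡ q ^ a * M × ¬ (q ∣ M)
  strip q 2≤q zero N 1≤N N≤0 = ⊥-elim (<⇒≱ 1≤N N≤0)
  strip q 2≤q (suc k) N 1≤N N≤k with q ∣? N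
  ... | no q∤N = 0 , N , sym (*-identityˡ N) , q∤N
  ... | yes (divides zero e) = ⊥-elim (<⇒≱ 1≤N (≤-reflexive e))
  ... | yes (divides (suc M) e) with strip q 2≤q k (suc M) (s≤s z≤n) (s≤s⁻¹ (≤-trans (≤-trans (m<m*n (suc M) q 2≤q) (≤-reflexive (sym e))) N≤k))
  ...   | a , M′ , e′ , q∤M′ = suc a , M′ , trans e (trans (*-comm (suc M) q) (trans (cong (q *_) e′) (sym (*-assoc q (q ^ a) M′)))) , q∤M′

  -- The first index is a strict upper bound for the primes used. Each candidate below it is passed
  -- once, so the primes in a factorization are distinct and a new prime `m` is coprime to the part
  -- `N` built before it.
  data Factored : ℕ → ℕ → Set where
    one  : Factored 0 1
    skip : ∀ {m N} → Factored m N → Factored (suc m) N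
    mult : ∀ {m N} → Prime m → ∀ a → Factored m N → Factored (suc m) (m ^ suc a * N)

  prime>1 : ∀ {q} → Prime q → 2 ≤ q
  prime>1 pq = nonTrivial⇒n>1 _ {{prime⇒nonTrivial pq}}

  factored : ∀ m N → 1 ≤ N → (∀ {q} → Prime q → q ∣ N → q < m) → Factored m N
  factored zero N 1≤N h with N ≟ 1
  ... | yes refl = one
  ... | no N≢1 with prime-divisor {N} {{>-nonZero 1≤N}} N≢1
  ...   | q , pq , q∣N with h pq q∣N
  ...     | ()
  factored (suc m) N 1≤N h with prime? m
  ... | no ¬pm = skip (factored m N 1≤N λ {q} pq q∣N → ≤∧≢⇒< (s≤s⁻¹ (h pq q∣N)) λ { refl → ¬pm pq })
  ... | yes pm with strip m (prime>1 pm) N N 1≤N ≤-refl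
  ...   | zero , M , e , m∤M = skip (factored m N 1≤N λ {q} pq q∣N → ≤∧≢⇒< (s≤s⁻¹ (h pq q∣N))
          λ { refl → m∤M (subst (m ∣_) (trans e (*-identityˡ M)) q∣N) })
  ...   | suc a , M , e , m∤M = subst (Factored (suc m)) (sym e) (mult pm a (factored m M
          (n≢0⇒n>0 λ { refl → m∤M (m ∣0) })
          λ {q} pq q∣M → ≤∧≢⇒< (s≤s⁻¹ (h pq (subst (q ∣_) (sym e) (∣n⇒∣m*n (m ^ suc a) q∣M)))) λ { refl → m∤M q∣M }))

  factorization : ∀ n → 1 ≤ n → Factored (suc n) n
  factorization n 1≤n = factored (suc n) n 1≤n λ pq q∣n → s≤s (∣⇒≤ {{>-nonZero 1≤n}} q∣n)

  factored≥1 : ∀ {m N} → Factored m N → 1 ≤ N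
  factored≥1 one = ≤-refl
  factored≥1 (skip f) = factored≥1 f
  factored≥1 (mult {m} pm a f) = *-mono-≤ (m^n>0 m {{prime⇒nonZero pm}} (suc a)) (factored≥1 f)

  primes : ∀ {m N} → Factored m N → List ℕ
  primes one                = []
  primes (skip f)           = primes f
  primes (mult {m} pm a f)  = m ∷ primes f

  prime∣^ : ∀ {q} m a → Prime q → q ∣ m ^ a → q ∣ m
  prime∣^ m zero pq h = ⊥-elim (<⇒≱ (prime>1 pq) (∣⇒≤ h))
  prime∣^ m (suc a) pq h = [ (λ x → x) , prime∣^ m a pq ]′ (euclidsLemma m (m ^ a) pq h)

  prime∣prime : ∀ {q m} → Prime q → Prime m → q ∣ m → q ≡ m
  prime∣prime pq pm h = [ (λ e → ⊥-elim (<⇒≱ (prime>1 pq) (≤-reflexive e))) , (λ e → e) ]′ (prime⇒irreducible pm h)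

  prime∈primes : ∀ {m N} (f : Factored m N) {q} → Prime q → q ∣ N → q ∈ primes f
  prime∈primes one pq h = ⊥-elim (<⇒≱ (prime>1 pq) (∣⇒≤ h))
  prime∈primes (skip f) pq h = prime∈primes f pq h
  prime∈primes (mult {m} {N} pm a f) pq h with euclidsLemma (m ^ suc a) N pq h
  ... | inj₁ q∣ = here (prime∣prime pq pm (prime∣^ m (suc a) pq q∣))
  ... | inj₂ q∣N = there (prime∈primes f pq q∣N)

  prime<bound : ∀ {m N} (f : Factored m N) {q} → Prime q → q ∣ N → q < m
  prime<bound one pq h = ⊥-elim (<⇒≱ (prime>1 pq) (∣⇒≤ h))
  prime<bound (skip f) pq h = m<n⇒m<1+n (prime<bound f pq h)
  prime<bound (mult {m} {N} pm a f) pq h with euclidsLemma (m ^ suc a) N pq h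
  ... | inj₁ q∣ = s≤s (≤-reflexive (prime∣prime pq pm (prime∣^ m (suc a) pq q∣)))
  ... | inj₂ q∣N = m<n⇒m<1+n (prime<bound f pq q∣N)

  primes-∣ : ∀ {m N} (f : Factored m N) → All (_∣ N) (primes f)
  primes-∣ one = []
  primes-∣ (skip f) = primes-∣ f
  primes-∣ (mult {m} {N} pm a f) = ∣m⇒∣m*n N (m∣m*n (m ^ a)) ∷ All.map (∣n⇒∣m*n (m ^ suc a)) (primes-∣ f)

  primes-prime : ∀ {m N} (f : Factored m N) → All Prime (primes f)
  primes-prime one = []
  primes-prime (skip f) = primes-prime f
  primes-prime (mult pm a f) = pm ∷ primes-prime f

  no-common-prime⇒coprime : ∀ {a b} → 1 ≤ b → (∀ {q} → Prime q → q ∣ a → q ∣ b → ⊥) → Coprime a b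
  no-common-prime⇒coprime {a} {b} 1≤b h {zero} (d∣a , d∣b) = ⊥-elim (<⇒≱ 1≤b (≤-reflexive (0∣⇒≡0 d∣b)))
  no-common-prime⇒coprime {a} {b} 1≤b h {d@(suc _)} (d∣a , d∣b) with d ≟ 1
  ... | yes e = e
  ... | no d≢1 with prime-divisor {d} d≢1
  ...   | q , pq , q∣d = ⊥-elim (h pq (∣-trans q∣d d∣a) (∣-trans q∣d d∣b))

  prime-coprime : ∀ {q N} → Prime q → 1 ≤ N → ¬ (q ∣ N) → Coprime q N
  prime-coprime pq 1≤N q∤N = no-common-prime⇒coprime 1≤N λ pr r∣q r∣N → q∤N (subst (_∣ _) (prime∣prime pr pq r∣q) r∣N)

  coprime-* : ∀ {a b N} → 1 ≤ N → Coprime a N → Coprime b N → Coprime (a * b) N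
  coprime-* {a} {b} 1≤N ca cb = no-common-prime⇒coprime 1≤N λ pq q∣ab q∣N →
    [ (λ q∣a → <⇒≱ (prime>1 pq) (≤-reflexive (ca (q∣a , q∣N)))) , (λ q∣b → <⇒≱ (prime>1 pq) (≤-reflexive (cb (q∣b , q∣N)))) ]′ (euclidsLemma a b pq q∣ab)

  coprime-factorʳ : ∀ {d a N} → Coprime d (a * N) → Coprime d N
  coprime-factorʳ {a = a} c (x , y) = c (x , ∣n⇒∣m*n a y)

  coprime-factorˡ : ∀ {d a N} → Coprime d (a * N) → Coprime d a
  coprime-factorˡ {N = N} c (x , y) = c (x , ∣m⇒∣m*n N y)

  -- Sifted n d qs licenses the sieve recursion that removes the multiples of each q ∈ qs
  -- from the multiples of d below n.
  data Sifted (n : ℕ) : ℕ → List ℕ → Set where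
    []  : ∀ {d} → d ∣ n → Sifted n d []
    _∷_ : ∀ {d q qs} → Coprime d q × Prime q → Sifted n d qs × Sifted n (d * q) qs → Sifted n d (q ∷ qs)

  -- The invariant is that d is coprime to the unprocessed part N and d N divides n. Each prime of N
  -- is either dropped or moved into d, and once N = 1 the invariant says d ∣ n.
  sifted : ∀ {n m N} (f : Factored m N) d → Coprime d N → d * N ∣ n → Sifted n d (primes f)
  sifted one d c h = [] (subst (_∣ _) (*-identityʳ d) h)
  sifted (skip f) d c h = sifted f d c h
  sifted {n} (mult {m} {N} pm a f) d c h =
    (coprime-factorˡ {a = m} {N = m ^ a * N} (subst (Coprime d) (*-assoc m (m ^ a) N) c) , pm) ∷
    ( sifted f d c′ (∣-trans (*-monoʳ-∣ d (n∣m*n (m ^ suc a))) h)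
    , sifted f (d * m) (coprime-* (factored≥1 f) c′ (prime-coprime pm (factored≥1 f) λ m∣N → <-irrefl refl (prime<bound f pm m∣N)))
        (∣-trans (subst (_∣ d * (m ^ suc a * N)) (sym (*-assoc d m N)) (*-monoʳ-∣ d (*-monoˡ-∣ N (m∣m*n {m} (m ^ a))))) h) )
    where
    c′ : Coprime d N
    c′ = coprime-factorʳ {a = m ^ suc a} c

  -- Complementary divisors (D, E). Either m does not enter D and all its powers go to E, or one
  -- factor m of D is split off and the pair comes from the exponent t - 1.
  pairs : ℕ → List (ℕ × ℕ) → ℕ → List (ℕ × ℕ)
  pairs m Ds zero    = Ds
  pairs m Ds (suc t) = map (λ (D , E) → D , m ^ suc t * E) Ds ++ map (λ (D , E) → m * D , E) (pairs m Ds t)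

  divisors : ∀ {m N} → Factored m N → List (ℕ × ℕ)
  divisors one             = (1 , 1) ∷ []
  divisors (skip f)        = divisors f
  divisors (mult {m} _ a f) = pairs m (divisors f) (suc a)

  Product : ℕ → ℕ × ℕ → Set
  Product N (D , E) = D * E ≡ N

  pairs-product : ∀ m {Ds N} t → All (Product N) Ds → All (Product (m ^ t * N)) (pairs m Ds t)
  pairs-product m {Ds} {N} zero    h = subst (λ x → All (Product x) Ds) (sym (*-identityˡ N)) h
  pairs-product m {Ds} {N} (suc t) h = All-++⁺
    (All-map⁺ (All.map (λ { {D , E} e → trans (lem D (m ^ suc t) E) (cong (m ^ suc t *_) e) }) h))
    (All-map⁺ (All.map (λ { {D , E} e → trans (*-assoc m D E) (trans (cong (m *_) e) (sym (*-assoc m (m ^ t) N))) }) (pairs-product m t h)))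
    where
    lem : ∀ D x E → D * (x * E) ≡ x * (D * E)
    lem = solve-∀

  divisors-product : ∀ {m N} (f : Factored m N) → All (Product N) (divisors f)
  divisors-product one = refl ∷ []
  divisors-product (skip f) = divisors-product f
  divisors-product (mult {m} pm a f) = pairs-product m (suc a) (divisors-product f)

  Complete : ℕ → List (ℕ × ℕ) → Set
  Complete N Ds = ∀ {D} → D ∣ N → ∃ λ E → (D , E) ∈ Ds

  -- If m does not divide D, then D is coprime to mᵗ and divides N; otherwise one factor m is
  -- removed from D.
  pairs-complete : ∀ {m Ds N} → Prime m → ∀ t → Complete N Ds → Complete (m ^ t * N) (pairs m Ds t)
  pairs-complete {m} {Ds} {N} pm zero h D∣ = h (subst (_ ∣_) (*-identityˡ N) D∣)
  pairs-complete {m} {Ds} {N} pm (suc t) h {D} D∣ with m ∣? D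
  ... | yes (divides D′ refl) with pairs-complete pm t h {D′} (*-cancelˡ-∣ m {{prime⇒nonZero pm}}
          (subst₂ _∣_ (*-comm D′ m) (*-assoc m (m ^ t) N) D∣))
  ...   | E , z∈ = E , ∈-++⁺ʳ (map (λ (D , E) → D , m ^ suc t * E) Ds)
          (subst (λ x → (x , E) ∈ map (λ (D , E) → m * D , E) (pairs m Ds t)) (*-comm m D′) (∈-map⁺ (λ (D , E) → m * D , E) z∈))
  pairs-complete {m} {Ds} {N} pm (suc t) h {D} D∣ | no m∤D
    with h (coprime-divisor {D} {m ^ suc t} (no-common-prime⇒coprime (m^n>0 m {{prime⇒nonZero pm}} (suc t))
           λ pq q∣D q∣m^ → m∤D (subst (_∣ D) (prime∣prime pq pm (prime∣^ m (suc t) pq q∣m^)) q∣D)) D∣)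
  ... | E , z∈ = m ^ suc t * E , ∈-++⁺ˡ (∈-map⁺ (λ (D , E) → D , m ^ suc t * E) z∈)

  divisors-complete : ∀ {m N} (f : Factored m N) → Complete N (divisors f)
  divisors-complete one D∣1 = 1 , here (cong (_, 1) (∣1⇒≡1 D∣1))
  divisors-complete (skip f) = divisors-complete f
  divisors-complete (mult pm a f) = pairs-complete pm (suc a) (divisors-complete f)

  length-pairs : ∀ m Ds t → length (pairs m Ds t) ≡ suc t * length Ds
  length-pairs m Ds zero = sym (+-identityʳ (length Ds))
  length-pairs m Ds (suc t) = trans (length-++ (map (λ (D , E) → D , m ^ suc t * E) Ds))
    (cong₂ _+_ (length-map _ Ds) (trans (length-map _ (pairs m Ds t)) (length-pairs m Ds t)))

  divisorCount : ∀ {m N} → Factored m N → ℕ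
  divisorCount f = length (divisors f)

  2^ω≤divisorCount : ∀ {m N} (f : Factored m N) → 2 ^ length (primes f) ≤ divisorCount f
  2^ω≤divisorCount one = ≤-refl
  2^ω≤divisorCount (skip f) = 2^ω≤divisorCount f
  2^ω≤divisorCount (mult {m} pm a f) = ≤-trans (*-mono-≤ {2} {suc (suc a)} (s≤s (s≤s z≤n)) (2^ω≤divisorCount f))
    (≤-reflexive (sym (length-pairs m (divisors f) (suc a))))

  suc≤2^ : ∀ t → suc t ≤ 2 ^ t
  suc≤2^ zero = ≤-refl
  suc≤2^ (suc t) = ≤-trans (+-mono-≤ (m^n>0 2 t) (suc≤2^ t)) (≤-reflexive (cong (2 ^ t +_) (sym (+-identityʳ (2 ^ t)))))

  ^-distribʳ-* : ∀ k a b → (a * b) ^ k ≡ a ^ k * b ^ k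
  ^-distribʳ-* zero a b = refl
  ^-distribʳ-* (suc k) a b = trans (cong (a * b *_) (^-distribʳ-* k a b)) (lem a b (a ^ k) (b ^ k))
    where
    lem : ∀ a b c d → a * b * (c * d) ≡ a * c * (b * d)
    lem = solve-∀

  -- With s = ⌊t/8⌋, t + 1 ≤ 8 (s + 1) ≤ 8 · 2ˢ.
  suc^8≤ : ∀ t → suc t ^ 8 ≤ 8 ^ 8 * 2 ^ t
  suc^8≤ t = begin
    suc t ^ 8                    ≤⟨ ^-monoˡ-≤ 8 t+1≤ ⟩
    (8 * 2 ^ (t / 8)) ^ 8        ≡⟨ ^-distribʳ-* 8 8 (2 ^ (t / 8)) ⟩
    8 ^ 8 * (2 ^ (t / 8)) ^ 8    ≡⟨ cong (8 ^ 8 *_) (^-*-assoc 2 (t / 8) 8) ⟩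
    8 ^ 8 * 2 ^ (t / 8 * 8)      ≤⟨ *-monoʳ-≤ (8 ^ 8) (^-monoʳ-≤ 2 (m/n*n≤m t 8)) ⟩
    8 ^ 8 * 2 ^ t                ∎
    where
    open ≤-Reasoning
    open import Data.Nat.DivMod using (m/n*n≤m; m≡m%n+[m/n]*n; m%n<n)
    t+1≤ : suc t ≤ 8 * 2 ^ (t / 8)
    t+1≤ = begin
      suc t                          ≡⟨ cong suc (m≡m%n+[m/n]*n t 8) ⟩
      suc (t % 8 + t / 8 * 8)        ≤⟨ +-monoˡ-≤ (t / 8 * 8) (m%n<n t 8) ⟩
      8 + t / 8 * 8                  ≡⟨ *-comm (suc (t / 8)) 8 ⟩
      8 * suc (t / 8)                ≤⟨ *-monoʳ-≤ 8 (suc≤2^ (t / 8)) ⟩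
      8 * 2 ^ (t / 8)                ∎

  -- Opaque to keep such huge numerals from being evaluated; the same applies to `Kτ` below.
  opaque
    K₀ : ℕ
    K₀ = 8 ^ 8

    K₀≥1 : 1 ≤ K₀
    K₀≥1 = m^n>0 8 8

    suc^8≤K₀ : ∀ t → suc t ^ 8 ≤ K₀ * 2 ^ t
    suc^8≤K₀ = suc^8≤

  -- A prime power qᵃ with q ≥ 256 = 2⁸ satisfies (a + 1)⁸ ≤ 2⁸ᵃ ≤ qᵃ.
  divisorCount^8≤ : ∀ {m N} (f : Factored m N) → divisorCount f ^ 8 ≤ K₀ ^ (m ⊓ 256) * N
  divisorCount^8≤ one = ≤-refl
  divisorCount^8≤ (skip {m} {N} f) = ≤-trans (divisorCount^8≤ f) (*-monoˡ-≤ N (^-monoʳ-≤ K₀ {{>-nonZero K₀≥1}} (⊓-monoˡ-≤ 256 (n≤1+n m))))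
  divisorCount^8≤ (mult {m} {N} pm a f) = ≤-trans (≤-reflexive (trans (cong (_^ 8) (length-pairs m (divisors f) (suc a))) (^-distribʳ-* 8 (suc (suc a)) (divisorCount f)))) (go (m <? 256))
    where
    open ≤-Reasoning
    X : ℕ
    X = K₀ ^ (m ⊓ 256)
    go : Dec (m < 256) → suc (suc a) ^ 8 * divisorCount f ^ 8 ≤ K₀ ^ (suc m ⊓ 256) * (m ^ suc a * N)
    -- Each prime below 256 costs one factor `K₀` and larger ones cost none, which is what the
    -- exponent `m ⊓ 256` counts.
    go (yes m<256) = begin
      suc (suc a) ^ 8 * divisorCount f ^ 8                  ≤⟨ *-mono-≤ (suc^8≤K₀ (suc a)) (divisorCount^8≤ f) ⟩
      (K₀ * 2 ^ suc a) * (X * N)                 ≤⟨ *-monoˡ-≤ (X * N) (*-monoʳ-≤ K₀ (^-monoˡ-≤ (suc a) (prime>1 pm))) ⟩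
      (K₀ * m ^ suc a) * (X * N)                 ≡⟨ lem K₀ (m ^ suc a) X N ⟩
      K₀ * X * (m ^ suc a * N)                   ≡⟨ cong (λ e → K₀ * K₀ ^ e * (m ^ suc a * N)) (m≤n⇒m⊓n≡m (<⇒≤ m<256)) ⟩
      K₀ ^ suc m * (m ^ suc a * N)               ≡⟨ cong (λ e → K₀ ^ e * (m ^ suc a * N)) (sym (m≤n⇒m⊓n≡m m<256)) ⟩
      K₀ ^ (suc m ⊓ 256) * (m ^ suc a * N)       ∎
      where
      lem : ∀ k x y n → (k * x) * (y * n) ≡ k * y * (x * n)
      lem = solve-∀
    go (no m≮256) = begin
      suc (suc a) ^ 8 * divisorCount f ^ 8                  ≤⟨ *-mono-≤ (^-monoˡ-≤ 8 (suc≤2^ (suc a))) (divisorCount^8≤ f) ⟩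
      (2 ^ suc a) ^ 8 * (X * N)                  ≡⟨ cong (_* (X * N)) (trans (^-*-assoc 2 (suc a) 8) (trans (cong (2 ^_) (*-comm (suc a) 8)) (sym (^-*-assoc 2 8 (suc a))))) ⟩
      256 ^ suc a * (X * N)                      ≤⟨ *-monoˡ-≤ (X * N) (^-monoˡ-≤ (suc a) (≮⇒≥ m≮256)) ⟩
      m ^ suc a * (X * N)                        ≡⟨ lem (m ^ suc a) X N ⟩
      X * (m ^ suc a * N)                        ≤⟨ *-monoˡ-≤ (m ^ suc a * N) (^-monoʳ-≤ K₀ {{>-nonZero K₀≥1}} (⊓-monoˡ-≤ 256 (n≤1+n m))) ⟩
      K₀ ^ (suc m ⊓ 256) * (m ^ suc a * N)       ∎
      where
      lem : ∀ x y n → x * (y * n) ≡ y * (x * n)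
      lem = solve-∀

  opaque
    Kτ : ℕ
    Kτ = K₀ ^ 256

    Kτ≥1 : 1 ≤ Kτ
    Kτ≥1 = m^n>0 K₀ {{>-nonZero K₀≥1}} 256

    divisorCount^8≤Kτ : ∀ {m N} (f : Factored m N) → divisorCount f ^ 8 ≤ Kτ * N
    divisorCount^8≤Kτ {m} {N} f = ≤-trans (divisorCount^8≤ f) (*-monoˡ-≤ N (^-monoʳ-≤ K₀ {{>-nonZero K₀≥1}} (m⊓n≤n m 256)))

  open ℕΣ

  count-multiples : ∀ D E → 1 ≤ D → count (D ∣?_) (E * D) ≡ E
  count-multiples D zero 1≤D = refl
  count-multiples (suc D) (suc E) 1≤D = begin
    count (suc D ∣?_) (suc D + E * suc D)
      ≡⟨ Σ-++ (suc D) (E * suc D) (λ i → when (suc D ∣? i) 1) ⟩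
    count (suc D ∣?_) (suc D) + Σ (E * suc D) (λ i → when (suc D ∣? (suc D + i)) 1)
      ≡⟨ cong₂ _+_ first (Σ-cong′ (E * suc D) λ i → when-iff (suc D ∣? (suc D + i)) (suc D ∣? i) {1} (λ h → ∣m+n∣m⇒∣n h ∣-refl) (∣m∣n⇒∣m+n ∣-refl)) ⟩
    1 + count (suc D ∣?_) (E * suc D)
      ≡⟨ cong suc (count-multiples (suc D) E 1≤D) ⟩
    suc E ∎
    where
    open ≡-Reasoning
    first : count (suc D ∣?_) (suc D) ≡ 1
    first = cong₂ _+_ (when-yes (suc D ∣? 0) {1} (suc D ∣0)) (Σ-0 D λ i i<D → when-no (suc D ∣? suc i) {1} (>⇒∤ (s≤s i<D)))

  sumᴸ : ∀ {A : Set} → (A → ℕ) → List A → ℕ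
  sumᴸ f []       = 0
  sumᴸ f (x ∷ xs) = f x + sumᴸ f xs

  ∈⇒≤sumᴸ : ∀ {A : Set} (f : A → ℕ) {x xs} → x ∈ xs → f x ≤ sumᴸ f xs
  ∈⇒≤sumᴸ f (here refl) = m≤m+n _ _
  ∈⇒≤sumᴸ f (there h) = ≤-trans (∈⇒≤sumᴸ f h) (m≤n+m _ _)

  Σ-sumᴸ : ∀ {A : Set} n (f : A → ℕ → ℕ) xs → Σ n (λ i → sumᴸ (λ x → f x i) xs) ≡ sumᴸ (λ x → Σ n (f x)) xs
  Σ-sumᴸ n f [] = Σ-0 n λ _ _ → refl
  Σ-sumᴸ n f (x ∷ xs) = trans (Σ-+ n (f x) _) (cong (Σ n (f x) +_) (Σ-sumᴸ n f xs))

  sumᴸ-const : ∀ {A : Set} {P : A → Set} (f : A → ℕ) k → (∀ {x} → P x → f x ≡ k) → ∀ {xs} → All P xs → sumᴸ f xs ≡ length xs * k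
  sumᴸ-const f k h [] = refl
  sumᴸ-const f k h (p ∷ ps) = cong₂ _+_ (h p) (sumᴸ-const f k h ps)

  -- For θ of order n this is the number of y modulo n with θ^{xy} = 1, which is gcd(x, n). The form
  -- of a count suits both of its uses, as a bound for multiplicities and as a term of the mean.
  torsion : ℕ → ℕ → ℕ
  torsion n x = count (λ y → n ∣? (x * y)) n

  torsion≥1 : ∀ n x → 1 ≤ n → 1 ≤ torsion n x
  torsion≥1 n x = count≥1 (λ y → n ∣? (x * y)) n (subst (n ∣_) (sym (*-zeroʳ x)) (n ∣0))

  -- n ∣ x y forces D ∣ x and E ∣ y for the divisor pair with D = gcd x n.
  Σ-torsion : ∀ {m n} (f : Factored m n) → Σ n (λ i → torsion n (suc i)) ≤ n * divisorCount f
  Σ-torsion {m} {n} f = begin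
    Σ n (λ i → torsion n (suc i))
      ≤⟨ Σ-mono n (λ i _ → Σ-mono n λ y _ → split i y (n ∣? (suc i * y))) ⟩
    Σ n (λ i → Σ n (λ y → sumᴸ (λ z → term z i y) L))
      ≡⟨ Σ-cong′ n (λ i → Σ-sumᴸ n (λ z → term z i) L) ⟩
    Σ n (λ i → sumᴸ (λ z → Σ n (term z i)) L)
      ≡⟨ Σ-sumᴸ n (λ z i → Σ n (term z i)) L ⟩
    sumᴸ (λ z → Σ n (λ i → Σ n (term z i))) L
      ≡⟨ sumᴸ-const (λ z → Σ n (λ i → Σ n (term z i))) n (λ {z} → total z) (divisors-product f) ⟩
    divisorCount f * n
      ≡⟨ *-comm (divisorCount f) n ⟩
    n * divisorCount f ∎
    where
    open ≤-Reasoning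
    L = divisors f
    term : ℕ × ℕ → ℕ → ℕ → ℕ
    term (D , E) i y = when (D ∣? suc i) 1 * when (E ∣? y) 1
    1≤n : 1 ≤ n
    1≤n = factored≥1 f
    split : ∀ i y (d : Dec (n ∣ suc i * y)) → when d 1 ≤ sumᴸ (λ z → term z i y) L
    split i y (no _) = z≤n
    split i y (yes n∣xy) with divisors-complete f (gcd[m,n]∣n (suc i) n)
    ... | E , z∈L = ≤-trans (≤-reflexive (sym (cong₂ _*_ (when-yes (D ∣? suc i) {1} D∣x) (when-yes (E ∣? y) {1} E∣y)))) (∈⇒≤sumᴸ (λ z → term z i y) z∈L)
      where
      D : ℕ
      D = gcd (suc i) n
      D∣x : D ∣ suc i
      D∣x = gcd[m,n]∣m (suc i) n
      DE : D * E ≡ n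
      DE = All.lookup (divisors-product f) z∈L
      nz : NonZero D
      nz = >-nonZero (n≢0⇒n>0 λ e → <⇒≱ 1≤n (≤-reflexive (trans (sym DE) (cong (_* E) e))))
      k : ℕ
      k = quotient D∣x
      x≡ : suc i ≡ D * k
      x≡ = trans (_∣_.equality D∣x) (*-comm k D)
      E∣ky : E ∣ k * y
      E∣ky = *-cancelˡ-∣ D {{nz}} (subst₂ _∣_ (sym DE) (trans (cong (_* y) x≡) (*-assoc D k y)) n∣xy)
      cop : Coprime E k
      cop {d} (d∣E , d∣k) = *-cancelˡ-≡ d 1 D {{nz}} (trans (∣-antisym
        (gcd-greatest (subst (D * d ∣_) (sym x≡) (*-monoʳ-∣ D d∣k)) (subst (D * d ∣_) DE (*-monoʳ-∣ D d∣E)))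
        (m∣m*n d)) (sym (*-identityʳ D)))
      E∣y : E ∣ y
      E∣y = coprime-divisor cop E∣ky
    -- Up to n there are E multiples of D and D multiples of E, so every pair contributes E D = n.
    total : ∀ z → Product n z → Σ n (λ i → Σ n (term z i)) ≡ n
    total (D , E) DE = begin-equality
      Σ n (λ i → Σ n (λ y → when (D ∣? suc i) 1 * when (E ∣? y) 1))  ≡⟨ Σ-cong′ n (λ i → Σ-*ˡ n (when (D ∣? suc i) 1) (λ y → when (E ∣? y) 1)) ⟩
      Σ n (λ i → when (D ∣? suc i) 1 * count (E ∣?_) n)              ≡⟨ Σ-*ʳ n (count (E ∣?_) n) (λ i → when (D ∣? suc i) 1) ⟩
      Σ n (λ i → when (D ∣? suc i) 1) * count (E ∣?_) n              ≡⟨ cong₂ _*_ (Σ-rotate n (λ i → when (D ∣? i) 1)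
           (when-iff (D ∣? n) (D ∣? 0) {1} (λ _ → D ∣0) (λ _ → subst (D ∣_) DE (m∣m*n E)))) refl ⟩
      count (D ∣?_) n * count (E ∣?_) n                              ≡⟨ cong₂ _*_ (trans (cong (count (D ∣?_)) (trans (sym DE) (*-comm D E))) (count-multiples D E D≥1))
                                                                                (trans (cong (count (E ∣?_)) (sym DE)) (count-multiples E D E≥1)) ⟩
      E * D                                                          ≡⟨ trans (*-comm E D) DE ⟩
      n ∎
      where
      D≥1 : 1 ≤ D
      D≥1 = n≢0⇒n>0 λ e → <⇒≱ 1≤n (≤-reflexive (trans (sym DE) (cong (_* E) e)))
      E≥1 : 1 ≤ E
      E≥1 = n≢0⇒n>0 λ e → <⇒≱ 1≤n (≤-reflexive (trans (sym DE) (trans (cong (D *_) e) (*-zeroʳ D))))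

-- The sieve by the prime divisors of n, and n ≤ 2^ω φ(n).

module Sieves where
  open import Algebra.Bundles using (CommutativeMonoid)
  open import Data.Empty using (⊥-elim)
  open import Data.List using (List; []; _∷_; length; map; filter; applyUpTo)
  open import Data.List.Relation.Unary.All as All using (All; []; _∷_)
  open import Data.Nat
  open import Data.Nat.Coprimality using (Coprime; coprime?; coprime-divisor; 1-coprimeTo) renaming (sym to coprime-sym)
  open import Data.Nat.Divisibility
  open import Data.Nat.Primality
  open import Data.Nat.Properties
  open import Data.Nat.Tactic.RingSolver using (solve-∀)
  open import Data.Product using (_,_)
  open import Function using (_∘_; id)
  open import Relation.Binary.PropositionalEquality as ≡ using (_≡_; refl; cong; cong₂; subst)
  open import Relation.Nullary using (¬_; Dec; yes; no)
  open import Relation.Nullary.Decidable using (¬?)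
  open import Defs using (φ)
  open Sums
  open Arithmetic

  module Sieving {c ℓ} (M : CommutativeMonoid c ℓ) where
    open CommutativeMonoid M renaming (_∙_ to _⊕_; ε to 0#; refl to ≈-refl)
    open Summation M

    sift : List ℕ → (ℕ → Carrier) → ℕ → Carrier
    sift []       F y = F y
    sift (q ∷ qs) F y = when (¬? (q ∣? y)) (sift qs F y)

    sieve : ℕ → (ℕ → Carrier) → ℕ → List ℕ → Carrier
    sieve n F d qs = Σ n (λ y → when (d ∣? y) (sift qs F y))

    -- For coprime d and q, the multiples of d that the condition q ∤ y removes are exactly the
    -- multiples of d q. A sum on the left avoids subtraction, which a monoid does not have.
    sieve-step : ∀ n F d q qs → Coprime d q → sieve n F d (q ∷ qs) ⊕ sieve n F (d * q) qs ≈ sieve n F d qs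
    sieve-step n F d q qs cop = trans (sym (Σ-+ n _ _)) (Σ-cong′ n λ y → pointwise y (d ∣? y) (q ∣? y))
      where
      pointwise : ∀ y (a : Dec (d ∣ y)) (b : Dec (q ∣ y)) →
        when a (when (¬? b) (sift qs F y)) ⊕ when ((d * q) ∣? y) (sift qs F y) ≈ when a (sift qs F y)
      pointwise y (no ∤y) b = trans (identityˡ _) (when-no ((d * q) ∣? y) {sift qs F y} (∤y ∘ ∣-trans (m∣m*n q)))
      pointwise y (yes d∣y) (no ∤y) = trans (∙-congˡ (when-no ((d * q) ∣? y) {sift qs F y} (∤y ∘ ∣-trans (n∣m*n d)))) (identityʳ _)
      pointwise y (yes d∣y@(divides k refl)) (yes q∣y) = trans (identityˡ _) (when-yes ((d * q) ∣? y) {sift qs F y} dq∣y)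
        where
        dq∣y : d * q ∣ y
        dq∣y = subst (d * q ∣_) (*-comm d k) (*-monoʳ-∣ d (coprime-divisor (coprime-sym cop) (subst (q ∣_) (*-comm k d) q∣y)))

    sift-coprime : ∀ {m n} (f : Factored m n) F y → sift (primes f) F y ≈ when (coprime? y n) (F y)
    sift-coprime {n = n} f F y = sift-all (primes f) (coprime? y n)
      (λ c → All.tabulate λ q∈ q∣y → <⇒≱ (prime>1 (All.lookup (primes-prime f) q∈)) (≤-reflexive (c (q∣y , All.lookup (primes-∣ f) q∈))))
      (λ h → no-common-prime⇒coprime (factored≥1 f) λ pq q∣y q∣n → All.lookup h (prime∈primes f pq q∣n) q∣y)
      where
      sift-all : ∀ {P : Set} qs (d : Dec P) → (P → All (λ q → ¬ (q ∣ y)) qs) → (All (λ q → ¬ (q ∣ y)) qs → P) → sift qs F y ≈ when d (F y)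
      sift-all [] d f g = sym (when-yes d (g []))
      sift-all (q ∷ qs) d f g with q ∣? y
      ... | yes q∣y = sym (when-no d λ p → All.head (f p) q∣y)
      ... | no q∤y = sift-all qs d (All.tail ∘ f) (g ∘ (q∤y ∷_))

    sieve-coprime : ∀ {m n} (f : Factored m n) F → sieve n F 1 (primes f) ≈ Σ n (λ y → when (coprime? y n) (F y))
    sieve-coprime {n = n} f F = Σ-cong′ n λ y → trans (when-yes (1 ∣? y) {sift (primes f) F y} (1∣ y)) (sift-coprime f F y)

  open ℕΣ
  open Sieving +-0-commutativeMonoid

  productᴸ : (ℕ → ℕ) → List ℕ → ℕ
  productᴸ f []       = 1
  productᴸ f (q ∷ qs) = f q * productᴸ f qs

  -- Euler's product (n / d) ∏ (1 - 1/q) with its denominators cleared.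
  sieve-count : ∀ {n d qs} → 1 ≤ n → Sifted n d qs → sieve n (λ _ → 1) d qs * (d * productᴸ id qs) ≡ n * productᴸ pred qs
  sieve-count {n} {d} 1≤n ([] d∣n@(divides k eq)) = begin
    count (d ∣?_) n * (d * 1)       ≡⟨ cong₂ _*_ (≡.trans (cong (count (d ∣?_)) eq) (count-multiples d k d≥1)) (*-identityʳ d) ⟩
    k * d                           ≡⟨ ≡.sym eq ⟩
    n                               ≡⟨ ≡.sym (*-identityʳ n) ⟩
    n * 1                           ∎
    where
    open ≡.≡-Reasoning
    d≥1 : 1 ≤ d
    d≥1 = n≢0⇒n>0 λ e → <⇒≱ 1≤n (≤-reflexive (≡.trans eq (≡.trans (cong (k *_) e) (*-zeroʳ k))))
  sieve-count {n} {d} 1≤n (_∷_ {q = zero} {qs} (cop , pq) (s , s′)) = ⊥-elim (<⇒≱ (prime>1 pq) z≤n)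
  -- The part sieved out is added to both sides, so that `sieve-step` applies without subtraction.
  sieve-count {n} {d} 1≤n (_∷_ {q = suc q} {qs} (cop , pq) (s , s′)) = +-cancelʳ-≡ (n * Π′) _ _ (begin
    A * (d * (suc q * Π)) + n * Π′           ≡⟨ cong₂ _+_ refl (≡.sym (sieve-count 1≤n s′)) ⟩
    A * (d * (suc q * Π)) + B * (d * suc q * Π)  ≡⟨ lem₁ A B d (suc q) Π ⟩
    suc q * ((A + B) * (d * Π))              ≡⟨ cong (λ x → suc q * (x * (d * Π))) (sieve-step n (λ _ → 1) d (suc q) qs cop) ⟩
    suc q * (sieve n (λ _ → 1) d qs * (d * Π)) ≡⟨ cong (suc q *_) (sieve-count 1≤n s) ⟩
    suc q * (n * Π′)                         ≡⟨ lem₂ q n Π′ ⟩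
    n * (q * Π′) + n * Π′                    ∎)
    where
    open ≡.≡-Reasoning
    A = sieve n (λ _ → 1) d (suc q ∷ qs)
    B = sieve n (λ _ → 1) (d * suc q) qs
    Π = productᴸ id qs
    Π′ = productᴸ pred qs
    lem₁ : ∀ A B d q Π → A * (d * (q * Π)) + B * (d * q * Π) ≡ q * ((A + B) * (d * Π))
    lem₁ = solve-∀
    lem₂ : ∀ q n x → suc q * (n * x) ≡ n * (q * x) + n * x
    lem₂ = solve-∀

  -- Factor by factor, q ≤ 2 (q - 1).
  product≤2^*product-pred : ∀ {qs} → All Prime qs → productᴸ id qs ≤ 2 ^ length qs * productᴸ pred qs
  product≤2^*product-pred [] = ≤-refl
  product≤2^*product-pred {q ∷ qs} (pq ∷ h) = ≤-trans (*-mono-≤ (q≤ q (prime>1 pq)) (product≤2^*product-pred h))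
    (≤-reflexive (lem (pred q) (2 ^ length qs) (productᴸ pred qs)))
    where
    q≤ : ∀ q → 2 ≤ q → q ≤ 2 * pred q
    q≤ (suc zero) (s≤s ())
    q≤ (suc (suc q)) _ = ≤-trans (m≤n+m (suc (suc q)) q) (≤-reflexive (lem′ q))
      where
      lem′ : ∀ q → q + suc (suc q) ≡ 2 * suc q
      lem′ = solve-∀
    lem : ∀ a b c → (2 * a) * (b * c) ≡ (2 * b) * (a * c)
    lem = solve-∀

  productᴸ≥1 : ∀ {qs} → All Prime qs → 1 ≤ productᴸ id qs
  productᴸ≥1 [] = ≤-refl
  productᴸ≥1 (pq ∷ h) = *-mono-≤ (≤-trans (s≤s z≤n) (prime>1 pq)) (productᴸ≥1 h)

  length-filter : ∀ {P : ℕ → Set} (P? : ∀ i → Dec (P i)) (h g : ℕ → ℕ) n →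
    length (filter P? (map h (applyUpTo g n))) ≡ count (λ i → P? (h (g i))) n
  length-filter P? h g zero = refl
  length-filter P? h g (suc n) with P? (h (g 0))
  ... | yes _ = cong suc (length-filter P? h (g ∘ suc) n)
  ... | no _  = length-filter P? h (g ∘ suc) n

  -- The definition of φ runs over 1, ..., n and the count over 0, ..., n - 1; the ends agree
  -- because gcd(n, n) = gcd(0, n).
  φ-count : ∀ n → 1 ≤ n → φ n ≡ count (λ y → coprime? y n) n
  φ-count n 1≤n = ≡.trans (length-filter (λ k → coprime? k n) suc id n)
    (Σ-rotate n (λ i → when (coprime? i n) 1) (when-iff (coprime? n n) (coprime? 0 n) {1}
      (λ c (d∣0 , d∣n) → c (d∣n , d∣n)) (λ c (d∣n , d∣n′) → c (_ ∣0 , d∣n))))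

  -- From φ(n) ∏ q = n ∏ (q - 1) and ∏ q ≤ 2^ω ∏ (q - 1).
  n≤2^ω*φ : ∀ {m n} (f : Factored m n) → n ≤ 2 ^ length (primes f) * φ n
  n≤2^ω*φ {m} {n} f = *-cancelʳ-≤ n (2 ^ length (primes f) * φ n) Π {{>-nonZero (productᴸ≥1 (primes-prime f))}} (begin
    n * Π                    ≤⟨ *-monoʳ-≤ n (product≤2^*product-pred (primes-prime f)) ⟩
    n * (k * Π′)             ≡⟨ lem n k Π′ ⟩
    k * (n * Π′)             ≡⟨ cong (k *_) (≡.sym (sieve-count (factored≥1 f) (sifted f 1 (1-coprimeTo n) (≤→∣ n)))) ⟩
    k * (sieve n (λ _ → 1) 1 (primes f) * (1 * Π))  ≡⟨ cong₂ (λ x y → k * (x * y)) (≡.trans (sieve-coprime f (λ _ → 1)) (≡.sym (φ-count n (factored≥1 f)))) (*-identityˡ Π) ⟩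
    k * (φ n * Π)            ≡⟨ ≡.sym (*-assoc k (φ n) Π) ⟩
    k * φ n * Π              ∎)
    where
    open ≤-Reasoning
    k = 2 ^ length (primes f)
    Π = productᴸ id (primes f)
    Π′ = productᴸ pred (primes f)
    ≤→∣ : ∀ n → 1 * n ∣ n
    ≤→∣ n = ∣-reflexive (*-identityˡ n)
    lem : ∀ n k x → n * (k * x) ≡ k * (n * x)
    lem = solve-∀

-- Gaussian rationals and their norm.

module Analysis where
  open import Defs
  open import Algebra.Bundles using (CommutativeRing)
  import Algebra.Solver.Ring.Simple
  import Algebra.Solver.Ring.AlmostCommutativeRing as ACR
  open import Data.Bool using (true; false; if_then_else_)
  open import Data.Empty using (⊥-elim)
  open import Data.Fin using (Fin)
  open import Data.Integer as ℤ using (ℤ; +_; -[1+_])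
  import Data.Integer.Divisibility as ℤD
  open import Data.Integer.Divisibility.Signed using (∣ᵤ⇒∣; divides)
  import Data.Integer.Properties as ℤP
  open import Data.List using (List; []; _∷_)
  open import Data.Nat as ℕ using (ℕ; zero; suc; z≤n; s≤s; NonZero; _!; _∸_)
  open import Data.Nat.Primality using (Prime)
  import Data.Nat.Properties as ℕP
  open import Data.Product using (∃; _×_; _,_; proj₁; proj₂)
  open import Data.Rational as ℚ using (ℚ; 0ℚ; 1ℚ; ½; ∣_∣; _/_; _+_; _*_; _-_; -_; _≤_; _<_)
  open import Data.Rational.Properties as ℚP using ()
  open import Data.Rational.Solver using (module +-*-Solver)
  import Data.Rational.Unnormalised as ℚᵘ
  import Data.Rational.Unnormalised.Properties as ℚᵘP
  open import Data.Sum using ([_,_]′)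
  open import Function using (_∘_)
  open import Relation.Binary.Definitions using (DecidableEquality)
  open import Relation.Binary.PropositionalEquality
  open import Relation.Binary.Structures using (IsEquivalence)
  open import Relation.Nullary using (Dec; yes; no; does)
  open import Relation.Nullary.Decidable using (dec-true; dec-false)
  open Sums
  open Signs

  record 𝔾 : Set where
    constructor _⊹_
    field
      Re Im : ℚ
  open 𝔾 public
  infix 5 _⊹_

  infixl 6 _+ᵍ_ _-ᵍ_
  infixl 7 _*ᵍ_
  infix 8 -ᵍ_

  _+ᵍ_ _*ᵍ_ _-ᵍ_ : 𝔾 → 𝔾 → 𝔾
  z +ᵍ w = Re z + Re w ⊹ Im z + Im w
  z *ᵍ w = Re z * Re w - Im z * Im w ⊹ Re z * Im w + Im z * Re w
  z -ᵍ w = Re z - Re w ⊹ Im z - Im w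

  -ᵍ_ conj : 𝔾 → 𝔾
  -ᵍ z = - Re z ⊹ - Im z
  conj z = Re z ⊹ - Im z

  real : ℚ → 𝔾
  real q = q ⊹ 0ℚ

  0ᵍ 1ᵍ iᵍ : 𝔾
  0ᵍ = real 0ℚ
  1ᵍ = real 1ℚ
  iᵍ = 0ℚ ⊹ 1ℚ

  _≟ᵍ_ : DecidableEquality 𝔾
  (a ⊹ b) ≟ᵍ (c ⊹ d) with a ℚ.≟ c | b ℚ.≟ d
  ... | yes refl | yes refl = yes refl
  ... | no ¬p | _ = no λ { refl → ¬p refl }
  ... | _ | no ¬p = no λ { refl → ¬p refl }

  module _ where
    open +-*-Solver
    *ᵍ-assoc : ∀ x y z → (x *ᵍ y) *ᵍ z ≡ x *ᵍ (y *ᵍ z)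
    *ᵍ-assoc (a ⊹ b) (c ⊹ d) (e ⊹ f) = cong₂ _⊹_
      (solve 6 (λ a b c d e f → (a :* c :- b :* d) :* e :- (a :* d :+ b :* c) :* f :=
         a :* (c :* e :- d :* f) :- b :* (c :* f :+ d :* e)) refl a b c d e f)
      (solve 6 (λ a b c d e f → (a :* c :- b :* d) :* f :+ (a :* d :+ b :* c) :* e :=
         a :* (c :* f :+ d :* e) :+ b :* (c :* e :- d :* f)) refl a b c d e f)

    *ᵍ-comm : ∀ x y → x *ᵍ y ≡ y *ᵍ x
    *ᵍ-comm (a ⊹ b) (c ⊹ d) = cong₂ _⊹_
      (solve 4 (λ a b c d → a :* c :- b :* d := c :* a :- d :* b) refl a b c d)
      (solve 4 (λ a b c d → a :* d :+ b :* c := c :* b :+ d :* a) refl a b c d)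

    *ᵍ-identityˡ : ∀ x → 1ᵍ *ᵍ x ≡ x
    *ᵍ-identityˡ (a ⊹ b) = cong₂ _⊹_
      (solve 2 (λ a b → con 1ℚ :* a :- con 0ℚ :* b := a) refl a b)
      (solve 2 (λ a b → con 1ℚ :* b :+ con 0ℚ :* a := b) refl a b)

    *ᵍ-distribˡ-+ᵍ : ∀ x y z → x *ᵍ (y +ᵍ z) ≡ x *ᵍ y +ᵍ x *ᵍ z
    *ᵍ-distribˡ-+ᵍ (a ⊹ b) (c ⊹ d) (e ⊹ f) = cong₂ _⊹_
      (solve 6 (λ a b c d e f → a :* (c :+ e) :- b :* (d :+ f) := (a :* c :- b :* d) :+ (a :* e :- b :* f)) refl a b c d e f)
      (solve 6 (λ a b c d e f → a :* (d :+ f) :+ b :* (c :+ e) := (a :* d :+ b :* c) :+ (a :* f :+ b :* e)) refl a b c d e f)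

  𝔾-commutativeRing : CommutativeRing _ _
  𝔾-commutativeRing = record
    { Carrier = 𝔾 ; _≈_ = _≡_ ; _+_ = _+ᵍ_ ; _*_ = _*ᵍ_ ; -_ = -ᵍ_ ; 0# = 0ᵍ ; 1# = 1ᵍ
    ; isCommutativeRing = record
      { isRing = record
        { +-isAbelianGroup = record
          { isGroup = record
            { isMonoid = record
              { isSemigroup = record
                { isMagma = record { isEquivalence = isEquivalence ; ∙-cong = cong₂ _+ᵍ_ }
                ; assoc = λ x y z → cong₂ _⊹_ (ℚP.+-assoc (Re x) _ _) (ℚP.+-assoc (Im x) _ _) }
              ; identity = (λ x → cong₂ _⊹_ (ℚP.+-identityˡ _) (ℚP.+-identityˡ _))
                         , (λ x → cong₂ _⊹_ (ℚP.+-identityʳ _) (ℚP.+-identityʳ _)) }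
            ; inverse = (λ x → cong₂ _⊹_ (ℚP.+-inverseˡ (Re x)) (ℚP.+-inverseˡ (Im x)))
                      , (λ x → cong₂ _⊹_ (ℚP.+-inverseʳ (Re x)) (ℚP.+-inverseʳ (Im x)))
            ; ⁻¹-cong = cong (λ z → -ᵍ z) }
          ; comm = λ x y → cong₂ _⊹_ (ℚP.+-comm (Re x) _) (ℚP.+-comm (Im x) _) }
        ; *-cong = cong₂ _*ᵍ_
        ; *-assoc = *ᵍ-assoc
        ; *-identity = *ᵍ-identityˡ , λ x → trans (*ᵍ-comm x 1ᵍ) (*ᵍ-identityˡ x)
        ; distrib = *ᵍ-distribˡ-+ᵍ
                  , λ x y z → trans (*ᵍ-comm (y +ᵍ z) x)
                      (trans (*ᵍ-distribˡ-+ᵍ x y z) (cong₂ _+ᵍ_ (*ᵍ-comm x y) (*ᵍ-comm x z))) }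
      ; *-comm = *ᵍ-comm } }

  module 𝔾-Solver = Algebra.Solver.Ring.Simple (ACR.fromCommutativeRing 𝔾-commutativeRing) _≟ᵍ_

  ∣p-q∣≤∣p∣+∣q∣ : ∀ p q → ∣ p - q ∣ ≤ ∣ p ∣ + ∣ q ∣
  ∣p-q∣≤∣p∣+∣q∣ p q = subst (λ z → ∣ p - q ∣ ≤ ∣ p ∣ + z) (ℚP.∣-p∣≡∣p∣ q) (ℚP.∣p+q∣≤∣p∣+∣q∣ p (- q))

  opaque
    -- The sum norm is rational, unlike the Euclidean modulus, and it is still submultiplicative,
    -- which is what estimates of power series require.
    ν : 𝔾 → ℚ
    ν z = ∣ Re z ∣ + ∣ Im z ∣

    ν-nonNeg : ∀ z → 0ℚ ≤ ν z
    ν-nonNeg z = +-nonNeg (ℚP.0≤∣p∣ (Re z)) (ℚP.0≤∣p∣ (Im z))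

    ν-+ : ∀ z w → ν (z +ᵍ w) ≤ ν z + ν w
    ν-+ z w = subst (ν (z +ᵍ w) ≤_) (lem (∣ Re z ∣) (∣ Re w ∣) (∣ Im z ∣) (∣ Im w ∣))
      (ℚP.+-mono-≤ (ℚP.∣p+q∣≤∣p∣+∣q∣ (Re z) (Re w)) (ℚP.∣p+q∣≤∣p∣+∣q∣ (Im z) (Im w)))
      where
      open +-*-Solver
      lem : ∀ a b c d → (a + b) + (c + d) ≡ (a + c) + (b + d)
      lem = solve 4 (λ a b c d → (a :+ b) :+ (c :+ d) := (a :+ c) :+ (b :+ d)) refl

    ν-neg : ∀ z → ν (-ᵍ z) ≡ ν z
    ν-neg z = cong₂ _+_ (ℚP.∣-p∣≡∣p∣ (Re z)) (ℚP.∣-p∣≡∣p∣ (Im z))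

    ν-* : ∀ z w → ν (z *ᵍ w) ≤ ν z * ν w
    ν-* (a ⊹ b) (c ⊹ d) = subst (ν ((a ⊹ b) *ᵍ (c ⊹ d)) ≤_) (lem (∣ a ∣) (∣ b ∣) (∣ c ∣) (∣ d ∣))
      (ℚP.+-mono-≤
        (ℚP.≤-trans (∣p-q∣≤∣p∣+∣q∣ (a * c) (b * d)) (ℚP.≤-reflexive (cong₂ _+_ (ℚP.∣p*q∣≡∣p∣*∣q∣ a c) (ℚP.∣p*q∣≡∣p∣*∣q∣ b d))))
        (ℚP.≤-trans (ℚP.∣p+q∣≤∣p∣+∣q∣ (a * d) (b * c)) (ℚP.≤-reflexive (cong₂ _+_ (ℚP.∣p*q∣≡∣p∣*∣q∣ a d) (ℚP.∣p*q∣≡∣p∣*∣q∣ b c)))))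
      where
      open +-*-Solver
      lem : ∀ a b c d → (a * c + b * d) + (a * d + b * c) ≡ (a + b) * (c + d)
      lem = solve 4 (λ a b c d → (a :* c :+ b :* d) :+ (a :* d :+ b :* c) := (a :+ b) :* (c :+ d)) refl

    ν-real : ∀ q → ν (real q) ≡ ∣ q ∣
    ν-real q = ℚP.+-identityʳ ∣ q ∣

    ∣Re∣≤ν : ∀ z → ∣ Re z ∣ ≤ ν z
    ∣Re∣≤ν z = p≤p+q (ℚP.0≤∣p∣ (Im z))

    ν-conj : ∀ z → ν (conj z) ≡ ν z
    ν-conj z = cong (λ x → ∣ Re z ∣ + x) (ℚP.∣-p∣≡∣p∣ (Im z))

    ν-0 : ν 0ᵍ ≡ 0ℚ
    ν-0 = ℚP.+-identityˡ 0ℚ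

    ∣Im∣≤ν : ∀ z → ∣ Im z ∣ ≤ ν z
    ∣Im∣≤ν z = subst (_≤ ν z) (ℚP.+-identityˡ ∣ Im z ∣) (ℚP.+-monoˡ-≤ (∣ Im z ∣) (ℚP.0≤∣p∣ (Re z)))

    ν≤ : ∀ z {a b} → ∣ Re z ∣ ≤ a → ∣ Im z ∣ ≤ b → ν z ≤ a + b
    ν≤ z = ℚP.+-mono-≤

    ν-real-* : ∀ {q} → 0ℚ ≤ q → ∀ z → ν (real q *ᵍ z) ≡ q * ν z
    ν-real-* {q} 0≤q z = trans (cong₂ (λ x y → ∣ x ∣ + ∣ y ∣)
        (solve 3 (λ q a b → q :* a :- con 0ℚ :* b := q :* a) refl q (Re z) (Im z))
        (solve 3 (λ q a b → q :* b :+ con 0ℚ :* a := q :* b) refl q (Re z) (Im z)))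
      (trans (cong₂ _+_ (ℚP.∣p*q∣≡∣p∣*∣q∣ q (Re z)) (ℚP.∣p*q∣≡∣p∣*∣q∣ q (Im z)))
      (trans (sym (ℚP.*-distribˡ-+ ∣ q ∣ (∣ Re z ∣) (∣ Im z ∣))) (cong (_* (∣ Re z ∣ + ∣ Im z ∣)) (ℚP.0≤p⇒∣p∣≡p 0≤q))))
      where open +-*-Solver

  -- The ring of bounded sequences modulo null sequences.

  Eventually : (ℕ → Set) → Set
  Eventually P = ∃ λ K → ∀ {n} → K ℕ.≤ n → P n

  always : ∀ {P : ℕ → Set} → (∀ n → P n) → Eventually P
  always h = 0 , λ {n} _ → h n

  eventually-map : ∀ {P Q : ℕ → Set} → (∀ n → P n → Q n) → Eventually P → Eventually Q
  eventually-map f (K , h) = K , λ {n} k → f n (h k)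

  eventually-map₂ : ∀ {P Q R : ℕ → Set} → (∀ n → P n → Q n → R n) →
    Eventually P → Eventually Q → Eventually R
  eventually-map₂ f (K , h) (L , g) = K ℕ.⊔ L , λ {n} k →
    f n (h (ℕP.m⊔n≤o⇒m≤o K L k)) (g (ℕP.m⊔n≤o⇒n≤o K L k))

  module G = CommutativeRing 𝔾-commutativeRing

  -- Boundedness is what lets multiplication respect null differences. Since convergence is not
  -- demanded, no modulus of convergence has to be built for sums, products and exponentials.
  record 𝕊 : Set where
    no-eta-equality
    constructor mk𝕊
    field
      at      : ℕ → 𝔾
      bounded : ∃ λ B → Eventually (λ n → ν (at n) ≤ B)
  open 𝕊 public

  infix 4 _≈_
  record _≈_ (u v : 𝕊) : Set where
    constructor mk≈
    field close : ∀ δ → 0ℚ < δ → Eventually (λ n → ν (at u n -ᵍ at v n) ≤ δ)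
  open _≈_ public

  ν0 : ∀ {z w} → z ≡ w → ν (z -ᵍ w) ≡ 0ℚ
  ν0 {z} refl = trans (cong ν (G.-‿inverseʳ z)) ν-0

  eventually-≡⇒≈ : ∀ {u v} → Eventually (λ n → at u n ≡ at v n) → u ≈ v
  eventually-≡⇒≈ h = mk≈ λ δ 0<δ → eventually-map
    (λ n e → ℚP.≤-trans (ℚP.≤-reflexive (ν0 e)) (ℚP.<⇒≤ 0<δ)) h

  ≡⇒≈ : ∀ {u v} → (∀ n → at u n ≡ at v n) → u ≈ v
  ≡⇒≈ h = eventually-≡⇒≈ (always h)

  half : ∀ δ → 0ℚ < δ → 0ℚ < δ * ½
  half δ 0<δ = *-pos 0<δ 0<½

  ≤-halves : ∀ {x y} δ → x ≤ δ * ½ → y ≤ δ * ½ → x + y ≤ δ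
  ≤-halves δ h g = ℚP.≤-trans (ℚP.+-mono-≤ h g) (ℚP.≤-reflexive (half-split δ))

  module _ where
    open 𝔾-Solver
    ν-triangle : ∀ x y z → ν (x -ᵍ z) ≤ ν (x -ᵍ y) + ν (y -ᵍ z)
    ν-triangle x y z = subst (λ w → ν w ≤ ν (x -ᵍ y) + ν (y -ᵍ z))
      (solve 3 (λ x y z → (x :- y) :+ (y :- z) := x :- z) refl x y z) (ν-+ (x -ᵍ y) (y -ᵍ z))

    ν-swap : ∀ x y → ν (x -ᵍ y) ≡ ν (y -ᵍ x)
    ν-swap x y = trans (cong ν (solve 2 (λ x y → x :- y := :- (y :- x)) refl x y)) (ν-neg (y -ᵍ x))

    ν-+-sub : ∀ x y z w → ν ((x +ᵍ y) -ᵍ (z +ᵍ w)) ≤ ν (x -ᵍ z) + ν (y -ᵍ w)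
    ν-+-sub x y z w = subst (λ t → ν t ≤ ν (x -ᵍ z) + ν (y -ᵍ w))
      (solve 4 (λ x y z w → (x :- z) :+ (y :- w) := (x :+ y) :- (z :+ w)) refl x y z w)
      (ν-+ (x -ᵍ z) (y -ᵍ w))

    ν-neg-sub : ∀ x y → ν ((-ᵍ x) -ᵍ (-ᵍ y)) ≡ ν (x -ᵍ y)
    ν-neg-sub x y = trans (cong ν (solve 2 (λ x y → :- x :- :- y := :- (x :- y)) refl x y)) (ν-neg (x -ᵍ y))

    ν-*-sub : ∀ x y z w → ν (x *ᵍ y -ᵍ z *ᵍ w) ≤ ν x * ν (y -ᵍ w) + ν (x -ᵍ z) * ν w
    ν-*-sub x y z w = subst (λ t → ν t ≤ ν x * ν (y -ᵍ w) + ν (x -ᵍ z) * ν w)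
      (solve 4 (λ x y z w → x :* (y :- w) :+ (x :- z) :* w := x :* y :- z :* w) refl x y z w)
      (ℚP.≤-trans (ν-+ (x *ᵍ (y -ᵍ w)) ((x -ᵍ z) *ᵍ w)) (ℚP.+-mono-≤ (ν-* x (y -ᵍ w)) (ν-* (x -ᵍ z) w)))

  ≈-refl : ∀ {u} → u ≈ u
  ≈-refl = ≡⇒≈ λ _ → refl

  ≈-sym : ∀ {u v} → u ≈ v → v ≈ u
  ≈-sym {u} {v} h = mk≈ λ δ 0<δ → eventually-map
    (λ n → subst (_≤ δ) (ν-swap (at u n) (at v n))) (close h δ 0<δ)

  ≈-trans : ∀ {u v w} → u ≈ v → v ≈ w → u ≈ w
  ≈-trans {u} {v} {w} h g = mk≈ λ δ 0<δ → eventually-map₂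
    (λ n a b → ℚP.≤-trans (ν-triangle (at u n) (at v n) (at w n)) (≤-halves δ a b))
    (close h _ (half δ 0<δ)) (close g _ (half δ 0<δ))

  infixl 6 _+ˢ_
  infixl 7 _*ˢ_
  infix 8 -ˢ_

  -- Opaque because comparing such sequences definitionally would unfold their bounds, and
  -- with them the Cauchy moduli of closed real numbers.
  opaque
    _+ˢ_ _*ˢ_ : 𝕊 → 𝕊 → 𝕊
    u +ˢ v = mk𝕊 (λ n → at u n +ᵍ at v n)
      (proj₁ (bounded u) + proj₁ (bounded v) , eventually-map₂
        (λ n a b → ℚP.≤-trans (ν-+ (at u n) (at v n)) (ℚP.+-mono-≤ a b)) (proj₂ (bounded u)) (proj₂ (bounded v)))
    u *ˢ v = mk𝕊 (λ n → at u n *ᵍ at v n)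
      (proj₁ (bounded u) * proj₁ (bounded v) , eventually-map₂
        (λ n a b → ℚP.≤-trans (ν-* (at u n) (at v n))
          (*-mono (ν-nonNeg (at u n)) (ℚP.≤-trans (ν-nonNeg (at v n)) b) a b)) (proj₂ (bounded u)) (proj₂ (bounded v)))

    -ˢ_ conjˢ : 𝕊 → 𝕊
    -ˢ u = mk𝕊 (λ n → -ᵍ at u n)
      (proj₁ (bounded u) , eventually-map (λ n → subst (_≤ proj₁ (bounded u)) (sym (ν-neg (at u n)))) (proj₂ (bounded u)))
    conjˢ u = mk𝕊 (λ n → conj (at u n))
      (proj₁ (bounded u) , eventually-map (λ n → subst (_≤ proj₁ (bounded u))
        (sym (ν-conj (at u n)))) (proj₂ (bounded u)))

    const : 𝔾 → 𝕊
    const z = mk𝕊 (λ _ → z) (ν z , always λ _ → ℚP.≤-refl)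

    at-+ : ∀ u v n → at (u +ˢ v) n ≡ at u n +ᵍ at v n
    at-+ u v n = refl

    at-* : ∀ u v n → at (u *ˢ v) n ≡ at u n *ᵍ at v n
    at-* u v n = refl

    at-neg : ∀ u n → at (-ˢ u) n ≡ -ᵍ at u n
    at-neg u n = refl

    at-conj : ∀ u n → at (conjˢ u) n ≡ conj (at u n)
    at-conj u n = refl

    at-const : ∀ z n → at (const z) n ≡ z
    at-const z n = refl

  0ˢ 1ˢ : 𝕊
  0ˢ = const 0ᵍ
  1ˢ = const 1ᵍ

  opaque
    unfolding _+ˢ_
    +ˢ-cong : ∀ {u u′ v v′} → u ≈ u′ → v ≈ v′ → u +ˢ v ≈ u′ +ˢ v′
    +ˢ-cong {u} {u′} {v} {v′} h g = mk≈ λ δ 0<δ → eventually-map₂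
      (λ n a b → ℚP.≤-trans (ν-+-sub (at u n) (at v n) (at u′ n) (at v′ n)) (≤-halves δ a b))
      (close h _ (half δ 0<δ)) (close g _ (half δ 0<δ))

    -ˢ-cong : ∀ {u v} → u ≈ v → -ˢ u ≈ -ˢ v
    -ˢ-cong {u} {v} h = mk≈ λ δ 0<δ → eventually-map
      (λ n → subst (_≤ δ) (sym (ν-neg-sub (at u n) (at v n)))) (close h δ 0<δ)

  p≤1+p : ∀ p → p ≤ 1ℚ + p
  p≤1+p p = subst (_≤ 1ℚ + p) (ℚP.+-identityˡ p) (ℚP.+-monoˡ-≤ p (ℚP.<⇒≤ 0<1))

  -- `B` will be an eventual bound, whose sign is known only at an index where it holds; hence the
  -- premise inside the conclusion and the denominator 1 + ∣B∣.
  absorb : ∀ B δ → 0ℚ < δ → ∃ λ t → 0ℚ < t × (0ℚ ≤ B → B * t ≤ δ)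
  absorb B δ 0<δ with quotient {1ℚ + ∣ B ∣} δ (+-pos 0<1 (ℚP.0≤∣p∣ B)) 0<δ
  ... | t , 0<t , e = t , 0<t , λ 0≤B → subst (B * t ≤_) e
    (*-monoˡ (ℚP.<⇒≤ 0<t) (ℚP.≤-trans (p≤∣p∣ B) (p≤1+p (∣ B ∣))))

  opaque
    unfolding _+ˢ_
    *ˢ-cong : ∀ {u u′ v v′} → u ≈ u′ → v ≈ v′ → u *ˢ v ≈ u′ *ˢ v′
    *ˢ-cong {u} {u′} {v} {v′} h g = mk≈ λ δ 0<δ →
      let B , bu = bounded u
          C , bv = bounded v′
          s , 0<s , Bs = absorb B (δ * ½) (half δ 0<δ)
          t , 0<t , Ct = absorb C (δ * ½) (half δ 0<δ)
          l = eventually-map₂ (λ n a b → ℚP.≤-trans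
                (*-mono (ν-nonNeg (at u n)) (ℚP.<⇒≤ 0<s) a b) (Bs (ℚP.≤-trans (ν-nonNeg (at u n)) a)))
                bu (close g s 0<s)
          r = eventually-map₂ (λ n a b → ℚP.≤-trans
                (*-mono (ν-nonNeg (at u n -ᵍ at u′ n)) (ℚP.≤-trans (ν-nonNeg (at v′ n)) a) b a)
                (ℚP.≤-trans (ℚP.≤-reflexive (ℚP.*-comm t C)) (Ct (ℚP.≤-trans (ν-nonNeg (at v′ n)) a))))
                bv (close h t 0<t)
      in eventually-map₂ (λ n a b → ℚP.≤-trans (ν-*-sub (at u n) (at v n) (at u′ n) (at v′ n)) (≤-halves δ a b)) l r

  ≈-isEquivalence : IsEquivalence _≈_
  ≈-isEquivalence = record { refl = ≈-refl ; sym = ≈-sym ; trans = ≈-trans }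

  opaque
    unfolding _+ˢ_
    +ˢ-assoc : ∀ x y z → x +ˢ y +ˢ z ≈ x +ˢ (y +ˢ z)
    +ˢ-assoc x y z = ≡⇒≈ λ n → G.+-assoc (at x n) (at y n) (at z n)

    +ˢ-comm : ∀ x y → x +ˢ y ≈ y +ˢ x
    +ˢ-comm x y = ≡⇒≈ λ n → G.+-comm (at x n) (at y n)

    +ˢ-identityˡ : ∀ x → 0ˢ +ˢ x ≈ x
    +ˢ-identityˡ x = ≡⇒≈ λ n → G.+-identityˡ (at x n)

    -ˢ-inverseˡ : ∀ x → -ˢ x +ˢ x ≈ 0ˢ
    -ˢ-inverseˡ x = ≡⇒≈ λ n → G.-‿inverseˡ (at x n)

    *ˢ-assoc : ∀ x y z → x *ˢ y *ˢ z ≈ x *ˢ (y *ˢ z)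
    *ˢ-assoc x y z = ≡⇒≈ λ n → G.*-assoc (at x n) (at y n) (at z n)

    *ˢ-comm : ∀ x y → x *ˢ y ≈ y *ˢ x
    *ˢ-comm x y = ≡⇒≈ λ n → G.*-comm (at x n) (at y n)

    *ˢ-identityˡ : ∀ x → 1ˢ *ˢ x ≈ x
    *ˢ-identityˡ x = ≡⇒≈ λ n → G.*-identityˡ (at x n)

    *ˢ-distribˡ : ∀ x y z → x *ˢ (y +ˢ z) ≈ x *ˢ y +ˢ x *ˢ z
    *ˢ-distribˡ x y z = ≡⇒≈ λ n → G.distribˡ (at x n) (at y n) (at z n)

  𝕊-commutativeRing : CommutativeRing _ _
  𝕊-commutativeRing = record
    { Carrier = 𝕊 ; _≈_ = _≈_ ; _+_ = _+ˢ_ ; _*_ = _*ˢ_ ; -_ = -ˢ_ ; 0# = 0ˢ ; 1# = 1ˢ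
    ; isCommutativeRing = record
      { isRing = record
        { +-isAbelianGroup = record
          { isGroup = record
            { isMonoid = record
              { isSemigroup = record
                { isMagma = record { isEquivalence = ≈-isEquivalence ; ∙-cong = +ˢ-cong }
                ; assoc = +ˢ-assoc }
              ; identity = +ˢ-identityˡ , λ x → ≈-trans (+ˢ-comm x 0ˢ) (+ˢ-identityˡ x) }
            ; inverse = -ˢ-inverseˡ , λ x → ≈-trans (+ˢ-comm x (-ˢ x)) (-ˢ-inverseˡ x)
            ; ⁻¹-cong = -ˢ-cong }
          ; comm = +ˢ-comm }
        ; *-cong = *ˢ-cong
        ; *-assoc = *ˢ-assoc
        ; *-identity = *ˢ-identityˡ , λ x → ≈-trans (*ˢ-comm x 1ˢ) (*ˢ-identityˡ x)
        ; distrib = *ˢ-distribˡ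
                  , λ x y z → ≈-trans (*ˢ-comm (y +ˢ z) x) (≈-trans (*ˢ-distribˡ x y z) (+ˢ-cong (*ˢ-comm x y) (*ˢ-comm x z))) }
      ; *-comm = *ˢ-comm } }

  module 𝕊-Reasoning where
    open import Relation.Binary.Reasoning.Setoid (CommutativeRing.setoid 𝕊-commutativeRing) public

  -- Cauchy products of power series and the functional equation of exp.

  conv : (ℕ → 𝔾) → (ℕ → 𝔾) → ℕ → 𝔾
  conv f g zero    = f 0 *ᵍ g 0
  conv f g (suc k) = f 0 *ᵍ g (suc k) +ᵍ conv (f ∘ suc) g k

  conv-cong : ∀ {f f′ g g′} k → (∀ {j} → j ℕ.≤ k → f j ≡ f′ j) → (∀ {j} → j ℕ.≤ k → g j ≡ g′ j) →
    conv f g k ≡ conv f′ g′ k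
  conv-cong zero    hf hg = cong₂ _*ᵍ_ (hf z≤n) (hg z≤n)
  conv-cong (suc k) hf hg = cong₂ _+ᵍ_ (cong₂ _*ᵍ_ (hf z≤n) (hg ℕP.≤-refl))
    (conv-cong k (hf ∘ s≤s) (hg ∘ ℕP.m≤n⇒m≤1+n))

  module _ where
    open 𝔾-Solver

    conv-+ˡ : ∀ f f′ g k → conv (λ j → f j +ᵍ f′ j) g k ≡ conv f g k +ᵍ conv f′ g k
    conv-+ˡ f f′ g zero = G.distribʳ (g 0) (f 0) (f′ 0)
    conv-+ˡ f f′ g (suc k) = trans (cong ((f 0 +ᵍ f′ 0) *ᵍ g (suc k) +ᵍ_) (conv-+ˡ (f ∘ suc) (f′ ∘ suc) g k))
      (solve 5 (λ a b c d e → (a :+ b) :* c :+ (d :+ e) := (a :* c :+ d) :+ (b :* c :+ e)) refl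
        (f 0) (f′ 0) (g (suc k)) (conv (f ∘ suc) g k) (conv (f′ ∘ suc) g k))

    conv-*ˡ : ∀ a f g k → conv (λ j → a *ᵍ f j) g k ≡ a *ᵍ conv f g k
    conv-*ˡ a f g zero = G.*-assoc a (f 0) (g 0)
    conv-*ˡ a f g (suc k) = trans (cong (a *ᵍ f 0 *ᵍ g (suc k) +ᵍ_) (conv-*ˡ a (f ∘ suc) g k))
      (solve 4 (λ a b c d → a :* b :* c :+ a :* d := a :* (b :* c :+ d)) refl
        a (f 0) (g (suc k)) (conv (f ∘ suc) g k))

    conv-sucʳ : ∀ f g k → conv f g (suc k) ≡ conv f (g ∘ suc) k +ᵍ f (suc k) *ᵍ g 0
    conv-sucʳ f g zero = refl
    conv-sucʳ f g (suc k) = trans (cong (f 0 *ᵍ g (suc (suc k)) +ᵍ_) (conv-sucʳ (f ∘ suc) g k))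
      (sym (G.+-assoc (f 0 *ᵍ g (suc (suc k))) (conv (f ∘ suc) (g ∘ suc) k) _))

    conv-comm : ∀ f g k → conv f g k ≡ conv g f k
    conv-comm f g zero = G.*-comm (f 0) (g 0)
    conv-comm f g (suc k) = trans (cong (f 0 *ᵍ g (suc k) +ᵍ_) (conv-comm (f ∘ suc) g k))
      (trans (solve 3 (λ a b c → a :* b :+ c := c :+ b :* a) refl (f 0) (g (suc k)) (conv g (f ∘ suc) k))
        (sym (conv-sucʳ g f k)))

    conv-+ʳ : ∀ f g g′ k → conv f (λ j → g j +ᵍ g′ j) k ≡ conv f g k +ᵍ conv f g′ k
    conv-+ʳ f g g′ k = trans (conv-comm f _ k) (trans (conv-+ˡ g g′ f k)
      (cong₂ _+ᵍ_ (conv-comm g f k) (conv-comm g′ f k)))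

    conv-*ʳ : ∀ a f g k → conv f (λ j → a *ᵍ g j) k ≡ a *ᵍ conv f g k
    conv-*ʳ a f g k = trans (conv-comm f _ k) (trans (conv-*ˡ a g f k) (cong (a *ᵍ_) (conv-comm g f k)))

    conv-assoc : ∀ f g h k → conv (conv f g) h k ≡ conv f (conv g h) k
    conv-assoc f g h zero = G.*-assoc (f 0) (g 0) (h 0)
    conv-assoc f g h (suc k) = trans
      (cong (f 0 *ᵍ g 0 *ᵍ h (suc k) +ᵍ_)
        (trans (conv-+ˡ (λ j → f 0 *ᵍ g (suc j)) (conv (f ∘ suc) g) h k)
          (cong₂ _+ᵍ_ (conv-*ˡ (f 0) (g ∘ suc) h k) (conv-assoc (f ∘ suc) g h k))))
      (solve 5 (λ a b c d e → a :* b :* c :+ (a :* d :+ e) := a :* (b :* c :+ d) :+ e) refl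
        (f 0) (g 0) (h (suc k)) (conv (g ∘ suc) h k) (conv (f ∘ suc) (conv g h) k))

  ιᵍ : ℕ → 𝔾
  ιᵍ n = real (ι n)

  real-+ : ∀ a b → real (a + b) ≡ real a +ᵍ real b
  real-+ a b = cong (a + b ⊹_) (sym (ℚP.+-identityˡ 0ℚ))

  real-* : ∀ a b → real (a * b) ≡ real a *ᵍ real b
  real-* a b = cong₂ _⊹_ (solve 2 (λ a b → a :* b := a :* b :- con 0ℚ :* con 0ℚ) refl a b)
                         (solve 2 (λ a b → con 0ℚ := a :* con 0ℚ :+ con 0ℚ :* b) refl a b)
    where open +-*-Solver

  -- The derivation t · d/dt on coefficient sequences of power series in t.
  Δ : (ℕ → 𝔾) → ℕ → 𝔾
  Δ f k = ιᵍ k *ᵍ f k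

  Δ-suc : ∀ f k → Δ f (suc k) ≡ f (suc k) +ᵍ ιᵍ k *ᵍ f (suc k)
  Δ-suc f k = trans (cong (_*ᵍ f (suc k)) (real-+ 1ℚ (ι k)))
    (solve 2 (λ i x → (con 1ᵍ :+ i) :* x := x :+ i :* x) refl (ιᵍ k) (f (suc k)))
    where open 𝔾-Solver

  -- The Leibniz rule.
  Δ-conv : ∀ f g k → Δ (conv f g) k ≡ conv (Δ f) g k +ᵍ conv f (Δ g) k
  Δ-conv f g zero = solve 2 (λ a b → con 0ᵍ :* (a :* b) := con 0ᵍ :* a :* b :+ a :* (con 0ᵍ :* b)) refl (f 0) (g 0)
    where open 𝔾-Solver
  Δ-conv f g (suc k) = trans (cong (_*ᵍ (f 0 *ᵍ g (suc k) +ᵍ c)) (real-+ 1ℚ (ι k)))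
    (trans (solve 4 (λ i a b c → (con 1ᵍ :+ i) :* (a :* b :+ c) := a :* ((con 1ᵍ :+ i) :* b) :+ (c :+ i :* c)) refl
             (ιᵍ k) (f 0) (g (suc k)) c)
    (trans (cong (λ x → f 0 *ᵍ ((1ᵍ +ᵍ ιᵍ k) *ᵍ g (suc k)) +ᵍ (c +ᵍ x)) (Δ-conv (f ∘ suc) g k))
    (trans (cong (λ x → f 0 *ᵍ (x *ᵍ g (suc k)) +ᵍ (c +ᵍ (d +ᵍ r))) (sym (real-+ 1ℚ (ι k))))
    (trans (solve 6 (λ a a′ b c d r → a :* b :+ (c :+ (d :+ r)) := (con 0ᵍ :* a′ :* a′ :+ (c :+ d)) :+ (a :* b :+ r)) refl
              (f 0) 0ᵍ (Δ g (suc k)) c d r)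
      (cong₂ _+ᵍ_
        (cong₂ _+ᵍ_ (solve 2 (λ a b → con 0ᵍ :* con 0ᵍ :* con 0ᵍ := con 0ᵍ :* a :* b) refl (f 0) (g (suc k)))
          (sym (trans (conv-cong k (λ {j} _ → Δ-suc f j) (λ _ → refl)) (conv-+ˡ (f ∘ suc) (Δ (f ∘ suc)) g k))))
        refl)))))
    where
    open 𝔾-Solver
    c = conv (f ∘ suc) g k
    d = conv (Δ (f ∘ suc)) g k
    r = conv (f ∘ suc) (Δ g) k

  infixr 8 _^ᵍ_
  _^ᵍ_ : 𝔾 → ℕ → 𝔾
  z ^ᵍ zero  = 1ᵍ
  z ^ᵍ suc k = z *ᵍ z ^ᵍ k

  expCoeff : 𝔾 → ℕ → 𝔾
  expCoeff z k = real (1/k! k) *ᵍ z ^ᵍ k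

  Δ-expCoeff : ∀ z k → Δ (expCoeff z) (suc k) ≡ z *ᵍ expCoeff z k
  Δ-expCoeff z k = trans
    (solve 4 (λ i f z P → i :* (f :* (z :* P)) := z :* ((f :* i) :* P)) refl (ιᵍ (suc k)) (real (1/k! (suc k))) z (z ^ᵍ k))
    (cong (λ x → z *ᵍ (x *ᵍ z ^ᵍ k)) (trans (sym (real-* (1/k! (suc k)) (ι (suc k)))) (cong real (1/k!-step k))))
    where open 𝔾-Solver

  ιᵍ-cancel : ∀ k {x y} → ιᵍ (suc k) *ᵍ x ≡ ιᵍ (suc k) *ᵍ y → x ≡ y
  ιᵍ-cancel k {x} {y} h = trans (sym (undo x)) (trans (cong (real t *ᵍ_) h) (undo y))
    where
    t = proj₁ (recip-pos (ι-pos (suc k)))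
    undo : ∀ x → real t *ᵍ (ιᵍ (suc k) *ᵍ x) ≡ x
    undo x = trans (sym (G.*-assoc (real t) (ιᵍ (suc k)) x))
      (trans (cong (_*ᵍ x) (trans (sym (real-* t (ι (suc k))))
        (cong real (trans (ℚP.*-comm t (ι (suc k))) (proj₂ (proj₂ (recip-pos (ι-pos (suc k)))))))))
      (G.*-identityˡ x))

  conv-Δˡ-suc : ∀ f g k → conv (Δ f) g (suc k) ≡ conv (Δ f ∘ suc) g k
  conv-Δˡ-suc f g k = solve 3 (λ a b c → con 0ᵍ :* a :* b :+ c := c) refl (f 0) (g (suc k)) (conv (Δ f ∘ suc) g k)
    where open 𝔾-Solver

  -- No binomial theorem: the exponential series satisfies Δ E = z t E, so by the Leibniz rule the
  -- product satisfies the same equation with z + w, and k + 1 can be cancelled.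
  conv-expCoeff : ∀ z w k → conv (expCoeff z) (expCoeff w) k ≡ expCoeff (z +ᵍ w) k
  conv-expCoeff z w zero = refl
  conv-expCoeff z w (suc k) = ιᵍ-cancel k (trans (Δ-conv E F (suc k))
    (trans (cong₂ _+ᵍ_
      (trans (conv-Δˡ-suc E F k) (trans (conv-cong k (λ {j} _ → Δ-expCoeff z j) (λ _ → refl)) (conv-*ˡ z E F k)))
      (trans (conv-comm E (Δ F) (suc k)) (trans (conv-Δˡ-suc F E k)
        (trans (conv-cong k (λ {j} _ → Δ-expCoeff w j) (λ _ → refl)) (trans (conv-*ˡ w F E k) (cong (w *ᵍ_) (conv-comm F E k)))))))
    (trans (sym (G.distribʳ (conv E F k) z w))
    (trans (cong ((z +ᵍ w) *ᵍ_) (conv-expCoeff z w k)) (sym (Δ-expCoeff (z +ᵍ w) k))))))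
    where
    E = expCoeff z
    F = expCoeff w

  Σᵍ : (ℕ → 𝔾) → ℕ → 𝔾
  Σᵍ f zero    = 0ᵍ
  Σᵍ f (suc n) = Σᵍ f n +ᵍ f n

  Σᵍ-cong : ∀ {f g} n → (∀ {k} → k ℕ.< n → f k ≡ g k) → Σᵍ f n ≡ Σᵍ g n
  Σᵍ-cong zero    h = refl
  Σᵍ-cong (suc n) h = cong₂ _+ᵍ_ (Σᵍ-cong n (h ∘ ℕP.m<n⇒m<1+n)) (h ℕP.≤-refl)

  Σᵍ-front : ∀ f n → Σᵍ f (suc n) ≡ f 0 +ᵍ Σᵍ (f ∘ suc) n
  Σᵍ-front f zero = G.+-comm 0ᵍ (f 0)
  Σᵍ-front f (suc n) = trans (cong (_+ᵍ f (suc n)) (Σᵍ-front f n)) (G.+-assoc (f 0) _ (f (suc n)))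

  Σᵍ-+ : ∀ f g n → Σᵍ (λ k → f k +ᵍ g k) n ≡ Σᵍ f n +ᵍ Σᵍ g n
  Σᵍ-+ f g zero = refl
  Σᵍ-+ f g (suc n) = trans (cong (_+ᵍ (f n +ᵍ g n)) (Σᵍ-+ f g n))
    (solve 4 (λ a b c d → (a :+ b) :+ (c :+ d) := (a :+ c) :+ (b :+ d)) refl (Σᵍ f n) (Σᵍ g n) (f n) (g n))
    where open 𝔾-Solver

  Σᵍ-* : ∀ a f n → Σᵍ (λ k → a *ᵍ f k) n ≡ a *ᵍ Σᵍ f n
  Σᵍ-* a f zero = sym (G.zeroʳ a)
  Σᵍ-* a f (suc n) = trans (cong (_+ᵍ a *ᵍ f n) (Σᵍ-* a f n)) (sym (G.distribˡ a (Σᵍ f n) (f n)))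

  Support : ℕ → (ℕ → 𝔾) → Set
  Support n f = ∀ {k} → n ℕ.≤ k → f k ≡ 0ᵍ

  Σᵍ-support : ∀ {f N} → Support N f → ∀ j → Σᵍ f (j ℕ.+ N) ≡ Σᵍ f N
  Σᵍ-support s zero = refl
  Σᵍ-support {f} {N} s (suc j) = trans (cong₂ _+ᵍ_ (Σᵍ-support s j) (s (ℕP.m≤n+m N j))) (G.+-identityʳ _)

  conv-zeroˡ : ∀ {f} g k → (∀ j → f j ≡ 0ᵍ) → conv f g k ≡ 0ᵍ
  conv-zeroˡ g zero h = trans (cong (_*ᵍ g 0) (h 0)) (G.zeroˡ (g 0))
  conv-zeroˡ g (suc k) h = cong₂ _+ᵍ_ (trans (cong (_*ᵍ g (suc k)) (h 0)) (G.zeroˡ (g (suc k)))) (conv-zeroˡ g k (h ∘ suc))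

  conv-support : ∀ {f g} M N → Support M f → Support N g → Support (M ℕ.+ N) (conv f g)
  conv-support {f} {g} zero N sf sg {k} h = conv-zeroˡ g k (λ j → sf z≤n)
  conv-support {f} {g} (suc M) N sf sg {suc k} (s≤s h) = cong₂ _+ᵍ_
    (trans (cong (f 0 *ᵍ_) (sg (ℕP.≤-trans (ℕP.m≤n+m N M) (ℕP.m≤n⇒m≤1+n h)))) (G.zeroʳ (f 0)))
    (conv-support M N (sf ∘ s≤s) sg h)

  -- Evaluation of polynomials at t = 1 is multiplicative; `M + N` is long enough to contain the
  -- whole product.
  Σᵍ-conv : ∀ {f g} M N → Support M f → Support N g → Σᵍ (conv f g) (M ℕ.+ N) ≡ Σᵍ f M *ᵍ Σᵍ g N
  Σᵍ-conv {f} {g} zero N sf sg = trans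
    (trans (Σᵍ-cong N λ {k} _ → trans (conv-zeroˡ g k (λ j → sf z≤n)) (sym (G.zeroˡ (g k)))) (Σᵍ-* 0ᵍ g N))
    refl
  Σᵍ-conv {f} {g} (suc M) N sf sg = trans (Σᵍ-front (conv f g) (M ℕ.+ N))
    (trans (cong (f 0 *ᵍ g 0 +ᵍ_) (Σᵍ-+ (λ k → f 0 *ᵍ g (suc k)) (conv (f ∘ suc) g) (M ℕ.+ N)))
    (trans (cong₂ (λ x y → f 0 *ᵍ g 0 +ᵍ (x +ᵍ y)) (Σᵍ-* (f 0) (g ∘ suc) (M ℕ.+ N)) (Σᵍ-conv M N (sf ∘ s≤s) sg))
    (trans (solve 5 (λ a b c d e → a :* b :+ (a :* c :+ d :* e) := a :* (b :+ c) :+ d :* e) refl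
         (f 0) (g 0) (Σᵍ (g ∘ suc) (M ℕ.+ N)) (Σᵍ (f ∘ suc) M) (Σᵍ g N))
    (trans (cong (λ x → f 0 *ᵍ x +ᵍ Σᵍ (f ∘ suc) M *ᵍ Σᵍ g N)
         (trans (sym (Σᵍ-front g (M ℕ.+ N))) (Σᵍ-support sg (suc M))))
    (trans (sym (G.distribʳ (Σᵍ g N) (f 0) (Σᵍ (f ∘ suc) M)))
      (cong (_*ᵍ Σᵍ g N) (sym (Σᵍ-front f M))))))))
    where open 𝔾-Solver

  truncate : ℕ → (ℕ → 𝔾) → ℕ → 𝔾
  truncate n f k = if does (k ℕ.<? n) then f k else 0ᵍ

  truncate-< : ∀ {n} f {k} → k ℕ.< n → truncate n f k ≡ f k
  truncate-< {n} f {k} h = cong (if_then f k else 0ᵍ) (dec-true (k ℕ.<? n) h)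

  truncate-≥ : ∀ n f → Support n (truncate n f)
  truncate-≥ n f {k} h = cong (if_then f k else 0ᵍ) (dec-false (k ℕ.<? n) (ℕP.≤⇒≯ h))

  infix 4 _≪_
  -- Here `w` is a non-negative real majorant. It is kept among the Gaussian rationals so that
  -- `conv` and powers of majorants are the same operations as those they dominate.
  record _≪_ (z w : 𝔾) : Set where
    constructor _,_
    field
      ν≤Re : ν z ≤ Re w
      Im≡0 : Im w ≡ 0ℚ
  open _≪_ public

  ≪-+ : ∀ {z w z′ w′} → z ≪ w → z′ ≪ w′ → z +ᵍ z′ ≪ w +ᵍ w′
  ≪-+ {z} {z′ = z′} (h , e) (h′ , e′) = ℚP.≤-trans (ν-+ z z′) (ℚP.+-mono-≤ h h′) , cong₂ _+_ e e′

  ≪-* : ∀ {z w z′ w′} → z ≪ w → z′ ≪ w′ → z *ᵍ z′ ≪ w *ᵍ w′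
  ≪-* {z} {a ⊹ .0ℚ} {z′} {b ⊹ .0ℚ} (h , refl) (h′ , refl) =
    ℚP.≤-trans (ν-* z z′) (ℚP.≤-trans
      (*-mono (ν-nonNeg z) (ℚP.≤-trans (ν-nonNeg z′) h′) h h′)
      (ℚP.≤-reflexive (cong Re (real-* a b)))) , cong Im (sym (real-* a b))

  conv-≪ : ∀ {f g a b} k → (∀ j → f j ≪ a j) → (∀ j → g j ≪ b j) → conv f g k ≪ conv a b k
  conv-≪ zero hf hg = ≪-* (hf 0) (hg 0)
  conv-≪ (suc k) hf hg = ≪-+ (≪-* (hf 0) (hg (suc k))) (conv-≪ k (hf ∘ suc) hg)

  ^ᵍ-≪ : ∀ {z w} → z ≪ w → ∀ k → z ^ᵍ k ≪ w ^ᵍ k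
  ^ᵍ-≪ h zero = ℚP.≤-reflexive (ν-real 1ℚ) , refl
  ^ᵍ-≪ h (suc k) = ≪-* h (^ᵍ-≪ h k)

  real-≪ : ∀ {q} → 0ℚ ≤ q → real q ≪ real q
  real-≪ {q} h = ℚP.≤-reflexive (trans (ν-real q) (ℚP.0≤p⇒∣p∣≡p h)) , refl

  real-^ : ∀ q k → real q ^ᵍ k ≡ real (q ^ℚ k)
  real-^ q zero = refl
  real-^ q (suc k) = trans (cong (real q *ᵍ_) (real-^ q k)) (sym (real-* q (q ^ℚ k)))

  Σᵍ-tail : ∀ {f b} → (∀ k → ν (f k) ≤ b k) → ∀ j n → ν (Σᵍ f (j ℕ.+ n) -ᵍ Σᵍ f n) ≤ psum b (j ℕ.+ n) - psum b n
  Σᵍ-tail {f} {b} h zero n = ℚP.≤-reflexive (trans (ν0 {Σᵍ f n} refl) (sym (ℚP.+-inverseʳ (psum b n))))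
  Σᵍ-tail {f} {b} h (suc j) n = subst₂ _≤_
    (cong ν (solve 3 (λ x y z → (x :- y) :+ z := (x :+ z) :- y) refl (Σᵍ f (j ℕ.+ n)) (Σᵍ f n) (f (j ℕ.+ n))))
    (Q.solve 3 (λ x y z → (x Q.:- y) Q.:+ z Q.:= (x Q.:+ z) Q.:- y) refl (psum b (j ℕ.+ n)) (psum b n) (b (j ℕ.+ n)))
    (ℚP.≤-trans (ν-+ (Σᵍ f (j ℕ.+ n) -ᵍ Σᵍ f n) (f (j ℕ.+ n))) (ℚP.+-mono-≤ (Σᵍ-tail h j n) (h (j ℕ.+ n))))
    where
    open 𝔾-Solver
    module Q = +-*-Solver

  Σᵍ-ν : ∀ {f b} → (∀ k → ν (f k) ≤ b k) → ∀ n → ν (Σᵍ f n) ≤ psum b n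
  Σᵍ-ν h zero = ℚP.≤-reflexive ν-0
  Σᵍ-ν {f} h (suc n) = ℚP.≤-trans (ν-+ (Σᵍ f n) (f n)) (ℚP.+-mono-≤ (Σᵍ-ν h n) (h n))

  expSum : 𝔾 → ℕ → 𝔾
  expSum z = Σᵍ (expCoeff z)

  module _ {M} (0<M : 0ℚ < M) where
    open Exponential M 0<M using () renaming (e to majorantTerm)

    expCoeff-≪ : ∀ {z} → ν z ≤ M → ∀ k → expCoeff z k ≪ expCoeff (real M) k
    expCoeff-≪ {z} h k = ≪-* (real-≪ (1/k!-nonNeg k)) (^ᵍ-≪ (h , refl) k)

    expCoeff-real : ∀ k → expCoeff (real M) k ≡ real (majorantTerm k)
    expCoeff-real k = trans (cong (real (1/k! k) *ᵍ_) (real-^ M k)) (sym (real-* (1/k! k) (M ^ℚ k)))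

    expCoeff-ν : ∀ {z} → ν z ≤ M → ∀ k → ν (expCoeff z k) ≤ majorantTerm k
    expCoeff-ν h k = ℚP.≤-trans (ν≤Re (expCoeff-≪ h k)) (ℚP.≤-reflexive (cong Re (expCoeff-real k)))

  ≪-truncate : ∀ n {f b : ℕ → 𝔾} k → f k ≪ b k → truncate n f k ≪ b k
  ≪-truncate n {f} k h with does (k ℕ.<? n)
  ... | true = h
  ... | false = ℚP.≤-trans (ℚP.≤-reflexive ν-0) (ℚP.≤-trans (ν-nonNeg (f k)) (ν≤Re h)) , Im≡0 h

  -- The product of the two partial sums is the sum of 2n coefficients of a product of truncated
  -- series. The first n are those of exp(z + w); the others are dominated by the coefficients for M
  -- + M, whatever the truncation removed.
  expSum-* : ∀ {M} (0<M : 0ℚ < M) (0<2M : 0ℚ < M + M) {z w} → ν z ≤ M → ν w ≤ M → ∀ n →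
    ν (expSum z n *ᵍ expSum w n -ᵍ expSum (z +ᵍ w) n) ≤
    psum (Exponential.e (M + M) 0<2M) (n ℕ.+ n) - psum (Exponential.e (M + M) 0<2M) n
  expSum-* {M} 0<M 0<2M {z} {w} hz hw n = subst₂ (λ x y → ν (x -ᵍ y) ≤ psum (Exponential.e (M + M) 0<2M) (n ℕ.+ n) - psum (Exponential.e (M + M) 0<2M) n)
    (trans (Σᵍ-conv n n (truncate-≥ n E) (truncate-≥ n F))
      (cong₂ _*ᵍ_ (Σᵍ-cong n (truncate-< E)) (Σᵍ-cong n (truncate-< F))))
    (Σᵍ-cong n λ {k} k<n → trans
      (conv-cong k (λ j≤k → truncate-< E (ℕP.≤-<-trans j≤k k<n)) (λ j≤k → truncate-< F (ℕP.≤-<-trans j≤k k<n)))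
      (conv-expCoeff z w k))
    (Σᵍ-tail bound n n)
    where
    E = expCoeff z
    F = expCoeff w
    bound : ∀ k → ν (conv (truncate n E) (truncate n F) k) ≤ Exponential.e (M + M) 0<2M k
    bound k = ℚP.≤-trans
      (ν≤Re (conv-≪ k (λ j → ≪-truncate n {E} {expCoeff (real M)} j (expCoeff-≪ 0<M hz j)) (λ j → ≪-truncate n {F} {expCoeff (real M)} j (expCoeff-≪ 0<M hw j))))
      (ℚP.≤-reflexive (cong Re (trans (conv-expCoeff (real M) (real M) k)
        (trans (cong (λ x → expCoeff x k) (sym (real-+ M M))) (expCoeff-real 0<2M k)))))

  majorant : (u : 𝕊) → ∃ λ M → 0ℚ < M × Eventually (λ n → ν (at u n) ≤ M)
  majorant u = 1ℚ + ∣ B ∣ , +-pos 0<1 (ℚP.0≤∣p∣ B) ,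
    eventually-map (λ n h → ℚP.≤-trans h (ℚP.≤-trans (p≤∣p∣ B) (p≤1+p (∣ B ∣)))) (proj₂ (bounded u))
    where B = proj₁ (bounded u)

  opaque
    unfolding _+ˢ_
    -- The diagonal of partial sums and approximations, the same choice as in `exp-series`, so that
    -- the exponentials of the statement agree with it term by term.
    Exp : 𝕊 → 𝕊
    Exp u = mk𝕊 (λ n → expSum (at u n) n) (bound (majorant u))
      where
      bound : (∃ λ M → 0ℚ < M × Eventually (λ n → ν (at u n) ≤ M)) →
        ∃ λ B → Eventually (λ n → ν (expSum (at u n) n) ≤ B)
      bound (M , 0<M , h) = step (cauchy⇒bound E (Exponential.e-cauchy M 0<M))
        where
        E : ℕ → ℚ
        E = psum (Exponential.e M 0<M)
        step : Bound E → ∃ λ B → Eventually (λ n → ν (expSum (at u n) n) ≤ B)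
        step (B , _ , g) = B , eventually-map₂ (λ n a b → ℚP.≤-trans (Σᵍ-ν (expCoeff-ν 0<M a) n)
          (ℚP.≤-trans (p≤∣p∣ (E n)) b)) h g

    Exp-+ : ∀ u v → Exp (u +ˢ v) ≈ Exp u *ˢ Exp v
    Exp-+ u v = ≈-sym (go (majorant u) (majorant v))
      where
      go : (∃ λ M → 0ℚ < M × Eventually (λ n → ν (at u n) ≤ M)) →
           (∃ λ M → 0ℚ < M × Eventually (λ n → ν (at v n) ≤ M)) → Exp u *ˢ Exp v ≈ Exp (u +ˢ v)
      go (M , 0<M , hu) (M′ , 0<M′ , hv) = mk≈ λ δ 0<δ →
        let K , h = Exponential.e-cauchy (m + m) 0<2m δ 0<δ
        in eventually-map₂ (λ n f g → ℚP.≤-trans (f g) (ℚP.≤-trans (p≤∣p∣ (psum E (n ℕ.+ n) - psum E n)) g))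
             (eventually-map₂ (λ n a b _ → expSum-* 0<m 0<2m
               (ℚP.≤-trans a (p≤p+q (ℚP.<⇒≤ 0<M′)))
               (ℚP.≤-trans b (subst (M′ ≤_) (ℚP.+-comm M′ M) (p≤p+q (ℚP.<⇒≤ 0<M)))) n) hu hv)
             (K , λ {n} k → h (ℕP.≤-trans k (ℕP.m≤m+n n n)) k)
        where
        m : ℚ
        m = M + M′
        0<m : 0ℚ < m
        0<m = +-pos 0<M (ℚP.<⇒≤ 0<M′)
        0<2m : 0ℚ < m + m
        0<2m = +-pos 0<m (ℚP.<⇒≤ 0<m)
        E : ℕ → ℚ
        E = Exponential.e (m + m) 0<2m

    at-Exp : ∀ u n → at (Exp u) n ≡ expSum (at u n) n
    at-Exp u n = refl

  1/k!-anti : ∀ k → 1/k! (suc k) ≤ 1/k! k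
  1/k!-anti k = subst₂ _≤_ (ℚP.*-identityʳ _) (1/k!-step k)
    (*-monoʳ (1/k!-nonNeg (suc k)) (p≤p+q (ι-nonNeg k)))

  1^ℚ : ∀ k → 1ℚ ^ℚ k ≡ 1ℚ
  1^ℚ zero = refl
  1^ℚ (suc k) = trans (ℚP.*-identityˡ _) (1^ℚ k)

  -- exp z - 1 is z times a series whose coefficients 1/(k + 1)! are at most 1/k!, so B may be any
  -- bound for the partial sums of e. Uniformity in z is essential, as the argument varies with n on
  -- the diagonal.
  expSum-near-1 : ∃ λ B → 0ℚ < B × Eventually (λ n → ∀ z → ν z ≤ 1ℚ → ν (expSum z n -ᵍ 1ᵍ) ≤ B * ν z)
  expSum-near-1 = step (cauchy⇒bound (psum (Exponential.e 1ℚ 0<1)) (Exponential.e-cauchy 1ℚ 0<1))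
    where
    main : ∀ B z → ν z ≤ 1ℚ → ∀ n → ∣ psum (Exponential.e 1ℚ 0<1) n ∣ ≤ B → ν (expSum z (suc n) -ᵍ 1ᵍ) ≤ B * ν z
    main B z hz n hn = subst (λ x → ν x ≤ B * ν z) (sym eq) (ℚP.≤-trans (ν-* z (Σᵍ g n))
      (ℚP.≤-trans (*-monoʳ (ν-nonNeg z) (ℚP.≤-trans (Σᵍ-ν g≤ n) (ℚP.≤-trans (p≤∣p∣ (psum (Exponential.e 1ℚ 0<1) n)) hn)))
        (ℚP.≤-reflexive (ℚP.*-comm (ν z) B))))
      where
      open 𝔾-Solver
      g : ℕ → 𝔾
      g k = real (1/k! (suc k)) *ᵍ z ^ᵍ k
      g≤ : ∀ k → ν (g k) ≤ Exponential.e 1ℚ 0<1 k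
      g≤ k = ℚP.≤-trans (ν≤Re (≪-* (real-≪ (1/k!-nonNeg (suc k))) (^ᵍ-≪ (hz , refl) k)))
        (ℚP.≤-trans (ℚP.≤-reflexive (cong Re (trans (cong (real (1/k! (suc k)) *ᵍ_) (real-^ 1ℚ k)) (sym (real-* (1/k! (suc k)) (1ℚ ^ℚ k))))))
          (*-monoˡ (^ℚ-nonNeg (ℚP.<⇒≤ 0<1) k) (1/k!-anti k)))
      eq : expSum z (suc n) -ᵍ 1ᵍ ≡ z *ᵍ Σᵍ g n
      eq = trans (cong (_-ᵍ 1ᵍ) (Σᵍ-front (expCoeff z) n))
        (trans (solve 1 (λ x → con 1ᵍ :* con 1ᵍ :+ x :- con 1ᵍ := x) refl (Σᵍ (expCoeff z ∘ suc) n))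
        (trans (Σᵍ-cong n λ {k} _ → solve 3 (λ f z P → f :* (z :* P) := z :* (f :* P)) refl (real (1/k! (suc k))) z (z ^ᵍ k))
          (Σᵍ-* z g n)))
    step : Bound (psum (Exponential.e 1ℚ 0<1)) →
      ∃ λ B → 0ℚ < B × Eventually (λ n → ∀ z → ν z ≤ 1ℚ → ν (expSum z n -ᵍ 1ᵍ) ≤ B * ν z)
    step (B , 0<B , K , h) = B , 0<B , suc K , λ { {suc n} (s≤s k) z hz → main B z hz n (h k) }

  opaque
    unfolding _+ˢ_ Exp
    Exp-null : ∀ {u} → u ≈ 0ˢ → Exp u ≈ 1ˢ
    Exp-null {u} h = step expSum-near-1
      where
      small : ∀ n → ν (at u n -ᵍ 0ᵍ) ≡ ν (at u n)
      small n = cong ν (G.+-identityʳ (at u n))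
      step : (∃ λ B → 0ℚ < B × Eventually (λ n → ∀ z → ν z ≤ 1ℚ → ν (expSum z n -ᵍ 1ᵍ) ≤ B * ν z)) → Exp u ≈ 1ˢ
      step (B , 0<B , near) = mk≈ λ δ 0<δ →
        let t , 0<t , Bt = absorb B δ 0<δ
        in eventually-map₂ (λ n f a → ℚP.≤-trans (f a) (ℚP.≤-trans (*-monoʳ (ℚP.<⇒≤ 0<B) a) (Bt (ℚP.<⇒≤ 0<B))))
           (eventually-map₂ (λ n f a → λ _ → f (at u n) (subst (_≤ 1ℚ) (small n) a)) near (close h 1ℚ 0<1))
           (eventually-map (λ n → subst (_≤ t) (small n)) (close h t 0<t))

  module S = CommutativeRing 𝕊-commutativeRing

  opaque
    unfolding _+ˢ_ Exp
    Exp-≡ : ∀ {u v} → (∀ n → at u n ≡ at v n) → Exp u ≈ Exp v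
    Exp-≡ h = ≡⇒≈ (λ n → cong (λ z → expSum z n) (h n))

  -- The exponential of the logarithm series.

  1/suc : ℕ → ℚ
  1/suc k = + 1 / suc k

  ι*1/suc : ∀ k → ι (suc k) * 1/suc k ≡ 1ℚ
  ι*1/suc k = trans (ℚP.*-comm (ι (suc k)) (1/suc k)) (/-*ι 1 (suc k))

  -- The coefficient sequence of ∑_{1 ≤ k ≤ n} zᵏ tᵏ / k, a truncation of - log (1 - z t).
  logCoeff : ℕ → 𝔾 → ℕ → 𝔾
  logCoeff n z zero    = 0ᵍ
  logCoeff n z (suc k) = truncate n (λ j → real (1/suc j) *ᵍ z ^ᵍ suc j) k

  logSum : 𝔾 → ℕ → 𝔾
  logSum z = Σᵍ (λ j → real (1/suc j) *ᵍ z ^ᵍ suc j)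

  -- Let f be the truncated series of - log (1 - z t) and F_R = ∑_{r < R} fʳ / r!. The chain rule
  -- reads Δ F_{R+1} = (Δ f) F_R, where Δ f is a truncated geometric series. Hence coefficient k of
  -- F_R is q zᵏ with 0 ≤ q ≤ 1, and q = 1 as long as neither truncation is felt. At t = 1 this
  -- compares exp of a partial sum of the logarithm with a partial sum of the geometric series.
  module Composition (n : ℕ) (z : 𝔾) where
    open 𝔾-Solver

    f : ℕ → 𝔾
    f = logCoeff n z

    -- u r is the coefficient sequence of fʳ / r!, and c R that of ∑_{r < R} fʳ / r!.
    u : ℕ → ℕ → 𝔾
    u zero    zero    = 1ᵍ
    u zero    (suc k) = 0ᵍ
    u (suc r) k       = real (1/suc r) *ᵍ conv f (u r) k

    c : ℕ → ℕ → 𝔾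
    c R k = Σᵍ (λ r → u r k) R

    f-support : Support (suc n) f
    f-support {suc k} (s≤s h) = truncate-≥ n (λ j → real (1/suc j) *ᵍ z ^ᵍ suc j) h

    size : ℕ → ℕ
    size zero    = 1
    size (suc r) = suc n ℕ.+ size r

    u-support : ∀ r → Support (size r) (u r)
    u-support zero    {suc k} _ = refl
    u-support (suc r) {k} h = trans (cong (real (1/suc r) *ᵍ_) (conv-support (suc n) (size r) f-support (u-support r) h))
      (G.zeroʳ (real (1/suc r)))

    Σf : Σᵍ f (suc n) ≡ logSum z n
    Σf = trans (Σᵍ-front f n) (trans (G.+-identityˡ (Σᵍ (f ∘ suc) n))
      (Σᵍ-cong n λ {k} h → truncate-< (λ j → real (1/suc j) *ᵍ z ^ᵍ suc j) h))

    1/!-suc : ∀ r → 1/k! (suc r) ≡ 1/suc r * 1/k! r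
    1/!-suc r = trans (sym (ℚP.*-identityʳ (1/k! (suc r)))) (trans (cong (1/k! (suc r) *_) (sym (ι*1/suc r)))
      (trans (sym (ℚP.*-assoc (1/k! (suc r)) (ι (suc r)) (1/suc r)))
        (trans (cong (_* 1/suc r) (1/k!-step r)) (ℚP.*-comm (1/k! r) (1/suc r)))))

    Σu : ∀ r → Σᵍ (u r) (size r) ≡ expCoeff (logSum z n) r
    Σu zero    = refl
    Σu (suc r) = begin
      Σᵍ (u (suc r)) (suc n ℕ.+ size r)                       ≡⟨ Σᵍ-* (real (1/suc r)) (conv f (u r)) (suc n ℕ.+ size r) ⟩
      real (1/suc r) *ᵍ Σᵍ (conv f (u r)) (suc n ℕ.+ size r)  ≡⟨ cong (real (1/suc r) *ᵍ_) (Σᵍ-conv (suc n) (size r) f-support (u-support r)) ⟩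
      real (1/suc r) *ᵍ (Σᵍ f (suc n) *ᵍ Σᵍ (u r) (size r))   ≡⟨ cong₂ (λ x y → real (1/suc r) *ᵍ (x *ᵍ y)) Σf (Σu r) ⟩
      real (1/suc r) *ᵍ (L *ᵍ (real (1/k! r) *ᵍ L ^ᵍ r))      ≡⟨ solve 4 (λ a b l p → a :* (l :* (b :* p)) := (a :* b) :* (l :* p)) refl (real (1/suc r)) (real (1/k! r)) L (L ^ᵍ r) ⟩
      (real (1/suc r) *ᵍ real (1/k! r)) *ᵍ (L *ᵍ L ^ᵍ r)      ≡⟨ cong (_*ᵍ (L *ᵍ L ^ᵍ r)) (trans (sym (real-* (1/suc r) (1/k! r))) (cong real (sym (1/!-suc r)))) ⟩
      real (1/k! (suc r)) *ᵍ L ^ᵍ suc r                       ∎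
      where
      open ≡-Reasoning
      L = logSum z n

    size-mono : ∀ {r R} → r ℕ.≤ R → size r ℕ.≤ size R
    size-mono {R = zero} z≤n = ℕP.≤-refl
    size-mono {R = suc R} z≤n = ℕP.≤-trans (size-mono {R = R} z≤n) (ℕP.m≤n+m (size R) (suc n))
    size-mono (s≤s h) = ℕP.+-monoʳ-≤ (suc n) (size-mono h)

    Σᵍ-extend : ∀ {g N N′} → Support N g → N ℕ.≤ N′ → Σᵍ g N′ ≡ Σᵍ g N
    Σᵍ-extend {g} {N} {N′} s h = subst (λ m → Σᵍ g m ≡ Σᵍ g N) (ℕP.m∸n+n≡m h) (Σᵍ-support s (N′ ℕ.∸ N))

    Σc : ∀ R N → size R ℕ.≤ N → Σᵍ (c R) N ≡ expSum (logSum z n) R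
    Σc zero    N h = trans (Σᵍ-cong N (λ {k} _ → sym (G.zeroˡ 0ᵍ))) (trans (Σᵍ-* 0ᵍ (λ _ → 0ᵍ) N) (G.zeroˡ (Σᵍ (λ _ → 0ᵍ) N)))
    Σc (suc R) N h = trans (Σᵍ-+ (c R) (u R) N) (cong₂ _+ᵍ_
      (Σc R N (ℕP.≤-trans (size-mono (ℕP.n≤1+n R)) h))
      (trans (Σᵍ-extend (u-support R) (ℕP.≤-trans (size-mono (ℕP.n≤1+n R)) h)) (Σu R)))

    real-ι-1/suc : ∀ r → ιᵍ (suc r) *ᵍ real (1/suc r) ≡ 1ᵍ
    real-ι-1/suc r = trans (sym (real-* (ι (suc r)) (1/suc r))) (cong real (ι*1/suc r))

    Δu₀ : ∀ k → Δ (u 0) k ≡ 0ᵍ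
    Δu₀ zero    = refl
    Δu₀ (suc k) = G.zeroʳ (ιᵍ (suc k))

    conv-zeroʳ : ∀ g k {h} → (∀ j → h j ≡ 0ᵍ) → conv g h k ≡ 0ᵍ
    conv-zeroʳ g k {h} e = trans (conv-comm g h k) (conv-zeroˡ g k e)

    -- The chain rule for fʳ⁺¹ / (r + 1)!: induction turns f Δ(u r) into r copies of (Δ f) (u r),
    -- and r + 1 cancels.
    Δu : ∀ r k → Δ (u (suc r)) k ≡ conv (Δ f) (u r) k
    Δu r k = trans (solve 3 (λ i a x → i :* (a :* x) := a :* (i :* x)) refl (ιᵍ k) (real (1/suc r)) (conv f (u r) k))
      (trans (cong (real (1/suc r) *ᵍ_) (trans (Δ-conv f (u r) k) (step r)))
      (trans (sym (G.*-assoc (real (1/suc r)) (ιᵍ (suc r)) x))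
      (trans (cong (_*ᵍ x) (trans (G.*-comm (real (1/suc r)) (ιᵍ (suc r))) (real-ι-1/suc r))) (G.*-identityˡ x))))
      where
      x = conv (Δ f) (u r) k
      step : ∀ r → conv (Δ f) (u r) k +ᵍ conv f (Δ (u r)) k ≡ ιᵍ (suc r) *ᵍ conv (Δ f) (u r) k
      step zero = trans (cong (conv (Δ f) (u 0) k +ᵍ_) (conv-zeroʳ f k Δu₀))
        (solve 1 (λ x → x :+ con 0ᵍ := con (ιᵍ 1) :* x) refl (conv (Δ f) (u 0) k))
      step (suc r) = trans (cong (y +ᵍ_) rest) (trans
        (solve 2 (λ i y → y :+ i :* y := (con 1ᵍ :+ i) :* y) refl (ιᵍ (suc r)) y)
        (cong (_*ᵍ y) (sym (real-+ 1ℚ (ι (suc r))))))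
        where
        y = conv (Δ f) (u (suc r)) k
        rest : conv f (Δ (u (suc r))) k ≡ ιᵍ (suc r) *ᵍ y
        rest = begin
          conv f (Δ (u (suc r))) k             ≡⟨ conv-cong k (λ _ → refl) (λ {j} _ → Δu r j) ⟩
          conv f (conv (Δ f) (u r)) k          ≡⟨ sym (conv-assoc f (Δ f) (u r) k) ⟩
          conv (conv f (Δ f)) (u r) k          ≡⟨ conv-cong k (λ {j} _ → conv-comm f (Δ f) j) (λ _ → refl) ⟩
          conv (conv (Δ f) f) (u r) k          ≡⟨ conv-assoc (Δ f) f (u r) k ⟩
          conv (Δ f) (conv f (u r)) k          ≡⟨ conv-cong k (λ _ → refl) (λ {j} _ → undo j) ⟩
          conv (Δ f) (λ j → ιᵍ (suc r) *ᵍ u (suc r) j) k  ≡⟨ conv-*ʳ (ιᵍ (suc r)) (Δ f) (u (suc r)) k ⟩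
          ιᵍ (suc r) *ᵍ y                      ∎
          where
          open ≡-Reasoning
          undo : ∀ j → conv f (u r) j ≡ ιᵍ (suc r) *ᵍ u (suc r) j
          undo j = sym (trans (sym (G.*-assoc (ιᵍ (suc r)) (real (1/suc r)) (conv f (u r) j)))
            (trans (cong (_*ᵍ conv f (u r) j) (real-ι-1/suc r)) (G.*-identityˡ (conv f (u r) j))))

    Δc : ∀ R k → Δ (c (suc R)) k ≡ conv (Δ f) (c R) k
    Δc zero k = trans (trans (cong (ιᵍ k *ᵍ_) (G.+-identityˡ (u 0 k))) (Δu₀ k)) (sym (conv-zeroʳ (Δ f) k (λ _ → refl)))
    Δc (suc R) k = trans (G.distribˡ (ιᵍ k) (c (suc R) k) (u (suc R) k))
      (trans (cong₂ _+ᵍ_ (Δc R k) (Δu R k)) (sym (conv-+ʳ (Δ f) (c R) (u R) k)))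

    Δf-suc : ∀ k → Δ f (suc k) ≡ truncate n (λ j → z ^ᵍ suc j) k
    Δf-suc k with does (k ℕ.<? n)
    ... | true = trans (sym (G.*-assoc (ιᵍ (suc k)) (real (1/suc k)) (z ^ᵍ suc k)))
      (trans (cong (_*ᵍ z ^ᵍ suc k) (real-ι-1/suc k)) (G.*-identityˡ (z ^ᵍ suc k)))
    ... | false = G.zeroʳ (ιᵍ (suc k))

    -- Splitting off zᵏ reduces an estimate for a complex coefficient to inequalities for one
    -- rational number.
    record Coefficient (lo hi : ℚ) (k : ℕ) (x : 𝔾) : Set where
      constructor coefficient
      field
        q    : ℚ
        eq   : x ≡ real q *ᵍ z ^ᵍ k
        lo≤q : lo ≤ q
        q≤hi : q ≤ hi

    z^+ : ∀ i j → z ^ᵍ i *ᵍ z ^ᵍ j ≡ z ^ᵍ (i ℕ.+ j)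
    z^+ zero j = G.*-identityˡ (z ^ᵍ j)
    z^+ (suc i) j = trans (G.*-assoc z (z ^ᵍ i) (z ^ᵍ j)) (cong (z *ᵍ_) (z^+ i j))

    -- `l * l ≡ l` covers the lower bounds 0 and 1 at once.
    coefficient-* : ∀ {l i j x y} → 0ℚ ≤ l → l * l ≡ l → Coefficient l 1ℚ i x → Coefficient l 1ℚ j y →
      Coefficient l 1ℚ (i ℕ.+ j) (x *ᵍ y)
    coefficient-* {l} {i} {j} 0≤l l² (coefficient q e a b) (coefficient r f c d) = coefficient (q * r)
      (trans (cong₂ _*ᵍ_ e f) (trans (solve 4 (λ a x b y → a :* x :* (b :* y) := (a :* b) :* (x :* y)) refl (real q) (z ^ᵍ i) (real r) (z ^ᵍ j))
        (cong₂ _*ᵍ_ (sym (real-* q r)) (z^+ i j))))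
      (subst (_≤ q * r) l² (*-mono 0≤l (ℚP.≤-trans 0≤l c) a c))
      (*-mono (ℚP.≤-trans 0≤l a) (ℚP.<⇒≤ 0<1) b d)

    coefficient-+ : ∀ {l h l′ h′ k x y} → Coefficient l h k x → Coefficient l′ h′ k y → Coefficient (l + l′) (h + h′) k (x +ᵍ y)
    coefficient-+ {k = k} (coefficient q e a b) (coefficient r f c d) = coefficient (q + r)
      (trans (cong₂ _+ᵍ_ e f) (trans (sym (G.distribʳ (z ^ᵍ k) (real q) (real r))) (cong (_*ᵍ z ^ᵍ k) (sym (real-+ q r)))))
      (ℚP.+-mono-≤ a c) (ℚP.+-mono-≤ b d)

    coefficient-conv : ∀ {l} → 0ℚ ≤ l → l * l ≡ l → ∀ k m {g h} →
      (∀ j → j ℕ.≤ k → Coefficient l 1ℚ (m ℕ.+ j) (g j)) → (∀ j → j ℕ.≤ k → Coefficient l 1ℚ j (h j)) →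
      Coefficient (ι (suc k) * l) (ι (suc k)) (m ℕ.+ k) (conv g h k)
    coefficient-conv {l} 0≤l l² zero m {g} {h} hg hh = subst₂ (λ a b → Coefficient a b (m ℕ.+ 0) (g 0 *ᵍ h 0))
      (sym (ℚP.*-identityˡ l)) refl
      (subst (λ i → Coefficient l 1ℚ i (g 0 *ᵍ h 0)) (cong (ℕ._+ 0) (ℕP.+-identityʳ m)) (coefficient-* 0≤l l² (hg 0 z≤n) (hh 0 z≤n)))
    coefficient-conv {l} 0≤l l² (suc k) m {g} {h} hg hh =
      subst (λ a → Coefficient a (ι (suc (suc k))) (m ℕ.+ suc k) (conv g h (suc k))) (lem l (ι (suc k)))
      (coefficient-+
        (subst (λ i → Coefficient l 1ℚ (i ℕ.+ suc k) (g 0 *ᵍ h (suc k))) (ℕP.+-identityʳ m) (coefficient-* 0≤l l² (hg 0 z≤n) (hh (suc k) ℕP.≤-refl)))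
        (subst (λ i → Coefficient (ι (suc k) * l) (ι (suc k)) i (conv (g ∘ suc) h k)) (sym (ℕP.+-suc m k))
          (coefficient-conv 0≤l l² k (suc m)
            (λ j h → subst (λ i → Coefficient l 1ℚ i (g (suc j))) (ℕP.+-suc m j) (hg (suc j) (s≤s h)))
            (λ j h → hh j (ℕP.m≤n⇒m≤1+n h)))))
      where
      module Q = +-*-Solver
      lem : ∀ l i → l + i * l ≡ (1ℚ + i) * l
      lem = Q.solve 2 (λ l i → l Q.:+ i Q.:* l Q.:= (Q.con 1ℚ Q.:+ i) Q.:* l) refl

    z^-coefficient : ∀ k → Coefficient 1ℚ 1ℚ k (z ^ᵍ k)
    z^-coefficient k = coefficient 1ℚ (sym (G.*-identityˡ (z ^ᵍ k))) ℚP.≤-refl ℚP.≤-refl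

    coefficient-weaken : ∀ {l l′ h k x} → l′ ≤ l → Coefficient l h k x → Coefficient l′ h k x
    coefficient-weaken a (coefficient q e b c) = coefficient q e (ℚP.≤-trans a b) c

    zero-coefficient : ∀ k → Coefficient 0ℚ 1ℚ k 0ᵍ
    zero-coefficient k = coefficient 0ℚ (sym (G.zeroˡ (z ^ᵍ k))) ℚP.≤-refl (ℚP.<⇒≤ 0<1)

    -- By `Δc`, k + 1 times the new coefficient is a sum of k + 1 products, so its q is an average
    -- of numbers in [l, 1].
    c-step : ∀ {l} → 0ℚ ≤ l → l * l ≡ l → ∀ R k →
      (∀ j → j ℕ.≤ k → Coefficient l 1ℚ (1 ℕ.+ j) (Δ f (suc j))) →
      (∀ j → j ℕ.≤ k → Coefficient l 1ℚ j (c R j)) →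
      Coefficient l 1ℚ (suc k) (c (suc R) (suc k))
    c-step {l} 0≤l l² R k hf hc with coefficient-conv 0≤l l² k 1 hf hc
    ... | coefficient s e a b = coefficient (1/suc k * s)
      (ιᵍ-cancel k (trans (Δc R (suc k)) (trans (conv-Δˡ-suc f (c R) k) (trans e
        (trans (cong (_*ᵍ z ^ᵍ suc k) (trans (trans (sym (G.*-identityˡ (real s))) (cong (_*ᵍ real s) (sym (real-ι-1/suc k))))
            (trans (G.*-assoc (ιᵍ (suc k)) (real (1/suc k)) (real s)) (cong (ιᵍ (suc k) *ᵍ_) (sym (real-* (1/suc k) s))))))
          (G.*-assoc (ιᵍ (suc k)) (real (1/suc k * s)) (z ^ᵍ suc k)))))))
      (subst (_≤ 1/suc k * s) (trans (sym (ℚP.*-assoc (1/suc k) (ι (suc k)) l)) (trans (cong (_* l) (/-*ι 1 (suc k))) (ℚP.*-identityˡ l)))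
        (*-monoʳ (1/-nonNeg (suc k)) a))
      (subst (1/suc k * s ≤_) (/-*ι 1 (suc k)) (*-monoʳ (1/-nonNeg (suc k)) b))

    c-0 : ∀ R → c (suc R) 0 ≡ 1ᵍ
    c-0 zero = refl
    c-0 (suc R) = trans (cong (_+ᵍ u (suc R) 0) (c-0 R)) (trans (cong (λ x → 1ᵍ +ᵍ real (1/suc R) *ᵍ x) (G.zeroˡ (u R 0)))
      (trans (cong (1ᵍ +ᵍ_) (G.zeroʳ (real (1/suc R)))) refl))

    c-coefficient : ∀ R k → Coefficient 0ℚ 1ℚ k (c R k)
    c-coefficient zero k = zero-coefficient k
    c-coefficient (suc R) zero = subst (Coefficient 0ℚ 1ℚ 0) (sym (c-0 R)) (coefficient-weaken (ℚP.<⇒≤ 0<1) (z^-coefficient 0))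
    c-coefficient (suc R) (suc k) = c-step ℚP.≤-refl refl R k
      (λ j _ → subst (Coefficient 0ℚ 1ℚ (suc j)) (sym (Δf-suc j)) (trunc j)) (λ j _ → c-coefficient R j)
      where
      trunc : ∀ j → Coefficient 0ℚ 1ℚ (suc j) (truncate n (λ j → z ^ᵍ suc j) j)
      trunc j with does (j ℕ.<? n)
      ... | true = coefficient-weaken (ℚP.<⇒≤ 0<1) (z^-coefficient (suc j))
      ... | false = zero-coefficient (suc j)

    c-low : ∀ R k → k ℕ.< R → k ℕ.≤ n → Coefficient 1ℚ 1ℚ k (c R k)
    c-low (suc R) zero _ _ = subst (Coefficient 1ℚ 1ℚ 0) (sym (c-0 R)) (z^-coefficient 0)
    c-low (suc R) (suc k) (s≤s k<R) k<n = c-step (ℚP.<⇒≤ 0<1) refl R k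
      (λ j j≤k → subst (Coefficient 1ℚ 1ℚ (suc j))
        (sym (trans (Δf-suc j) (truncate-< (λ j → z ^ᵍ suc j) (ℕP.≤-<-trans j≤k k<n)))) (z^-coefficient (suc j)))
      (λ j j≤k → c-low R j (ℕP.≤-<-trans j≤k k<R) (ℕP.≤-trans j≤k (ℕP.<⇒≤ k<n)))

    c≡z^ : ∀ {k} → k ℕ.< n → c n k ≡ z ^ᵍ k
    c≡z^ {k} h with c-low n k h (ℕP.<⇒≤ h)
    ... | coefficient q e a b = trans e (trans (cong (λ q → real q *ᵍ z ^ᵍ k) (ℚP.≤-antisym b a)) (G.*-identityˡ (z ^ᵍ k)))

    c-ν : ∀ {ρ} → ν z ≤ ρ → ∀ k → ν (c n k) ≤ ρ ^ℚ k
    c-ν {ρ} h k with c-coefficient n k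
    ... | coefficient q e a b = begin
      ν (c n k)                     ≡⟨ cong ν e ⟩
      ν (real q *ᵍ z ^ᵍ k)          ≤⟨ ν≤Re (≪-* (real-≪ a) (^ᵍ-≪ (h , refl) k)) ⟩
      Re (real q *ᵍ real ρ ^ᵍ k)    ≡⟨ cong Re (trans (cong (real q *ᵍ_) (real-^ ρ k)) (sym (real-* q (ρ ^ℚ k)))) ⟩
      q * ρ ^ℚ k                    ≤⟨ *-monoˡ (^ℚ-nonNeg (ℚP.≤-trans (ν-nonNeg z) h) k) b ⟩
      1ℚ * ρ ^ℚ k                   ≡⟨ ℚP.*-identityˡ (ρ ^ℚ k) ⟩
      ρ ^ℚ k                        ∎
      where open ℚP.≤-Reasoning

    -- The first n coefficients of the composition are those of the geometric series, and the later
    -- ones are at most ρᵏ. `N` is a length that exhausts the composed polynomial.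
    error : ∀ {ρ} → ν z ≤ ρ → ∃ λ N → n ℕ.≤ N ×
      ν (expSum (logSum z n) n -ᵍ Σᵍ (z ^ᵍ_) n) ≤ psum (ρ ^ℚ_) N - psum (ρ ^ℚ_) n
    error {ρ} h = size n ℕ.+ n , ℕP.m≤n+m n (size n) ,
      subst₂ (λ x y → ν (x -ᵍ y) ≤ psum (ρ ^ℚ_) (size n ℕ.+ n) - psum (ρ ^ℚ_) n)
        (Σc n (size n ℕ.+ n) (ℕP.m≤m+n (size n) n)) (Σᵍ-cong n c≡z^) (Σᵍ-tail (c-ν h) (size n) n)

  -- Exp u is close to the partial sums of the geometric series, which telescope against 1 - z.
  Exp-log : ∀ {z ρ} → ν z ≤ ρ → ρ < 1ℚ → (u : 𝕊) → Eventually (λ n → at u n ≡ logSum z n) →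
    Exp u *ˢ const (1ᵍ -ᵍ z) ≈ 1ˢ
  Exp-log {z} {ρ} h ρ<1 u hu = begin
    Exp u *ˢ const (1ᵍ -ᵍ z)   ≈⟨ *ˢ-cong close-geo (≈-refl {const (1ᵍ -ᵍ z)}) ⟩
    geo *ˢ const (1ᵍ -ᵍ z)     ≈⟨ geo-inverse ⟩
    1ˢ                         ∎
    where
    open 𝕊-Reasoning
    0≤ρ : 0ℚ ≤ ρ
    0≤ρ = ℚP.≤-trans (ν-nonNeg z) h
    z^-ν : ∀ k → ν (z ^ᵍ k) ≤ ρ ^ℚ k
    z^-ν k = ℚP.≤-trans (ν≤Re (^ᵍ-≪ (h , refl) k)) (ℚP.≤-reflexive (cong Re (real-^ ρ k)))
    gc : IsCauchy (psum (ρ ^ℚ_))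
    gc = geometric-cauchy 0≤ρ ρ<1
    gb : Bound (psum (ρ ^ℚ_)) → ∃ λ B → Eventually (λ n → ν (Σᵍ (z ^ᵍ_) n) ≤ B)
    gb (B , _ , b) = B , eventually-map (λ n b → ℚP.≤-trans (Σᵍ-ν z^-ν n) (ℚP.≤-trans (p≤∣p∣ (psum (ρ ^ℚ_) n)) b)) b
    geo : 𝕊
    geo = mk𝕊 (Σᵍ (z ^ᵍ_)) (gb (cauchy⇒bound (psum (ρ ^ℚ_)) gc))
    close-geo : Exp u ≈ geo
    close-geo = mk≈ λ δ 0<δ → eventually-map₂ (λ n e g → subst (λ w → ν (w -ᵍ Σᵍ (z ^ᵍ_) n) ≤ δ) (sym (trans (at-Exp u n) (cong (λ w → expSum w n) e))) g) hu
      (proj₁ (gc δ 0<δ) , λ {n} k → let N , n≤N , b = Composition.error n z h in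
        ℚP.≤-trans b (ℚP.≤-trans (p≤∣p∣ (psum (ρ ^ℚ_) N - psum (ρ ^ℚ_) n)) (proj₂ (gc δ 0<δ) (ℕP.≤-trans k n≤N) k)))
    telescope : ∀ n → Σᵍ (z ^ᵍ_) n *ᵍ (1ᵍ -ᵍ z) ≡ 1ᵍ -ᵍ z ^ᵍ n
    telescope zero = solve 1 (λ z → con 0ᵍ :* (con 1ᵍ :- z) := con 1ᵍ :- con 1ᵍ) refl z
      where open 𝔾-Solver
    telescope (suc n) = trans (G.distribʳ (1ᵍ -ᵍ z) (Σᵍ (z ^ᵍ_) n) (z ^ᵍ n)) (trans (cong (_+ᵍ z ^ᵍ n *ᵍ (1ᵍ -ᵍ z)) (telescope n))
      (solve 2 (λ z p → (con 1ᵍ :- p) :+ p :* (con 1ᵍ :- z) := con 1ᵍ :- z :* p) refl z (z ^ᵍ n)))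
      where open 𝔾-Solver
    at-geo : ∀ n → at (geo *ˢ const (1ᵍ -ᵍ z)) n ≡ 1ᵍ -ᵍ z ^ᵍ n
    at-geo n = trans (at-* geo (const (1ᵍ -ᵍ z)) n)
      (trans (cong (Σᵍ (z ^ᵍ_) n *ᵍ_) (at-const (1ᵍ -ᵍ z) n)) (telescope n))
    geo-inverse : geo *ˢ const (1ᵍ -ᵍ z) ≈ 1ˢ
    geo-inverse = mk≈ λ δ 0<δ → proj₁ (gc δ 0<δ) , λ {n} k → ℚP.≤-trans
      (ℚP.≤-trans (ℚP.≤-reflexive (trans (cong₂ (λ x y → ν (x -ᵍ y)) (at-geo n) (at-const 1ᵍ n))
        (trans (cong ν (solve 1 (λ p → (con 1ᵍ :- p) :- con 1ᵍ := :- p) refl (z ^ᵍ n))) (ν-neg (z ^ᵍ n)))))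
        (ℚP.≤-trans (z^-ν n) (ℚP.≤-reflexive (Q.solve 2 (λ s r → r Q.:= (s Q.:+ r) Q.:- s) refl (psum (ρ ^ℚ_) n) (ρ ^ℚ n)))))
      (ℚP.≤-trans (p≤∣p∣ (psum (ρ ^ℚ_) (suc n) - psum (ρ ^ℚ_) n)) (proj₂ (gc δ 0<δ) (ℕP.m≤n⇒m≤1+n k) k))
      where
      open 𝔾-Solver
      module Q = +-*-Solver

  -- Cosine, sine and arctangent as components, and e^{2πi} = 1.

  κ : ℤ → ℚ
  κ i = i / 1

  κ-+ : ∀ i j → κ (i ℤ.+ j) ≡ κ i + κ j
  κ-+ i j = ℚP.toℚᵘ-injective (ℚᵘP.≃-trans (/-as-ℚᵘ (i ℤ.+ j) 1) (ℚᵘP.≃-sym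
    (ℚᵘP.≃-trans (ℚP.toℚᵘ-homo-+ (κ i) (κ j)) (ℚᵘP.≃-trans (ℚᵘP.+-cong (/-as-ℚᵘ i 1) (/-as-ℚᵘ j 1))
      (ℚᵘ.*≡* (cong (ℤ._* + 1) (cong₂ ℤ._+_ (ℤP.*-identityʳ i) (ℤP.*-identityʳ j))))))))

  κ-neg : ∀ i → κ (ℤ.- i) ≡ - κ i
  κ-neg i = inverseˡ-unique (κ (ℤ.- i)) (κ i) (trans (sym (κ-+ (ℤ.- i) i)) (cong κ (ℤP.+-inverseˡ i)))
    where open import Algebra.Properties.Group ℚP.+-0-group using (inverseˡ-unique)

  κ-ι : ∀ n → κ (+ n) ≡ ι n
  κ-ι n = sym (ι-/ n)

  /-κ : ∀ i d .{{_ : NonZero d}} → i / d ≡ κ i * (+ 1 / d)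
  /-κ (+ a) d = sym (/-unique {a} {d} (trans (ℚP.*-assoc (κ (+ a)) (+ 1 / d) (ι d))
    (trans (cong₂ _*_ (κ-ι a) (/-*ι 1 d)) (ℚP.*-identityʳ (ι a)))))
  /-κ -[1+ a ] d = trans (cong -_ (/-κ (+ suc a) d)) (trans (ℚP.neg-distribˡ-* (κ (+ suc a)) (+ 1 / d))
    (cong (_* (+ 1 / d)) (sym (κ-neg (+ suc a)))))

  sin-suc : ∀ k → sign sinSigns (suc k) ≡ sign cosSigns k
  sin-suc 0 = refl
  sin-suc 1 = refl
  sin-suc 2 = refl
  sin-suc 3 = refl
  sin-suc (suc (suc (suc (suc k)))) = sin-suc k

  cos-suc : ∀ k → sign cosSigns (suc k) ≡ ℤ.- sign sinSigns k
  cos-suc 0 = refl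
  cos-suc 1 = refl
  cos-suc 2 = refl
  cos-suc 3 = refl
  cos-suc (suc (suc (suc (suc k)))) = cos-suc k

  imag : ℚ → 𝔾
  imag y = 0ℚ ⊹ y

  -- The two sign patterns are the real and imaginary parts of iᵏ.
  imag-^ : ∀ y k → imag y ^ᵍ k ≡ (κ (sign cosSigns k) * y ^ℚ k ⊹ κ (sign sinSigns k) * y ^ℚ k)
  imag-^ y zero = refl
  imag-^ y (suc k) = trans (cong (imag y *ᵍ_) (imag-^ y k)) (cong₂ _⊹_
    (trans (solve 4 (λ y c s P → con 0ℚ :* (c :* P) :- y :* (s :* P) := (:- s) :* (y :* P)) refl y (κ (sign cosSigns k)) (κ (sign sinSigns k)) (y ^ℚ k))
      (cong (_* (y * y ^ℚ k)) (trans (sym (κ-neg (sign sinSigns k))) (cong κ (sym (cos-suc k))))))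
    (trans (solve 4 (λ y c s P → con 0ℚ :* (s :* P) :+ y :* (c :* P) := c :* (y :* P)) refl y (κ (sign cosSigns k)) (κ (sign sinSigns k)) (y ^ℚ k))
      (cong (_* (y * y ^ℚ k)) (cong κ (sym (sin-suc k))))))
    where open +-*-Solver

  real-*-⊹ : ∀ a x y → real a *ᵍ (x ⊹ y) ≡ (a * x ⊹ a * y)
  real-*-⊹ a x y = cong₂ _⊹_
    (solve 3 (λ a x y → a :* x :- con 0ℚ :* y := a :* x) refl a x y)
    (solve 3 (λ a x y → a :* y :+ con 0ℚ :* x := a :* y) refl a x y)
    where open +-*-Solver

  term-component : ∀ i d .{{_ : NonZero d}} P → (+ 1 / d) * (κ i * P) ≡ (i / d) * P
  term-component i d P = trans (sym (ℚP.*-assoc (+ 1 / d) (κ i) P))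
    (cong (_* P) (trans (ℚP.*-comm (+ 1 / d) (κ i)) (sym (/-κ i d))))

  Σᵍ-⊹ : ∀ {f a b} → (∀ k → f k ≡ (a k ⊹ b k)) → ∀ n → Σᵍ f n ≡ (psum a n ⊹ psum b n)
  Σᵍ-⊹ h zero = refl
  Σᵍ-⊹ h (suc n) = cong₂ _+ᵍ_ (Σᵍ-⊹ h n) (h n)

  expSum-imag : ∀ t n → expSum (imag t) n ≡ (psum (exp-term cosSigns t) n ⊹ psum (exp-term sinSigns t) n)
  expSum-imag t = Σᵍ-⊹ λ k → trans (cong (real (1/k! k) *ᵍ_) (imag-^ t k))
    (trans (real-*-⊹ (1/k! k) (κ (sign cosSigns k) * t ^ℚ k) (κ (sign sinSigns k) * t ^ℚ k))
      (cong₂ _⊹_ (term-component (sign cosSigns k) (k !) {{k ℕP.!≢0}} (t ^ℚ k)) (term-component (sign sinSigns k) (k !) {{k ℕP.!≢0}} (t ^ℚ k))))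

  Im-logSum : ∀ y (h : ∣ y ∣ < 1ℚ) n → Im (logSum (imag y) n) ≡ seq (arctan y h) n
  Im-logSum y h n = cong Im (Σᵍ-⊹ {b = λ k → (sign sinSigns (suc k) / suc k) * y ^ℚ suc k} (λ k → trans (cong (real (1/suc k) *ᵍ_) (imag-^ y (suc k)))
    (trans (real-*-⊹ (1/suc k) (κ (sign cosSigns (suc k)) * y ^ℚ suc k) (κ (sign sinSigns (suc k)) * y ^ℚ suc k))
      (cong₂ _⊹_ (term-component (sign cosSigns (suc k)) (suc k) (y ^ℚ suc k)) (term-component (sign sinSigns (suc k)) (suc k) (y ^ℚ suc k))))) n)

  conj-+ : ∀ z w → conj (z +ᵍ w) ≡ conj z +ᵍ conj w
  conj-+ z w = cong (Re z + Re w ⊹_) (ℚP.neg-distrib-+ (Im z) (Im w))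

  conj-* : ∀ z w → conj (z *ᵍ w) ≡ conj z *ᵍ conj w
  conj-* (a ⊹ b) (c ⊹ d) = cong₂ _⊹_
    (solve 4 (λ a b c d → a :* c :- b :* d := a :* c :- (:- b) :* (:- d)) refl a b c d)
    (solve 4 (λ a b c d → :- (a :* d :+ b :* c) := a :* (:- d) :+ (:- b) :* c) refl a b c d)
    where open +-*-Solver

  conj-^ : ∀ z k → conj (z ^ᵍ k) ≡ conj z ^ᵍ k
  conj-^ z zero = refl
  conj-^ z (suc k) = trans (conj-* z (z ^ᵍ k)) (cong (conj z *ᵍ_) (conj-^ z k))

  conj-real-* : ∀ q z → conj (real q *ᵍ z) ≡ real q *ᵍ conj z
  conj-real-* q z = conj-* (real q) z

  conj-Σᵍ : ∀ {f g} → (∀ k → conj (f k) ≡ g k) → ∀ n → conj (Σᵍ f n) ≡ Σᵍ g n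
  conj-Σᵍ h zero = refl
  conj-Σᵍ {f} h (suc n) = trans (conj-+ (Σᵍ f n) (f n)) (cong₂ _+ᵍ_ (conj-Σᵍ h n) (h n))

  conj-logSum : ∀ z n → conj (logSum z n) ≡ logSum (conj z) n
  conj-logSum z = conj-Σᵍ λ k → trans (conj-real-* (1/suc k) (z ^ᵍ suc k)) (cong (real (1/suc k) *ᵍ_) (conj-^ z (suc k)))

  conj-expSum : ∀ z n → conj (expSum z n) ≡ expSum (conj z) n
  conj-expSum z = conj-Σᵍ λ k → trans (conj-real-* (1/k! k) (z ^ᵍ k)) (cong (real (1/k! k) *ᵍ_) (conj-^ z k))

  logSeq : ∀ z {ρ} → ν z ≤ ρ → ρ < 1ℚ → 𝕊
  logSeq z {ρ} h ρ<1 = mk𝕊 (logSum z) (step (cauchy⇒bound (psum (ρ ^ℚ_)) (geometric-cauchy (ℚP.≤-trans (ν-nonNeg z) h) ρ<1)))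
    where
    0≤ρ : 0ℚ ≤ ρ
    0≤ρ = ℚP.≤-trans (ν-nonNeg z) h
    bound : ∀ k → ν (real (1/suc k) *ᵍ z ^ᵍ suc k) ≤ ρ ^ℚ k
    bound k = ℚP.≤-trans (ν≤Re (≪-* (real-≪ (1/-nonNeg (suc k))) (^ᵍ-≪ (h , refl) (suc k))))
      (ℚP.≤-trans (ℚP.≤-reflexive (cong Re (trans (cong (real (1/suc k) *ᵍ_) (real-^ ρ (suc k))) (sym (real-* (1/suc k) (ρ ^ℚ suc k))))))
      (ℚP.≤-trans (*-mono (1/-nonNeg (suc k)) (^ℚ-nonNeg 0≤ρ k) (1/d≤1 (suc k)) (ℚP.≤-trans (*-monoˡ (^ℚ-nonNeg 0≤ρ k) (ℚP.<⇒≤ ρ<1)) (ℚP.≤-reflexive (ℚP.*-identityˡ (ρ ^ℚ k)))))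
        (ℚP.≤-reflexive (ℚP.*-identityˡ (ρ ^ℚ k)))))
    step : Bound (psum (ρ ^ℚ_)) → ∃ λ B → Eventually (λ n → ν (logSum z n) ≤ B)
    step (B , _ , b) = B , eventually-map (λ n b → ℚP.≤-trans (Σᵍ-ν bound n) (ℚP.≤-trans (p≤∣p∣ (psum (ρ ^ℚ_) n)) b)) b

  fromℂ : ℂ → 𝕊
  fromℂ z = mk𝕊 (λ n → seq (re z) n ⊹ seq (im z) n)
    (step (cauchy⇒bound (seq (re z)) (cauchy (re z))) (cauchy⇒bound (seq (im z)) (cauchy (im z))))
    where
    step : Bound (seq (re z)) → Bound (seq (im z)) → ∃ λ B → Eventually (λ n → ν (seq (re z) n ⊹ seq (im z) n) ≤ B)
    step (B , _ , b) (C , _ , c) = B + C , eventually-map₂ (λ n b c → ν≤ (seq (re z) n ⊹ seq (im z) n) b c) b c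

  imagSeq : ℝ → 𝕊
  imagSeq x = fromℂ (0ʳ +𝕚 x)

  const-* : ∀ z w → const z *ˢ const w ≈ const (z *ᵍ w)
  const-* z w = ≡⇒≈ λ n → trans (at-* (const z) (const w) n)
    (trans (cong₂ _*ᵍ_ (at-const z n) (at-const w n)) (sym (at-const (z *ᵍ w) n)))

  ν-imag : ∀ y → ν (imag y) ≤ ∣ y ∣
  ν-imag y = ℚP.≤-trans (ν≤ (imag y) (ℚP.≤-refl {∣ 0ℚ ∣}) (ℚP.≤-refl {∣ y ∣})) (ℚP.≤-reflexive (ℚP.+-identityˡ ∣ y ∣))

  -- With L = - log (1 - i y), 2 i arctan y = L - conj L.
  Exp-2i-arctan : ∀ y (h : ∣ y ∣ < 1ℚ) (w v : 𝔾) → (1ᵍ -ᵍ imag y) *ᵍ w ≡ 1ᵍ → (1ᵍ -ᵍ imag (- y)) *ᵍ w ≡ v →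
    Exp (imagSeq (arctan y h +ʳ arctan y h)) ≈ const v
  Exp-2i-arctan y h w v inv value = begin
    Exp U                                 ≈⟨ S.sym (S.*-identityʳ (Exp U)) ⟩
    Exp U *ˢ 1ˢ                           ≈⟨ *ˢ-cong (≈-refl {Exp U}) (S.sym (Exp-log ν-y′ h L̄ (always λ _ → refl))) ⟩
    Exp U *ˢ (Exp L̄ *ˢ C̄)                 ≈⟨ S.sym (S.*-assoc (Exp U) (Exp L̄) C̄) ⟩
    Exp U *ˢ Exp L̄ *ˢ C̄                   ≈⟨ *ˢ-cong (S.sym (Exp-+ U L̄)) (≈-refl {C̄}) ⟩
    Exp (U +ˢ L̄) *ˢ C̄                     ≈⟨ *ˢ-cong (Exp-≡ {U +ˢ L̄} {L} U+L̄) (≈-refl {C̄}) ⟩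
    Exp L *ˢ C̄                            ≈⟨ S.sym (S.*-identityʳ (Exp L *ˢ C̄)) ⟩
    Exp L *ˢ C̄ *ˢ 1ˢ                      ≈⟨ *ˢ-cong (≈-refl {Exp L *ˢ C̄}) (S.sym C*W) ⟩
    Exp L *ˢ C̄ *ˢ (C *ˢ W)                ≈⟨ swap ⟩
    Exp L *ˢ C *ˢ (C̄ *ˢ W)                ≈⟨ *ˢ-cong (Exp-log ν-y h L (always λ _ → refl)) (const-* (1ᵍ -ᵍ imag (- y)) w) ⟩
    1ˢ *ˢ const ((1ᵍ -ᵍ imag (- y)) *ᵍ w) ≈⟨ S.*-identityˡ (const ((1ᵍ -ᵍ imag (- y)) *ᵍ w)) ⟩
    const ((1ᵍ -ᵍ imag (- y)) *ᵍ w)       ≈⟨ S.reflexive (cong const value) ⟩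
    const v                               ∎
    where
    open 𝕊-Reasoning
    U L L̄ C C̄ W : 𝕊
    U = imagSeq (arctan y h +ʳ arctan y h)
    ν-y : ν (imag y) ≤ ∣ y ∣
    ν-y = ν-imag y
    ν-y′ : ν (imag (- y)) ≤ ∣ y ∣
    ν-y′ = ℚP.≤-trans (ν-imag (- y)) (ℚP.≤-reflexive (ℚP.∣-p∣≡∣p∣ y))
    L = logSeq (imag y) ν-y h
    L̄ = logSeq (imag (- y)) ν-y′ h
    C = const (1ᵍ -ᵍ imag y)
    C̄ = const (1ᵍ -ᵍ imag (- y))
    W = const w
    C*W : C *ˢ W ≈ 1ˢ
    C*W = ≈-trans (const-* (1ᵍ -ᵍ imag y) w) (S.reflexive (cong const inv))
    swap : Exp L *ˢ C̄ *ˢ (C *ˢ W) ≈ Exp L *ˢ C *ˢ (C̄ *ˢ W)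
    swap = ≈-trans (S.*-assoc (Exp L) C̄ (C *ˢ W)) (≈-trans (*ˢ-cong (≈-refl {Exp L})
      (≈-trans (S.sym (S.*-assoc C̄ C W)) (≈-trans (*ˢ-cong (S.*-comm C̄ C) (≈-refl {W})) (S.*-assoc C C̄ W))))
      (S.sym (S.*-assoc (Exp L) C (C̄ *ˢ W))))
    add-conj : ∀ z a → Im z ≡ a → (0ℚ ⊹ a + a) +ᵍ conj z ≡ z
    add-conj (x ⊹ y) .y refl = cong₂ _⊹_ (ℚP.+-identityˡ x) (solve 1 (λ y → (y :+ y) :+ :- y := y) refl y)
      where open +-*-Solver
    U+L̄ : ∀ n → at (U +ˢ L̄) n ≡ at L n
    U+L̄ n = trans (at-+ U L̄ n) (trans
      (cong (at U n +ᵍ_) (sym (conj-logSum (imag y) n)))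
      (add-conj (logSum (imag y) n) (seq (arctan y h) n) (Im-logSum y h n)))

  -- The values of (1 + i y) / (1 - i y) are (3 + 4i)/5 at y = 1/2 and (4 + 3i)/5 at y = 1/3. Their
  -- product i is Euler's formula for π/4 in multiplicative form.
  ½-inverse : (1ᵍ -ᵍ imag ½) *ᵍ (+ 4 / 5 ⊹ + 2 / 5) ≡ 1ᵍ
  ½-inverse = refl

  ½-value : (1ᵍ -ᵍ imag (- ½)) *ᵍ (+ 4 / 5 ⊹ + 2 / 5) ≡ (+ 3 / 5 ⊹ + 4 / 5)
  ½-value = refl

  ⅓-inverse : (1ᵍ -ᵍ imag (+ 1 / 3)) *ᵍ (+ 9 / 10 ⊹ + 3 / 10) ≡ 1ᵍ
  ⅓-inverse = refl

  ⅓-value : (1ᵍ -ᵍ imag (- (+ 1 / 3))) *ᵍ (+ 9 / 10 ⊹ + 3 / 10) ≡ (+ 4 / 5 ⊹ + 3 / 5)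
  ⅓-value = refl

  i-product : (+ 3 / 5 ⊹ + 4 / 5) *ᵍ (+ 4 / 5 ⊹ + 3 / 5) ≡ iᵍ
  i-product = refl

  i²-product : (iᵍ *ᵍ iᵍ) *ᵍ (iᵍ *ᵍ iᵍ) ≡ 1ᵍ
  i²-product = refl

  -- `a` and `b` stand for the two arctangents, and `A`, `B`, `T` for i times 2a, 2b and 2π;
  -- `quarter` is iπ/2. With variables in place of closed real numbers nothing can be unfolded
  -- during the computation.
  module Quarter (a b : ℕ → ℚ) (A B T : 𝕊)
    (at-A : ∀ n → at A n ≡ imag (a n + a n)) (at-B : ∀ n → at B n ≡ imag (b n + b n))
    (at-T : ∀ n → at T n ≡ imag (+ 2 / 1 * (+ 4 / 1 * (a n + b n))))
    (Exp-A : Exp A ≈ const (+ 3 / 5 ⊹ + 4 / 5))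
    (Exp-B : Exp B ≈ const (+ 4 / 5 ⊹ + 3 / 5))
    where

    quarter : 𝕊
    quarter = A +ˢ B

    Exp-quarter : Exp quarter ≈ const iᵍ
    Exp-quarter = ≈-trans (Exp-+ A B)
      (≈-trans (*ˢ-cong Exp-A Exp-B)
        (≈-trans (const-* (+ 3 / 5 ⊹ + 4 / 5) (+ 4 / 5 ⊹ + 3 / 5)) (S.reflexive (cong const i-product))))

    at-quarter : ∀ n → at quarter n ≡ imag ((a n + a n) + (b n + b n))
    at-quarter n = trans (at-+ A B n) (trans (cong₂ _+ᵍ_ (at-A n) (at-B n))
      (cong (_⊹ ((a n + a n) + (b n + b n))) (ℚP.+-identityˡ 0ℚ)))

    τ-quarter : ∀ n → at T n ≡ (at quarter n +ᵍ at quarter n) +ᵍ (at quarter n +ᵍ at quarter n)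
    τ-quarter n = trans (at-T n) (trans (lem (a n) (b n)) (cong (λ z → (z +ᵍ z) +ᵍ (z +ᵍ z)) (sym (at-quarter n))))
      where
      open +-*-Solver
      lem′ : ∀ a b → + 2 / 1 * (+ 4 / 1 * (a + b)) ≡ (((a + a) + (b + b)) + ((a + a) + (b + b))) + (((a + a) + (b + b)) + ((a + a) + (b + b)))
      lem′ = solve 2 (λ a b → con (+ 2 / 1) :* (con (+ 4 / 1) :* (a :+ b)) := (((a :+ a) :+ (b :+ b)) :+ ((a :+ a) :+ (b :+ b))) :+ (((a :+ a) :+ (b :+ b)) :+ ((a :+ a) :+ (b :+ b)))) refl
      lem : ∀ a b → imag (+ 2 / 1 * (+ 4 / 1 * (a + b))) ≡
        (imag ((a + a) + (b + b)) +ᵍ imag ((a + a) + (b + b))) +ᵍ (imag ((a + a) + (b + b)) +ᵍ imag ((a + a) + (b + b)))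
      lem a b = cong₂ _⊹_ refl (lem′ a b)

    Exp-τ : Exp T ≈ 1ˢ
    Exp-τ = begin
      Exp T             ≈⟨ Exp-≡ {T} {Q +ˢ Q} (λ n → trans (τ-quarter n)
                                       (sym (trans (at-+ Q Q n) (cong₂ _+ᵍ_ (at-+ quarter quarter n) (at-+ quarter quarter n))))) ⟩
      Exp (Q +ˢ Q)                ≈⟨ Exp-+ Q Q ⟩
      Exp Q *ˢ Exp Q              ≈⟨ *ˢ-cong Exp-Q Exp-Q ⟩
      const (iᵍ *ᵍ iᵍ) *ˢ const (iᵍ *ᵍ iᵍ)  ≈⟨ const-* (iᵍ *ᵍ iᵍ) (iᵍ *ᵍ iᵍ) ⟩
      const ((iᵍ *ᵍ iᵍ) *ᵍ (iᵍ *ᵍ iᵍ))      ≈⟨ S.reflexive (cong const i²-product) ⟩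
      1ˢ                          ∎
      where
      open 𝕊-Reasoning
      Q : 𝕊
      Q = quarter +ˢ quarter
      Exp-Q : Exp Q ≈ const (iᵍ *ᵍ iᵍ)
      Exp-Q = ≈-trans (Exp-+ quarter quarter) (≈-trans (*ˢ-cong Exp-quarter Exp-quarter) (const-* iᵍ iᵍ))

    -- τ stays away from 0 because e^{iτ/4} = i is not close to 1.
    τ-apart : ∃ λ t → 0ℚ < t × Eventually (λ n → t ≤ ∣ Im (at T n) ∣)
    τ-apart = step expSum-near-1
      where
      step : (∃ λ B → 0ℚ < B × Eventually (λ n → ∀ z → ν z ≤ 1ℚ → ν (expSum z n -ᵍ 1ᵍ) ≤ B * ν z)) →
        ∃ λ t → 0ℚ < t × Eventually (λ n → t ≤ ∣ Im (at T n) ∣)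
      step′ : ∀ B → 0ℚ < B → Eventually (λ n → ∀ z → ν z ≤ 1ℚ → ν (expSum z n -ᵍ 1ᵍ) ≤ B * ν z) →
        (∃ λ s → 0ℚ < s × (1ℚ + B) * s ≡ 1ℚ) → ∃ λ t → 0ℚ < t × Eventually (λ n → t ≤ ∣ Im (at T n) ∣)
      step (B , 0<B , near) = step′ B 0<B near (recip-pos (+-pos 0<1 (ℚP.<⇒≤ 0<B)))
      step′ B 0<B near (s , 0<s , 1+Bs) = t , *-pos 0<½ 0<s , eventually-map₂ main near (close Exp-quarter ½ 0<½)
        where
        -- Let x be the size of the approximation to π/2. If x ≤ 1, then ½ ≤ |e^{ix} - 1| ≤ B x,
        -- where ½ is the distance |i - 1| ≥ 1 less the error ½. Dividing by 1 + B instead of B also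
        -- makes t ≤ 1, which settles x ≥ 1.
        t : ℚ
        t = ½ * s
        s≤1 : s ≤ 1ℚ
        s≤1 = subst₂ _≤_ (ℚP.*-identityˡ s) 1+Bs (*-monoˡ {s} {1ℚ} {1ℚ + B} (ℚP.<⇒≤ 0<s) (p≤p+q (ℚP.<⇒≤ 0<B)))
        main : ∀ n → (∀ z → ν z ≤ 1ℚ → ν (expSum z n -ᵍ 1ᵍ) ≤ B * ν z) →
          ν (at (Exp quarter) n -ᵍ at (const iᵍ) n) ≤ ½ → t ≤ ∣ Im (at T n) ∣
        main n f g = ℚP.≤-trans t≤x (ℚP.≤-trans x≤4x (ℚP.≤-reflexive (trans (sym (ℚP.∣p*q∣≡∣p∣*∣q∣ (+ 4 / 1) q)) (cong ∣_∣ (sym (cong Im τq))))))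
          where
          q : ℚ
          q = (a n + a n) + (b n + b n)
          x : ℚ
          x = ∣ q ∣
          four : ∀ q → ((q + q) + (q + q)) ≡ + 4 / 1 * q
          four = solve 1 (λ q → (q :+ q) :+ (q :+ q) := con (+ 4 / 1) :* q) refl
            where open +-*-Solver
          τq : at T n ≡ imag (+ 4 / 1 * q)
          τq = trans (τ-quarter n) (trans (cong (λ z → (z +ᵍ z) +ᵍ (z +ᵍ z)) (at-quarter n)) (cong₂ _⊹_ refl (four q)))
          x≤4x : x ≤ ∣ + 4 / 1 ∣ * x
          x≤4x = ℚP.≤-trans (ℚP.≤-reflexive (sym (ℚP.*-identityˡ x))) (*-monoˡ (ℚP.0≤∣p∣ q) (subst₂ _≤_ (trans (sym (ι-/ 1)) refl) (sym (ι-/ 4)) (ι-mono {1} {4} (s≤s z≤n))))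
          ν-iq : ν (imag q) ≤ x
          ν-iq = ν-imag q
          ½≤ : ½ ≤ ν (expSum (imag q) n -ᵍ 1ᵍ)
          ½≤ = ℚP.≤-trans (ℚP.≤-trans (ℚP.≤-reflexive (sym 1-½)) (ℚP.+-mono-≤ 1≤ (ℚP.neg-antimono-≤ g′))) rearrange
            where
            1-½ : 1ℚ - ½ ≡ ½
            1-½ = refl
            1≤ : 1ℚ ≤ ν (iᵍ -ᵍ 1ᵍ)
            1≤ = ∣Im∣≤ν (iᵍ -ᵍ 1ᵍ)
            g′ : ν (iᵍ -ᵍ expSum (imag q) n) ≤ ½
            g′ = subst (_≤ ½) (trans (cong₂ (λ z w → ν (z -ᵍ w)) (trans (at-Exp quarter n) (cong (λ z → expSum z n) (at-quarter n))) (at-const iᵍ n))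
              (ν-swap (expSum (imag q) n) iᵍ)) g
            cancel : ∀ {u v w} → u ≤ v + w → u - v ≤ w
            cancel {u} {v} {w} h = subst (u - v ≤_) (solve 2 (λ v w → v :+ w :- v := w) refl v w) (ℚP.+-monoˡ-≤ (- v) h)
              where open +-*-Solver
            rearrange : ν (iᵍ -ᵍ 1ᵍ) - ν (iᵍ -ᵍ expSum (imag q) n) ≤ ν (expSum (imag q) n -ᵍ 1ᵍ)
            rearrange = cancel {ν (iᵍ -ᵍ 1ᵍ)} {ν (iᵍ -ᵍ expSum (imag q) n)} {ν (expSum (imag q) n -ᵍ 1ᵍ)} (ν-triangle iᵍ (expSum (imag q) n) 1ᵍ)
          small : x ≤ 1ℚ → t ≤ x
          small x≤1 = begin
            t                ≡⟨ ℚP.*-comm ½ s ⟩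
            s * ½            ≤⟨ *-monoʳ (ℚP.<⇒≤ 0<s) ½≤ ⟩
            s * ν (expSum (imag q) n -ᵍ 1ᵍ) ≤⟨ *-monoʳ (ℚP.<⇒≤ 0<s) (f (imag q) (ℚP.≤-trans ν-iq x≤1)) ⟩
            s * (B * ν (imag q)) ≤⟨ *-monoʳ (ℚP.<⇒≤ 0<s) (*-monoʳ (ℚP.<⇒≤ 0<B) ν-iq) ⟩
            s * (B * x)      ≤⟨ *-monoʳ (ℚP.<⇒≤ 0<s) (*-monoˡ (ℚP.0≤∣p∣ q) (p≤1+p B)) ⟩
            s * ((1ℚ + B) * x) ≡⟨ sym (ℚP.*-assoc s (1ℚ + B) x) ⟩
            s * (1ℚ + B) * x ≡⟨ cong (_* x) (trans (ℚP.*-comm s (1ℚ + B)) 1+Bs) ⟩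
            1ℚ * x           ≡⟨ ℚP.*-identityˡ x ⟩
            x                ∎
            where open ℚP.≤-Reasoning
          large : 1ℚ ≤ x → t ≤ x
          large 1≤x = ℚP.≤-trans (*-mono (ℚP.<⇒≤ 0<½) (ℚP.<⇒≤ 0<1) ½≤1 s≤1) 1≤x
            where
            ½≤1 : ½ ≤ 1ℚ
            ½≤1 = ℚ.*≤* (ℤ.+≤+ (s≤s z≤n))
          t≤x : t ≤ x
          t≤x = [ small , large ]′ (ℚP.≤-total x 1ℚ)

  h½ : ∣ ½ ∣ < 1ℚ
  h½ = ℚ.*<* (ℤ.+<+ ℕP.≤-refl)

  h⅓ : ∣ + 1 / 3 ∣ < 1ℚ
  h⅓ = ℚ.*<* (ℤ.+<+ (ℕP.m≤n+m 2 1))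

  Angle : 𝕊
  Angle = imagSeq (fromℚ (+ 2 / 1) *ʳ π)

  at-Angle : ∀ n → at Angle n ≡ imag (+ 2 / 1 * (+ 4 / 1 * (seq (arctan ½ h½) n + seq (arctan (+ 1 / 3) h⅓) n)))
  at-Angle n = refl

  Exp-½ : Exp (imagSeq (arctan ½ h½ +ʳ arctan ½ h½)) ≈ const (+ 3 / 5 ⊹ + 4 / 5)
  Exp-½ = Exp-2i-arctan ½ h½ (+ 4 / 5 ⊹ + 2 / 5) (+ 3 / 5 ⊹ + 4 / 5) ½-inverse ½-value

  Exp-⅓ : Exp (imagSeq (arctan (+ 1 / 3) h⅓ +ʳ arctan (+ 1 / 3) h⅓)) ≈ const (+ 4 / 5 ⊹ + 3 / 5)
  Exp-⅓ = Exp-2i-arctan (+ 1 / 3) h⅓ (+ 9 / 10 ⊹ + 3 / 10) (+ 4 / 5 ⊹ + 3 / 5) ⅓-inverse ⅓-value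

  Exp-Angle : Exp Angle ≈ 1ˢ
  Exp-Angle = Quarter.Exp-τ (seq (arctan ½ h½)) (seq (arctan (+ 1 / 3) h⅓))
    (imagSeq (arctan ½ h½ +ʳ arctan ½ h½)) (imagSeq (arctan (+ 1 / 3) h⅓ +ʳ arctan (+ 1 / 3) h⅓)) Angle
    (λ _ → refl) (λ _ → refl) at-Angle Exp-½ Exp-⅓

  Angle-apart : ∃ λ t → 0ℚ < t × Eventually (λ n → t ≤ ∣ Im (at Angle n) ∣)
  Angle-apart = Quarter.τ-apart (seq (arctan ½ h½)) (seq (arctan (+ 1 / 3) h⅓))
    (imagSeq (arctan ½ h½ +ʳ arctan ½ h½)) (imagSeq (arctan (+ 1 / 3) h⅓ +ʳ arctan (+ 1 / 3) h⅓)) Angle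
    (λ _ → refl) (λ _ → refl) at-Angle Exp-½ Exp-⅓

  -- The characters e_p, and the gap between e_p(1) and 1.

  ∣p∣*∣p∣≡p*p : ∀ p → ∣ p ∣ * ∣ p ∣ ≡ p * p
  ∣p∣*∣p∣≡p*p p = [ (λ e → cong₂ _*_ e e) , (λ e → trans (cong₂ _*_ e e) (lem p)) ]′ (ℚP.∣p∣≡p∨∣p∣≡-p p)
    where
    open +-*-Solver
    lem : ∀ p → - p * - p ≡ p * p
    lem = solve 1 (λ p → :- p :* :- p := p :* p) refl

  opaque
    unfolding _+ˢ_
    conjˢ-cong : ∀ {u v} → u ≈ v → conjˢ u ≈ conjˢ v
    conjˢ-cong {u} {v} h = mk≈ λ δ 0<δ → eventually-map (λ n → subst (_≤ δ)
      (trans (sym (ν-conj (at u n -ᵍ at v n))) (cong ν (trans (conj-+ (at u n) (-ᵍ at v n)) refl)))) (close h δ 0<δ)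

    conjˢ-+ : ∀ u v → conjˢ (u +ˢ v) ≈ conjˢ u +ˢ conjˢ v
    conjˢ-+ u v = ≡⇒≈ λ n → conj-+ (at u n) (at v n)

    conjˢ-* : ∀ u v → conjˢ (u *ˢ v) ≈ conjˢ u *ˢ conjˢ v
    conjˢ-* u v = ≡⇒≈ λ n → conj-* (at u n) (at v n)

    conjˢ-0 : conjˢ 0ˢ ≈ 0ˢ
    conjˢ-0 = ≡⇒≈ λ n → refl

  opaque
    unfolding _+ˢ_
    -- Multiplying by the conjugate of `w` replaces it by |w|² ≥ g², a positive rational that can be
    -- divided out at each index.
    cancel-apart : ∀ {z w g} → 0ℚ < g → Eventually (λ n → g ≤ Re (at w n)) → z *ˢ w ≈ 0ˢ → z ≈ 0ˢ
    cancel-apart {z} {w} {g} 0<g apart zw≈0 = mk≈ λ δ 0<δ → eventually-map₂ (λ n a b →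
        *-cancelˡ (*-pos 0<g 0<g) (ℚP.≤-trans (*-monoˡ (ν-nonNeg (at z n -ᵍ 0ᵍ)) (g²≤ n a)) (ℚP.≤-trans (scale n) b)))
      apart (close zwc≈0 (g * g * δ) (*-pos (*-pos 0<g 0<g) 0<δ))
      where
      zwc≈0 : z *ˢ w *ˢ conjˢ w ≈ 0ˢ
      zwc≈0 = ≈-trans (*ˢ-cong zw≈0 (≈-refl {conjˢ w})) (S.zeroˡ (conjˢ w))
      N : ℕ → ℚ
      N n = Re (at w n) * Re (at w n) + Im (at w n) * Im (at w n)
      sq-nonNeg : ∀ x → 0ℚ ≤ x * x
      sq-nonNeg x = subst (0ℚ ≤_) (∣p∣*∣p∣≡p*p x) (*-nonNeg (ℚP.0≤∣p∣ x) (ℚP.0≤∣p∣ x))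
      g²≤ : ∀ n → g ≤ Re (at w n) → g * g ≤ N n
      g²≤ n a = ℚP.≤-trans (*-mono (ℚP.<⇒≤ 0<g) (ℚP.≤-trans (ℚP.<⇒≤ 0<g) a) a a) (p≤p+q (sq-nonNeg (Im (at w n))))
      eq : ∀ a b c d → real (c * c + d * d) *ᵍ ((a ⊹ b) -ᵍ 0ᵍ) ≡ ((a ⊹ b) *ᵍ (c ⊹ d)) *ᵍ (c ⊹ - d) -ᵍ 0ᵍ
      eq a b c d = trans (cong (real (c * c + d * d) *ᵍ_) (G.+-identityʳ (a ⊹ b))) (trans (real-*-⊹ (c * c + d * d) a b) (trans (cong₂ _⊹_
        (solve 4 (λ a b c d → (c :* c :+ d :* d) :* a := (a :* c :- b :* d) :* c :- (a :* d :+ b :* c) :* (:- d)) refl a b c d)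
        (solve 4 (λ a b c d → (c :* c :+ d :* d) :* b := (a :* c :- b :* d) :* (:- d) :+ (a :* d :+ b :* c) :* c) refl a b c d))
        (sym (G.+-identityʳ (((a ⊹ b) *ᵍ (c ⊹ d)) *ᵍ (c ⊹ - d))))))
        where open +-*-Solver
      scale : ∀ n → N n * ν (at z n -ᵍ 0ᵍ) ≤ ν (at z n *ᵍ at w n *ᵍ conj (at w n) -ᵍ 0ᵍ)
      scale n = ℚP.≤-trans (ℚP.≤-reflexive (sym (ν-real-* (ℚP.+-mono-≤ (sq-nonNeg (Re (at w n))) (sq-nonNeg (Im (at w n)))) (at z n -ᵍ 0ᵍ))))
        (ℚP.≤-reflexive (cong ν (eq (Re (at z n)) (Im (at z n)) (Re (at w n)) (Im (at w n)))))

  opaque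
    Angle-bounded : ∃ λ P → Eventually (λ n → ∣ Im (at Angle n) ∣ ≤ ι P)
    Angle-bounded = step (cauchy⇒bound (seq (fromℚ (+ 2 / 1) *ʳ π)) (cauchy (fromℚ (+ 2 / 1) *ʳ π)))
      where
      step : Bound (seq (fromℚ (+ 2 / 1) *ʳ π)) → ∃ λ P → Eventually (λ n → ∣ Im (at Angle n) ∣ ≤ ι P)
      step (B , _ , b) = proj₁ (archimedean B) , eventually-map (λ n h → ℚP.≤-trans h (proj₂ (archimedean B))) b

  opaque
    -- An integer above almost all approximations to 2π, so that 2π/p is at most 1 once p ≥ `P₀`.
    -- Opaque, so that the number is never computed.
    P₀ : ℕ
    P₀ = proj₁ Angle-bounded

    τ-bound : Eventually (λ n → ∣ Im (at Angle n) ∣ ≤ ι P₀)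
    τ-bound = proj₂ Angle-bounded

  -- A geometric majorant for the tail of the cosine series after its quadratic term.
  1/k!-bound : ∀ j → 1/k! (3 ℕ.+ j) ≤ + 1 / 6 * ½ ^ℚ j
  1/k!-bound zero = ℚP.≤-reflexive (sym (ℚP.*-identityʳ (+ 1 / 6)))
  1/k!-bound (suc j) = ℚP.≤-trans
    (*-cancelˡ {+ 2 / 1} (ℚP.positive⁻¹ (+ 2 / 1)) (begin
      + 2 / 1 * 1/k! (4 ℕ.+ j)         ≤⟨ *-monoˡ (1/k!-nonNeg (4 ℕ.+ j)) (subst (_≤ ι (4 ℕ.+ j)) (ι-/ 2) (ι-mono {2} {4 ℕ.+ j} (s≤s (s≤s z≤n)))) ⟩
      ι (4 ℕ.+ j) * 1/k! (4 ℕ.+ j)     ≡⟨ trans (ℚP.*-comm (ι (4 ℕ.+ j)) (1/k! (4 ℕ.+ j))) (1/k!-step (3 ℕ.+ j)) ⟩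
      1/k! (3 ℕ.+ j)                   ≡⟨ lem (1/k! (3 ℕ.+ j)) ⟩
      + 2 / 1 * (½ * 1/k! (3 ℕ.+ j))   ∎))
    (ℚP.≤-trans (*-monoʳ (ℚP.<⇒≤ 0<½) (1/k!-bound j)) (ℚP.≤-reflexive (lem′ (½ ^ℚ j))))
    where
    open ℚP.≤-Reasoning
    open +-*-Solver
    lem : ∀ x → x ≡ + 2 / 1 * (½ * x)
    lem = solve 1 (λ x → x := con (+ 2 / 1) :* (con ½ :* x)) refl
    lem′ : ∀ x → ½ * (+ 1 / 6 * x) ≡ + 1 / 6 * (½ * x)
    lem′ = solve 1 (λ x → con ½ :* (con (+ 1 / 6) :* x) := con (+ 1 / 6) :* (con ½ :* x)) refl

  -- The terms after 1 - c²/2 add up to at most c² ∑ (1/6) 2⁻ʲ = c²/3. The last summand is the part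
  -- of this allowance not yet spent after j terms.
  cos-upper : ∀ c → ∣ c ∣ ≤ 1ℚ → ∀ j → psum (exp-term cosSigns c) (3 ℕ.+ j) ≤ 1ℚ - c * c * (+ 1 / 6) - c * c * (+ 1 / 3 * ½ ^ℚ j)
  cos-upper c h zero = ℚP.≤-reflexive (lem c)
    where
    open +-*-Solver
    lem : ∀ c → psum (exp-term cosSigns c) 3 ≡ 1ℚ - c * c * (+ 1 / 6) - c * c * (+ 1 / 3 * 1ℚ)
    lem = solve 1 (λ c → ((con 0ℚ :+ con 1ℚ :* con 1ℚ) :+ con 0ℚ :* (c :* con 1ℚ)) :+ con (- ½) :* (c :* (c :* con 1ℚ)) :=
      con 1ℚ :- c :* c :* con (+ 1 / 6) :- c :* c :* (con (+ 1 / 3) :* con 1ℚ)) refl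
  cos-upper c h (suc j) = ℚP.≤-trans (ℚP.+-mono-≤ (cos-upper c h j) term≤) (ℚP.≤-reflexive (lem (c * c) (½ ^ℚ j)))
    where
    open +-*-Solver
    lem : ∀ w x → (1ℚ - w * (+ 1 / 6) - w * (+ 1 / 3 * x)) + (+ 1 / 6 * x) * w ≡ 1ℚ - w * (+ 1 / 6) - w * (+ 1 / 3 * (½ * x))
    lem = solve 2 (λ w x → (con 1ℚ :- w :* con (+ 1 / 6) :- w :* (con (+ 1 / 3) :* x)) :+ (con (+ 1 / 6) :* x) :* w :=
      con 1ℚ :- w :* con (+ 1 / 6) :- w :* (con (+ 1 / 3) :* (con ½ :* x))) refl
    k : ℕ
    k = 3 ℕ.+ j
    w≥0 : 0ℚ ≤ c * c
    w≥0 = subst (0ℚ ≤_) (∣p∣*∣p∣≡p*p c) (*-nonNeg (ℚP.0≤∣p∣ c) (ℚP.0≤∣p∣ c))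
    pow : ∣ c ^ℚ k ∣ ≤ c * c
    pow = begin
      ∣ c * (c * c ^ℚ (1 ℕ.+ j)) ∣       ≡⟨ cong ∣_∣ (sym (ℚP.*-assoc c c (c ^ℚ (1 ℕ.+ j)))) ⟩
      ∣ c * c * c ^ℚ (1 ℕ.+ j) ∣         ≡⟨ ℚP.∣p*q∣≡∣p∣*∣q∣ (c * c) (c ^ℚ (1 ℕ.+ j)) ⟩
      ∣ c * c ∣ * ∣ c ^ℚ (1 ℕ.+ j) ∣     ≡⟨ cong (_* ∣ c ^ℚ (1 ℕ.+ j) ∣) (ℚP.0≤p⇒∣p∣≡p w≥0) ⟩
      c * c * ∣ c ^ℚ (1 ℕ.+ j) ∣         ≤⟨ *-monoʳ w≥0 (ℚP.≤-trans (∣^ℚ∣-≤ h (1 ℕ.+ j)) (ℚP.≤-reflexive (1^ℚ (1 ℕ.+ j)))) ⟩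
      c * c * 1ℚ                         ≡⟨ ℚP.*-identityʳ (c * c) ⟩
      c * c                              ∎
      where open ℚP.≤-Reasoning
    term≤ : exp-term cosSigns c k ≤ (+ 1 / 6 * ½ ^ℚ j) * (c * c)
    term≤ = begin
      exp-coeff cosSigns k * c ^ℚ k          ≤⟨ p≤∣p∣ (exp-coeff cosSigns k * c ^ℚ k) ⟩
      ∣ exp-coeff cosSigns k * c ^ℚ k ∣      ≡⟨ ℚP.∣p*q∣≡∣p∣*∣q∣ (exp-coeff cosSigns k) (c ^ℚ k) ⟩
      ∣ exp-coeff cosSigns k ∣ * ∣ c ^ℚ k ∣  ≤⟨ *-mono (ℚP.0≤∣p∣ (exp-coeff cosSigns k)) w≥0 (∣sign/d∣ cosSigns k (k !) {{k ℕP.!≢0}}) pow ⟩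
      1/k! k * (c * c)                       ≤⟨ *-monoˡ w≥0 (1/k!-bound j) ⟩
      (+ 1 / 6 * ½ ^ℚ j) * (c * c)           ∎
      where open ℚP.≤-Reasoning

  Re-expSum-upper : ∀ c → ∣ c ∣ ≤ 1ℚ → ∀ n → 3 ℕ.≤ n → Re (expSum (imag c) n) ≤ 1ℚ - c * c * (+ 1 / 6)
  Re-expSum-upper c h (suc zero) (s≤s ())
  Re-expSum-upper c h (suc (suc zero)) (s≤s (s≤s ()))
  Re-expSum-upper c h (suc (suc (suc j))) _ = ℚP.≤-trans (ℚP.≤-reflexive (cong Re (expSum-imag c (3 ℕ.+ j))))
    (ℚP.≤-trans (cos-upper c h j) (≤-of-0≤- (subst (0ℚ ≤_) (sym (lem (1ℚ - c * c * (+ 1 / 6)) (c * c * (+ 1 / 3 * ½ ^ℚ j))))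
      (*-nonNeg (subst (0ℚ ≤_) (∣p∣*∣p∣≡p*p c) (*-nonNeg (ℚP.0≤∣p∣ c) (ℚP.0≤∣p∣ c)))
        (*-nonNeg (1/-nonNeg 3) (^ℚ-nonNeg (ℚP.<⇒≤ 0<½) j))))))
    where
    open +-*-Solver
    lem : ∀ x y → x - (x - y) ≡ y
    lem = solve 2 (λ x y → x :- (x :- y) := y) refl

  -- Here q approximates 2π and r = 1/p, so c = q r lies between t r and 1 in size and 1 - cos c ≥
  -- c²/6 applies. The factor `1ℚ * r` is the shape of `turn (+ 1)`.
  expSum-apart : ∀ q r t → 0ℚ < t → 0ℚ < r → t ≤ ∣ q ∣ → ∣ q ∣ * r ≤ 1ℚ → ∀ n → 3 ℕ.≤ n →
    (t * r) * (t * r) * (+ 1 / 6) ≤ 1ℚ + - Re (expSum (imag (q * (1ℚ * r))) n)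
  expSum-apart q r t 0<t 0<r a b n h = ℚP.≤-trans (*-monoˡ (1/-nonNeg 6) sq) (flip (Re-expSum-upper c (ℚP.≤-trans (ℚP.≤-reflexive ∣c∣) b) n h))
    where
    c : ℚ
    c = q * (1ℚ * r)
    ∣c∣ : ∣ c ∣ ≡ ∣ q ∣ * r
    ∣c∣ = trans (ℚP.∣p*q∣≡∣p∣*∣q∣ q (1ℚ * r)) (cong (∣ q ∣ *_) (trans (cong ∣_∣ (ℚP.*-identityˡ r)) (ℚP.0≤p⇒∣p∣≡p (ℚP.<⇒≤ 0<r))))
    tr≤ : t * r ≤ ∣ c ∣
    tr≤ = ℚP.≤-trans (*-monoˡ (ℚP.<⇒≤ 0<r) a) (ℚP.≤-reflexive (sym ∣c∣))
    sq : (t * r) * (t * r) ≤ c * c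
    sq = ℚP.≤-trans (*-mono (ℚP.<⇒≤ (*-pos 0<t 0<r)) (ℚP.0≤∣p∣ c) tr≤ tr≤) (ℚP.≤-reflexive (∣p∣*∣p∣≡p*p c))
    flip : ∀ {x y} → x ≤ 1ℚ - y → y ≤ 1ℚ + - x
    flip {x} {y} l = subst₂ _≤_ (lem x y) (lem′ x y) (ℚP.+-monoˡ-≤ (y - x) l)
      where
      open +-*-Solver
      lem : ∀ x y → x + (y - x) ≡ y
      lem = solve 2 (λ x y → x :+ (y :- x) := y) refl
      lem′ : ∀ x y → 1ℚ - y + (y - x) ≡ 1ℚ + - x
      lem′ = solve 2 (λ x y → con 1ℚ :- y :+ (y :- x) := con 1ℚ :+ :- x) refl

  module Additive (p : ℕ) .{{_ : NonZero p}} where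

    -- As a multiple of 1/p, the fraction α/p is additive in α by a ring identity; `/-κ` connects it
    -- with the quotient used in `e`.
    turn : ℤ → ℚ
    turn α = κ α * (+ 1 / p)

    angle : ℤ → 𝕊
    angle α = imagSeq ((fromℚ (+ 2 / 1) *ʳ π) *ʳ fromℚ (turn α))

    τ : ℕ → ℚ
    τ n = seq (fromℚ (+ 2 / 1) *ʳ π) n

    opaque
      𝐞 : ℤ → 𝕊
      𝐞 α = Exp (angle α)

      at-𝐞 : ∀ α n → at (𝐞 α) n ≡ expSum (imag (τ n * turn α)) n
      at-𝐞 α n = at-Exp (angle α) n

      𝐞-+ : ∀ α β → 𝐞 (α ℤ.+ β) ≈ 𝐞 α *ˢ 𝐞 β
      𝐞-+ α β = ≈-trans (Exp-≡ {angle (α ℤ.+ β)} {angle α +ˢ angle β} λ n →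
        trans (lem (τ n)) (sym (at-+ (angle α) (angle β) n))) (Exp-+ (angle α) (angle β))
        where
        open +-*-Solver
        lem′ : ∀ t a b r → t * ((a + b) * r) ≡ t * (a * r) + t * (b * r)
        lem′ = solve 4 (λ t a b r → t :* ((a :+ b) :* r) := t :* (a :* r) :+ t :* (b :* r)) refl
        lem : ∀ t → imag (t * turn (α ℤ.+ β)) ≡ imag (t * turn α) +ᵍ imag (t * turn β)
        lem t = cong₂ _⊹_ (sym (ℚP.+-identityˡ 0ℚ)) (trans (cong (λ x → t * (x * (+ 1 / p))) (κ-+ α β)) (lem′ t (κ α) (κ β) (+ 1 / p)))

      𝐞-0 : 𝐞 (+ 0) ≈ 1ˢ
      𝐞-0 = Exp-null {angle (+ 0)} (≡⇒≈ λ n → trans (cong imag (lem (τ n) (+ 1 / p))) (sym (at-const 0ᵍ n)))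
        where
        open +-*-Solver
        lem : ∀ t r → t * (0ℚ * r) ≡ 0ℚ
        lem = solve 2 (λ t r → t :* (con 0ℚ :* r) := con 0ℚ) refl

      𝐞-p : 𝐞 (+ p) ≈ 1ˢ
      𝐞-p = ≈-trans (Exp-≡ {angle (+ p)} {Angle} λ n → cong imag (trans (cong (τ n *_) turn-p) (ℚP.*-identityʳ (τ n)))) Exp-Angle
        where
        turn-p : turn (+ p) ≡ 1ℚ
        turn-p = trans (cong (_* (+ 1 / p)) (κ-ι p)) (trans (ℚP.*-comm (ι p) (+ 1 / p)) (/-*ι 1 p))

      conj-𝐞 : ∀ α → conjˢ (𝐞 α) ≈ 𝐞 (ℤ.- α)
      conj-𝐞 α = ≡⇒≈ λ n → trans (at-conj (𝐞 α) n) (trans (cong conj (at-𝐞 α n)) (trans (conj-expSum (imag (τ n * turn α)) n)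
        (trans (cong (λ x → expSum (imag x) n) (lem (τ n))) (sym (at-𝐞 (ℤ.- α) n)))))
        where
        open +-*-Solver
        lem′ : ∀ t a r → - (t * (a * r)) ≡ t * (- a * r)
        lem′ = solve 3 (λ t a r → :- (t :* (a :* r)) := t :* (:- a :* r)) refl
        lem : ∀ t → - (t * turn α) ≡ t * turn (ℤ.- α)
        lem t = trans (lem′ t (κ α) (+ 1 / p)) (cong (λ x → t * (x * (+ 1 / p))) (sym (κ-neg α)))

      -- In `e` the real part of the exponent is an approximation times 0, whose exponential series
      -- equals 1 as soon as its first term is included; hence agreement from index 1 on.
      fromℂ-e : ∀ α → fromℂ (e p α) ≈ 𝐞 α
      fromℂ-e α = eventually-≡⇒≈ (1 , λ {n} h → trans (cong₂ _⊹_ (comp cosSigns n h) (comp sinSigns n h)) (sym (trans (at-𝐞 α n) (expSum-imag (τ n * turn α) n))))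
        where
        one : ∀ t n → 1 ℕ.≤ n → psum (exp-term ones (t * 0ℚ)) n ≡ 1ℚ
        one t (suc zero) _ = refl
        one t (suc (suc n)) _ = trans (cong₂ _+_ (one t (suc n) (s≤s z≤n)) (trans (cong (exp-coeff ones (suc n) *_)
          (trans (cong (_* (t * 0ℚ) ^ℚ n) (ℚP.*-zeroʳ t)) (ℚP.*-zeroˡ ((t * 0ℚ) ^ℚ n)))) (ℚP.*-zeroʳ (exp-coeff ones (suc n))))) (ℚP.+-identityʳ 1ℚ)
        comp : ∀ s n → 1 ℕ.≤ n → psum (exp-term ones (τ n * (α / p) * 0ℚ)) n * psum (exp-term s (τ n * (α / p) * 1ℚ)) n ≡ psum (exp-term s (τ n * turn α)) n
        comp s n h = trans (cong₂ _*_ (one (τ n * (α / p)) n h) (cong (λ x → psum (exp-term s x) n)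
          (trans (ℚP.*-identityʳ (τ n * (α / p))) (cong (τ n *_) (/-κ α p))))) (ℚP.*-identityˡ (psum (exp-term s (τ n * turn α)) n))

    𝐞-inverse : ∀ α → 𝐞 α *ˢ 𝐞 (ℤ.- α) ≈ 1ˢ
    𝐞-inverse α = ≈-trans (≈-sym (𝐞-+ α (ℤ.- α))) (≈-trans (S.reflexive (cong 𝐞 (ℤP.+-inverseʳ α))) 𝐞-0)

    𝐞-multiple⁺ : ∀ k → 𝐞 (+ k ℤ.* + p) ≈ 1ˢ
    𝐞-multiple⁺ zero = 𝐞-0
    𝐞-multiple⁺ (suc k) = ≈-trans (S.reflexive (cong 𝐞 (ℤP.suc-* (+ k) (+ p)))) (≈-trans (𝐞-+ (+ p) (+ k ℤ.* + p))
      (≈-trans (*ˢ-cong 𝐞-p (𝐞-multiple⁺ k)) (S.*-identityˡ 1ˢ)))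

    𝐞-multiple : ∀ k → 𝐞 (k ℤ.* + p) ≈ 1ˢ
    𝐞-multiple (+ k) = 𝐞-multiple⁺ k
    𝐞-multiple -[1+ k ] = ≈-trans (≈-sym (S.*-identityˡ (𝐞 (-[1+ k ] ℤ.* + p))))
      (≈-trans (*ˢ-cong (≈-sym (𝐞-multiple⁺ (suc k))) (≈-refl {𝐞 (-[1+ k ] ℤ.* + p)}))
      (≈-trans (*ˢ-cong (≈-refl {𝐞 (+ suc k ℤ.* + p)}) (S.reflexive (cong 𝐞 (sym (ℤP.neg-distribˡ-* (+ suc k) (+ p)))))) (𝐞-inverse (+ suc k ℤ.* + p))))

    𝐞-cong : ∀ {α β} → + p ℤD.∣ (α ℤ.- β) → 𝐞 α ≈ 𝐞 β
    𝐞-cong {α} {β} h with ∣ᵤ⇒∣ {+ p} {α ℤ.- β} h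
    ... | divides k eq = ≈-trans (S.reflexive (cong 𝐞 α≡)) (≈-trans (𝐞-+ (k ℤ.* + p) β)
      (≈-trans (*ˢ-cong (𝐞-multiple k) (≈-refl {𝐞 β})) (S.*-identityˡ (𝐞 β))))
      where
      α≡ : α ≡ k ℤ.* + p ℤ.+ β
      α≡ = trans (sym (trans (ℤP.+-assoc α (ℤ.- β) β) (trans (cong (ℤ._+_ α) (ℤP.+-inverseˡ β)) (ℤP.+-identityʳ α)))) (cong (ℤ._+ β) eq)

    -- The lower bound t for |2π| makes the angle at least t/p, and `P₀ ≤ p` brings it down to at
    -- most 1.
    𝐞-apart : P₀ ℕ.≤ p → ∃ λ g → 0ℚ < g × Eventually (λ n → g ≤ Re (at (1ˢ +ˢ -ˢ 𝐞 (+ 1)) n))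
    𝐞-apart P≤p = step Angle-apart
      where
      r : ℚ
      r = + 1 / p
      0<r : 0ℚ < r
      0<r = ℚP.positive⁻¹ r {{ℚP.normalize-pos 1 p}}
      at-gap : ∀ n → at (1ˢ +ˢ -ˢ 𝐞 (+ 1)) n ≡ 1ᵍ +ᵍ -ᵍ expSum (imag (τ n * turn (+ 1))) n
      at-gap n = trans (at-+ 1ˢ (-ˢ 𝐞 (+ 1)) n) (cong₂ _+ᵍ_ (at-const 1ᵍ n) (trans (at-neg (𝐞 (+ 1)) n) (cong (λ z → -ᵍ z) (at-𝐞 (+ 1) n))))
      step : (∃ λ t → 0ℚ < t × Eventually (λ n → t ≤ ∣ Im (at Angle n) ∣)) →
        ∃ λ g → 0ℚ < g × Eventually (λ n → g ≤ Re (at (1ˢ +ˢ -ˢ 𝐞 (+ 1)) n))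
      step (t , 0<t , apart) = (t * r) * (t * r) * (+ 1 / 6) , *-pos (*-pos (*-pos 0<t 0<r) (*-pos 0<t 0<r)) (ℚP.positive⁻¹ (+ 1 / 6)) ,
        eventually-map₂ (λ n f h → f h) (eventually-map₂ (λ n a b h → subst (λ z → (t * r) * (t * r) * (+ 1 / 6) ≤ Re z) (sym (at-gap n))
          (expSum-apart (τ n) r t 0<t 0<r a (ℚP.≤-trans (*-monoˡ (ℚP.<⇒≤ 0<r) (ℚP.≤-trans b (ι-mono P≤p)))
            (ℚP.≤-reflexive (trans (ℚP.*-comm (ι p) r) (/-*ι 1 p)))) n h)) apart τ-bound) (3 , λ h → h)

  -- Inequalities between real parts, and bounds for moduli.

  infix 4 _≲_
  record _≲_ (u v : 𝕊) : Set where
    constructor mk≲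
    field below : ∀ δ → 0ℚ < δ → Eventually (λ n → Re (at u n) ≤ Re (at v n) + δ)
  open _≲_ public

  ≈⇒≲ : ∀ {u v} → u ≈ v → u ≲ v
  ≈⇒≲ {u} {v} h = mk≲ λ δ 0<δ → eventually-map (λ n a → lem {Re (at u n)} {Re (at v n)}
    (ℚP.≤-trans (p≤∣p∣ (Re (at u n) - Re (at v n))) (ℚP.≤-trans (∣Re∣≤ν (at u n -ᵍ at v n)) a))) (close h δ 0<δ)
    where
    lem : ∀ {x y δ} → x - y ≤ δ → x ≤ y + δ
    lem {x} {y} {δ} h = subst (_≤ y + δ) (solve 2 (λ x y → y :+ (x :- y) := x) refl x y) (ℚP.+-monoʳ-≤ y h)
      where open +-*-Solver

  ≲-trans : ∀ {u v w} → u ≲ v → v ≲ w → u ≲ w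
  ≲-trans {u} {v} {w} h g = mk≲ λ δ 0<δ → eventually-map₂ (λ n a b → ℚP.≤-trans a (ℚP.≤-trans (ℚP.+-monoˡ-≤ (δ * ½) b)
    (ℚP.≤-reflexive (trans (ℚP.+-assoc (Re (at w n)) (δ * ½) (δ * ½)) (cong (λ x → Re (at w n) + x) (half-split δ))))))
    (below h (δ * ½) (half δ 0<δ)) (below g (δ * ½) (half δ 0<δ))

  N : 𝕊 → 𝕊
  N u = u *ˢ conjˢ u

  normSq : 𝔾 → ℚ
  normSq z = Re z * Re z + Im z * Im z

  sq-nonNeg : ∀ x → 0ℚ ≤ x * x
  sq-nonNeg x = subst (0ℚ ≤_) (∣p∣*∣p∣≡p*p x) (*-nonNeg (ℚP.0≤∣p∣ x) (ℚP.0≤∣p∣ x))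

  normSq-nonNeg : ∀ z → 0ℚ ≤ normSq z
  normSq-nonNeg z = +-nonNeg (sq-nonNeg (Re z)) (sq-nonNeg (Im z))

  ιˢ : ℕ → 𝕊
  ιˢ k = const (ιᵍ k)

  scale : ℚ → 𝕊 → 𝕊
  scale q u = const (real q) *ˢ u

  module 𝕊Σ = Summation S.+-commutativeMonoid
  open 𝕊Σ using () renaming (Σ to ∑ˢ; when to whenˢ)

  opaque
    unfolding _+ˢ_

    Re-N : ∀ u n → Re (at (N u) n) ≡ normSq (at u n)
    Re-N u n = solve 2 (λ a b → a :* a :- b :* (:- b) := a :* a :+ b :* b) refl (Re (at u n)) (Im (at u n))
      where open +-*-Solver

    Re-scale : ∀ q u n → Re (at (scale q u) n) ≡ q * Re (at u n)
    Re-scale q u n = cong Re (real-*-⊹ q (Re (at u n)) (Im (at u n)))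

    Re-ιˢ : ∀ k n → Re (at (ιˢ k) n) ≡ ι k
    Re-ιˢ k n = refl

    ≲-pointwise : ∀ {u v} → (∀ n → Re (at u n) ≤ Re (at v n)) → u ≲ v
    ≲-pointwise {u} {v} h = mk≲ λ δ 0<δ → always λ n → ℚP.≤-trans (h n) (p≤p+q (ℚP.<⇒≤ 0<δ))

    +ˢ-mono-≲ : ∀ {u u′ v v′} → u ≲ u′ → v ≲ v′ → u +ˢ v ≲ u′ +ˢ v′
    +ˢ-mono-≲ {u} {u′} {v} {v′} h g = mk≲ λ δ 0<δ → eventually-map₂ (λ n a b →
      ℚP.≤-trans (ℚP.+-mono-≤ a b) (ℚP.≤-reflexive (trans (lem (Re (at u′ n)) (δ * ½) (Re (at v′ n)) (δ * ½))
        (cong (λ x → Re (at u′ n) + Re (at v′ n) + x) (half-split δ)))))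
      (below h (δ * ½) (half δ 0<δ)) (below g (δ * ½) (half δ 0<δ))
      where
      open +-*-Solver
      lem : ∀ a b c d → (a + b) + (c + d) ≡ (a + c) + (b + d)
      lem = solve 4 (λ a b c d → (a :+ b) :+ (c :+ d) := (a :+ c) :+ (b :+ d)) refl

    ιˢ-+ : ∀ a b → ιˢ (a ℕ.+ b) ≈ ιˢ a +ˢ ιˢ b
    ιˢ-+ a b = ≡⇒≈ λ n → trans (cong real (ι-+ a b)) (real-+ (ι a) (ι b))

    ιˢ-* : ∀ a b → ιˢ (a ℕ.* b) ≈ ιˢ a *ˢ ιˢ b
    ιˢ-* a b = ≡⇒≈ λ n → trans (cong real (ι-* a b)) (real-* (ι a) (ι b))

    ιˢ-1 : ιˢ 1 ≈ 1ˢ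
    ιˢ-1 = ≡⇒≈ λ n → refl

    N-cong : ∀ {u v} → u ≈ v → N u ≈ N v
    N-cong h = *ˢ-cong h (conjˢ-cong h)

    N-scale : ∀ q u → N (scale q u) ≈ scale (q * q) (N u)
    N-scale q u = ≡⇒≈ λ n → trans (cong (real q *ᵍ at u n *ᵍ_) (conj-* (real q) (at u n)))
      (trans (solve 3 (λ q u v → q :* u :* (q :* v) := q :* q :* (u :* v)) refl (real q) (at u n) (conj (at u n)))
        (cong (_*ᵍ (at u n *ᵍ conj (at u n))) (sym (real-* q q))))
      where open 𝔾-Solver

    scale-scale : ∀ p q u → scale p (scale q u) ≈ scale (p * q) u
    scale-scale p q u = ≡⇒≈ λ n → trans (sym (G.*-assoc (real p) (real q) (at u n))) (cong (_*ᵍ at u n) (sym (real-* p q)))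

    scale-1 : ∀ u → scale 1ℚ u ≈ u
    scale-1 u = S.*-identityˡ u

    -- (A + B) (B |z|² + A |w|²) - A B |z + w|² = |B z - A w|².
    N-triangle : ∀ A B u v → scale (ι A * ι B) (N (u +ˢ v)) ≲ scale (ι (A ℕ.+ B)) (scale (ι B) (N u) +ˢ scale (ι A) (N v))
    N-triangle A B u v = ≲-pointwise λ n → subst₂ _≤_
      (sym (trans (Re-scale (ι A * ι B) (N (u +ˢ v)) n) (cong (ι A * ι B *_) (Re-N (u +ˢ v) n))))
      (sym (trans (Re-scale (ι (A ℕ.+ B)) (scale (ι B) (N u) +ˢ scale (ι A) (N v)) n) (cong₂ _*_ (ι-+ A B)
        (cong₂ _+_ (trans (Re-scale (ι B) (N u) n) (cong (ι B *_) (Re-N u n))) (trans (Re-scale (ι A) (N v) n) (cong (ι A *_) (Re-N v n)))))))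
      (main (ι A) (ι B) (Re (at u n)) (Im (at u n)) (Re (at v n)) (Im (at v n)))
      where
      open +-*-Solver
      main : ∀ A B a b c d → A * B * ((a + c) * (a + c) + (b + d) * (b + d)) ≤ (A + B) * (B * (a * a + b * b) + A * (c * c + d * d))
      main A B a b c d = ≤-of-0≤- (subst (0ℚ ≤_)
        (solve 6 (λ A B a b c d → (B :* a :- A :* c) :* (B :* a :- A :* c) :+ (B :* b :- A :* d) :* (B :* b :- A :* d) :=
           (A :+ B) :* (B :* (a :* a :+ b :* b) :+ A :* (c :* c :+ d :* d)) :- A :* B :* ((a :+ c) :* (a :+ c) :+ (b :+ d) :* (b :+ d))) refl A B a b c d)
        (+-nonNeg (sq-nonNeg (B * a - A * c)) (sq-nonNeg (B * b - A * d))))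

  scale-mono : ∀ {q u v} → 0ℚ < q → u ≲ v → scale q u ≲ scale q v
  scale-mono {q} {u} {v} 0<q h = mk≲ λ δ 0<δ → go δ (quotient {q} δ 0<q 0<δ)
    where
    go : ∀ δ → (∃ λ t → 0ℚ < t × q * t ≡ δ) → Eventually (λ n → Re (at (scale q u) n) ≤ Re (at (scale q v) n) + δ)
    go δ (t , 0<t , qt) = eventually-map (λ n a → subst₂ _≤_ (sym (Re-scale q u n))
      (trans (ℚP.*-distribˡ-+ q (Re (at v n)) t) (cong₂ _+_ (sym (Re-scale q v n)) qt)) (*-monoʳ (ℚP.<⇒≤ 0<q) a)) (below h t 0<t)

  scale-cong : ∀ {q u v} → u ≈ v → scale q u ≈ scale q v
  scale-cong h = *ˢ-cong ≈-refl h

  scale-cancel : ∀ {q u v} → 0ℚ < q → scale q u ≲ scale q v → u ≲ v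
  scale-cancel {q} {u} {v} 0<q h = go (recip-pos 0<q)
    where
    go : (∃ λ t → 0ℚ < t × q * t ≡ 1ℚ) → u ≲ v
    go (t , 0<t , qt) = ≲-trans (≈⇒≲ (≈-sym (undo u))) (≲-trans (scale-mono 0<t h) (≈⇒≲ (undo v)))
      where
      undo : ∀ u → scale t (scale q u) ≈ u
      undo u = ≈-trans (scale-scale t q u) (≈-trans (S.reflexive (cong (λ x → scale x u) (trans (ℚP.*-comm t q) qt))) (scale-1 u))

  N-nonNeg : ∀ u n → 0ℚ ≤ Re (at (N u) n)
  N-nonNeg u n = subst (0ℚ ≤_) (sym (Re-N u n)) (normSq-nonNeg (at u n))

  ∑ˢ-mono : ∀ n {f g} → (∀ i → i ℕ.< n → f i ≲ g i) → ∑ˢ n f ≲ ∑ˢ n g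
  ∑ˢ-mono zero    h = ≈⇒≲ ≈-refl
  ∑ˢ-mono (suc n) h = +ˢ-mono-≲ (h 0 (s≤s z≤n)) (∑ˢ-mono n λ i l → h (suc i) (s≤s l))

  ιˢ-mono : ∀ {a b} → a ℕ.≤ b → ιˢ a ≲ ιˢ b
  ιˢ-mono {a} {b} h = ≲-pointwise λ n → subst₂ _≤_ (sym (Re-ιˢ a n)) (sym (Re-ιˢ b n)) (ι-mono h)

  infix 4 _≼_
  record _≼_ (u : 𝕊) (B : ℕ) : Set where
    constructor norm≤
    field N≲ : N u ≲ ιˢ (B ℕ.* B)
  open _≼_ public

  ≼-cong : ∀ {u v B} → u ≈ v → u ≼ B → v ≼ B
  ≼-cong h (norm≤ g) = norm≤ (≲-trans (≈⇒≲ (N-cong (≈-sym h))) g)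

  ≼-weaken : ∀ {u A B} → A ℕ.≤ B → u ≼ A → u ≼ B
  ≼-weaken h (norm≤ g) = norm≤ (≲-trans g (ιˢ-mono (ℕP.*-mono-≤ h h)))

  ≼-0 : ∀ B → 0ˢ ≼ B
  ≼-0 B = norm≤ (≲-trans (≈⇒≲ (S.zeroˡ (conjˢ 0ˢ))) (ιˢ-mono {0} {B ℕ.* B} z≤n))

  -- The triangle inequality without roots. With |u| ≤ A and |v| ≤ B, the weighted inequality
  -- `N-triangle` gives A B |u + v|² ≤ (A + B) (B A² + A B²) = A B (A + B)², and the positive factor
  -- A B is cancelled.
  ≼-+ : ∀ {u v} A B .{{_ : NonZero A}} .{{_ : NonZero B}} → u ≼ A → v ≼ B → u +ˢ v ≼ A ℕ.+ B
  ≼-+ {u} {v} A B (norm≤ hu) (norm≤ hv) = norm≤ (scale-cancel (*-pos (ι-pos A) (ι-pos B)) (≲-trans (N-triangle A B u v)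
    (≲-trans (scale-mono 0<A+B (+ˢ-mono-≲ (scale-mono (ι-pos B) hu) (scale-mono (ι-pos A) hv)))
    (≈⇒≲ (begin
      scale (ι (A ℕ.+ B)) (scale (ι B) (ιˢ (A ℕ.* A)) +ˢ scale (ι A) (ιˢ (B ℕ.* B)))  ≈⟨ scale-cong (+ˢ-cong (S.sym (ιˢ-* B (A ℕ.* A))) (S.sym (ιˢ-* A (B ℕ.* B)))) ⟩
      scale (ι (A ℕ.+ B)) (ιˢ (B ℕ.* (A ℕ.* A)) +ˢ ιˢ (A ℕ.* (B ℕ.* B)))              ≈⟨ scale-cong (S.sym (ιˢ-+ (B ℕ.* (A ℕ.* A)) (A ℕ.* (B ℕ.* B)))) ⟩
      scale (ι (A ℕ.+ B)) (ιˢ (B ℕ.* (A ℕ.* A) ℕ.+ A ℕ.* (B ℕ.* B)))                  ≈⟨ S.sym (ιˢ-* (A ℕ.+ B) (B ℕ.* (A ℕ.* A) ℕ.+ A ℕ.* (B ℕ.* B))) ⟩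
      ιˢ ((A ℕ.+ B) ℕ.* (B ℕ.* (A ℕ.* A) ℕ.+ A ℕ.* (B ℕ.* B)))                        ≈⟨ S.reflexive (cong ιˢ (lem A B)) ⟩
      ιˢ (A ℕ.* B ℕ.* ((A ℕ.+ B) ℕ.* (A ℕ.+ B)))                                      ≈⟨ ιˢ-* (A ℕ.* B) ((A ℕ.+ B) ℕ.* (A ℕ.+ B)) ⟩
      ιˢ (A ℕ.* B) *ˢ ιˢ ((A ℕ.+ B) ℕ.* (A ℕ.+ B))                                    ≈⟨ S.reflexive (cong (λ x → scale x (ιˢ ((A ℕ.+ B) ℕ.* (A ℕ.+ B)))) (ι-* A B)) ⟩
      scale (ι A * ι B) (ιˢ ((A ℕ.+ B) ℕ.* (A ℕ.+ B)))                                ∎)))))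
    where
    open 𝕊-Reasoning
    0<A+B : 0ℚ < ι (A ℕ.+ B)
    0<A+B = subst (0ℚ <_) (sym (ι-+ A B)) (+-pos (ι-pos A) (ι-nonNeg B))
    open import Data.Nat.Tactic.RingSolver using (solve-∀)
    lem : ∀ A B → (A ℕ.+ B) ℕ.* (B ℕ.* (A ℕ.* A) ℕ.+ A ℕ.* (B ℕ.* B)) ≡ A ℕ.* B ℕ.* ((A ℕ.+ B) ℕ.* (A ℕ.+ B))
    lem = solve-∀

  ≼-neg : ∀ {u B} → u ≼ B → -ˢ u ≼ B
  ≼-neg {u} {B} (norm≤ h) = norm≤ (≲-trans (≲-pointwise λ n → ℚP.≤-reflexive (trans (Re-N (-ˢ u) n) (trans (cong normSq (at-neg u n)) (trans (lem (Re (at u n)) (Im (at u n))) (sym (Re-N u n)))))) h)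
    where
    open +-*-Solver
    lem : ∀ a b → - a * - a + - b * - b ≡ a * a + b * b
    lem = solve 2 (λ a b → :- a :* :- a :+ :- b :* :- b := a :* a :+ b :* b) refl

  -- The extra 1 is the bound given to the empty sum, because `≼-+` asks for non-zero bounds.
  ≼-∑ : ∀ n {f} (B : ℕ → ℕ) → (∀ i → i ℕ.< n → NonZero (B i)) → (∀ i → i ℕ.< n → f i ≼ B i) → ∑ˢ n f ≼ suc (ℕΣ.Σ n B)
  ≼-∑ zero    B nz h = ≼-0 1
  ≼-∑ (suc n) {f} B nz h = subst (∑ˢ (suc n) f ≼_) (ℕP.+-suc (B 0) (ℕΣ.Σ n (B ∘ suc)))
    (≼-+ (B 0) (suc (ℕΣ.Σ n (B ∘ suc))) {{nz 0 (s≤s z≤n)}} (h 0 (s≤s z≤n))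
      (≼-∑ n (B ∘ suc) (λ i l → nz (suc i) (s≤s l)) λ i l → h (suc i) (s≤s l)))

  unit-* : ∀ {w u B} → N w ≈ 1ˢ → u ≼ B → w *ˢ u ≼ B
  unit-* {w} {u} {B} hw (norm≤ hu) = norm≤ (≲-trans (≈⇒≲ (≈-trans (*ˢ-cong (≈-refl {w *ˢ u}) (conjˢ-* w u)) (≈-trans swap (≈-trans (*ˢ-cong hw ≈-refl) (S.*-identityˡ (N u)))))) hu)
    where
    open import Algebra.Properties.CommutativeSemigroup S.*-commutativeSemigroup using (interchange)
    swap : (w *ˢ u) *ˢ (conjˢ w *ˢ conjˢ u) ≈ N w *ˢ N u
    swap = interchange w u (conjˢ w) (conjˢ u)

  -- Approximations to the mean, powers of p, and moduli.

  value : ℂ → ℕ → 𝔾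
  value z m = seq (re z) m ⊹ seq (im z) m

  Σᴸ : List ℕ → (ℕ → 𝔾) → 𝔾
  Σᴸ []       f = 0ᵍ
  Σᴸ (x ∷ xs) f = f x +ᵍ Σᴸ xs f

  value-∑ : ∀ xs (f : ℕ → ℂ) m → value (∑ xs f) m ≡ Σᴸ xs (λ x → value (f x) m)
  value-∑ []       f m = refl
  value-∑ (x ∷ xs) f m = cong (value (f x) m +ᵍ_) (value-∑ xs f m)

  value-scaled : ∀ q xs (f : ℕ → ℂ) m → value (fromℚ q • ∑ xs f) m ≡ real q *ᵍ Σᴸ xs (λ x → value (f x) m)
  value-scaled q xs f m = trans (sym (real-*-⊹ q (seq (re (∑ xs f)) m) (seq (im (∑ xs f)) m))) (cong (real q *ᵍ_) (value-∑ xs f m))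

  Σᴸ-cong : ∀ xs {f g : ℕ → 𝔾} → (∀ x → f x ≡ g x) → Σᴸ xs f ≡ Σᴸ xs g
  Σᴸ-cong []       h = refl
  Σᴸ-cong (x ∷ xs) h = cong₂ _+ᵍ_ (h x) (Σᴸ-cong xs h)

  -- Sums and scaling of complex numbers are computed index by index, so this is an equality of
  -- rationals that involves no Cauchy modulus.
  value-meanSum : ∀ {p} (pp : Prime p) (Y : NonZero p) (W : NonZero (φ (p ∸ 1))) N {r} (a b : ℤ) (bs gs : Fin r → ℤ) m →
    value (meanSum pp N a b bs gs) m ≡ real (_/_ (+ 1) (φ (p ∸ 1)) {{W}}) *ᵍ
      Σᴸ (primitiveRoots p) (λ g → Σᴸ (1⋯ N) (λ x → value (e p {{Y}} (phase a b bs gs g x)) m))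
  value-meanSum {p} pp Y W N a b bs gs m = trans (value-scaled (_/_ (+ 1) (φ (p ∸ 1)) {{W}}) (primitiveRoots p) _ m)
    (cong (real (_/_ (+ 1) (φ (p ∸ 1)) {{W}}) *ᵍ_) (Σᴸ-cong (primitiveRoots p) λ g → value-∑ (1⋯ N) _ m))

  infixr 8 _^ˢ_
  _^ˢ_ : 𝕊 → ℕ → 𝕊
  u ^ˢ zero  = 1ˢ
  u ^ˢ suc k = u *ˢ u ^ˢ k

  ^ˢ-cong : ∀ {u v} k → u ≈ v → u ^ˢ k ≈ v ^ˢ k
  ^ˢ-cong zero    h = ≈-refl
  ^ˢ-cong (suc k) h = *ˢ-cong h (^ˢ-cong k h)

  at-^ˢ : ∀ u k n → at (u ^ˢ k) n ≡ at u n ^ᵍ k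
  at-^ˢ u zero    n = at-const 1ᵍ n
  at-^ˢ u (suc k) n = trans (at-* u (u ^ˢ k) n) (cong (at u n *ᵍ_) (at-^ˢ u k n))

  realSeq : ℝ → 𝕊
  realSeq x = fromℂ (x +𝕚 0ʳ)

  Exp-multiple : ∀ k u v → (∀ n → at v n ≡ ιᵍ k *ᵍ at u n) → Exp v ≈ Exp u ^ˢ k
  Exp-multiple zero    u v h = Exp-null {v} (≡⇒≈ λ n → trans (h n) (trans (G.zeroˡ (at u n)) (sym (at-const 0ᵍ n))))
  Exp-multiple (suc k) u v h = ≈-trans (Exp-≡ {v} {u +ˢ w} λ n → trans (h n) (trans (cong (_*ᵍ at u n) (real-+ 1ℚ (ι k)))
      (trans (G.distribʳ (at u n) 1ᵍ (ιᵍ k)) (trans (cong₂ _+ᵍ_ (G.*-identityˡ (at u n)) (sym (trans (at-* (const (ιᵍ k)) u n) (cong (_*ᵍ at u n) (at-const (ιᵍ k) n)))))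
        (sym (at-+ u w n))))))
    (≈-trans (Exp-+ u w) (*ˢ-cong (≈-refl {Exp u}) (Exp-multiple k u w λ n → trans (at-* (const (ιᵍ k)) u n) (cong (_*ᵍ at u n) (at-const (ιᵍ k) n)))))
    where
    w : 𝕊
    w = const (ιᵍ k) *ˢ u

  logSum-real : ∀ y n → logSum (real y) n ≡ real (psum (λ k → (sign ones (suc k) / suc k) * y ^ℚ suc k) n)
  logSum-real y zero = refl
  logSum-real y (suc n) = trans (cong₂ _+ᵍ_ (logSum-real y n) (trans (cong (real (1/suc n) *ᵍ_) (real-^ y (suc n)))
      (trans (sym (real-* (1/suc n) (y ^ℚ suc n))) (cong (λ i → real ((i / suc n) * y ^ℚ suc n)) (sym (sign-ones (suc n)))))))
    (sym (real-+ (psum (λ k → (sign ones (suc k) / suc k) * y ^ℚ suc k) n) ((sign ones (suc n) / suc n) * y ^ℚ suc n)))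
    where
    sign-ones : ∀ k → sign ones k ≡ + 1
    sign-ones k = refl

  expSum-real : ∀ t n → expSum (real t) n ≡ real (psum (exp-term ones t) n)
  expSum-real t zero = refl
  expSum-real t (suc n) = trans (cong₂ _+ᵍ_ (expSum-real t n) (trans (cong (real (1/k! n) *ᵍ_) (real-^ t n)) (sym (real-* (1/k! n) (t ^ℚ n)))))
    (sym (real-+ (psum (exp-term ones t) n) (1/k! n * t ^ℚ n)))

  ιˢ-^ : ∀ a k → ιˢ a ^ˢ k ≈ ιˢ (a ℕ.^ k)
  ιˢ-^ a zero    = ≈-sym ιˢ-1
  ιˢ-^ a (suc k) = ≈-trans (*ˢ-cong (≈-refl {ιˢ a}) (ιˢ-^ a k)) (≈-sym (ιˢ-* a (a ℕ.^ k)))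

  Exp-log-real : ∀ y i → ∣ y ∣ < 1ℚ → (1ℚ - y) * i ≡ 1ℚ → (u : 𝕊) → (∀ n → at u n ≡ logSum (real y) n) → Exp u ≈ const (real i)
  Exp-log-real y i y<1 inv u hu = begin
    E                                  ≈⟨ ≈-sym (S.*-identityʳ E) ⟩
    E *ˢ 1ˢ                            ≈⟨ *ˢ-cong (≈-refl {E}) (≈-sym inverse) ⟩
    E *ˢ (C *ˢ const (real i))         ≈⟨ ≈-sym (S.*-assoc E C (const (real i))) ⟩
    E *ˢ C *ˢ const (real i)           ≈⟨ *ˢ-cong (Exp-log (ℚP.≤-reflexive (ν-real y)) y<1 u (always hu)) (≈-refl {const (real i)}) ⟩
    1ˢ *ˢ const (real i)               ≈⟨ S.*-identityˡ (const (real i)) ⟩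
    const (real i)                     ∎
    where
    open 𝕊-Reasoning
    E C : 𝕊
    E = Exp u
    C = const (1ᵍ -ᵍ real y)
    inverse : C *ˢ const (real i) ≈ 1ˢ
    inverse = ≈-trans (const-* (1ᵍ -ᵍ real y) (real i)) (S.reflexive (cong const (trans (sym (real-* (1ℚ - y) i)) (cong real inv))))

  ι-pred : ∀ p .{{_ : NonZero p}} → ι p ≡ 1ℚ + ι (p ℕ.∸ 1)
  ι-pred (suc m) = refl

  log-sum : ∀ p (nz : NonZero p) n → at (realSeq (log p {{nz}})) n ≡ logSum (real (_/_ (+ (p ℕ.∸ 1)) p {{nz}})) n
  log-sum p nz n = sym (logSum-real (_/_ (+ (p ℕ.∸ 1)) p {{nz}}) n)

  -- 1 - (p - 1) / p = 1 / p.
  Exp-logNat : ∀ p (nz : NonZero p) → Exp (realSeq (log p {{nz}})) ≈ ιˢ p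
  Exp-logNat p nz = Exp-log-real y (ι p) (∣pred[n]/n∣<1 p {{nz}})
    (lem y (ι (p ℕ.∸ 1)) (ι p) (ι-pred p {{nz}}) (/-*ι (p ℕ.∸ 1) p {{nz}})) (realSeq (log p {{nz}})) (log-sum p nz)
    where
    y : ℚ
    y = _/_ (+ (p ℕ.∸ 1)) p {{nz}}
    lem : ∀ y i j → j ≡ 1ℚ + i → y * j ≡ i → (1ℚ - y) * j ≡ 1ℚ
    lem y i j e f = trans (solve 2 (λ y j → (con 1ℚ :- y) :* j := j :- y :* j) refl y j)
      (trans (cong₂ (λ a b → a - b) e f) (solve 1 (λ i → (con 1ℚ :+ i) :- i := con 1ℚ) refl i))
      where open +-*-Solver

  module _ (p : ℕ) (nz : NonZero p) where

    exponent : ℚ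
    exponent = + 23 / 24

    scaledLog : ℝ
    scaledLog = fromℚ exponent *ʳ log p {{nz}}

    -- Both sides are exp(23 log p).
    Exp-scaledLog : Exp (realSeq scaledLog) ^ˢ 24 ≈ ιˢ (p ℕ.^ 23)
    Exp-scaledLog = begin
      Exp (realSeq scaledLog) ^ˢ 24     ≈⟨ ≈-sym (Exp-multiple 24 (realSeq scaledLog) w24 λ n → trans (at-* (const (ιᵍ 23)) (realSeq (log p {{nz}})) n)
                                       (trans (cong (_*ᵍ real (seq (log p {{nz}}) n)) (at-const (ιᵍ 23) n)) (eq (seq (log p {{nz}}) n)))) ⟩
      Exp w24                      ≈⟨ Exp-multiple 23 (realSeq (log p {{nz}})) w24 (λ n → trans (at-* (const (ιᵍ 23)) (realSeq (log p {{nz}})) n) (cong (_*ᵍ real (seq (log p {{nz}}) n)) (at-const (ιᵍ 23) n))) ⟩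
      Exp (realSeq (log p {{nz}})) ^ˢ 23  ≈⟨ ^ˢ-cong 23 (Exp-logNat p nz) ⟩
      ιˢ p ^ˢ 23                   ≈⟨ ιˢ-^ p 23 ⟩
      ιˢ (p ℕ.^ 23)                ∎
      where
      open 𝕊-Reasoning
      w24 : 𝕊
      w24 = const (ιᵍ 23) *ˢ realSeq (log p {{nz}})
      23≡ : ι 23 ≡ ι 24 * exponent
      23≡ = refl
      eq : ∀ l → ιᵍ 23 *ᵍ real l ≡ ιᵍ 24 *ᵍ real (exponent * l)
      eq l = trans (sym (real-* (ι 23) l)) (trans (cong real (trans (cong (_* l) 23≡) (ℚP.*-assoc (ι 24) exponent l))) (real-* (ι 24) (exponent * l)))

    rootPower : ℕ → ℚ
    rootPower n = psum (exp-term ones (seq scaledLog n)) n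

    -- The approximations need only come within ½, because p²³ ≥ 1 can absorb that error at the cost
    -- of a factor 2.
    rootPower^24 : Eventually (λ n → ι (p ℕ.^ 23) ≤ rootPower n ^ℚ 24 + ½)
    rootPower^24 = eventually-map (λ n h → subst₂ _≤_ (Re-ιˢ (p ℕ.^ 23) n) (cong (_+ ½) (at-v 24 n)) h) (below (≈⇒≲ (≈-sym Exp-scaledLog)) ½ 0<½)
      where
      at-v : ∀ k n → Re (at (Exp (realSeq scaledLog) ^ˢ k) n) ≡ rootPower n ^ℚ k
      at-v k n = cong Re (trans (at-^ˢ (Exp (realSeq scaledLog)) k n) (trans (cong (_^ᵍ k) (trans (at-Exp (realSeq scaledLog) n) (expSum-real (seq scaledLog n) n))) (real-^ (rootPower n) k)))

  ^ℚ-mono : ∀ {x y} → 0ℚ ≤ x → x ≤ y → ∀ k → x ^ℚ k ≤ y ^ℚ k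
  ^ℚ-mono 0≤x x≤y zero    = ℚP.≤-refl
  ^ℚ-mono 0≤x x≤y (suc k) = *-mono 0≤x (^ℚ-nonNeg (ℚP.≤-trans 0≤x x≤y) k) x≤y (^ℚ-mono 0≤x x≤y k)

  ^ℚ-distrib-* : ∀ x y k → (x * y) ^ℚ k ≡ x ^ℚ k * y ^ℚ k
  ^ℚ-distrib-* x y zero = refl
  ^ℚ-distrib-* x y (suc k) = trans (cong (x * y *_) (^ℚ-distrib-* x y k)) (lem x y (x ^ℚ k) (y ^ℚ k))
    where
    open +-*-Solver
    lem : ∀ a b c d → a * b * (c * d) ≡ a * c * (b * d)
    lem = solve 4 (λ a b c d → a :* b :* (c :* d) := a :* c :* (b :* d)) refl

  ^ℚ-cancel-≤ : ∀ {x y} k → 0ℚ ≤ y → x ^ℚ suc k ≤ y ^ℚ suc k → x ≤ y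
  ^ℚ-cancel-≤ {x} {y} k 0≤y h = [ (λ l → l) , (λ y≤x → go y≤x (x ℚP.≤? y)) ]′ (ℚP.≤-total x y)
    where
    strict : ∀ k → y < x → y ^ℚ suc k < x ^ℚ suc k
    strict zero y<x = subst₂ _<_ (sym (ℚP.*-identityʳ y)) (sym (ℚP.*-identityʳ x)) y<x
    strict (suc k) y<x = ℚP.≤-<-trans (*-monoʳ 0≤y (ℚP.<⇒≤ (strict k y<x)))
      (ℚP.*-monoˡ-<-pos (x ^ℚ suc k) {{ℚ.positive (ℚP.≤-<-trans (^ℚ-nonNeg 0≤y (suc k)) (strict k y<x))}} y<x)
    go : y ≤ x → Dec (x ≤ y) → x ≤ y
    go _ (yes l) = l
    go _ (no ¬l) = ⊥-elim (ℚP.<-irrefl refl (ℚP.<-≤-trans (strict k (ℚP.≰⇒> ¬l)) h))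

  ι-^ : ∀ a k → ι (a ℕ.^ k) ≡ ι a ^ℚ k
  ι-^ a zero    = ℚP.+-identityʳ 1ℚ
  ι-^ a (suc k) = trans (ι-* a (a ℕ.^ k)) (cong (ι a *_) (ι-^ a k))

  psum-mono : ∀ {a b} → (∀ k → a k ≤ b k) → ∀ n → psum a n ≤ psum b n
  psum-mono h zero    = ℚP.≤-refl
  psum-mono h (suc n) = ℚP.+-mono-≤ (psum-mono h n) (h n)

  psum-nonNeg : ∀ {a} → (∀ k → 0ℚ ≤ a k) → ∀ n → 0ℚ ≤ psum a n
  psum-nonNeg h zero    = ℚP.≤-refl
  psum-nonNeg h (suc n) = +-nonNeg (psum-nonNeg h n) (h n)

  exp-nonNeg : ∀ {x} → 0ℚ ≤ x → ∀ n → 0ℚ ≤ psum (exp-term ones x) n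
  exp-nonNeg 0≤x = psum-nonNeg λ k → *-nonNeg (1/k!-nonNeg k) (^ℚ-nonNeg 0≤x k)

  exp-mono : ∀ {x y} → 0ℚ ≤ x → x ≤ y → ∀ n → psum (exp-term ones x) n ≤ psum (exp-term ones y) n
  exp-mono 0≤x x≤y = psum-mono λ k → *-monoʳ (1/k!-nonNeg k) (^ℚ-mono 0≤x x≤y k)

  log-nonNeg : ∀ p (nz : NonZero p) n → 0ℚ ≤ seq (log p {{nz}}) n
  log-nonNeg p nz = psum-nonNeg {λ k → (sign ones (suc k) / suc k) * y ^ℚ suc k} λ k →
    *-nonNeg (coefficient-nonNeg (sign ones (suc k)) k refl) (^ℚ-nonNeg 0≤y (suc k))
    where
    y : ℚ
    y = _/_ (+ (p ℕ.∸ 1)) p {{nz}}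
    0≤y : 0ℚ ≤ y
    0≤y = ℚP.nonNegative⁻¹ y {{ℚP.normalize-nonNeg (p ℕ.∸ 1) p {{nz}}}}
    coefficient-nonNeg : ∀ i k → i ≡ + 1 → 0ℚ ≤ i / suc k
    coefficient-nonNeg _ k refl = 1/-nonNeg (suc k)

  -- The hypothesis is X ≤ K p^{23/24} in 24th powers. The factor 2 pays for the error ½ in
  -- `rootPower^24`. Adding ε enlarges the exponent, and with it the partial sums of exp, because
  -- all terms of log p are non-negative.
  power-lower : ∀ X K p (nz : NonZero p) → X ℕ.^ 24 ℕ.≤ K ℕ.^ 24 ℕ.* p ℕ.^ 23 → (ε : ℝ) → 0ʳ <ʳ ε →
    Eventually (λ n → ι X ≤ ι (2 ℕ.* K) * seq (_^ʳ_ p {{nz}} (fromℚ (+ 23 / 24) +ʳ ε)) n)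
  power-lower X K p nz hX ε (δ , 0<δ , L , hε) = eventually-map₂ main (rootPower^24 p nz) (L , λ {n} k → hε k)
    where
    main : ∀ n → ι (p ℕ.^ 23) ≤ rootPower p nz n ^ℚ 24 + ½ → 0ℚ + δ ≤ seq ε n → ι X ≤ ι (2 ℕ.* K) * seq (_^ʳ_ p {{nz}} (fromℚ (+ 23 / 24) +ʳ ε)) n
    main n hv he = ℚP.≤-trans X≤ (*-monoʳ (ι-nonNeg (2 ℕ.* K)) v≤)
      where
      l : ℚ
      l = seq (log p {{nz}}) n
      0≤l : 0ℚ ≤ l
      0≤l = log-nonNeg p nz n
      0≤ε : 0ℚ ≤ seq ε n
      0≤ε = ℚP.≤-trans (ℚP.≤-trans (ℚP.<⇒≤ 0<δ) (ℚP.≤-reflexive (sym (ℚP.+-identityˡ δ)))) he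
      0≤b : 0ℚ ≤ exponent p nz * l
      0≤b = *-nonNeg (1/-nonNeg′ 23 24) 0≤l
        where
        1/-nonNeg′ : ∀ a d .{{_ : NonZero d}} → 0ℚ ≤ + a / d
        1/-nonNeg′ a d = ℚP.nonNegative⁻¹ (+ a / d) {{ℚP.normalize-nonNeg a d}}
      v≤ : rootPower p nz n ≤ seq (_^ʳ_ p {{nz}} (fromℚ (+ 23 / 24) +ʳ ε)) n
      v≤ = exp-mono 0≤b (*-monoˡ {l} {exponent p nz} {exponent p nz + seq ε n} 0≤l (p≤p+q {exponent p nz} 0≤ε)) n
      V : ℚ
      V = rootPower p nz n ^ℚ 24
      1≤P : 1ℚ ≤ ι (p ℕ.^ 23)
      1≤P = ℚP.≤-trans (ℚP.≤-reflexive (sym (ℚP.+-identityʳ 1ℚ))) (ι-mono {1} {p ℕ.^ 23} (ℕP.m^n>0 p {{nz}} 23))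
      P≤2V : ι (p ℕ.^ 23) ≤ (1ℚ + 1ℚ) * V
      P≤2V = half-slack {ι (p ℕ.^ 23)} {V} 1≤P hv
        where
        half-slack : ∀ {P V} → 1ℚ ≤ P → P ≤ V + ½ → P ≤ (1ℚ + 1ℚ) * V
        half-slack {P} {V} a b = ≤-of-0≤- (subst (0ℚ ≤_) (lem P V) (+-nonNeg (+-nonNeg (0≤-of-≤ b) (0≤-of-≤ b)) (0≤-of-≤ a)))
          where
          open +-*-Solver
          lem : ∀ P V → ((V + ½ - P) + (V + ½ - P)) + (P - 1ℚ) ≡ (1ℚ + 1ℚ) * V - P
          lem = solve 2 (λ P V → ((V :+ con ½ :- P) :+ (V :+ con ½ :- P)) :+ (P :- con 1ℚ) := (con 1ℚ :+ con 1ℚ) :* V :- P) refl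
      X≤ : ι X ≤ ι (2 ℕ.* K) * rootPower p nz n
      X≤ = ^ℚ-cancel-≤ 23 (*-nonNeg (ι-nonNeg (2 ℕ.* K)) (exp-nonNeg 0≤b n)) (begin
        ι X ^ℚ 24                                    ≡⟨ sym (ι-^ X 24) ⟩
        ι (X ℕ.^ 24)                                 ≤⟨ ι-mono hX ⟩
        ι (K ℕ.^ 24 ℕ.* p ℕ.^ 23)                    ≡⟨ ι-* (K ℕ.^ 24) (p ℕ.^ 23) ⟩
        ι (K ℕ.^ 24) * ι (p ℕ.^ 23)                  ≤⟨ *-monoʳ (ι-nonNeg (K ℕ.^ 24)) P≤2V ⟩
        ι (K ℕ.^ 24) * ((1ℚ + 1ℚ) * V)               ≡⟨ trans (sym (ℚP.*-assoc (ι (K ℕ.^ 24)) (1ℚ + 1ℚ) V)) (cong (_* V) (ℚP.*-comm (ι (K ℕ.^ 24)) (1ℚ + 1ℚ))) ⟩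
        (1ℚ + 1ℚ) * ι (K ℕ.^ 24) * V                 ≡⟨ cong (_* V) (sym (trans (ι-* 2 (K ℕ.^ 24)) (cong (_* ι (K ℕ.^ 24)) (cong (λ x → 1ℚ + x) (ℚP.+-identityʳ 1ℚ))))) ⟩
        ι (2 ℕ.* K ℕ.^ 24) * V                       ≤⟨ *-monoˡ (^ℚ-nonNeg (exp-nonNeg 0≤b n) 24) (ι-mono (ℕP.≤-trans (ℕP.*-monoˡ-≤ (K ℕ.^ 24) 2≤2^24) (ℕP.≤-reflexive (sym (Arithmetic.^-distribʳ-* 24 2 K))))) ⟩
        ι ((2 ℕ.* K) ℕ.^ 24) * V                     ≡⟨ cong (_* V) (ι-^ (2 ℕ.* K) 24) ⟩
        ι (2 ℕ.* K) ^ℚ 24 * V                        ≡⟨ sym (^ℚ-distrib-* (ι (2 ℕ.* K)) (rootPower p nz n) 24) ⟩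
        (ι (2 ℕ.* K) * rootPower p nz n) ^ℚ 24                  ∎)
        where
        open ℚP.≤-Reasoning
        2≤2^24 : 2 ℕ.≤ 2 ℕ.^ 24
        2≤2^24 = ℕP.^-monoʳ-≤ 2 {1} {24} (s≤s z≤n)

  -- `√-approx` rounds down, so the root itself adds no error, and the error δ² in the square is
  -- covered by X² + δ² ≤ (X + δ)².
  abs-bound : ∀ (z : ℂ) X → N (fromℂ z) ≲ ιˢ (X ℕ.* X) → ∀ δ → 0ℚ < δ → Eventually (λ n → seq (∣ z ∣ᶜ) n ≤ ι X + δ)
  abs-bound z X h δ 0<δ = eventually-map main (below h (δ * δ) (*-pos 0<δ 0<δ))
    where
    main : ∀ n → Re (at (N (fromℂ z)) n) ≤ Re (at (ιˢ (X ℕ.* X)) n) + δ * δ → seq (∣ z ∣ᶜ) n ≤ ι X + δ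
    main n a = ^ℚ-cancel-≤ 1 (+-nonNeg (ι-nonNeg X) (ℚP.<⇒≤ 0<δ)) (begin
      s * (s * 1ℚ)               ≡⟨ cong (s *_) (ℚP.*-identityʳ s) ⟩
      s * s                      ≤⟨ √-Approx.lower w n ⟩
      ∣ w ∣                      ≡⟨ ℚP.0≤p⇒∣p∣≡p (normSq-nonNeg (at (fromℂ z) n)) ⟩
      w                          ≡⟨ sym (Re-N (fromℂ z) n) ⟩
      Re (at (N (fromℂ z)) n)    ≤⟨ a ⟩
      Re (at (ιˢ (X ℕ.* X)) n) + δ * δ ≡⟨ cong (_+ δ * δ) (trans (Re-ιˢ (X ℕ.* X) n) (ι-* X X)) ⟩
      ι X * ι X + δ * δ          ≤⟨ p≤p+q (+-nonNeg (*-nonNeg (ι-nonNeg X) (ℚP.<⇒≤ 0<δ)) (*-nonNeg (ι-nonNeg X) (ℚP.<⇒≤ 0<δ))) ⟩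
      ι X * ι X + δ * δ + (ι X * δ + ι X * δ) ≡⟨ lem (ι X) δ ⟩
      (ι X + δ) * ((ι X + δ) * 1ℚ) ∎)
      where
      open ℚP.≤-Reasoning
      w s : ℚ
      w = normSq (at (fromℂ z) n)
      s = √-approx w n
      open +-*-Solver
      lem : ∀ x d → x * x + d * d + (x * d + x * d) ≡ (x + d) * ((x + d) * 1ℚ)
      lem = solve 2 (λ x d → x :* x :+ d :* d :+ (x :* d :+ x :* d) := (x :+ d) :* ((x :+ d) :* con 1ℚ)) refl

-- Congruences modulo p and discrete logarithms to a primitive root.

module Residues where
  open import Defs using (φ; IsPrimitiveRoot)
  open import Data.Empty using (⊥-elim)
  open import Data.Integer using (ℤ; +_; _-_; _*_; _+_; _^_; -_; ∣_∣)
  import Data.Integer.Divisibility as ℤD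
  open import Data.Integer.Divisibility.Signed using (_∣_; divides; ∣ᵤ⇒∣; ∣⇒∣ᵤ; ∣m∣n⇒∣m+n; ∣m⇒∣-m; ∣n⇒∣m*n; ∣m⇒∣m*n)
  open import Data.Integer.DivMod using (_%ℕ_; _/ℕ_; a≡a%ℕn+[a/ℕn]*n; n%ℕd<d)
  import Data.Integer.Properties as ℤP
  open import Data.Integer.Tactic.RingSolver using (solve-∀)
  open import Data.Nat as ℕ using (ℕ; zero; suc; z≤n; s≤s; NonZero; _∸_)
  open import Data.Nat.Coprimality using (Coprime; coprime?; coprime-divisor; gcd≡1⇒coprime; prime⇒coprime) renaming (sym to coprime-sym)
  import Data.Nat.Divisibility as ℕD
  open import Data.Nat.DivMod using (m≡m%n+[m/n]*n; m%n<n)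
  open import Data.Nat.GCD using (gcd; gcd[m,n]∣m; gcd[m,n]∣n)
  open import Data.Nat.Primality using (Prime; euclidsLemma)
  import Data.Nat.Properties as ℕP
  open import Data.Product using (_,_; proj₁; proj₂)
  open import Data.Sum using (_⊎_; inj₁; inj₂; [_,_]′)
  open import Function using (_∘_)
  open import Relation.Binary.PropositionalEquality
  open import Relation.Nullary using (¬_; Dec; yes; no)
  open Sums
  open Arithmetic
  open Sieves
  open ℕΣ

  open ℕΣ

  module Congruence (p : ℕ) where
    infix 4 _≡ₚ_
    record _≡ₚ_ (α β : ℤ) : Set where
      constructor mod
      field divisible : + p ∣ (α - β)
    open _≡ₚ_ public

    ≡ₚ-refl : ∀ α → α ≡ₚ α
    ≡ₚ-refl α = mod (divides (+ 0) (ℤP.+-inverseʳ α))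

    ≡ₚ-sym : ∀ {α β} → α ≡ₚ β → β ≡ₚ α
    ≡ₚ-sym {α} {β} (mod h) = mod (subst (+ p ∣_) (lem α β) (∣m⇒∣-m h))
      where
      lem : ∀ α β → - (α - β) ≡ β - α
      lem = solve-∀

    ≡ₚ-trans : ∀ {α β γ} → α ≡ₚ β → β ≡ₚ γ → α ≡ₚ γ
    ≡ₚ-trans {α} {β} {γ} (mod h) (mod g) = mod (subst (+ p ∣_) (lem α β γ) (∣m∣n⇒∣m+n h g))
      where
      lem : ∀ α β γ → (α - β) + (β - γ) ≡ α - γ
      lem = solve-∀

    *-congₚ : ∀ {α α′ β β′} → α ≡ₚ α′ → β ≡ₚ β′ → α * β ≡ₚ α′ * β′
    *-congₚ {α} {α′} {β} {β′} (mod h) (mod g) = mod (subst (+ p ∣_) (lem α α′ β β′) (∣m∣n⇒∣m+n (∣n⇒∣m*n α g) (∣m⇒∣m*n β′ h)))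
      where
      lem : ∀ α α′ β β′ → α * (β - β′) + (α - α′) * β′ ≡ α * β - α′ * β′
      lem = solve-∀

    ^-congₚ : ∀ {α β} k → α ≡ₚ β → α ^ k ≡ₚ β ^ k
    ^-congₚ zero h = ≡ₚ-refl (+ 1)
    ^-congₚ (suc k) h = *-congₚ h (^-congₚ k h)

    ≡⇒≡ₚ : ∀ {α β} → α ≡ β → α ≡ₚ β
    ≡⇒≡ₚ {α} refl = ≡ₚ-refl α

    ∣ᵤ⇒≡ₚ : ∀ {α β} → + p ℤD.∣ (α - β) → α ≡ₚ β
    ∣ᵤ⇒≡ₚ {α} {β} h = mod (∣ᵤ⇒∣ {+ p} {α - β} h)

    ≡ₚ⇒∣ᵤ : ∀ {α β} → α ≡ₚ β → + p ℤD.∣ (α - β)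
    ≡ₚ⇒∣ᵤ {α} {β} (mod h) = ∣⇒∣ᵤ {+ p} {α - β} h

    module _ .{{_ : NonZero p}} where
      res : ℤ → ℕ
      res α = α %ℕ p

      res<p : ∀ α → res α ℕ.< p
      res<p α = n%ℕd<d α p

      res-≡ₚ : ∀ α → α ≡ₚ + res α
      res-≡ₚ α = mod (divides (α /ℕ p) (trans (cong (_- + res α) (a≡a%ℕn+[a/ℕn]*n α p)) (lem (+ res α) (α /ℕ p) (+ p))))
        where
        lem : ∀ r q p → (r + q * p) - r ≡ q * p
        lem = solve-∀

    euclid : Prime p → ∀ α β → + p ∣ α * β → (+ p ∣ α) ⊎ (+ p ∣ β)
    euclid pp α β h = [ inj₁ ∘ ∣ᵤ⇒∣ , inj₂ ∘ ∣ᵤ⇒∣ ]′ (euclidsLemma ∣ α ∣ ∣ β ∣ pp (subst (p ℕD.∣_) (ℤP.abs-* α β) (∣⇒∣ᵤ h)))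

    cancelₚ : Prime p → ∀ {α β γ} → ¬ (+ p ∣ γ) → γ * α ≡ₚ γ * β → α ≡ₚ β
    cancelₚ pp {α} {β} {γ} ∤γ (mod h) = [ ⊥-elim ∘ ∤γ , mod ]′ (euclid pp γ (α - β) (subst (+ p ∣_) (lem α β γ) h))
      where
      lem : ∀ α β γ → γ * α - γ * β ≡ γ * (α - β)
      lem = solve-∀

  φ-prime : ∀ {p} → Prime p → φ p ≡ p ∸ 1
  φ-prime {suc n} pp = trans (φ-count (suc n) (s≤s z≤n)) (trans (cong₂ ℕ._+_
    (when-no (coprime? 0 (suc n)) {1} (λ c → ℕP.<⇒≱ (prime>1 pp) (ℕP.≤-reflexive (c (suc n ℕD.∣0 , ℕD.∣-refl)))))
    (trans (Σ-cong n λ i i<n → when-yes (coprime? (suc i) (suc n)) {1} (coprime-sym (prime⇒coprime pp (s≤s i<n)))) (Σ-const n 1)))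
    (ℕP.*-identityʳ n))

  module PrimitiveRoot (n : ℕ) (pp : Prime (suc n)) (θ : ℤ) (root : IsPrimitiveRoot (suc n) θ) where
    p : ℕ
    p = suc n
    open Congruence p public

    1≤n : 1 ℕ.≤ n
    1≤n = ℕ.s≤s⁻¹ (prime>1 pp)

    φp≡n : φ p ≡ n
    φp≡n = φ-prime pp

    θ^n : θ ^ n ≡ₚ + 1
    θ^n = subst (λ k → θ ^ k ≡ₚ + 1) φp≡n (∣ᵤ⇒≡ₚ (proj₁ root))

    θ^<n : ∀ {k} → k ℕ.< n → 0 ℕ.< k → ¬ (θ ^ k ≡ₚ + 1)
    θ^<n {k} k<n 0<k h = proj₂ root (subst (k ℕ.<_) (sym φp≡n) k<n) 0<k (≡ₚ⇒∣ᵤ h)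

    p∤1 : ¬ (+ p ∣ + 1)
    p∤1 h = ℕP.<⇒≱ (prime>1 pp) (ℕD.∣⇒≤ (∣⇒∣ᵤ h))

    p∤θ : ¬ (+ p ∣ θ)
    p∤θ h = p∤1 (subst (+ p ∣_) (lem (θ ^ n) (+ 1)) (∣m∣n⇒∣m+n (power n 1≤n) (∣m⇒∣-m (divisible θ^n))))
      where
      power : ∀ n → 1 ℕ.≤ n → + p ∣ θ ^ n
      power (suc n) _ = ∣m⇒∣m*n (θ ^ n) h
      lem : ∀ x y → x + - (x - y) ≡ y
      lem = solve-∀

    p∤θ^ : ∀ k → ¬ (+ p ∣ θ ^ k)
    p∤θ^ zero h = p∤1 h
    p∤θ^ (suc k) h = [ p∤θ , p∤θ^ k ]′ (euclid pp θ (θ ^ k) h)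

    multiple⇒θ^≡1 : ∀ {m} → n ℕD.∣ m → θ ^ m ≡ₚ + 1
    multiple⇒θ^≡1 (ℕD.divides k refl) = ≡ₚ-trans (≡⇒≡ₚ (trans (cong (θ ^_) (ℕP.*-comm k n)) (sym (ℤP.^-*-assoc θ n k))))
      (≡ₚ-trans (^-congₚ k θ^n) (≡⇒≡ₚ (ℤP.^-zeroˡ k)))

    θ^≡1⇒multiple : ∀ {m} → θ ^ m ≡ₚ + 1 → n ℕD.∣ m
    θ^≡1⇒multiple {m} h = ℕD.m%n≡0⇒n∣m m n {{nz}} (r≡0 r refl)
      where
      nz : NonZero n
      nz = ℕ.>-nonZero 1≤n
      r q : ℕ
      r = ℕ._%_ m n {{nz}}
      q = ℕ._/_ m n {{nz}}
      θ^r : θ ^ r ≡ₚ + 1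
      θ^r = ≡ₚ-trans (≡ₚ-sym (≡ₚ-trans (≡⇒≡ₚ (trans (cong (θ ^_) (m≡m%n+[m/n]*n m n {{nz}})) (ℤP.^-distribˡ-+-* θ r (q ℕ.* n))))
        (≡ₚ-trans (*-congₚ (≡ₚ-refl (θ ^ r)) (multiple⇒θ^≡1 (ℕD.n∣m*n q))) (≡⇒≡ₚ (ℤP.*-identityʳ (θ ^ r)))))) h
      r≡0 : ∀ r′ → r′ ≡ r → r ≡ 0
      r≡0 zero e = sym e
      r≡0 (suc _) e = ⊥-elim (θ^<n (m%n<n m n {{nz}}) (subst (0 ℕ.<_) e (s≤s z≤n)) θ^r)

    -- The premise of `count-differences`: exponents at which γ θⁱ takes the same residue differ by
    -- a multiple of the order.
    difference : ∀ {i j γ} → ¬ (+ p ∣ γ) → γ * θ ^ (j ℕ.+ i) ≡ₚ γ * θ ^ i → θ ^ j ≡ₚ + 1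
    difference {i} {j} {γ} ∤γ h = cancelₚ pp (p∤θ^ i) (≡ₚ-trans (≡⇒≡ₚ (trans (ℤP.*-comm (θ ^ i) (θ ^ j)) (sym (ℤP.^-distribˡ-+-* θ j i))))
      (≡ₚ-trans (cancelₚ pp ∤γ h) (≡⇒≡ₚ (sym (ℤP.*-identityʳ (θ ^ i))))))

    -- The number of discrete logarithms of `g` to the base θ.
    logs : ℕ → ℕ
    logs g = count (λ y → res (θ ^ y) ℕ.≟ g) n

    logs≤1 : ∀ g → logs g ℕ.≤ 1
    logs≤1 g = ℕP.≤-trans (count-differences (λ y → res (θ ^ y) ℕ.≟ g) (n ℕD.∣?_) n
      λ i j a b → θ^≡1⇒multiple (difference {i} {j} {+ 1} p∤1 (*-congₚ (≡ₚ-refl (+ 1))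
        (≡ₚ-trans (res-≡ₚ (θ ^ (j ℕ.+ i))) (≡ₚ-trans (≡⇒≡ₚ (cong +_ (trans b (sym a)))) (≡ₚ-sym (res-≡ₚ (θ ^ i))))))))
      (ℕP.≤-reflexive (trans (cong (count (n ℕD.∣?_)) (sym (ℕP.+-identityʳ n))) (count-multiples n 1 1≤n)))

    res-θ^≢0 : ∀ y → res (θ ^ y) ≢ 0
    res-θ^≢0 y e = p∤θ^ y (subst (+ p ∣_) (ℤP.+-identityʳ (θ ^ y)) (divisible (subst (λ r → θ ^ y ≡ₚ + r) e (res-≡ₚ (θ ^ y)))))

    -- n powers of θ fall injectively into the n non-zero residue classes.
    logs≡1 : ∀ g → g ℕ.< n → logs (suc g) ≡ 1
    logs≡1 = Σ-extremal n (λ g _ → logs≤1 (suc g)) (begin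
      Σ n (λ g → logs (suc g))          ≡⟨ cong (ℕ._+ Σ n (λ g → logs (suc g))) (sym logs0) ⟩
      Σ (suc n) logs                    ≡⟨ Σ-swap (suc n) n (λ g y → when (res (θ ^ y) ℕ.≟ g) 1) ⟩
      Σ n (λ y → Σ (suc n) (λ g → when (res (θ ^ y) ℕ.≟ g) 1))  ≡⟨ Σ-cong′ n (λ y → Σ-single (suc n) (res (θ ^ y)) (res<p (θ ^ y)) (λ _ → 1)) ⟩
      Σ n (λ _ → 1)                     ≡⟨ trans (Σ-const n 1) (ℕP.*-identityʳ n) ⟩
      n                                 ∎)
      where
      open ≡-Reasoning
      logs0 : logs 0 ≡ 0
      logs0 = Σ-0 n λ y _ → when-no (res (θ ^ y) ℕ.≟ 0) {1} (res-θ^≢0 y)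

    power-of : ∀ {g y} → + g ≡ₚ θ ^ y → ∀ k → (+ g) ^ k ≡ₚ θ ^ (y ℕ.* k)
    power-of {g} {y} h k = ≡ₚ-trans (^-congₚ k h) (≡⇒≡ₚ (ℤP.^-*-assoc θ y k))

    -- Put d = gcd(y, n) and n = k d. Then n divides y k, so gᵏ = 1, and minimality of the order
    -- forces k = n.
    primitive⇒coprime : ∀ {g y} → + g ≡ₚ θ ^ y → IsPrimitiveRoot p (+ g) → Coprime y n
    primitive⇒coprime {g} {y} h (_ , min) = gcd≡1⇒coprime (gcd1 (gcd[m,n]∣m y n) (gcd[m,n]∣n y n))
      where
      gcd1 : gcd y n ℕD.∣ y → gcd y n ℕD.∣ n → gcd y n ≡ 1
      gcd1 (ℕD.divides y′ ey) (ℕD.divides k en) = dec (k ℕ.<? n)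
        where
        d = gcd y n
        k>0 : 0 ℕ.< k
        k>0 = ℕP.n≢0⇒n>0 λ e → ℕP.<⇒≱ 1≤n (ℕP.≤-reflexive (trans en (cong (ℕ._* d) e)))
        g^k : (+ g) ^ k ≡ₚ + 1
        g^k = ≡ₚ-trans (power-of {g} {y} h k) (multiple⇒θ^≡1 (ℕD.divides y′ (trans (cong (ℕ._* k) ey) (trans (ℕP.*-assoc y′ d k) (cong (y′ ℕ.*_) (trans (ℕP.*-comm d k) (sym en)))))))
        dec : Dec (k ℕ.< n) → d ≡ 1
        dec (yes k<n) = ⊥-elim (min (subst (k ℕ.<_) (sym φp≡n) k<n) k>0 (≡ₚ⇒∣ᵤ g^k))
        dec (no k≮n) = ℕP.*-cancelˡ-≡ d 1 k {{ℕ.>-nonZero k>0}} (trans (sym en) (trans (ℕP.≤-antisym (ℕP.≮⇒≥ k≮n)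
          (ℕD.∣⇒≤ {{ℕ.>-nonZero 1≤n}} (ℕD.divides d (trans en (ℕP.*-comm k d))))) (sym (ℕP.*-identityʳ k))))

    coprime⇒primitive : ∀ {g y} → + g ≡ₚ θ ^ y → Coprime y n → IsPrimitiveRoot p (+ g)
    coprime⇒primitive {g} {y} h c = ≡ₚ⇒∣ᵤ (subst (λ k → (+ g) ^ k ≡ₚ + 1) (sym φp≡n) (≡ₚ-trans (power-of {g} {y} h n) (multiple⇒θ^≡1 (ℕD.n∣m*n y)))) ,
      λ {k} k<φ 0<k d → ℕP.<⇒≱ (subst (k ℕ.<_) φp≡n k<φ) (ℕD.∣⇒≤ {{ℕ.>-nonZero 0<k}}
        (coprime-divisor (coprime-sym c) (θ^≡1⇒multiple (≡ₚ-trans (≡ₚ-sym (power-of {g} {y} h k)) (∣ᵤ⇒≡ₚ d)))))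

-- Orthogonality and the bound for the sum over primitive roots.

module Estimates where
  open import Defs using (IsPrimitiveRoot; isPrimitiveRoot?; ι; ι-pos; ι-mono; *-monoˡ; isqrt; isqrt-bounds)
  open import Data.Empty using (⊥-elim)
  open import Data.Integer as ℤ using (ℤ; +_; _-_; _*_; _+_; _^_; -_)
  open import Data.Integer.Divisibility.Signed using (_∣_; divides; ∣m∣n⇒∣m+n; ∣m⇒∣-m; ∣n⇒∣m*n; _∣?_)
  import Data.Integer.Properties as ℤP
  open import Data.Integer.Tactic.RingSolver using (solve-∀)
  open import Data.List using ([]; _∷_; length)
  open import Data.Nat as ℕ using (ℕ; zero; suc; z≤n; s≤s; NonZero)
  open import Data.Nat.Coprimality using (Coprime; coprime?; prime⇒coprime; coprime-Bézout; 1-coprimeTo) renaming (sym to coprime-sym)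
  import Data.Nat.Divisibility as ℕD
  open import Data.Nat.GCD using (module Bézout)
  open import Data.Nat.Primality using (Prime)
  import Data.Nat.Properties as ℕP
  open import Data.Nat.Tactic.RingSolver using () renaming (solve-∀ to solveℕ-∀)
  open import Data.Product using (∃; _×_; _,_; proj₂)
  open import Data.Rational as ℚ using (0ℚ)
  import Data.Rational.Properties as ℚP
  open import Function using (_∘_)
  open import Relation.Binary.PropositionalEquality
  open import Relation.Nullary using (¬_; Dec; yes; no)
  open Sums
  open Arithmetic
  open Sieves
  open Analysis
  open Residues

  open 𝕊Σ renaming (Σ to ∑ˢ)

  ∑-*ˡ : ∀ n a f → a *ˢ ∑ˢ n f ≈ ∑ˢ n (λ i → a *ˢ f i)
  ∑-*ˡ zero    a f = S.zeroʳ a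
  ∑-*ˡ (suc n) a f = ≈-trans (S.distribˡ a (f 0) (∑ˢ n (f ∘ suc))) (+ˢ-cong (≈-refl {a *ˢ f 0}) (∑-*ˡ n a (f ∘ suc)))

  ∑-*ʳ : ∀ n a f → ∑ˢ n f *ˢ a ≈ ∑ˢ n (λ i → f i *ˢ a)
  ∑-*ʳ n a f = ≈-trans (S.*-comm (∑ˢ n f) a) (≈-trans (∑-*ˡ n a f) (Σ-cong′ n λ i → S.*-comm a (f i)))

  ∑-*-∑ : ∀ m n f g → ∑ˢ m f *ˢ ∑ˢ n g ≈ ∑ˢ m (λ i → ∑ˢ n (λ j → f i *ˢ g j))
  ∑-*-∑ m n f g = ≈-trans (∑-*ʳ m (∑ˢ n g) f) (Σ-cong′ m λ i → ∑-*ˡ n (f i) g)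

  when-*ˢ : ∀ {P Q : Set} (d : Dec P) (e : Dec Q) u v → when d u *ˢ when e v ≈ when d (when e (u *ˢ v))
  when-*ˢ (yes _) (yes _) u v = ≈-refl
  when-*ˢ (yes _) (no _)  u v = S.zeroʳ u
  when-*ˢ (no _)  e       u v = S.zeroˡ (when e v)

  conjˢ-when : ∀ {P : Set} (d : Dec P) u → conjˢ (when d u) ≈ when d (conjˢ u)
  conjˢ-when (yes _) u = ≈-refl
  conjˢ-when (no _)  u = conjˢ-0

  conjˢ-∑ : ∀ n f → conjˢ (∑ˢ n f) ≈ ∑ˢ n (conjˢ ∘ f)
  conjˢ-∑ zero    f = conjˢ-0
  conjˢ-∑ (suc n) f = ≈-trans (conjˢ-+ (f 0) (∑ˢ n (f ∘ suc))) (+ˢ-cong (≈-refl {conjˢ (f 0)}) (conjˢ-∑ n (f ∘ suc)))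

  ∑-count : ∀ {P : ℕ → Set} (P? : ∀ i → Dec (P i)) n u → ∑ˢ n (λ i → when (P? i) u) ≈ ιˢ (ℕΣ.count P? n) *ˢ u
  ∑-count P? zero    u = ≈-sym (S.zeroˡ u)
  ∑-count P? (suc n) u = ≈-trans (+ˢ-cong (first (P? 0)) (∑-count (P? ∘ suc) n u))
    (≈-trans (≈-sym (S.distribʳ u _ _)) (*ˢ-cong (≈-sym (ιˢ-+ (ℕΣ.when (P? 0) 1) (ℕΣ.count (P? ∘ suc) n))) (≈-refl {u})))
    where
    first : ∀ {P : Set} (d : Dec P) → when d u ≈ ιˢ (ℕΣ.when d 1) *ˢ u
    first (yes _) = ≈-sym (≈-trans (*ˢ-cong ιˢ-1 (≈-refl {u})) (S.*-identityˡ u))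
    first (no _)  = ≈-sym (S.zeroˡ u)

  ∑-const : ∀ n u → ∑ˢ n (λ _ → u) ≈ ιˢ n *ˢ u
  ∑-const zero    u = ≈-sym (S.zeroˡ u)
  ∑-const (suc n) u = ≈-trans (+ˢ-cong (≈-sym (≈-trans (*ˢ-cong ιˢ-1 (≈-refl {u})) (S.*-identityˡ u))) (∑-const n u))
    (≈-trans (≈-sym (S.distribʳ u (ιˢ 1) (ιˢ n))) (*ˢ-cong (≈-sym (ιˢ-+ 1 n)) (≈-refl {u})))

  when-mono-≲ : ∀ {P : Set} (d : Dec P) {u v} → (P → u ≲ v) → when d u ≲ when d v
  when-mono-≲ (yes h) f = f h
  when-mono-≲ (no _)  f = ≈⇒≲ ≈-refl

  0≲⇒when≲ : ∀ {P : Set} (d : Dec P) {u} → 0ˢ ≲ u → when d u ≲ u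
  0≲⇒when≲ (yes _) h = ≈⇒≲ ≈-refl
  0≲⇒when≲ (no _)  h = h

  0≲N : ∀ u → 0ˢ ≲ N u
  0≲N u = ≲-pointwise λ n → ℚP.≤-trans (ℚP.≤-reflexive (cong Re (at-const 0ᵍ n))) (N-nonNeg u n)

  ιˢ-*-mono : ∀ {a b u} → a ℕ.≤ b → (∀ n → 0ℚ ℚ.≤ Re (at u n)) → ιˢ a *ˢ u ≲ ιˢ b *ˢ u
  ιˢ-*-mono {a} {b} {u} h 0≤u = ≲-pointwise λ n → subst₂ ℚ._≤_ (sym (Re-scale (ι a) u n)) (sym (Re-scale (ι b) u n)) (*-monoˡ (0≤u n) (ι-mono h))

  module Orthogonality (n : ℕ) (pp : Prime (suc n)) (P≤p : P₀ ℕ.≤ suc n) where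
    p : ℕ
    p = suc n
    open Congruence p
    open Additive p

    𝐞-congₚ : ∀ {α β} → α ≡ₚ β → 𝐞 α ≈ 𝐞 β
    𝐞-congₚ h = 𝐞-cong (≡ₚ⇒∣ᵤ h)

    fullSum : ℤ → 𝕊
    fullSum β = ∑ˢ p (λ c → 𝐞 (+ c * β))

    fullSum-divisible : ∀ {β} → + p ∣ β → fullSum β ≈ ιˢ p
    fullSum-divisible {β} h = ≈-trans (Σ-cong′ p λ c → ≈-trans (𝐞-congₚ {+ c * β} {+ 0} (mod (subst (+ p ∣_) (sym (ℤP.+-identityʳ (+ c * β))) (∣n⇒∣m*n (+ c) h)))) 𝐞-0)
      (≈-trans (∑-const p 1ˢ) (S.*-identityʳ (ιˢ p)))

    fullSum-shift : ∀ β → fullSum β *ˢ 𝐞 β ≈ fullSum β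
    fullSum-shift β = ≈-trans (∑-*ʳ p (𝐞 β) (λ c → 𝐞 (+ c * β))) (≈-trans
      (Σ-cong′ p λ c → ≈-trans (≈-sym (𝐞-+ (+ c * β) β)) (S.reflexive (cong 𝐞 (trans (ℤP.+-comm (+ c * β) β) (sym (ℤP.suc-* (+ c) β))))))
      (Σ-rotate p (λ c → 𝐞 (+ c * β)) (𝐞-congₚ (mod (divides β (lem (+ p) β))))))
      where
      lem : ∀ p β → p * β - + 0 * β ≡ β * p
      lem = solve-∀

    fullSum-shift^ : ∀ β k → fullSum β *ˢ 𝐞 (+ k * β) ≈ fullSum β
    fullSum-shift^ β zero = ≈-trans (*ˢ-cong (≈-refl {fullSum β}) 𝐞-0) (S.*-identityʳ (fullSum β))
    fullSum-shift^ β (suc k) = ≈-trans (*ˢ-cong (≈-refl {fullSum β}) (≈-trans (S.reflexive (cong 𝐞 (ℤP.suc-* (+ k) β))) (𝐞-+ β (+ k * β))))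
      (≈-trans (≈-sym (S.*-assoc (fullSum β) (𝐞 β) (𝐞 (+ k * β)))) (≈-trans (*ˢ-cong (fullSum-shift β) (≈-refl {𝐞 (+ k * β)})) (fullSum-shift^ β k)))

    -- Shifting c by x multiplies the sum by 𝐞(x β) without changing it, and Bézout supplies x with
    -- x β congruent to 1 or to -1 modulo p.
    fullSum-fixed : ∀ {β} → ¬ (+ p ∣ β) → fullSum β *ˢ 𝐞 (+ 1) ≈ fullSum β
    fullSum-fixed {β} ∤β = bezout (res β) refl (coprime-Bézout {res β} {p} ∘ coprime-sym)
      where
      bezout : ∀ g → g ≡ res β → (Coprime p g → Bézout.Identity 1 g p) → fullSum β *ˢ 𝐞 (+ 1) ≈ fullSum β
      bezout zero e f = ⊥-elim (∤β (subst (+ p ∣_) (ℤP.+-identityʳ β) (divisible (subst (λ r → β ≡ₚ + r) (sym e) (res-≡ₚ β)))))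
      bezout g@(suc _) e f = solve (f (prime⇒coprime pp (subst (ℕ._< p) (sym e) (res<p β))))
        where
        β≡g : β ≡ₚ + g
        β≡g = subst (λ r → β ≡ₚ + r) (sym e) (res-≡ₚ β)
        solve : Bézout.Identity 1 g p → fullSum β *ˢ 𝐞 (+ 1) ≈ fullSum β
        solve (Bézout.+- x y eq) = ≈-trans (*ˢ-cong (≈-refl {fullSum β}) (𝐞-congₚ (≡ₚ-sym xβ≡1))) (fullSum-shift^ β x)
          where
          xβ≡1 : + x * β ≡ₚ + 1
          xβ≡1 = ≡ₚ-trans (*-congₚ (≡ₚ-refl (+ x)) β≡g) (≡ₚ-trans (≡⇒≡ₚ (trans (sym (ℤP.pos-* x g)) (cong +_ (sym eq))))
            (mod (divides (+ y) (trans (cong (_- + 1) (trans (ℤP.pos-+ 1 (y ℕ.* p)) (cong (λ z → + 1 + z) (ℤP.pos-* y p)))) (lem (+ y * + p))))))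
            where
            lem : ∀ z → (+ 1 + z) - + 1 ≡ z
            lem = solve-∀
        solve (Bézout.-+ x y eq) = ≈-trans (*ˢ-cong (≈-sym (fullSum-shift^ β x)) (≈-refl {𝐞 (+ 1)}))
          (≈-trans (S.*-assoc (fullSum β) (𝐞 (+ x * β)) (𝐞 (+ 1))) (≈-trans (*ˢ-cong (≈-refl {fullSum β})
            (≈-trans (≈-sym (𝐞-+ (+ x * β) (+ 1))) (≈-trans (𝐞-congₚ xβ+1≡0) 𝐞-0))) (S.*-identityʳ (fullSum β))))
          where
          xβ+1≡0 : + x * β + + 1 ≡ₚ + 0
          xβ+1≡0 = mod (subst (+ p ∣_) (lem (+ x * β) (+ x * + g))
            (∣m∣n⇒∣m+n (divisible (*-congₚ (≡ₚ-refl (+ x)) β≡g))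
              (divides (+ y) (trans (cong (λ z → + 1 + z) (sym (ℤP.pos-* x g))) (trans (sym (ℤP.pos-+ 1 (x ℕ.* g))) (trans (cong +_ eq) (ℤP.pos-* y p)))))))
            where
            lem : ∀ a b → (a - b) + (+ 1 + b) ≡ a + + 1 - + 0
            lem = solve-∀

    -- The sum is annihilated by 1 - 𝐞(1), and `𝐞-apart` allows that factor to be cancelled.
    fullSum-indivisible : ∀ {β} → ¬ (+ p ∣ β) → fullSum β ≈ 0ˢ
    fullSum-indivisible {β} ∤β = go (𝐞-apart P≤p)
      where
      killed : fullSum β *ˢ (1ˢ +ˢ -ˢ 𝐞 (+ 1)) ≈ 0ˢ
      killed = ≈-trans (S.distribˡ (fullSum β) 1ˢ (-ˢ 𝐞 (+ 1))) (≈-trans (+ˢ-cong (S.*-identityʳ (fullSum β))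
        (≈-trans (≈-sym (-‿distribʳ-* (fullSum β) (𝐞 (+ 1)))) (-ˢ-cong (fullSum-fixed ∤β)))) (S.-‿inverseʳ (fullSum β)))
        where open import Algebra.Properties.Ring S.ring using (-‿distribʳ-*)
      go : (∃ λ g → 0ℚ ℚ.< g × Eventually (λ n → g ℚ.≤ Re (at (1ˢ +ˢ -ˢ 𝐞 (+ 1)) n))) → fullSum β ≈ 0ˢ
      go (g , 0<g , apart) = cancel-apart 0<g apart killed

    fullSum≲ : ∀ β → fullSum β ≲ when (+ p ∣? β) (ιˢ p)
    fullSum≲ β = go (+ p ∣? β)
      where
      go : (d : Dec (+ p ∣ β)) → fullSum β ≲ when d (ιˢ p)
      go (yes h) = ≈⇒≲ (fullSum-divisible h)
      go (no h)  = ≈⇒≲ (fullSum-indivisible h)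

  -- As y runs over the multiples of d, `h y` runs over the subgroup generated by θ^{xd}, with
  -- repetitions that `torsion n x` bounds.
  module Subgroup (n : ℕ) (pp : Prime (suc n)) (P≤p : P₀ ℕ.≤ suc n)
    (θ : ℤ) (root : IsPrimitiveRoot (suc n) θ) (x d : ℕ) (d∣n : d ℕD.∣ n) where
    open PrimitiveRoot n pp θ root
    open Additive p
    open Orthogonality n pp P≤p using (𝐞-congₚ; fullSum; fullSum≲)

    h : ℕ → ℤ
    h y = θ ^ (x ℕ.* y)

    T : ℤ → 𝕊
    T c = ∑ˢ n (λ y → when (d ℕD.∣? y) (𝐞 (c * h y)))

    T-cong : ∀ {c c′} → c ≡ₚ c′ → T c ≈ T c′
    T-cong e = Σ-cong′ n λ y → when-cong (d ℕD.∣? y) λ _ → 𝐞-congₚ (*-congₚ e (≡ₚ-refl (h y)))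

    h-+ : ∀ i j → h (i ℕ.+ j) ≡ h i * h j
    h-+ i j = trans (cong (θ ^_) (ℕP.*-distribˡ-+ x i j)) (ℤP.^-distribˡ-+-* θ (x ℕ.* i) (x ℕ.* j))

    -- The factor `h y₀` shifts the summation index by y₀, and the summand has period n in y because
    -- d divides n.
    T-invariant : ∀ c y₀ → d ℕD.∣ y₀ → T (c * h y₀) ≈ T c
    T-invariant c y₀ d∣y₀ = ≈-trans (Σ-cong′ n λ y → ≈-trans
        (when-iff (d ℕD.∣? y) (d ℕD.∣? (y₀ ℕ.+ y)) (ℕD.∣m∣n⇒∣m+n d∣y₀) (λ e → ℕD.∣m+n∣m⇒∣n e d∣y₀))
        (S.reflexive (cong (λ z → when (d ℕD.∣? (y₀ ℕ.+ y)) (𝐞 z)) (trans (ℤP.*-assoc c (h y₀) (h y)) (cong (c *_) (sym (h-+ y₀ y)))))))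
      (Σ-shift n (λ y → when (d ℕD.∣? y) (𝐞 (c * h y))) y₀ periodic)
      where
      periodic : ∀ y → when (d ℕD.∣? (y ℕ.+ n)) (𝐞 (c * h (y ℕ.+ n))) ≈ when (d ℕD.∣? y) (𝐞 (c * h y))
      periodic y = ≈-trans (when-cong (d ℕD.∣? (y ℕ.+ n)) λ _ → 𝐞-congₚ (*-congₚ (≡ₚ-refl c)
          (≡ₚ-trans (≡⇒≡ₚ (h-+ y n)) (≡ₚ-trans (*-congₚ (≡ₚ-refl (h y)) (multiple⇒θ^≡1 (ℕD.n∣m*n x))) (≡⇒≡ₚ (ℤP.*-identityʳ (h y)))))))
        (when-iff (d ℕD.∣? (y ℕ.+ n)) (d ℕD.∣? y) (λ e → ℕD.∣m+n∣m⇒∣n (subst (d ℕD.∣_) (ℕP.+-comm y n) e) d∣n) (λ e → ℕD.∣m∣n⇒∣m+n e d∣n))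

    D : ℕ
    D = torsion n x

    -- Any two elements of P differ by some j with n ∣ x j. It is used with γ = 1 for pairs with h y
    -- = h y′, and with γ = b for the y whose b h y falls into a given class.
    multiplicity : ∀ {P : ℕ → Set} (P? : ∀ y → Dec (P y)) γ → ¬ (+ p ∣ γ) → (∀ {i j} → P i → P j → γ * h i ≡ₚ γ * h j) → ℕΣ.count P? n ℕ.≤ D
    multiplicity P? γ ∤γ same = ℕΣ.count-differences P? (λ y → n ℕD.∣? (x ℕ.* y)) n λ i j a b →
      θ^≡1⇒multiple (difference {x ℕ.* i} {x ℕ.* j} {γ} ∤γ
        (≡ₚ-trans (≡⇒≡ₚ (cong (λ k → γ * θ ^ k) (sym (ℕP.*-distribˡ-+ x j i)))) (same b a)))

    m : ℕ
    m = ℕΣ.count (d ℕD.∣?_) n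

    conj-T : ∀ c → conjˢ (T c) ≈ ∑ˢ n (λ y → when (d ℕD.∣? y) (𝐞 (- (c * h y))))
    conj-T c = ≈-trans (conjˢ-∑ n (λ y → when (d ℕD.∣? y) (𝐞 (c * h y)))) (Σ-cong′ n λ y →
      ≈-trans (conjˢ-when (d ℕD.∣? y) (𝐞 (c * h y))) (when-cong (d ℕD.∣? y) λ _ → conj-𝐞 (c * h y)))

    N-T : ∀ c → N (T c) ≈ ∑ˢ n (λ y → ∑ˢ n (λ y′ → when (d ℕD.∣? y) (when (d ℕD.∣? y′) (𝐞 (c * (h y - h y′))))))
    N-T c = ≈-trans (*ˢ-cong (≈-refl {T c}) (conj-T c)) (≈-trans (∑-*-∑ n n _ _) (Σ-cong′ n λ y → Σ-cong′ n λ y′ →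
      ≈-trans (when-*ˢ (d ℕD.∣? y) (d ℕD.∣? y′) (𝐞 (c * h y)) (𝐞 (- (c * h y′))))
        (when-cong (d ℕD.∣? y) λ _ → when-cong (d ℕD.∣? y′) λ _ →
          ≈-trans (≈-sym (𝐞-+ (c * h y) (- (c * h y′)))) (S.reflexive (cong 𝐞 (lem c (h y) (h y′)))))))
      where
      lem : ∀ c a b → c * a + - (c * b) ≡ c * (a - b)
      lem = solve-∀

    -- Orthogonality, and each y has at most D partners y′ with h y ≡ h y′.
    ∑N-T : ∑ˢ p (λ c → N (T (+ c))) ≲ ιˢ m *ˢ ιˢ (D ℕ.* p)
    ∑N-T = ≲-trans (≈⇒≲ rearrange) (≲-trans bound (≈⇒≲ (∑-count (d ℕD.∣?_) n (ιˢ (D ℕ.* p)))))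
      where
      rearrange : ∑ˢ p (λ c → N (T (+ c))) ≈ ∑ˢ n (λ y → when (d ℕD.∣? y) (∑ˢ n (λ y′ → when (d ℕD.∣? y′) (fullSum (h y - h y′)))))
      rearrange = begin
        ∑ˢ p (λ c → N (T (+ c)))
          ≈⟨ Σ-cong′ p (λ c → N-T (+ c)) ⟩
        ∑ˢ p (λ c → ∑ˢ n (λ y → ∑ˢ n (λ y′ → when (d ℕD.∣? y) (when (d ℕD.∣? y′) (𝐞 (+ c * (h y - h y′)))))))
          ≈⟨ Σ-swap p n (λ c y → ∑ˢ n (λ y′ → when (d ℕD.∣? y) (when (d ℕD.∣? y′) (𝐞 (+ c * (h y - h y′)))))) ⟩
        ∑ˢ n (λ y → ∑ˢ p (λ c → ∑ˢ n (λ y′ → when (d ℕD.∣? y) (when (d ℕD.∣? y′) (𝐞 (+ c * (h y - h y′)))))))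
          ≈⟨ Σ-cong′ n (λ y → Σ-swap p n (λ c y′ → when (d ℕD.∣? y) (when (d ℕD.∣? y′) (𝐞 (+ c * (h y - h y′)))))) ⟩
        ∑ˢ n (λ y → ∑ˢ n (λ y′ → ∑ˢ p (λ c → when (d ℕD.∣? y) (when (d ℕD.∣? y′) (𝐞 (+ c * (h y - h y′)))))))
          ≈⟨ Σ-cong′ n (λ y → ≈-trans (Σ-cong′ n (λ y′ → ≈-trans (≈-sym (when-Σ (d ℕD.∣? y) p (λ c → when (d ℕD.∣? y′) (𝐞 (+ c * (h y - h y′))))))
               (when-cong (d ℕD.∣? y) λ _ → ≈-sym (when-Σ (d ℕD.∣? y′) p (λ c → 𝐞 (+ c * (h y - h y′)))))))
               (≈-sym (when-Σ (d ℕD.∣? y) n (λ y′ → when (d ℕD.∣? y′) (fullSum (h y - h y′)))))) ⟩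
        ∑ˢ n (λ y → when (d ℕD.∣? y) (∑ˢ n (λ y′ → when (d ℕD.∣? y′) (fullSum (h y - h y′))))) ∎
        where open 𝕊-Reasoning
      0≲ : ∀ y y′ → 0ˢ ≲ when (+ p ∣? (h y - h y′)) (ιˢ p)
      0≲ y y′ = go (+ p ∣? (h y - h y′))
        where
        go : ∀ {P : Set} (e : Dec P) → 0ˢ ≲ when e (ιˢ p)
        go (yes _) = ιˢ-mono {0} {p} z≤n
        go (no _)  = ≈⇒≲ ≈-refl
      bound : ∑ˢ n (λ y → when (d ℕD.∣? y) (∑ˢ n (λ y′ → when (d ℕD.∣? y′) (fullSum (h y - h y′))))) ≲ ∑ˢ n (λ y → when (d ℕD.∣? y) (ιˢ (D ℕ.* p)))
      bound = ∑ˢ-mono n λ y _ → when-mono-≲ (d ℕD.∣? y) λ _ →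
        ≲-trans (∑ˢ-mono n λ y′ _ → ≲-trans (when-mono-≲ (d ℕD.∣? y′) λ _ → fullSum≲ (h y - h y′)) (0≲⇒when≲ (d ℕD.∣? y′) (0≲ y y′)))
        (≲-trans (≈⇒≲ (≈-trans (∑-count (λ y′ → + p ∣? (h y - h y′)) n (ιˢ p)) (≈-sym (ιˢ-* (ℕΣ.count (λ y′ → + p ∣? (h y - h y′)) n) p))))
          (ιˢ-mono (ℕP.*-monoˡ-≤ p (multiplicity (λ y′ → + p ∣? (h y - h y′)) (+ 1) p∤1
            λ a b → *-congₚ (≡ₚ-refl (+ 1)) (≡ₚ-trans (≡ₚ-sym {h y} (mod a)) (mod {h y} b))))))

    -- By invariance m |T(b)|² is the sum of |T(c)|² over the m values c = b h y with d ∣ y. A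
    -- residue c occurs at most D times, so the sum over all residues, at most m D p, is multiplied
    -- by D; then m cancels. One D thus comes from completion and the other from orthogonality.
    N-T≲ : ∀ {b} → ¬ (+ p ∣ b) → N (T b) ≲ ιˢ (D ℕ.* (D ℕ.* p))
    N-T≲ {b} ∤b = scale-cancel (ι-pos m {{ℕ.>-nonZero m≥1}}) (≲-trans lower (≲-trans upper (≈⇒≲ collect)))
      where
      m≥1 : 1 ℕ.≤ m
      m≥1 = ℕΣ.count≥1 (d ℕD.∣?_) n (d ℕD.∣0) 1≤n
      r : ℕ → ℕ
      r y = res (b * h y)
      c# : ℕ → ℕ
      c# c = ℕΣ.count (λ y → r y ℕ.≟ c) n
      lower : ιˢ m *ˢ N (T b) ≲ ∑ˢ p (λ c → ιˢ (c# c) *ˢ N (T (+ c)))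
      lower = ≲-trans (≈⇒≲ (≈-sym (∑-count (d ℕD.∣?_) n (N (T b)))))
        (≲-trans (∑ˢ-mono n λ y _ → ≲-trans (when-mono-≲ (d ℕD.∣? y) λ d∣y →
            ≈⇒≲ (N-cong (≈-trans (≈-sym (T-invariant b y d∣y)) (T-cong (res-≡ₚ (b * h y))))))
            (0≲⇒when≲ (d ℕD.∣? y) (0≲N (T (+ r y)))))
          (≈⇒≲ (≈-trans (Σ-cong′ n λ y → ≈-sym (Σ-single p (r y) (res<p (b * h y)) (λ c → N (T (+ c)))))
            (≈-trans (Σ-swap n p (λ y c → when (r y ℕ.≟ c) (N (T (+ c)))))
              (Σ-cong′ p λ c → ∑-count (λ y → r y ℕ.≟ c) n (N (T (+ c))))))))
      c#≤D : ∀ c → c# c ℕ.≤ D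
      c#≤D c = multiplicity (λ y → r y ℕ.≟ c) b ∤b λ {i} {j} e e′ →
        ≡ₚ-trans (res-≡ₚ (b * h i)) (≡ₚ-trans (≡⇒≡ₚ (cong +_ (trans e (sym e′)))) (≡ₚ-sym (res-≡ₚ (b * h j))))
      upper : ∑ˢ p (λ c → ιˢ (c# c) *ˢ N (T (+ c))) ≲ ιˢ D *ˢ (ιˢ m *ˢ ιˢ (D ℕ.* p))
      upper = ≲-trans (∑ˢ-mono p λ c _ → ιˢ-*-mono {c# c} {D} {N (T (+ c))} (c#≤D c) (N-nonNeg (T (+ c))))
        (≲-trans (≈⇒≲ (≈-sym (∑-*ˡ p (ιˢ D) (λ c → N (T (+ c)))))) (scale-mono (ι-pos D {{ℕ.>-nonZero (torsion≥1 n x 1≤n)}}) ∑N-T))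
      collect : ιˢ D *ˢ (ιˢ m *ˢ ιˢ (D ℕ.* p)) ≈ ιˢ m *ˢ ιˢ (D ℕ.* (D ℕ.* p))
      collect = ≈-trans (≈-sym (S.*-assoc (ιˢ D) (ιˢ m) (ιˢ (D ℕ.* p)))) (≈-trans (*ˢ-cong (S.*-comm (ιˢ D) (ιˢ m)) ≈-refl)
        (≈-trans (S.*-assoc (ιˢ m) (ιˢ D) (ιˢ (D ℕ.* p))) (*ˢ-cong (≈-refl {ιˢ m}) (≈-sym (ιˢ-* D (D ℕ.* p))))))

  open Sieving S.+-commutativeMonoid

  -- A substitute for √p which also exceeds p when p < P₀, where the angle 2π/p may be too
  -- large for the estimate of its cosine and the trivial bound is used instead.
  radius : ℕ → ℕ
  radius p = suc (P₀ ℕ.+ isqrt p)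

  p≤radius² : ∀ p → p ℕ.≤ radius p ℕ.* radius p
  p≤radius² p = ℕP.≤-trans (ℕP.<⇒≤ (proj₂ (isqrt-bounds p))) (ℕP.*-mono-≤ le le)
    where
    le : suc (isqrt p) ℕ.≤ radius p
    le = s≤s (ℕP.m≤n+m (isqrt p) P₀)

  module _ (p : ℕ) .{{_ : NonZero p}} where
    open Additive p

    N-𝐞 : ∀ α → N (𝐞 α) ≈ 1ˢ
    N-𝐞 α = ≈-trans (*ˢ-cong (≈-refl {𝐞 α}) (conj-𝐞 α)) (𝐞-inverse α)

    opaque
      rootSum : ℤ → ℕ → 𝕊
      rootSum b x = ∑ˢ p (λ g → when (isPrimitiveRoot? p (+ g)) (𝐞 (b * (+ g) ^ x)))

      rootSum-definition : ∀ b x → rootSum b x ≈ ∑ˢ p (λ g → when (isPrimitiveRoot? p (+ g)) (𝐞 (b * (+ g) ^ x)))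
      rootSum-definition b x = ≈-refl

  module PowerSums (n : ℕ) (pp : Prime (suc n)) (θ : ℤ) (root : IsPrimitiveRoot (suc n) θ) where
    open PrimitiveRoot n pp θ root
    open Additive p

    𝐞≼1 : ∀ α → 𝐞 α ≼ 1
    𝐞≼1 α = norm≤ (≈⇒≲ (≈-trans (N-𝐞 p α) (≈-sym ιˢ-1)))

    R : ℕ
    R = radius p

    -- Each primitive root g is θ ^ y for exactly one y < n, and y is coprime to n.
    rootSum-powers : ∀ b x → rootSum p b x ≈ ∑ˢ n (λ y → when (coprime? y n) (𝐞 (b * θ ^ (x ℕ.* y))))
    rootSum-powers b x = ≈-trans (rootSum-definition p b x) (≈-sym (begin
      ∑ˢ n (λ y → when (coprime? y n) (𝐞 (b * θ ^ (x ℕ.* y))))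
        ≈⟨ Σ-cong′ n (λ y → when-cong (coprime? y n) λ _ → 𝐞-cong (≡ₚ⇒∣ᵤ (*-congₚ (≡ₚ-refl b)
             (≡ₚ-trans (≡⇒≡ₚ (cong (θ ^_) (ℕP.*-comm x y))) (≡ₚ-sym (power-of {r y} {y} (≡ₚ-sym (res-≡ₚ (θ ^ y))) x)))))) ⟩
      ∑ˢ n (λ y → when (coprime? y n) (F (r y)))
        ≈⟨ Σ-cong′ n (λ y → when-iff (coprime? y n) (isPrimitiveRoot? p (+ r y))
             (coprime⇒primitive {r y} {y} (≡ₚ-sym (res-≡ₚ (θ ^ y)))) (primitive⇒coprime {r y} {y} (≡ₚ-sym (res-≡ₚ (θ ^ y))))) ⟩
      ∑ˢ n (λ y → G (r y))
        ≈⟨ Σ-cong′ n (λ y → ≈-sym (Σ-single p (r y) (res<p (θ ^ y)) G)) ⟩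
      ∑ˢ n (λ y → ∑ˢ p (λ g → when (r y ℕ.≟ g) (G g)))
        ≈⟨ Σ-swap n p (λ y g → when (r y ℕ.≟ g) (G g)) ⟩
      ∑ˢ p (λ g → ∑ˢ n (λ y → when (r y ℕ.≟ g) (G g)))
        ≈⟨ Σ-cong p (λ g g<p → ≈-trans (∑-count (λ y → r y ℕ.≟ g) n (G g)) (once g g<p)) ⟩
      ∑ˢ p G ∎))
      where
      open 𝕊-Reasoning
      r : ℕ → ℕ
      r y = res (θ ^ y)
      F G : ℕ → 𝕊
      F g = 𝐞 (b * (+ g) ^ x)
      G g = when (isPrimitiveRoot? p (+ g)) (F g)
      once : ∀ g → g ℕ.< p → ιˢ (logs g) *ˢ G g ≈ G g
      -- The class 0 has no logarithm, but 0 is not a primitive root either, so both sides vanish.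
      once zero    _ = ≈-trans (*ˢ-cong (≈-refl {ιˢ (logs 0)}) G0) (≈-trans (S.zeroʳ (ιˢ (logs 0))) (≈-sym G0))
        where
        0^ : ∀ n → 1 ℕ.≤ n → (+ 0) ^ n ≡ + 0
        0^ (suc n) _ = refl
        G0 : G 0 ≈ 0ˢ
        G0 = when-no (isPrimitiveRoot? p (+ 0)) λ { (d , _) → p∤θ^ 0 (neg (divisible (∣ᵤ⇒≡ₚ {(+ 0) ^ n} {+ 1} (subst (λ k → p ℕD.∣ ℤ.∣ (+ 0) ^ k - + 1 ∣) φp≡n d)))) }
          where
          neg : + p ∣ ((+ 0) ^ n - + 1) → + p ∣ + 1
          neg h = ∣m⇒∣-m (subst (λ z → + p ∣ (z - + 1)) (0^ n 1≤n) h)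
      once (suc g) (s≤s g<n) = ≈-trans (*ˢ-cong (≈-trans (S.reflexive (cong ιˢ (logs≡1 g g<n))) ιˢ-1) (≈-refl {G (suc g)})) (S.*-identityˡ (G (suc g)))

    module _ {b : ℤ} (∤b : ¬ (+ p ∣ b)) (x : ℕ) where

      F : ℕ → 𝕊
      F y = 𝐞 (b * θ ^ (x ℕ.* y))

      B : ℕ
      B = torsion n x ℕ.* R

      1≤B : 1 ℕ.≤ B
      1≤B = ℕP.*-mono-≤ (torsion≥1 n x 1≤n) (s≤s z≤n)

      subgroup-bound : ∀ d → d ℕD.∣ n → sieve n F d [] ≼ B
      subgroup-bound d d∣n = go (P₀ ℕP.≤? p)
        where
        go : Dec (P₀ ℕ.≤ p) → sieve n F d [] ≼ B
        go (yes P≤p) = norm≤ (≲-trans (Subgroup.N-T≲ n pp P≤p θ root x d d∣n ∤b) (ιˢ-mono (begin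
          D ℕ.* (D ℕ.* p)            ≤⟨ ℕP.*-monoʳ-≤ D (ℕP.*-monoʳ-≤ D (p≤radius² p)) ⟩
          D ℕ.* (D ℕ.* (R ℕ.* R))    ≡⟨ lem D R ⟩
          B ℕ.* B                    ∎)))
          where
          open ℕP.≤-Reasoning
          D : ℕ
          D = torsion n x
          lem : ∀ D R → D ℕ.* (D ℕ.* (R ℕ.* R)) ≡ (D ℕ.* R) ℕ.* (D ℕ.* R)
          lem = solveℕ-∀
        -- The trivial bound: n terms of modulus at most 1 give n + 1 = p by `≼-∑`, and p < `P₀`.
        go (no P≰p) = ≼-weaken (begin
          suc (ℕΣ.Σ n (λ _ → 1))     ≡⟨ cong suc (trans (ℕΣ.Σ-const n 1) (ℕP.*-identityʳ n)) ⟩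
          p                          ≤⟨ ℕP.<⇒≤ (ℕP.≰⇒> P≰p) ⟩
          P₀                         ≤⟨ ℕP.m≤n⇒m≤1+n (ℕP.m≤m+n P₀ (isqrt p)) ⟩
          R                          ≡⟨ sym (ℕP.*-identityˡ R) ⟩
          1 ℕ.* R                    ≤⟨ ℕP.*-monoˡ-≤ R (torsion≥1 n x 1≤n) ⟩
          B                          ∎)
          (≼-∑ n (λ _ → 1) (λ _ _ → _) λ y _ → when≼ (d ℕD.∣? y) (b * θ ^ (x ℕ.* y)))
          where
          open ℕP.≤-Reasoning
          when≼ : ∀ {P : Set} (e : Dec P) α → when e (𝐞 α) ≼ 1
          when≼ (yes _) α = 𝐞≼1 α
          when≼ (no _)  α = ≼-0 1

      -- A sum sieved by one more prime is the difference of two sums sieved without it, so every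
      -- prime doubles the bound.
      sieve-bound : ∀ {d qs} → Sifted n d qs → sieve n F d qs ≼ 2 ℕ.^ length qs ℕ.* B
      sieve-bound {d} ([] d∣n) = subst (sieve n F d [] ≼_) (sym (ℕP.+-identityʳ B)) (subgroup-bound d d∣n)
      sieve-bound {d} (_∷_ {q = q} {qs} (cop , _) (s , s′)) = subst (sieve n F d (q ∷ qs) ≼_) (lem (2 ℕ.^ length qs) B)
        (≼-cong (≈-sym solved) (≼-+ K K {{nz}} {{nz}} (sieve-bound s) (≼-neg {sieve n F (d ℕ.* q) qs} {K} (sieve-bound s′))))
        where
        lem : ∀ k B → k ℕ.* B ℕ.+ k ℕ.* B ≡ (k ℕ.+ (k ℕ.+ 0)) ℕ.* B
        lem = solveℕ-∀
        K : ℕ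
        K = 2 ℕ.^ length qs ℕ.* B
        nz : NonZero K
        nz = ℕ.>-nonZero (ℕP.*-mono-≤ (ℕP.m^n>0 2 (length qs)) 1≤B)
        solved : sieve n F d (q ∷ qs) ≈ sieve n F d qs +ˢ -ˢ sieve n F (d ℕ.* q) qs
        solved = ≈-sym (≈-trans (+ˢ-cong (≈-sym (sieve-step n F d q qs cop)) (≈-refl { -ˢ sieve n F (d ℕ.* q) qs}))
          (≈-trans (S.+-assoc (sieve n F d (q ∷ qs)) (sieve n F (d ℕ.* q) qs) (-ˢ sieve n F (d ℕ.* q) qs))
            (≈-trans (+ˢ-cong (≈-refl {sieve n F d (q ∷ qs)}) (S.-‿inverseʳ (sieve n F (d ℕ.* q) qs))) (S.+-identityʳ (sieve n F d (q ∷ qs))))))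

      rootSum-bound : (f : Factored (suc n) n) → rootSum p b x ≼ 2 ℕ.^ length (primes f) ℕ.* B
      rootSum-bound f = ≼-cong (≈-trans (sieve-coprime f F) (≈-sym (rootSum-powers b x)))
        (sieve-bound (sifted f 1 (1-coprimeTo n) (ℕD.∣-reflexive (ℕP.*-identityˡ n))))

    Σ-mono-length : ∀ {M n} (g : ℕ → ℕ) → M ℕ.≤ n → ℕΣ.Σ M g ℕ.≤ ℕΣ.Σ n g
    Σ-mono-length g z≤n = z≤n
    Σ-mono-length g (s≤s h) = ℕP.+-monoʳ-≤ (g 0) (Σ-mono-length (g ∘ suc) h)

    bound : Factored (suc n) n → ℕ
    bound f = suc (2 ℕ.^ length (primes f) ℕ.* R ℕ.* (n ℕ.* divisorCount f))

    -- The weights have modulus 1 and disappear. The bounds for the single x are then summed up to n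
    -- instead of M, since the mean of `torsion` is known over a whole period.
    weighted-bound : ∀ {b} → ¬ (+ p ∣ b) → (f : Factored (suc n) n) → ∀ M → M ℕ.≤ n → (w : ℕ → 𝕊) → (∀ i → N (w i) ≈ 1ˢ) →
      ∑ˢ M (λ i → w i *ˢ rootSum p b (suc i)) ≼ bound f
    weighted-bound {b} ∤b f M M≤n w hw = ≼-weaken (s≤s le) (≼-∑ M (λ i → k ℕ.* (torsion n (suc i) ℕ.* R))
      (λ i _ → ℕ.>-nonZero (ℕP.*-mono-≤ (ℕP.m^n>0 2 (length (primes f))) (1≤B ∤b (suc i))))
      λ i _ → unit-* (hw i) (rootSum-bound ∤b (suc i) f))
      where
      open ℕP.≤-Reasoning
      k : ℕ
      k = 2 ℕ.^ length (primes f)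
      le : ℕΣ.Σ M (λ i → k ℕ.* (torsion n (suc i) ℕ.* R)) ℕ.≤ k ℕ.* R ℕ.* (n ℕ.* divisorCount f)
      le = begin
        ℕΣ.Σ M (λ i → k ℕ.* (torsion n (suc i) ℕ.* R))  ≤⟨ Σ-mono-length (λ i → k ℕ.* (torsion n (suc i) ℕ.* R)) M≤n ⟩
        ℕΣ.Σ n (λ i → k ℕ.* (torsion n (suc i) ℕ.* R))  ≡⟨ ℕΣ.Σ-*ˡ n k (λ i → torsion n (suc i) ℕ.* R) ⟩
        k ℕ.* ℕΣ.Σ n (λ i → torsion n (suc i) ℕ.* R)    ≡⟨ cong (k ℕ.*_) (trans (ℕΣ.Σ-*ʳ n R (λ i → torsion n (suc i))) (ℕP.*-comm _ R)) ⟩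
        k ℕ.* (R ℕ.* ℕΣ.Σ n (λ i → torsion n (suc i)))  ≤⟨ ℕP.*-monoʳ-≤ k (ℕP.*-monoʳ-≤ R (Σ-torsion f)) ⟩
        k ℕ.* (R ℕ.* (n ℕ.* divisorCount f))                       ≡⟨ sym (ℕP.*-assoc k R (n ℕ.* divisorCount f)) ⟩
        k ℕ.* R ℕ.* (n ℕ.* divisorCount f)                         ∎

-- The mean as a weighted sum, the numerical estimate, and the theorem.

open import Defs
open import Data.Empty using (⊥-elim)
open import Data.Fin using (Fin; zero)
open import Data.Integer as ℤ using (ℤ; +_)
open import Data.Integer.Divisibility using (_∣_)
import Data.Integer.Divisibility.Signed as Signed
open import Data.Integer.GCD using (gcd)
import Data.Integer.Properties as ℤP
open import Data.List using (map; filter; applyUpTo; length)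
open import Data.Nat as ℕ using (ℕ; zero; suc; _≤_; _∸_; z≤n; s≤s; NonZero)
import Data.Nat.Divisibility as ℕD
import Data.Nat.GCD as ℕGCD
open import Data.Nat.Primality using (Prime; prime⇒nonZero; ¬prime[0])
import Data.Nat.Properties as ℕP
open import Data.Product using (∃; _×_; _,_; proj₁; proj₂)
open import Data.Rational as ℚ using (ℚ; _/_; 0ℚ; 1ℚ)
import Data.Rational.Properties as ℚP
open import Function using (_∘_; id)
open import Relation.Binary.PropositionalEquality using (_≡_; refl; sym; trans; cong; cong₂; subst)
open import Relation.Nullary using (¬_; Dec; yes; no)
open Sums
open Arithmetic
open Sieves
open Analysis
open Residues
open Estimates

open 𝕊Σ renaming (Σ to ∑ˢ)

-- Filtered lists, as used in the statement, become indicator sums over an interval.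
at-∑ˢ-filter : ∀ {P : ℕ → Set} (P? : ∀ g → Dec (P g)) (h : ℕ → ℕ) k (f : ℕ → 𝕊) m →
  Σᴸ (filter P? (applyUpTo h k)) (λ x → at (f x) m) ≡ at (∑ˢ k (λ i → when (P? (h i)) (f (h i)))) m
at-∑ˢ-filter P? h zero    f m = sym (at-const 0ᵍ m)
at-∑ˢ-filter P? h (suc k) f m with P? (h 0)
... | yes _ = trans (cong (at (f (h 0)) m +ᵍ_) (at-∑ˢ-filter P? (h ∘ suc) k f m)) (sym (at-+ (f (h 0)) _ m))
... | no _  = trans (at-∑ˢ-filter P? (h ∘ suc) k f m)
  (sym (trans (at-+ 0ˢ tail m) (trans (cong (_+ᵍ at tail m) (at-const 0ᵍ m)) (G.+-identityˡ (at tail m)))))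
  where
  tail : 𝕊
  tail = ∑ˢ k (λ i → when (P? (h (suc i))) (f (h (suc i))))

at-∑ˢ-suc : ∀ (h : ℕ → ℕ) k (f : ℕ → 𝕊) m →
  Σᴸ (map suc (applyUpTo h k)) (λ x → at (f x) m) ≡ at (∑ˢ k (λ i → f (suc (h i)))) m
at-∑ˢ-suc h zero    f m = sym (at-const 0ᵍ m)
at-∑ˢ-suc h (suc k) f m = trans (cong (at (f (suc (h 0))) m +ᵍ_) (at-∑ˢ-suc (h ∘ suc) k f m)) (sym (at-+ (f (suc (h 0))) _ m))

at-1⋯ : ∀ M (f : ℕ → 𝕊) m → Σᴸ (1⋯ M) (λ x → at (f x) m) ≡ at (∑ˢ M (λ i → f (suc i))) m
at-1⋯ M f m = at-∑ˢ-suc id M f m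

at-primitiveRoots : ∀ p (f : ℕ → 𝕊) m → Σᴸ (primitiveRoots p) (λ x → at (f x) m) ≡ at (∑ˢ p (λ g → when (isPrimitiveRoot? p (+ g)) (f g))) m
at-primitiveRoots p f m = at-∑ˢ-filter (λ g → isPrimitiveRoot? p (+ g)) id p f m

module Summed {p} (pp : Prime p) (Y : NonZero p) (W : NonZero (φ (p ∸ 1))) (M : ℕ) {r} (a b : ℤ) (bs gs : Fin r → ℤ) where

  private
    1/φ : ℚ
    1/φ = _/_ (+ 1) (φ (p ∸ 1)) {{W}}

    term : ℕ → ℕ → 𝕊
    term g x = fromℂ (e p {{Y}} (phase a b bs gs g x))

    inner : ℕ → 𝕊
    inner g = ∑ˢ M (λ i → term g (suc i))

    outer : 𝕊
    outer = ∑ˢ p (λ g → when (isPrimitiveRoot? p (+ g)) (inner g))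

    mean-value : ∀ m → value (meanSum pp M a b bs gs) m ≡ real 1/φ *ᵍ at outer m
    mean-value m = trans (value-meanSum pp Y W M a b bs gs m) (cong (real 1/φ *ᵍ_)
      (trans (Σᴸ-cong (primitiveRoots p) {λ g → Σᴸ (1⋯ M) (λ x → at (term g x) m)} {λ g → at (inner g) m} (λ g → at-1⋯ M (term g) m))
        (at-primitiveRoots p inner m)))

    mean-sums : fromℂ (meanSum pp M a b bs gs) ≈ scale 1/φ outer
    mean-sums = ≡⇒≈ λ m → trans (mean-value m) (sym (trans (at-* (const (real 1/φ)) outer m) (cong (_*ᵍ at outer m) (at-const (real 1/φ) m))))

  open Additive p {{Y}}

  rest : ℕ → ℤ
  rest x = a ℤ.* + x ℤ.+ sumℤ (λ j → bs j ℤ.* gs j ℤ.^ x)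
    where open import Algebra.Definitions.RawMonoid ℤ.+-0-rawMonoid using () renaming (sum to sumℤ)

  weight : ℕ → 𝕊
  weight i = 𝐞 (rest (suc i))

  private
    split-phase : ∀ g i → term g (suc i) ≈ weight i *ˢ 𝐞 (b ℤ.* (+ g) ℤ.^ suc i)
    split-phase g i = ≈-trans (fromℂ-e (phase a b bs gs g (suc i)))
      (≈-trans (S.reflexive (cong 𝐞 (lem (a ℤ.* + suc i) (b ℤ.* (+ g) ℤ.^ suc i) _))) (𝐞-+ (rest (suc i)) (b ℤ.* (+ g) ℤ.^ suc i)))
      where
      open import Data.Integer.Tactic.RingSolver using (solve-∀)
      lem : ∀ a b c → a ℤ.+ b ℤ.+ c ≡ a ℤ.+ c ℤ.+ b
      lem = solve-∀

  meanSum≈ : fromℂ (meanSum pp M a b bs gs) ≈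
    scale (_/_ (+ 1) (φ (p ∸ 1)) {{W}}) (∑ˢ M (λ i → weight i *ˢ rootSum p {{Y}} b (suc i)))
  meanSum≈ = ≈-trans mean-sums (scale-cong {1/φ} (begin
    outer
      ≈⟨ Σ-cong′ p (λ g → ≈-trans (when-cong (prim? g) λ _ → Σ-cong′ M λ i → split-phase g i) (when-Σ (prim? g) M (λ i → weight i *ˢ 𝐞 (b ℤ.* (+ g) ℤ.^ suc i)))) ⟩
    ∑ˢ p (λ g → ∑ˢ M (λ i → when (prim? g) (weight i *ˢ 𝐞 (b ℤ.* (+ g) ℤ.^ suc i))))
      ≈⟨ Σ-swap p M (λ g i → when (prim? g) (weight i *ˢ 𝐞 (b ℤ.* (+ g) ℤ.^ suc i))) ⟩
    ∑ˢ M (λ i → ∑ˢ p (λ g → when (prim? g) (weight i *ˢ 𝐞 (b ℤ.* (+ g) ℤ.^ suc i))))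
      ≈⟨ Σ-cong′ M (λ i → ≈-trans (Σ-cong′ p λ g → pull (prim? g) (weight i) (𝐞 (b ℤ.* (+ g) ℤ.^ suc i)))
           (≈-trans (≈-sym (∑-*ˡ p (weight i) (λ g → when (prim? g) (𝐞 (b ℤ.* (+ g) ℤ.^ suc i)))))
             (*ˢ-cong (≈-refl {weight i}) (≈-sym (rootSum-definition p {{Y}} b (suc i)))))) ⟩
    ∑ˢ M (λ i → weight i *ˢ rootSum p {{Y}} b (suc i)) ∎))
    where
    open 𝕊-Reasoning
    prim? : ∀ g → Dec (IsPrimitiveRoot p (+ g))
    prim? g = isPrimitiveRoot? p (+ g)
    pull : ∀ {P : Set} (d : Dec P) u v → when d (u *ˢ v) ≈ u *ˢ when d v
    pull (yes _) u v = ≈-refl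
    pull (no _)  u v = ≈-sym (S.zeroʳ u)

  1/φ*φ : ∀ {n} → n ≡ p ∸ 1 → _/_ (+ 1) (φ (p ∸ 1)) {{W}} ℚ.* ι (φ n) ≡ 1ℚ
  1/φ*φ refl = /-*ι 1 (φ (p ∸ 1)) {{W}}

  1/φ-pos : 0ℚ ℚ.< _/_ (+ 1) (φ (p ∸ 1)) {{W}}
  1/φ-pos = ℚP.positive⁻¹ 1/φ {{ℚP.normalize-pos 1 (φ (p ∸ 1)) {{W}}}}

-- Since isqrt p ≥ 1, the summands 1 and `P₀` of the radius are absorbed as multiples of isqrt p.
radius²≤ : ∀ p → 1 ≤ p → radius p ℕ.^ 2 ≤ (2 ℕ.+ P₀) ℕ.^ 2 ℕ.* p
radius²≤ p 1≤p = ℕP.≤-trans (ℕP.^-monoˡ-≤ 2 R≤) (ℕP.≤-trans (ℕP.≤-reflexive (^-distribʳ-* 2 c s))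
  (ℕP.*-monoʳ-≤ (c ℕ.^ 2) (ℕP.≤-trans (ℕP.≤-reflexive (cong (s ℕ.*_) (ℕP.*-identityʳ s))) (proj₁ (isqrt-bounds p)))))
  where
  open import Data.Nat.Tactic.RingSolver using (solve-∀)
  s c : ℕ
  s = isqrt p
  c = 2 ℕ.+ P₀
  s≥1 : 1 ≤ s
  s≥1 = ℕP.n≢0⇒n>0 λ e → ℕP.<⇒≱ (proj₂ (isqrt-bounds p)) (subst (λ s → suc s ℕ.* suc s ≤ p) (sym e) 1≤p)
  lem : ∀ P s → s ℕ.+ (P ℕ.* s ℕ.+ s) ≡ (2 ℕ.+ P) ℕ.* s
  lem = solve-∀
  R≤ : radius p ≤ c ℕ.* s
  R≤ = ℕP.≤-trans (ℕP.+-mono-≤ s≥1 (ℕP.+-monoˡ-≤ s (ℕP.≤-trans (ℕP.≤-reflexive (sym (ℕP.*-identityʳ P₀))) (ℕP.*-monoʳ-≤ P₀ s≥1))))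
    (ℕP.≤-reflexive (lem P₀ s))

-- In 24th powers R contributes (R²)¹² and d³ contributes (d⁸)⁹, so the power of p is 12 + 9 = 21.
power-estimate : ∀ R d c k p → 1 ≤ k → 1 ≤ p → R ℕ.^ 2 ≤ c ℕ.^ 2 ℕ.* p → d ℕ.^ 8 ≤ k ℕ.* p →
  (2 ℕ.* R ℕ.* d ℕ.^ 3) ℕ.^ 24 ≤ (2 ℕ.* c ℕ.* k) ℕ.^ 24 ℕ.* p ℕ.^ 23
power-estimate R d c k p 1≤k 1≤p hR hd = go 24 23 12 9 3 8 2 refl refl (ℕP.m≤m+n 9 15) (ℕP.m≤m+n 21 2) hR hd
  where
  -- Variables in place of the numerals keep the powers from being unfolded.
  go : ∀ e e′ e₁ e₂ e₃ e₄ e₅ → e₅ ℕ.* e₁ ≡ e → e₄ ℕ.* e₂ ≡ e₃ ℕ.* e → e₂ ≤ e → e₁ ℕ.+ e₂ ≤ e′ →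
    R ℕ.^ e₅ ≤ c ℕ.^ e₅ ℕ.* p → d ℕ.^ e₄ ≤ k ℕ.* p →
    (2 ℕ.* R ℕ.* d ℕ.^ e₃) ℕ.^ e ≤ (2 ℕ.* c ℕ.* k) ℕ.^ e ℕ.* p ℕ.^ e′
  go e e′ e₁ e₂ e₃ e₄ e₅ h₁ h₂ h₃ h₄ hR hd = begin
    (2 ℕ.* R ℕ.* d ℕ.^ e₃) ℕ.^ e
      ≡⟨ trans (^-distribʳ-* e (2 ℕ.* R) (d ℕ.^ e₃)) (cong₂ ℕ._*_ (trans (^-distribʳ-* e 2 R) (cong (2 ℕ.^ e ℕ.*_)
           (trans (cong (R ℕ.^_) (sym h₁)) (sym (ℕP.^-*-assoc R e₅ e₁))))) (trans (ℕP.^-*-assoc d e₃ e) (trans (cong (d ℕ.^_) (sym h₂)) (sym (ℕP.^-*-assoc d e₄ e₂))))) ⟩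
    2 ℕ.^ e ℕ.* (R ℕ.^ e₅) ℕ.^ e₁ ℕ.* (d ℕ.^ e₄) ℕ.^ e₂
      ≤⟨ ℕP.*-mono-≤ (ℕP.*-monoʳ-≤ (2 ℕ.^ e) (ℕP.^-monoˡ-≤ e₁ hR)) (ℕP.^-monoˡ-≤ e₂ hd) ⟩
    2 ℕ.^ e ℕ.* (c ℕ.^ e₅ ℕ.* p) ℕ.^ e₁ ℕ.* (k ℕ.* p) ℕ.^ e₂
      ≡⟨ cong₂ (λ x y → 2 ℕ.^ e ℕ.* x ℕ.* y) (trans (^-distribʳ-* e₁ (c ℕ.^ e₅) p) (cong (ℕ._* p ℕ.^ e₁) (trans (ℕP.^-*-assoc c e₅ e₁) (cong (c ℕ.^_) h₁)))) (^-distribʳ-* e₂ k p) ⟩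
    2 ℕ.^ e ℕ.* (c ℕ.^ e ℕ.* p ℕ.^ e₁) ℕ.* (k ℕ.^ e₂ ℕ.* p ℕ.^ e₂)
      ≡⟨ lem (2 ℕ.^ e) (c ℕ.^ e) (p ℕ.^ e₁) (k ℕ.^ e₂) (p ℕ.^ e₂) ⟩
    2 ℕ.^ e ℕ.* c ℕ.^ e ℕ.* k ℕ.^ e₂ ℕ.* (p ℕ.^ e₁ ℕ.* p ℕ.^ e₂)
      ≤⟨ ℕP.*-mono-≤ (ℕP.*-monoʳ-≤ (2 ℕ.^ e ℕ.* c ℕ.^ e) (ℕP.^-monoʳ-≤ k {{ℕ.>-nonZero 1≤k}} h₃))
           (ℕP.≤-trans (ℕP.≤-reflexive (sym (ℕP.^-distribˡ-+-* p e₁ e₂))) (ℕP.^-monoʳ-≤ p {{ℕ.>-nonZero 1≤p}} h₄)) ⟩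
    2 ℕ.^ e ℕ.* c ℕ.^ e ℕ.* k ℕ.^ e ℕ.* p ℕ.^ e′
      ≡⟨ cong (ℕ._* p ℕ.^ e′) (trans (cong (ℕ._* k ℕ.^ e) (sym (^-distribʳ-* e 2 c))) (sym (^-distribʳ-* e (2 ℕ.* c) k))) ⟩
    (2 ℕ.* c ℕ.* k) ℕ.^ e ℕ.* p ℕ.^ e′ ∎
    where
    open ℕP.≤-Reasoning
    open import Data.Nat.Tactic.RingSolver using (solve-∀)
    lem : ∀ t c x k y → t ℕ.* (c ℕ.* x) ℕ.* (k ℕ.* y) ≡ t ℕ.* c ℕ.* k ℕ.* (x ℕ.* y)
    lem = solve-∀

-- The factor 2 is that of `X` below, 2 + `P₀` compares the radius with √p, and `Kτ` bounds the
-- divisor function.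
constant : ℕ
constant = 2 ℕ.* (2 ℕ.+ P₀) ℕ.* Kτ

module Estimate {n} (pp : Prime (suc n)) {M : ℕ} (M≤n : M ≤ n) {b : ℤ}
  (∤b : ¬ (+ suc n Signed.∣ b)) (θ : ℤ) (root : IsPrimitiveRoot (suc n) θ) where

  open PrimitiveRoot n pp θ root using (1≤n)

  f : Factored (suc n) n
  f = factorization n 1≤n

  X : ℕ
  X = 2 ℕ.* radius (suc n) ℕ.* divisorCount f ℕ.^ 3

  -- The three factors d come from the 2^ω of the sieve, from n ≤ 2^ω φ(n), and from the mean of
  -- `torsion`. The leading 2 absorbs the `suc` of the bound.
  bound≤ : PowerSums.bound n pp θ root f ≤ X ℕ.* φ n
  bound≤ = begin
    suc (k ℕ.* R ℕ.* (n ℕ.* d))                 ≤⟨ ℕP.+-monoˡ-≤ (k ℕ.* R ℕ.* (n ℕ.* d)) one≤ ⟩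
    k ℕ.* R ℕ.* (n ℕ.* d) ℕ.+ k ℕ.* R ℕ.* (n ℕ.* d) ≡⟨ lem₁ k R n d ⟩
    2 ℕ.* R ℕ.* (k ℕ.* n ℕ.* d)                 ≤⟨ ℕP.*-monoʳ-≤ (2 ℕ.* R) (ℕP.*-monoˡ-≤ d (ℕP.*-mono-≤ (2^ω≤divisorCount f) (ℕP.≤-trans (n≤2^ω*φ f) (ℕP.*-monoˡ-≤ (φ n) (2^ω≤divisorCount f))))) ⟩
    2 ℕ.* R ℕ.* (d ℕ.* (d ℕ.* φ n) ℕ.* d)       ≡⟨ lem₂ R d (φ n) ⟩
    X ℕ.* φ n ∎
    where
    open ℕP.≤-Reasoning
    open import Data.Nat.Tactic.RingSolver using (solve-∀)
    k d R : ℕ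
    R = radius (suc n)
    k = 2 ℕ.^ length (primes f)
    d = divisorCount f
    k≥1 : 1 ≤ k
    k≥1 = ℕP.m^n>0 2 (length (primes f))
    one≤ : 1 ≤ k ℕ.* R ℕ.* (n ℕ.* d)
    one≤ = ℕP.*-mono-≤ {1} {k ℕ.* R} {1} {n ℕ.* d} (ℕP.*-mono-≤ {1} {k} {1} {R} k≥1 (s≤s z≤n)) (ℕP.*-mono-≤ {1} {n} {1} {d} 1≤n (ℕP.≤-trans k≥1 (2^ω≤divisorCount f)))
    lem₁ : ∀ k R n d → k ℕ.* R ℕ.* (n ℕ.* d) ℕ.+ k ℕ.* R ℕ.* (n ℕ.* d) ≡ 2 ℕ.* R ℕ.* (k ℕ.* n ℕ.* d)
    lem₁ = solve-∀
    lem₂ : ∀ R d φ → 2 ℕ.* R ℕ.* (d ℕ.* (d ℕ.* φ) ℕ.* d) ≡ 2 ℕ.* R ℕ.* (d ℕ.* (d ℕ.* (d ℕ.* 1))) ℕ.* φ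
    lem₂ = solve-∀

  mean≲ : ∀ q → 0ℚ ℚ.< q → q ℚ.* ι (φ n) ≡ 1ℚ → ∀ w → (∀ i → N (w i) ≈ 1ˢ) →
    N (scale q (∑ˢ M (λ i → w i *ˢ rootSum (suc n) b (suc i)))) ≲ ιˢ (X ℕ.* X)
  mean≲ q 0<q qφ w hw = ≲-trans (≈⇒≲ (N-scale q _)) (≲-trans
    (scale-mono (*-pos 0<q 0<q) (N≲ (≼-weaken bound≤ (PowerSums.weighted-bound n pp θ root ∤b f M M≤n w hw))))
    (≈⇒≲ (≈-trans (scale-cong {q ℚ.* q} (≈-trans (S.reflexive (cong ιˢ (lem X (φ n)))) (ιˢ-* (φ n ℕ.* φ n) (X ℕ.* X))))
      (≈-trans (scale-scale (q ℚ.* q) (ι (φ n ℕ.* φ n)) (ιˢ (X ℕ.* X)))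
        (≈-trans (S.reflexive (cong (λ q → scale q (ιˢ (X ℕ.* X))) unit)) (scale-1 (ιˢ (X ℕ.* X))))))))
    where
    open import Data.Nat.Tactic.RingSolver using (solve-∀)
    lem : ∀ x y → x ℕ.* y ℕ.* (x ℕ.* y) ≡ y ℕ.* y ℕ.* (x ℕ.* x)
    lem = solve-∀
    unit : q ℚ.* q ℚ.* ι (φ n ℕ.* φ n) ≡ 1ℚ
    unit = trans (cong (q ℚ.* q ℚ.*_) (ι-* (φ n) (φ n))) (lem′ q (ι (φ n)) qφ)
      where
      open import Data.Rational.Solver using (module +-*-Solver)
      open +-*-Solver
      lem′ : ∀ q i → q ℚ.* i ≡ 1ℚ → q ℚ.* q ℚ.* (i ℚ.* i) ≡ 1ℚ
      lem′ q i e = trans (solve 2 (λ q i → q :* q :* (i :* i) := (q :* i) :* (q :* i)) refl q i) (trans (cong₂ ℚ._*_ e e) (ℚP.*-identityˡ 1ℚ))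

  X^24≤ : X ℕ.^ 24 ≤ constant ℕ.^ 24 ℕ.* suc n ℕ.^ 23
  X^24≤ = power-estimate (radius (suc n)) (divisorCount f) (2 ℕ.+ P₀) Kτ (suc n) Kτ≥1 (s≤s z≤n) (radius²≤ (suc n) (s≤s z≤n))
    (ℕP.≤-trans (divisorCount^8≤Kτ f) (ℕP.*-monoʳ-≤ Kτ (ℕP.n≤1+n n)))

gcd≡1⇒∤ : ∀ {n b} → Prime (suc n) → gcd b (+ suc n) ≡ + 1 → ¬ (+ suc n Signed.∣ b)
gcd≡1⇒∤ {n} {b} pp g h = ℕP.<⇒≱ (prime>1 pp) (ℕD.∣⇒≤ (subst (suc n ℕD.∣_) (ℤP.+-injective g) (ℕGCD.gcd-greatest (Signed.∣⇒∣ᵤ h) ℕD.∣-refl)))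

φ-pred-nonZero : ∀ {p} → Prime p → NonZero (φ (p ∸ 1))
φ-pred-nonZero {suc n} pp = φ-nonZero n {{ℕ.>-nonZero (ℕ.s≤s⁻¹ (prime>1 pp))}}

conclude : ∀ {p} (pp : Prime p) M {r} (a b : ℤ) (bs gs : Fin r → ℤ) X K (ε : ℝ) → 0ʳ <ʳ ε →
  N (fromℂ (meanSum pp M a b bs gs)) ≲ ιˢ (X ℕ.* X) → X ℕ.^ 24 ≤ K ℕ.^ 24 ℕ.* p ℕ.^ 23 →
  ∣ meanSum pp M a b bs gs ∣ᶜ ≤ʳ fromℚ (ι (2 ℕ.* K)) *ʳ _^ʳ_ p {{prime⇒nonZero pp}} (fromℚ (+ 23 / 24) +ʳ ε)
conclude {p} pp M a b bs gs X K ε 0<ε h hX δ 0<δ = eventually-map₂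
  (λ m h g → ℚP.≤-trans h (ℚP.+-monoˡ-≤ δ g))
  (abs-bound (meanSum pp M a b bs gs) X h δ 0<δ) (power-lower X K p (prime⇒nonZero pp) hX ε 0<ε)

mean-bound : ∀ {n} (pp : Prime (suc n)) M (M≤n : M ≤ n) {r} (a b : ℤ) (bs gs : Fin r → ℤ) (∤b : ¬ (+ suc n Signed.∣ b)) θ (root : IsPrimitiveRoot (suc n) θ) →
  N (fromℂ (meanSum pp M a b bs gs)) ≲ ιˢ (Estimate.X pp M≤n ∤b θ root ℕ.* Estimate.X pp M≤n ∤b θ root)
mean-bound {n} pp M M≤n a b bs gs ∤b θ root = ≲-trans (≈⇒≲ (N-cong Sum.meanSum≈)) rest
    where
    module E = Estimate pp {M} M≤n {b} ∤b θ root
    module Sum = Summed pp (prime⇒nonZero pp) (φ-pred-nonZero pp) M a b bs gs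
    rest : N (scale (_/_ (+ 1) (φ (suc n ∸ 1)) {{φ-pred-nonZero pp}}) (∑ˢ M (λ i → Sum.weight i *ˢ rootSum (suc n) {{prime⇒nonZero pp}} b (suc i)))) ≲ ιˢ (E.X ℕ.* E.X)
    rest = E.mean≲ (_/_ (+ 1) (φ (suc n ∸ 1)) {{φ-pred-nonZero pp}}) Sum.1/φ-pos (Sum.1/φ*φ refl) Sum.weight
        (λ i → N-𝐞 (suc n) {{prime⇒nonZero pp}} (Sum.rest (suc i)))

theorem1 : ∀ (ε : ℝ) → 0ʳ <ʳ ε →
    ∃ λ (C : ℝ) → 0ʳ <ʳ C ×
    (∀ (p : ℕ) (p-prime : Prime p) →
    ∀ (N : ℕ) → 1 ≤ N → N ≤ p ∸ 1 →
    ∀ (r : ℕ) → 1 ≤ r →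
    ∀ (a b : ℤ) (bs : Fin r → ℤ) →
    ¬ (+ p ∣ a × + p ∣ b × (∀ i → + p ∣ bs i)) →
    gcd b (+ p) ≡ + 1 →
    ∀ (gs : Fin r → ℤ) → (∀ i → IsPrimitiveRoot p (gs i)) →
    ∣ meanSum p-prime N a b bs gs ∣ᶜ ≤ʳ
    C *ʳ _^ʳ_ p {{prime⇒nonZero p-prime}} (fromℚ (+ 23 / 24) +ʳ ε))
theorem1 ε 0<ε = fromℚ (ι (2 ℕ.* constant)) , positive , main
  where
  constant≥1 : 1 ≤ constant
  constant≥1 = ℕP.*-mono-≤ {1} {2 ℕ.* (2 ℕ.+ P₀)} (s≤s z≤n) Kτ≥1
  positive : 0ʳ <ʳ fromℚ (ι (2 ℕ.* constant))
  positive = ι (2 ℕ.* constant) , ι-pos (2 ℕ.* constant) {{ℕ.>-nonZero (ℕP.*-mono-≤ {1} {2} (s≤s z≤n) constant≥1)}} ,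
    0 , λ _ → ℚP.≤-reflexive (ℚP.+-identityˡ (ι (2 ℕ.* constant)))
  main : ∀ (p : ℕ) (p-prime : Prime p) →
    ∀ (N : ℕ) → 1 ≤ N → N ≤ p ∸ 1 →
    ∀ (r : ℕ) → 1 ≤ r →
    ∀ (a b : ℤ) (bs : Fin r → ℤ) →
    ¬ (+ p ∣ a × + p ∣ b × (∀ i → + p ∣ bs i)) →
    gcd b (+ p) ≡ + 1 →
    ∀ (gs : Fin r → ℤ) → (∀ i → IsPrimitiveRoot p (gs i)) →
    ∣ meanSum p-prime N a b bs gs ∣ᶜ ≤ʳ
    fromℚ (ι (2 ℕ.* constant)) *ʳ _^ʳ_ p {{prime⇒nonZero p-prime}} (fromℚ (+ 23 / 24) +ʳ ε)
  main zero pp = ⊥-elim (¬prime[0] pp)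
  -- As r ≥ 1, the first of the given primitive roots serves as the generator θ.
  main (suc n) pp M _ M≤n (suc r) _ a b bs _ cop gs roots =
    conclude pp M a b bs gs E.X constant ε 0<ε (mean-bound pp M M≤n a b bs gs ∤b (gs zero) (roots zero)) E.X^24≤
    where
    ∤b : ¬ (+ suc n Signed.∣ b)
    ∤b = gcd≡1⇒∤ {n} {b} pp cop
    module E = Estimate pp {M} M≤n {b} ∤b (gs zero) (roots zero)
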